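{- Let $(G,B,N,S)$ be a Tits system of rank $\ell+1$ with $G$ a finite group, and let $\mathfrak{B}$ be its building, a finite simplicial complex of dimension $\ell$. For every integer $i$ with $0\leq i\leq \ell-1$, the minimal non-zero eigenvalue $m^i(\mathfrak{B})$ of the Laplace operator $\Delta=\delta d$ acting on $C^i(\mathfrak{B})$ satisfies $$m^i(\mathfrak{B})\leq \ell-i.$$
   Context: Tits system (BN-pair) has its usual meaning; its rank is $|S|$. The building $\mathfrak{B}$ of $(G,B,N,S)$ is the simplicial complex whose simplices correspond to the proper parabolic subgroups of $G$ (proper subgroups containing a conjugate of $B$), with the face relation being reverse inclusion; thus vertices correspond to maximal proper parabolic subgroups, and $\ell$-simplices to conjugates of $B$. Every simplex of $\mathfrak{B}$ is a face of an $\ell$-simplex. Let $X$ be a finite simplicial complex of dimension $n$ in which every simplex is a face of some $n$-simplex (for $X=\mathfrak{B}$, $n=\ell$). $\mathrm{Ver}(X)$ is the set of vertices and $S_i(X)$ is the set of oriented $i$-simplices ($i$-simplices with an ordering of the vertices up to even permutation); $\bar s$ is $s$ with the opposite orientation. $C^i(X)$ is the real vector space of functions $f:S_i(X)\to\mathbb{R}$ with $f(\bar s)=-f(s)$ (no condition if $i=0$), and $C^i(X)=0$ for $i<0$ or $i>n$. For a simplex $s$, $w(s)$ is the number of (non-oriented) $n$-simplices of $X$ containing $s$. The coboundary $d:C^i(X)\to C^{i+1}(X)$ is $(df)([v_0,\dots,v_{i+1}])=\sum_{j=0}^{i+1}(-1)^jf([v_0,\dots,\hat v_j,\dots,v_{i+1}])$.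 The map $\delta:C^{i+1}(X)\to C^{i}(X)$ is $(\delta f)(s)=\sum_{v}\frac{w([v,s])}{w(s)}f([v,s])$, the sum being over $v\in\mathrm{Ver}(X)$ such that $\{v\}\cup s$ is an $(i+1)$-simplex, where for $s=[v_0,\dots,v_i]$ one puts $[v,s]=[v,v_0,\dots,v_i]$. The Laplace operator on $C^i(X)$ is $\Delta=\delta d$. It is self-adjoint and positive semi-definite for the inner product $(f,g)=\sum_{s}w(s)f(s)g(s)$ (sum over non-oriented $i$-simplices, each with an arbitrary orientation), so it is diagonalizable with non-negative real eigenvalues. -}

module Defs where

open import Level using (Level; _⊔_; 0ℓ) renaming (suc to lsuc)
open import Algebra.Bundles using (Group)
open import Data.Nat.Base as Nat using (ℕ; zero; suc)
import Data.Nat.Properties as ℕₚ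
open import Data.Integer.Base using (+_)
open import Data.Rational.Base as Rat using (ℚ; 0ℚ; 1ℚ; ½; Positive)
import Data.Rational.Properties as ℚₚ
open import Data.Rational.Solver using (module +-*-Solver)
open import Data.Bool.Properties using () renaming (_≟_ to _≟ᵇ_)
open import Data.Fin.Base as Fin using (Fin; toℕ)
import Data.Fin.Properties as Finₚ
open import Data.Fin.Subset using (Subset; Side; inside; outside; ⊤; ⊥; ⁅_⁆; _∪_; ∣_∣)
  renaming (_∈_ to _∈ˢ_; _⊆_ to _⊆ˢ_)
open import Data.Fin.Subset.Properties using (_∈?_; _⊆?_; anySubset?)
open import Data.Fin.Permutation.Components using (transpose)
open import Data.List.Base as List using (List; []; _∷_; _++_; filter; length; allFin)
open import Data.Parity.Base using (Parity; 0ℙ; 1ℙ; _⁻¹)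
open import Data.Product.Base using (Σ; ∃; ∃₂; _×_; _,_; proj₁; proj₂)
open import Data.Sum.Base using (_⊎_)
open import Data.Vec.Base as Vec using (Vec; []; _∷_; lookup; tabulate; removeAt)
open import Data.Vec.Properties using (≡-dec)
open import Data.Vec.Relation.Unary.AllPairs using (allPairs?)
open import Data.Vec.Relation.Unary.Unique.Propositional using (Unique)
open import Function.Base using (_∘_)
open import Function.Bundles using (Inverse)
open import Relation.Binary.PropositionalEquality as ≡ using (_≡_; _≢_; refl)
open import Relation.Nullary.Decidable
  using (Dec; yes; no; does; map′; ¬?; _×-dec_; _→-dec_; decidable-stable)
open import Relation.Nullary.Negation using (¬_)
open import Relation.Unary using (Pred; Decidable)

private
  variable
    p : Level
    n : ℕ

------------------------------------------------------------------------
-- Real numbers: Cauchy sequences of rationals, taken up to _≃_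

module Real where

  open Rat using (_≤_; _+_; _-_; _*_; -_; 1/_) renaming (∣_∣ to abs)

  Eventually : Pred ℕ 0ℓ → Set
  Eventually Q = ∃ λ N → ∀ n → N Nat.≤ n → Q n

  Cauchy : (ℕ → ℚ) → Set
  Cauchy x = ∀ ε → Positive ε →
    ∃ λ N → ∀ m n → N Nat.≤ m → N Nat.≤ n → abs (x m - x n) ≤ ε

  record ℝ : Set where
    -- With η, or with transparent Cauchy proofs, checking becomes very slow.
    no-eta-equality
    constructor mkℝ
    field
      seq    : ℕ → ℚ
      cauchy : Cauchy seq

  open ℝ

  infix 4 _≃_ _≤ᴿ_

  _≃_ : ℝ → ℝ → Set
  x ≃ y = ∀ ε → Positive ε → Eventually λ n → abs (seq x n - seq y n) ≤ ε

  _≤ᴿ_ : ℝ → ℝ → Set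
  x ≤ᴿ y = ∀ ε → Positive ε → Eventually λ n → seq x n ≤ seq y n + ε

  private
    half : ∀ ε → Positive ε → Positive (½ * ε)
    half ε ε>0 = ℚₚ.pos*pos⇒pos ½ ε {{ε>0}}

    half+half : ∀ ε → ½ * ε + ½ * ε ≡ ε
    half+half ε = ≡.trans (≡.sym (ℚₚ.*-distribʳ-+ ε ½ ½)) (ℚₚ.*-identityˡ ε)

    open +-*-Solver

    swap-sub : ∀ a b c d → (a + b) - (c + d) ≡ (a - c) + (b - d)
    swap-sub = solve 4 (λ a b c d →
      (a :+ b) :- (c :+ d) := (a :- c) :+ (b :- d)) refl

    swap-neg : ∀ a b → (- a) - (- b) ≡ - (a - b)
    swap-neg = solve 2 (λ a b → (:- a) :- (:- b) := :- (a :- b)) refl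

    swap-mul : ∀ a b c d → (a * b) - (c * d) ≡ a * (b - d) + d * (a - c)
    swap-mul = solve 4 (λ a b c d →
      (a :* b) :- (c :* d) := a :* (b :- d) :+ d :* (a :- c)) refl

    cancel-mid : ∀ a b → b + (a - b) ≡ a
    cancel-mid = solve 2 (λ a b → b :+ (a :- b) := a) refl

    open ℚₚ.≤-Reasoning

    -- A common bound for the tails of two Cauchy sequences.
    bound : ∀ x y → ∃ λ K → Positive K ×
      Eventually (λ n → abs (seq x n) ≤ K × abs (seq y n) ≤ K)
    bound x y = K , K>0 , N Nat.⊔ M , λ n q →
        (begin
          abs (seq x n)                  ≤⟨ tail x 1ℚ _ N (proj₂ cx) n (ℕₚ.≤-trans (ℕₚ.m≤m⊔n N M) q) ⟩
          A + 1ℚ                       ≡⟨ ≡.sym (ℚₚ.+-identityʳ (A + 1ℚ)) ⟩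
          A + 1ℚ + 0ℚ                ≤⟨ ℚₚ.+-monoʳ-≤ (A + 1ℚ) (ℚₚ.0≤∣p∣ _) ⟩
          K                              ∎)
      , (begin
          abs (seq y n)                  ≤⟨ tail y 1ℚ _ M (proj₂ cy) n (ℕₚ.≤-trans (ℕₚ.m≤n⊔m N M) q) ⟩
          C + 1ℚ                       ≡⟨ ≡.sym (ℚₚ.+-identityˡ (C + 1ℚ)) ⟩
          0ℚ + (C + 1ℚ)              ≤⟨ ℚₚ.+-monoˡ-≤ (C + 1ℚ) (ℚₚ.0≤∣p∣ (seq x N)) ⟩
          A + (C + 1ℚ)               ≡⟨ rearrange A C ⟩
          K                              ∎)
      where
      cx = cauchy x 1ℚ _
      cy = cauchy y 1ℚ _
      N = proj₁ cx
      M = proj₁ cy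
      A = abs (seq x N)
      C = abs (seq y M)
      K = A + 1ℚ + C
      rearrange : ∀ a c → a + (c + 1ℚ) ≡ a + 1ℚ + c
      rearrange = solve 2 (λ a c → a :+ (c :+ con 1ℚ) := a :+ con 1ℚ :+ c) refl
      K>0 : Positive K
      K>0 = ℚₚ.pos+nonNeg⇒pos (A + 1ℚ)
              {{≡.subst Positive (ℚₚ.+-comm 1ℚ A) (ℚₚ.pos+nonNeg⇒pos 1ℚ A {{ℚₚ.∣-∣-nonNeg (seq x N)}})}}
              C {{ℚₚ.∣-∣-nonNeg (seq y M)}}
      tail : ∀ z ε → Positive ε → ∀ L →
        (∀ m n → L Nat.≤ m → L Nat.≤ n → abs (seq z m - seq z n) ≤ ε) →
        ∀ n → L Nat.≤ n → abs (seq z n) ≤ abs (seq z L) + ε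
      tail z ε _ L c n q = begin
        abs (seq z n)                                 ≡⟨ ≡.cong abs (≡.sym (cancel-mid (seq z n) (seq z L))) ⟩
        abs (seq z L + (seq z n - seq z L))         ≤⟨ ℚₚ.∣p+q∣≤∣p∣+∣q∣ (seq z L) _ ⟩
        abs (seq z L) + abs (seq z n - seq z L)     ≤⟨ ℚₚ.+-monoʳ-≤ (abs (seq z L)) (c n L q ℕₚ.≤-refl) ⟩
        abs (seq z L) + ε                           ∎

    abstract
      const-cauchy : ∀ q → Cauchy (λ _ → q)
      const-cauchy q = λ ε ε>0 → 0 , λ _ _ _ _ →
        ≡.subst (λ r → abs r ≤ ε) (≡.sym (ℚₚ.+-inverseʳ q))
          (ℚₚ.<⇒≤ (ℚₚ.positive⁻¹ ε {{ε>0}}))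

      +-cauchy : ∀ x y → Cauchy (λ n → seq x n + seq y n)
      +-cauchy x y = λ ε ε>0 →
        let N , hx = cauchy x (½ * ε) (half ε ε>0)
            M , hy = cauchy y (½ * ε) (half ε ε>0)
        in N Nat.⊔ M , λ m n p q → begin
          abs ((seq x m + seq y m) - (seq x n + seq y n))
            ≡⟨ ≡.cong abs (swap-sub (seq x m) (seq y m) (seq x n) (seq y n)) ⟩
          abs ((seq x m - seq x n) + (seq y m - seq y n))
            ≤⟨ ℚₚ.∣p+q∣≤∣p∣+∣q∣ (seq x m - seq x n) (seq y m - seq y n) ⟩
          abs (seq x m - seq x n) + abs (seq y m - seq y n)
            ≤⟨ ℚₚ.+-mono-≤
                 (hx m n (ℕₚ.≤-trans (ℕₚ.m≤m⊔n N M) p) (ℕₚ.≤-trans (ℕₚ.m≤m⊔n N M) q))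
                 (hy m n (ℕₚ.≤-trans (ℕₚ.m≤n⊔m N M) p) (ℕₚ.≤-trans (ℕₚ.m≤n⊔m N M) q)) ⟩
          ½ * ε + ½ * ε
            ≡⟨ half+half ε ⟩
          ε ∎

      neg-cauchy : ∀ x → Cauchy (λ n → - seq x n)
      neg-cauchy x = λ ε ε>0 →
        let N , hx = cauchy x ε ε>0
        in N , λ m n p q → begin
          abs ((- seq x m) - (- seq x n)) ≡⟨ ≡.cong abs (swap-neg (seq x m) (seq x n)) ⟩
          abs (- (seq x m - seq x n))       ≡⟨ ℚₚ.∣-p∣≡∣p∣ (seq x m - seq x n) ⟩
          abs (seq x m - seq x n)             ≤⟨ hx m n p q ⟩
          ε                                   ∎

      *-cauchy : ∀ x y → Cauchy (λ n → seq x n * seq y n)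
      *-cauchy x y = λ ε ε>0 →
        let K , K>0 , L , hK = bound x y
            instance
              _ = K>0
              _ = ℚₚ.pos⇒nonZero K
              _ = ℚₚ.pos⇒nonNeg K
            η = 1/ K * (½ * ε)
            η>0 = ℚₚ.pos*pos⇒pos (1/ K) {{ℚₚ.1/pos⇒pos K}} (½ * ε) {{half ε ε>0}}
            N , hx = cauchy x η η>0
            M , hy = cauchy y η η>0
            Kη≡ : K * η ≡ ½ * ε
            Kη≡ = ≡.trans (≡.sym (ℚₚ.*-assoc K (1/ K) (½ * ε)))
                    (≡.trans (≡.cong (_* (½ * ε)) (ℚₚ.*-inverseʳ K))
                             (ℚₚ.*-identityˡ (½ * ε)))
            product : ∀ a b → abs a ≤ K → abs b ≤ η → abs (a * b) ≤ ½ * ε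
            product a b a≤ b≤ = begin
              abs (a * b)      ≡⟨ ℚₚ.∣p*q∣≡∣p∣*∣q∣ a b ⟩
              abs a * abs b    ≤⟨ ℚₚ.*-monoʳ-≤-nonNeg (abs b) {{ℚₚ.∣-∣-nonNeg b}} a≤ ⟩
              K * abs b        ≤⟨ ℚₚ.*-monoˡ-≤-nonNeg K b≤ ⟩
              K * η            ≡⟨ Kη≡ ⟩
              ½ * ε            ∎
        in L Nat.⊔ (N Nat.⊔ M) , λ m n p q →
          let L≤ = ℕₚ.m≤m⊔n L (N Nat.⊔ M)
              N≤ = ℕₚ.≤-trans (ℕₚ.m≤m⊔n N M) (ℕₚ.m≤n⊔m L (N Nat.⊔ M))
              M≤ = ℕₚ.≤-trans (ℕₚ.m≤n⊔m N M) (ℕₚ.m≤n⊔m L (N Nat.⊔ M))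
          in begin
          abs ((seq x m * seq y m) - (seq x n * seq y n))
            ≡⟨ ≡.cong abs (swap-mul (seq x m) (seq y m) (seq x n) (seq y n)) ⟩
          abs (seq x m * (seq y m - seq y n) + seq y n * (seq x m - seq x n))
            ≤⟨ ℚₚ.∣p+q∣≤∣p∣+∣q∣ (seq x m * (seq y m - seq y n)) (seq y n * (seq x m - seq x n)) ⟩
          abs (seq x m * (seq y m - seq y n)) + abs (seq y n * (seq x m - seq x n))
            ≤⟨ ℚₚ.+-mono-≤
                 (product _ _ (proj₁ (hK m (ℕₚ.≤-trans L≤ p)))
                              (hy m n (ℕₚ.≤-trans M≤ p) (ℕₚ.≤-trans M≤ q)))
                 (product _ _ (proj₂ (hK n (ℕₚ.≤-trans L≤ q)))
                              (hx m n (ℕₚ.≤-trans N≤ p) (ℕₚ.≤-trans N≤ q))) ⟩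
          ½ * ε + ½ * ε
            ≡⟨ half+half ε ⟩
          ε ∎

  fromℚ : ℚ → ℝ
  fromℚ q = mkℝ (λ _ → q) (const-cauchy q)

  fromℕ : ℕ → ℝ
  fromℕ k = fromℚ (+ k Rat./ 1)

  0ᴿ : ℝ
  0ᴿ = fromℚ 0ℚ

  infixl 6 _+ᴿ_
  infixl 7 _*ᴿ_
  infix  8 -ᴿ_

  _+ᴿ_ _*ᴿ_ : ℝ → ℝ → ℝ
  x +ᴿ y = mkℝ (λ n → seq x n + seq y n) (+-cauchy x y)
  x *ᴿ y = mkℝ (λ n → seq x n * seq y n) (*-cauchy x y)

  -ᴿ_ : ℝ → ℝ
  -ᴿ x = mkℝ (λ n → - seq x n) (neg-cauchy x)

  sumᴿ : {A : Set} → (A → ℝ) → List A → ℝ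
  sumᴿ f = List.foldr (λ a r → f a +ᴿ r) 0ᴿ

open Real public using (ℝ; _≃_; _≤ᴿ_; 0ᴿ; fromℕ; fromℚ; _+ᴿ_; _*ᴿ_; -ᴿ_; sumᴿ)

------------------------------------------------------------------------
-- Finite simplicial complexes and the Laplace operator

subsets : ∀ n → List (Subset n)
subsets zero    = [] ∷ []
subsets (suc n) = List.map (outside ∷_) (subsets n) ++ List.map (inside ∷_) (subsets n)

infix 4 _≟ˢ_

_≟ˢ_ : (σ τ : Subset n) → Dec (σ ≡ τ)
_≟ˢ_ = ≡-dec _≟ᵇ_

-- Closure under passing to faces and purity are not fields: none of the
-- definitions below uses them, and for a building they are theorems.
record Complex p : Set (lsuc p) where
  field
    #vertices : ℕ
    dim       : ℕ
    Simplex   : Pred (Subset #vertices) p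
    simplex?  : Decidable Simplex

  Vertex : Set
  Vertex = Fin #vertices

support : ∀ {k} → Vec (Fin n) k → Subset n
support []      = ⊥
support (v ∷ s) = ⁅ v ⁆ ∪ support s

exchange : ∀ {A : Set} {k} → Fin k → Fin k → Vec A k → Vec A k
exchange a b s = tabulate (lookup s ∘ transpose a b)

-- Reordering π s t: t is obtained from s by a permutation of parity π,
-- i.e. by a sequence of π-many (mod 2) exchanges of two distinct positions.
data Reordering {A : Set} {k : ℕ} : Parity → Vec A k → Vec A k → Set where
  done : ∀ {s} → Reordering 0ℙ s s
  step : ∀ {π s t} {a b : Fin k} → a ≢ b →
         Reordering π s t → Reordering (π ⁻¹) s (exchange a b t)

-- The junk value at 0 is irrelevant: in a pure complex every simplex lies in
-- some simplex of top dimension, so the denominators below are positive.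
ratio : ℕ → ℕ → ℚ
ratio a zero    = 0ℚ
ratio a (suc b) = + a Rat./ suc b

module Laplacian (X : Complex p) where

  open Complex X

  -- An i-simplex together with an ordering of its i + 1 vertices.
  IsOrderedSimplex : ∀ {i} → Vec Vertex (suc i) → Set p
  IsOrderedSimplex s = Unique s × Simplex (support s)

  isOrderedSimplex? : ∀ {i} → Decidable (IsOrderedSimplex {i})
  isOrderedSimplex? s = allPairs? (λ u v → ¬? (u Finₚ.≟ v)) s ×-dec simplex? (support s)

  w : ∀ {i} → Vec Vertex (suc i) → ℕ
  w s = length (filter top⊇s? (subsets #vertices))
    where
    top⊇s? : Decidable (λ σ → Simplex σ × ∣ σ ∣ ≡ suc dim × support s ⊆ˢ σ)
    top⊇s? σ = simplex? σ ×-dec (∣ σ ∣ ℕₚ.≟ suc dim) ×-dec (support s ⊆? σ)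

  -- Values on tuples which are not ordered simplices carry no information:
  -- all conditions and equations are imposed on ordered simplices only.
  Values : ℕ → Set
  Values i = Vec Vertex (suc i) → ℝ

  -- A function on ordered simplices descends to an f on oriented simplices
  -- with f s̄ = - f s iff it is invariant under even reorderings and changes
  -- sign under odd ones.
  IsCochain : ∀ {i} → Values i → Set p
  IsCochain f = ∀ {s t} → IsOrderedSimplex s →
    (Reordering 0ℙ s t → f t ≃ f s) × (Reordering 1ℙ s t → f t ≃ -ᴿ f s)

  alternate : ℕ → ℝ → ℝ
  alternate zero    x = x
  alternate (suc j) x = -ᴿ alternate j x

  d : ∀ {i} → Values i → Values (suc i)
  d {i} f s = sumᴿ (λ j → alternate (toℕ j) (f (removeAt s j))) (allFin (suc (suc i)))

  δ : ∀ {i} → Values (suc i) → Values i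
  δ f s = sumᴿ (λ v → fromℚ (ratio (w (v ∷ s)) (w s)) *ᴿ f (v ∷ s))
               (filter (λ v → isOrderedSimplex? (v ∷ s)) (allFin #vertices))

  Δ : ∀ {i} → Values i → Values i
  Δ f = δ (d f)

  -- Eigenvalues of Δ acting on C^i(X).
  IsEigenvalue : ℕ → ℝ → Set p
  IsEigenvalue i μ = Σ (Values i) λ f →
    IsCochain f ×
    ¬ (∀ s → IsOrderedSimplex s → f s ≃ 0ᴿ) ×
    (∀ s → IsOrderedSimplex s → Δ f s ≃ μ *ᴿ f s)

  record IsMinimalNonzeroEigenvalue (i : ℕ) (m : ℝ) : Set p where
    field
      eigenvalue : IsEigenvalue i m
      nonzero    : ¬ (m ≃ 0ᴿ)
      minimal    : ∀ μ → IsEigenvalue i μ → ¬ (μ ≃ 0ᴿ) → m ≤ᴿ μ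

open Laplacian public using (IsMinimalNonzeroEigenvalue)

------------------------------------------------------------------------
-- Finite groups, Tits systems and buildings

record FiniteGroup c e : Set (lsuc (c ⊔ e)) where
  field
    group       : Group c e
    order       : ℕ
    enumeration : Inverse (Group.setoid group) (≡.setoid (Fin order))

  open Group group public renaming (_⁻¹ to inv)
  open Inverse enumeration using (to; from; to-cong; strictlyInverseʳ)

  infix 4 _∈_ _∉_

  -- Subsets of G, encoded through the enumeration of its elements.
  _∈_ : Carrier → Subset order → Set
  g ∈ P = to g ∈ˢ P

  _∉_ : Carrier → Subset order → Set
  g ∉ P = ¬ g ∈ P

  record IsSubgroup (P : Subset order) : Set c where
    field
      ε-closed   : ε ∈ P
      ∙-closed   : ∀ g h → g ∈ P → h ∈ P → g ∙ h ∈ P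
      inv-closed : ∀ g → g ∈ P → inv g ∈ P

  -- The subgroup generated by X.
  data ⟨_⟩ {x} (X : Pred Carrier x) : Pred Carrier (c ⊔ e ⊔ x) where
    gen  : ∀ {g} → X g → ⟨ X ⟩ g
    unit : ⟨ X ⟩ ε
    mul  : ∀ {g h} → ⟨ X ⟩ g → ⟨ X ⟩ h → ⟨ X ⟩ (g ∙ h)
    neg  : ∀ {g} → ⟨ X ⟩ g → ⟨ X ⟩ (inv g)
    resp : ∀ {g h} → g ≈ h → ⟨ X ⟩ g → ⟨ X ⟩ h

  ∈-resp : ∀ {P g h} → g ≈ h → g ∈ P → h ∈ P
  ∈-resp {P} g≈h = ≡.subst (_∈ˢ P) (to-cong g≈h)

  private
    Resp : ∀ {q} → Pred Carrier q → Set (c ⊔ e ⊔ q)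
    Resp Q = ∀ {g h} → g ≈ h → Q g → Q h

  ∀? : ∀ {q} {Q : Pred Carrier q} → Resp Q → Decidable Q → Dec (∀ g → Q g)
  ∀? r Q? = map′ (λ h g → r (strictlyInverseʳ g) (h (to g))) (λ h i → h (from i))
                 (Finₚ.all? (Q? ∘ from))

  ∃? : ∀ {q} {Q : Pred Carrier q} → Resp Q → Decidable Q → Dec (∃ Q)
  ∃? r Q? = map′ (λ (i , q) → from i , q)
                 (λ (g , q) → to g , r (sym (strictlyInverseʳ g)) q)
                 (Finₚ.any? (Q? ∘ from))

  isSubgroup? : Decidable IsSubgroup
  isSubgroup? P =
    map′ (λ (a , b , c) → record { ε-closed = a ; ∙-closed = b ; inv-closed = c })
         (λ S → let open IsSubgroup S in ε-closed , ∙-closed , inv-closed)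
    ( (to ε ∈? P)
    ×-dec ∀? (λ g≈g′ Q h g′∈ h∈ → ∈-resp (∙-congʳ g≈g′) (Q h (∈-resp (sym g≈g′) g′∈) h∈))
             (λ g → ∀? (λ h≈h′ Q g∈ h′∈ → ∈-resp (∙-congˡ h≈h′) (Q g∈ (∈-resp (sym h≈h′) h′∈)))
                       (λ h → (to g ∈? P) →-dec (to h ∈? P) →-dec (to (g ∙ h) ∈? P)))
    ×-dec ∀? (λ g≈g′ Q g′∈ → ∈-resp (⁻¹-cong g≈g′) (Q (∈-resp (sym g≈g′) g′∈)))
             (λ g → (to g ∈? P) →-dec (to (inv g) ∈? P)))

-- Bourbaki's axioms.  The elements of S ⊆ W = N / T, where T = B ∩ N, are given by
-- representatives s j ∈ N, one for each j : Fin rank; two elements x, y of N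
-- represent the same element of W iff inv x ∙ y ∈ T.
record TitsSystem {c e} (G : FiniteGroup c e) (rank : ℕ) : Set (c ⊔ e) where
  open FiniteGroup G

  field
    B N : Subset order
    s   : Fin rank → Carrier

  InT : Pred Carrier 0ℓ
  InT g = g ∈ B × g ∈ N

  BwB : Carrier → Pred Carrier (c ⊔ e)
  BwB x g = ∃₂ λ b b′ → b ∈ B × b′ ∈ B × g ≈ b ∙ x ∙ b′

  field
    B-subgroup  : IsSubgroup B
    N-subgroup  : IsSubgroup N
    G-generated : ∀ g → ⟨ (λ x → x ∈ B ⊎ x ∈ N) ⟩ g
    T-normal    : ∀ n t → n ∈ N → InT t → InT (n ∙ t ∙ inv n)

    s∈N         : ∀ j → s j ∈ N
    s-distinct  : ∀ j k → InT (inv (s j) ∙ s k) → j ≡ k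
    s-nontriv   : ∀ j → ¬ InT (s j)
    s-invol     : ∀ j → InT (s j ∙ s j)
    W-generated : ∀ n → n ∈ N → ⟨ (λ x → InT x ⊎ ∃ λ j → x ≈ s j) ⟩ n

    sBw⊆        : ∀ j w b → w ∈ N → b ∈ B →
                  BwB w (s j ∙ b ∙ w) ⊎ BwB (s j ∙ w) (s j ∙ b ∙ w)
    sBs≢B       : ∀ j → ¬ (∀ b → b ∈ B → s j ∙ b ∙ inv (s j) ∈ B)

module _ {c e} {G : FiniteGroup c e} {ℓ : ℕ} (𝒯 : TitsSystem G (suc ℓ)) where

  open FiniteGroup G
  open TitsSystem 𝒯

  ContainsConjugateOfB : Pred (Subset order) c
  ContainsConjugateOfB P = ∃ λ g → ∀ b → b ∈ B → g ∙ b ∙ inv g ∈ P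

  ProperParabolic : Pred (Subset order) c
  ProperParabolic P = IsSubgroup P × P ≢ ⊤ × ContainsConjugateOfB P

  MaximalParabolic : Pred (Subset order) c
  MaximalParabolic P = ProperParabolic P × ¬ ∃ λ Q → ProperParabolic Q × P ⊆ˢ Q × P ≢ Q

  properParabolic? : Decidable ProperParabolic
  properParabolic? P = isSubgroup? P ×-dec ¬? (P ≟ˢ ⊤) ×-dec
    ∃? (λ g≈g′ Q b b∈ → ∈-resp (∙-cong (∙-congʳ g≈g′) (⁻¹-cong g≈g′)) (Q b b∈))
       (λ g → ∀? (λ b≈b′ Q b′∈ → ∈-resp (∙-congʳ (∙-congˡ b≈b′)) (Q (∈-resp (sym b≈b′) b′∈)))
                 (λ b → (_ ∈? B) →-dec (_ ∈? P)))

  maximalParabolic? : Decidable MaximalParabolic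
  maximalParabolic? P = properParabolic? P ×-dec
    ¬? (anySubset? λ Q → properParabolic? Q ×-dec (P ⊆? Q) ×-dec ¬? (P ≟ˢ Q))

  maximalParabolics : List (Subset order)
  maximalParabolics = filter maximalParabolic? (subsets order)

  -- The simplex corresponding to P, as a set of vertices: its faces correspond
  -- to the proper parabolic subgroups containing P, so its vertices are the
  -- maximal ones among these.
  verticesOf : Subset order → Subset (length maximalParabolics)
  verticesOf P = tabulate λ v → does (P ⊆? List.lookup maximalParabolics v)

  building : Complex c
  building = record
    { #vertices = length maximalParabolics
    ; dim       = ℓ
    ; Simplex   = λ σ → ∃ λ P → ProperParabolic P × σ ≡ verticesOf P
    ; simplex?  = λ σ → anySubset? λ P → properParabolic? P ×-dec (σ ≟ˢ verticesOf P)
    }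

-- Colour the vertices of the building by the ℓ + 1 types of maximal parabolic subgroups; a chamber
-- has one vertex of each colour.  If an i-cochain f is supported on the simplices of one type J,
-- with i + 1 colours, then every (i+1)-simplex has at most one face of type J, so
-- (df, df) = (ℓ - i) (f, f).  Such an f which lies in the image of δ, hence is orthogonal to ker d,
-- is found as follows.  Let F be the face of type J of the fundamental chamber, K = J ∪ {k} for a
-- further colour k, and put sgn w / w(t) on the translates t of the face of type K by the elements w
-- of the subgroup W_J generated by the s j with j in J.  In δ of this cochain the contributions of w
-- and w s j cancel on faces of type K \ {j}, and there remains a multiple of the alternating sum of
-- the translates of F, which is nonzero because only 1 in W_J fixes F.
--
-- The least λ for which ‖dδg‖² - λ ‖δg‖² is not positive definite modulo ker δ is therefore at most
-- ℓ - i.  It is computed as a Cauchy sequence, since positivity is decidable over ℚ by elimination.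
-- Elimination over ℝ, under a double negation, shows that at λ the form has a null vector g with
-- δg ≠ 0; then δg is an eigenvector of Δ for λ, and λ ≠ 0 as Δ is injective on the image of δ.
-- The double negation is harmless because ≤ on ℝ is stable.

module Submission where

open import Algebra.Bundles using (CommutativeRing; Group; RawRing)
import Algebra.Solver.Ring
import Algebra.Solver.Ring.AlmostCommutativeRing as ACR
open import Data.Bool.Base using (Bool; true; false; not; if_then_else_)
import Data.Bool.Properties as Boolₚ
open import Data.Empty using (⊥; ⊥-elim)
open import Data.Fin.Base as Fin using (Fin; zero; suc; toℕ; fromℕ<; combine; remQuot)
open import Data.Fin.Permutation.Components using (transpose; transpose-inverse)
import Data.Fin.Properties as Finₚ
open import Data.Fin.Subset using (Subset; inside; outside; ∣_∣; ⁅_⁆; _∪_) renaming (_∈_ to _∈ˢ_; _⊆_ to _⊆ˢ_; ⊤ to full)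
open import Data.Fin.Subset.Properties using (_∈?_; _⊆?_; ⊆-antisym; ⊆⊤; ∈⊤; ∣⊤∣≡n; x∈p∪q⁻; x∈p∪q⁺; x∈⁅x⁆; x∈⁅y⁆⇒x≡y; ∉⊥; ∣⊥∣≡0)
import Data.Integer.Base as ℤ
import Data.Integer.Properties as ℤₚ
open import Data.List.Base as List using (List; []; _∷_; _++_; length; filter; allFin; reverse; initLast; _∷ʳ′_)
open import Data.List.Membership.Propositional using () renaming (_∈_ to _∈ᴸ_)
open import Data.List.Membership.Propositional.Properties using (∈-++⁺ˡ; ∈-++⁺ʳ; ∈-map⁺; ∈-map⁻; ∈-lookup; ∈-filter⁺; ∈-filter⁻; ∈-allFin)
import Data.List.Properties as Listₚ
open import Data.List.Relation.Unary.All as All using (All; []; _∷_)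
import Data.List.Relation.Unary.All.Properties as Allₚ
open import Data.List.Relation.Unary.AllPairs using ([]; _∷_)
open import Data.List.Relation.Unary.Any as Any using (here; there)
open import Data.List.Relation.Unary.Any.Properties using (lookup-index)
open import Data.List.Relation.Unary.Unique.Propositional using (Unique)
import Data.List.Relation.Unary.Unique.Propositional.Properties as Uniqueₚ
open import Data.Maybe.Base using (Maybe; just; nothing)
open import Data.Nat.Base as ℕ using (ℕ; zero; suc; z≤n; s≤s; _∸_)
import Data.Nat.Properties as ℕₚ
open import Data.Parity.Base using (Parity; 0ℙ; 1ℙ)
open import Data.Product.Base as Product using (∃; ∃₂; _×_; _,_; proj₁; proj₂)
open import Data.Rational.Base as Rat using (ℚ; 0ℚ; 1ℚ; ½; Positive; mkℚ)
import Data.Rational.Properties as ℚₚ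
import Data.Rational.Unnormalised.Base as ℚᵘ
import Data.Rational.Unnormalised.Properties as ℚᵘₚ
open import Data.Sum.Base as Sum using (_⊎_; inj₁; inj₂)
open import Data.Unit.Base using (⊤; tt)
open import Data.Vec.Base as Vec using (Vec; []; _∷_; lookup; tabulate; removeAt; _[_]≔_)
import Data.Vec.Properties as Vecₚ
open import Data.Vec.Relation.Unary.All using ([]; _∷_) renaming (All to Allᵛ)
import Data.Vec.Relation.Unary.All.Properties as Allᵛₚ
open import Data.Vec.Relation.Unary.AllPairs using ([]; _∷_)
open import Data.Vec.Relation.Unary.Unique.Propositional using () renaming (Unique to Uniqueᵛ)
import Data.Vec.Relation.Unary.Unique.Propositional.Properties as Uniqueᵛₚ
open import Defs
open import Function.Base using (_∘_; case_of_; _|>_)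
open import Function.Bundles using (Inverse)
open import Level using (_⊔_; 0ℓ)
open import Relation.Binary.Definitions using (tri<; tri≈; tri>)
open import Relation.Binary.PropositionalEquality using (_≡_; _≢_; refl; sym; trans; cong; cong₂; subst; module ≡-Reasoning)
import Relation.Binary.Reflection
open import Relation.Nullary using (¬_; Dec; yes; no; does; contradiction)
open import Relation.Nullary.Decidable using (map′; ¬?; _×-dec_; _→-dec_; dec-true; dec-false; decidable-stable; ¬¬-excluded-middle)
open import Relation.Unary using (Pred; Decidable)

-- The obstacle on the analytic side is that minima over real vectors cannot be found by comparison,
-- as the order of ℝ is undecidable; all comparisons are therefore made on rational vectors, and
-- only the limit is real. On the image of δ the zero eigenvalue has disappeared, so the minimum of
-- ‖dδg‖² / ‖δg‖² is already a non-zero eigenvalue, and the test cochain merely bounds it from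
-- above. The constant has a combinatorial origin: a simplex with i + 1 vertices misses ℓ - i
-- colours, and each chamber around it supplies one vertex for each of them. The cancellation works
-- because the chambers w and w s j differ only in the vertex of colour j. On the algebraic side,
-- colours, stabilisers and the sign of w all need facts about W and the subgroups above `B`. These
-- are derived from the axioms through double cosets: distinct elements of W have distinct double
-- cosets, and each letter of a reduced word can be recovered from it by conjugating `B`.
-- Orientations cost little, because the colours order the vertices of every simplex at once, and
-- cochains become functions on vertex sets.

-- Algebra: a ring solver, ordered rings and quadratic forms

-- Coefficients are formal differences of natural numbers, which need not satisfy any laws;
-- with coefficients in R itself the solver could not cancel x - x.
module CommutativeRingSolver {c ℓ} (R : CommutativeRing c ℓ) where

  open CommutativeRing R hiding (zero) renaming (refl to ≈-refl; sym to ≈-sym; trans to ≈-trans)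
  open import Algebra.Properties.Semiring.Mult.TCOptimised semiring using (×-homo-+; ×1-homo-*; 1+×) renaming (_×_ to _·_)
  open import Algebra.Properties.Ring ring using (-‿distribˡ-*; -‿distribʳ-*; -0#≈0#; -‿involutive)
  open import Algebra.Properties.AbelianGroup +-abelianGroup using (⁻¹-∙-comm)
  open import Relation.Binary.Reasoning.Setoid setoid

  private
    reduce : ℕ → ℕ → ℕ × ℕ
    reduce (suc a) (suc b) = reduce a b
    reduce a       b       = a , b

    differences : RawRing 0ℓ 0ℓ
    differences = record
      { Carrier = ℕ × ℕ
      ; _≈_ = _≡_
      ; _+_ = λ { (a , b) (c , d) → reduce (a ℕ.+ c) (b ℕ.+ d) }
      ; _*_ = λ { (a , b) (c , d) → reduce (a ℕ.* c ℕ.+ b ℕ.* d) (a ℕ.* d ℕ.+ b ℕ.* c) }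
      ; -_  = λ { (a , b) → b , a }
      ; 0#  = 0 , 0
      ; 1#  = 1 , 0
      }

    -- The case `b = 0` is kept apart so that the coefficients `(0 , 0)` and `(1 , 0)` evaluate
    -- definitionally to `0#` and `1#`; the solver's `:0` and `:1` then agree with the constants in
    -- the goals.
    value : ℕ × ℕ → Carrier
    value (a , zero)      = a · 1#
    value (a , b@(suc _)) = a · 1# - b · 1#

    value-minus : ∀ a b → value (a , b) ≈ a · 1# - b · 1#
    value-minus a zero    = ≈-sym (≈-trans (+-congˡ -0#≈0#) (+-identityʳ _))
    value-minus a (suc b) = ≈-refl

    interchange : ∀ a b c d → (a + b) + (c + d) ≈ (a + c) + (b + d)
    interchange a b c d = begin
      (a + b) + (c + d) ≈⟨ +-assoc a b (c + d) ⟩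
      a + (b + (c + d)) ≈⟨ +-congˡ (+-assoc b c d) ⟨
      a + ((b + c) + d) ≈⟨ +-congˡ (+-congʳ (+-comm b c)) ⟩
      a + ((c + b) + d) ≈⟨ +-congˡ (+-assoc c b d) ⟩
      a + (c + (b + d)) ≈⟨ +-assoc a c (b + d) ⟨
      (a + c) + (b + d) ∎

    value-reduce : ∀ a b → value (reduce a b) ≈ a · 1# - b · 1#
    value-reduce zero    b       = value-minus zero b
    value-reduce (suc a) zero    = value-minus (suc a) zero
    value-reduce (suc a) (suc b) = begin
      value (reduce a b)                       ≈⟨ value-reduce a b ⟩
      a · 1# - b · 1#                          ≈⟨ +-identityˡ _ ⟨
      0# + (a · 1# - b · 1#)                   ≈⟨ +-congʳ (-‿inverseʳ 1#) ⟨
      (1# - 1#) + (a · 1# - b · 1#)            ≈⟨ interchange _ _ _ _ ⟩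
      (1# + a · 1#) + (- 1# - b · 1#)          ≈⟨ +-congˡ (⁻¹-∙-comm _ _) ⟩
      (1# + a · 1#) - (1# + b · 1#)            ≈⟨ +-cong (1+× a 1#) (-‿cong (1+× b 1#)) ⟨
      suc a · 1# - suc b · 1#                  ∎

    minus-+ : ∀ a b c d → (a - b) + (c - d) ≈ (a + c) - (b + d)
    minus-+ a b c d = ≈-trans (interchange a (- b) c (- d)) (+-congˡ (⁻¹-∙-comm b d))

    minus-* : ∀ a b c d → (a - b) * (c - d) ≈ (a * c + b * d) - (a * d + b * c)
    minus-* a b c d = begin
      (a - b) * (c - d)                                  ≈⟨ distribˡ (a - b) c (- d) ⟩
      (a - b) * c + (a - b) * - d                        ≈⟨ +-cong (distribʳ c a (- b)) (distribʳ (- d) a (- b)) ⟩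
      (a * c + - b * c) + (a * - d + - b * - d)          ≈⟨ +-congˡ (+-comm _ _) ⟩
      (a * c + - b * c) + (- b * - d + a * - d)          ≈⟨ interchange _ _ _ _ ⟩
      (a * c + - b * - d) + (- b * c + a * - d)          ≈⟨ +-cong (+-congˡ cancel) (≈-trans (+-comm _ _) (+-cong (≈-sym (-‿distribʳ-* a d)) (≈-sym (-‿distribˡ-* b c)))) ⟩
      (a * c + b * d) + (- (a * d) + - (b * c))          ≈⟨ +-congˡ (⁻¹-∙-comm _ _) ⟩
      (a * c + b * d) - (a * d + b * c)                  ∎
      where
      cancel : - b * - d ≈ b * d
      cancel = ≈-trans (≈-sym (-‿distribˡ-* b (- d))) (≈-trans (-‿cong (≈-sym (-‿distribʳ-* b d))) (-‿involutive _))

    morphism : differences ACR.-Raw-AlmostCommutative⟶ ACR.fromCommutativeRing R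
    morphism = record
      { ⟦_⟧ = value
      ; +-homo = λ { (a , b) (c , d) → begin
          value (reduce (a ℕ.+ c) (b ℕ.+ d))                   ≈⟨ value-reduce (a ℕ.+ c) (b ℕ.+ d) ⟩
          (a ℕ.+ c) · 1# - (b ℕ.+ d) · 1#                      ≈⟨ +-cong (×-homo-+ 1# a c) (-‿cong (×-homo-+ 1# b d)) ⟩
          (a · 1# + c · 1#) - (b · 1# + d · 1#)                ≈⟨ minus-+ _ _ _ _ ⟨
          (a · 1# - b · 1#) + (c · 1# - d · 1#)                ≈⟨ +-cong (value-minus a b) (value-minus c d) ⟨
          value (a , b) + value (c , d)                        ∎ }
      ; *-homo = λ { (a , b) (c , d) → begin
          value (reduce (a ℕ.* c ℕ.+ b ℕ.* d) (a ℕ.* d ℕ.+ b ℕ.* c)) ≈⟨ value-reduce (a ℕ.* c ℕ.+ b ℕ.* d) (a ℕ.* d ℕ.+ b ℕ.* c) ⟩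
          (a ℕ.* c ℕ.+ b ℕ.* d) · 1# - (a ℕ.* d ℕ.+ b ℕ.* c) · 1#
            ≈⟨ +-cong (products a c b d) (-‿cong (products a d b c)) ⟩
          (a · 1# * c · 1# + b · 1# * d · 1#) - (a · 1# * d · 1# + b · 1# * c · 1#)
                                                               ≈⟨ minus-* _ _ _ _ ⟨
          (a · 1# - b · 1#) * (c · 1# - d · 1#)                ≈⟨ *-cong (value-minus a b) (value-minus c d) ⟨
          value (a , b) * value (c , d)                        ∎ }
      ; -‿homo = λ { (a , b) → begin
          value (b , a)             ≈⟨ value-minus b a ⟩
          b · 1# - a · 1#           ≈⟨ +-comm _ _ ⟩
          - (a · 1#) + b · 1#       ≈⟨ +-congˡ (-‿involutive _) ⟨
          - (a · 1#) - - (b · 1#)   ≈⟨ ⁻¹-∙-comm _ _ ⟩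
          - (a · 1# - b · 1#)       ≈⟨ -‿cong (value-minus a b) ⟨
          - value (a , b)           ∎ }
      ; 0-homo = ≈-refl
      ; 1-homo = ≈-refl
      }
      where
      products : ∀ a c b d → (a ℕ.* c ℕ.+ b ℕ.* d) · 1# ≈ a · 1# * c · 1# + b · 1# * d · 1#
      products a c b d = ≈-trans (×-homo-+ 1# (a ℕ.* c) (b ℕ.* d)) (+-cong (×1-homo-* a c) (×1-homo-* b d))

    weakly? : ∀ p q → Maybe (value p ≈ value q)
    weakly? (a , b) (c , d) with a ℕ.+ d ℕₚ.≟ c ℕ.+ b
    ... | no _   = nothing
    ... | yes eq = just (begin
      value (a , b)                         ≈⟨ value-minus a b ⟩
      a · 1# - b · 1#                       ≈⟨ +-identityʳ _ ⟨
      (a · 1# - b · 1#) + 0#                ≈⟨ +-congˡ (-‿inverseʳ (d · 1#)) ⟨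
      (a · 1# - b · 1#) + (d · 1# - d · 1#) ≈⟨ interchange _ _ _ _ ⟩
      (a · 1# + d · 1#) + (- (b · 1#) - d · 1#) ≈⟨ +-congʳ (≈-trans (≈-sym (×-homo-+ 1# a d)) (≈-trans (reflexive (cong (_· 1#) eq)) (×-homo-+ 1# c b))) ⟩
      (c · 1# + b · 1#) + (- (b · 1#) - d · 1#) ≈⟨ +-congˡ (+-comm _ _) ⟩
      (c · 1# + b · 1#) + (- (d · 1#) - b · 1#) ≈⟨ interchange _ _ _ _ ⟩
      (c · 1# - d · 1#) + (b · 1# - b · 1#) ≈⟨ +-congˡ (-‿inverseʳ (b · 1#)) ⟩
      (c · 1# - d · 1#) + 0#                ≈⟨ +-identityʳ _ ⟩
      c · 1# - d · 1#                       ≈⟨ value-minus c d ⟨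
      value (c , d)                         ∎)

  open Algebra.Solver.Ring differences (ACR.fromCommutativeRing R) morphism weakly? public
    hiding (⟦_⟧)

  :0 :1 : ∀ {n} → Polynomial n
  :0 = con (0 , 0)
  :1 = con (1 , 0)

-- The sign test lives in a monad: the identity for ℚ, double negation for ℝ.
record OrderedRing : Set₁ where
  field
    M      : Set → Set
    return : ∀ {A} → A → M A
    bind   : ∀ {A B} → M A → (A → M B) → M B
    commutativeRing : CommutativeRing 0ℓ 0ℓ

  open CommutativeRing commutativeRing public hiding (zero) renaming (Carrier to F; refl to ≈-refl; sym to ≈-sym; trans to ≈-trans)

  field
    NonNeg Pos : F → Set
    nn-resp    : ∀ {a b} → a ≈ b → NonNeg a → NonNeg b
    nn-0       : NonNeg 0#
    nn-+       : ∀ {a b} → NonNeg a → NonNeg b → NonNeg (a + b)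
    nn-*       : ∀ {a b} → NonNeg a → NonNeg b → NonNeg (a * b)
    nn-sq      : ∀ a → NonNeg (a * a)
    nn-cancel  : ∀ {a x} → Pos a → NonNeg (a * x) → NonNeg x
    sq-0       : ∀ {a} → NonNeg (- (a * a)) → a ≈ 0#
    pos⇒nn     : ∀ {a} → Pos a → NonNeg a
    pos-1      : Pos 1#
    pos-+      : ∀ {a b} → Pos a → NonNeg b → Pos (a + b)
    arch       : ∀ {a} b → Pos a → ∃ λ k → Pos k × NonNeg (k * a - b)
    sign?      : ∀ a → M (NonNeg (- a) ⊎ Pos a)

-- Elimination for a pair of symmetric forms

module Forms (O : OrderedRing) where

  open OrderedRing O

  open CommutativeRingSolver commutativeRing using (solve; _:=_; _:+_; _:*_; _:-_; :-_; :0; :1)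

  Vector : ℕ → Set
  Vector n = Fin n → F

  infix 4 _≋_
  _≋_ : ∀ {n} → Vector n → Vector n → Set
  x ≋ y = ∀ a → x a ≈ y a

  comb : ∀ {n} → F → Vector n → F → Vector n → Vector n
  comb s x t y a = s * x a + t * y a

  record SymmetricForm (n : ℕ) : Set where
    field
      ⟪_,_⟫ : Vector n → Vector n → F
      respects  : ∀ {x x′ y y′} → x ≋ x′ → y ≋ y′ → ⟪ x , y ⟫ ≈ ⟪ x′ , y′ ⟫
      symm  : ∀ x y → ⟪ x , y ⟫ ≈ ⟪ y , x ⟫
      linˡ  : ∀ s x t y z → ⟪ comb s x t y , z ⟫ ≈ s * ⟪ x , z ⟫ + t * ⟪ y , z ⟫

    linʳ : ∀ z s x t y → ⟪ z , comb s x t y ⟫ ≈ s * ⟪ z , x ⟫ + t * ⟪ z , y ⟫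
    linʳ z s x t y = ≈-trans (symm _ _) (≈-trans (linˡ s x t y z) (+-cong (*-congˡ (symm _ _)) (*-congˡ (symm _ _))))

    square-comb : ∀ s x t y → ⟪ comb s x t y , comb s x t y ⟫ ≈
      s * s * ⟪ x , x ⟫ + (s * t + s * t) * ⟪ x , y ⟫ + t * t * ⟪ y , y ⟫
    square-comb s x t y = begin
      ⟪ comb s x t y , comb s x t y ⟫
        ≈⟨ linˡ s x t y _ ⟩
      s * ⟪ x , comb s x t y ⟫ + t * ⟪ y , comb s x t y ⟫
        ≈⟨ +-cong (*-congˡ (linʳ x s x t y)) (*-congˡ (linʳ y s x t y)) ⟩
      s * (s * ⟪ x , x ⟫ + t * ⟪ x , y ⟫) + t * (s * ⟪ y , x ⟫ + t * ⟪ y , y ⟫)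
        ≈⟨ +-congˡ (*-congˡ (+-congʳ (*-congˡ (symm y x)))) ⟩
      s * (s * ⟪ x , x ⟫ + t * ⟪ x , y ⟫) + t * (s * ⟪ x , y ⟫ + t * ⟪ y , y ⟫)
        ≈⟨ expand s t ⟪ x , x ⟫ ⟪ x , y ⟫ ⟪ y , y ⟫ ⟩
      s * s * ⟪ x , x ⟫ + (s * t + s * t) * ⟪ x , y ⟫ + t * t * ⟪ y , y ⟫ ∎
      where
      open import Relation.Binary.Reasoning.Setoid setoid
      expand : ∀ s t a b c → s * (s * a + t * b) + t * (s * b + t * c) ≈ s * s * a + (s * t + s * t) * b + t * t * c
      expand = solve 5 (λ s t a b c →
        s :* (s :* a :+ t :* b) :+ t :* (s :* b :+ t :* c) := s :* s :* a :+ (s :* t :+ s :* t) :* b :+ t :* t :* c) ≈-refl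

  -- Cauchy-Schwarz without division: evaluate the form at `(k , - q)` with `k ≥ b`. After adding -
  -- k² a and q² (k - b), both non-negative, only - k q² is left, so q² ≤ 0.
  null⇒orthogonal : ∀ a q b → NonNeg (- a) →
    (∀ s t → NonNeg (s * s * a + (s * t + s * t) * q + t * t * b)) → q ≈ 0#
  null⇒orthogonal a q b a≤0 psd with arch {1#} b pos-1
  ... | k , k>0 , k≥b = sq-0 (nn-cancel k>0 (nn-resp (identity a q b k)
      (nn-+ (nn-+ (psd k (- q)) (nn-* (nn-sq k) a≤0)) (nn-* (nn-sq q) k≥b))))
    where
    identity : ∀ a q b k →
      (k * k * a + (k * - q + k * - q) * q + - q * - q * b) + k * k * - a + q * q * (k * 1# - b) ≈ k * - (q * q)
    identity = solve 4 (λ a q b k →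
      (k :* k :* a :+ (k :* :- q :+ k :* :- q) :* q :+ :- q :* :- q :* b) :+ k :* k :* :- a :+ q :* q :* (k :* :1 :- b) := k :* :- (q :* q)) ≈-refl

  module _ {n} (P Q : SymmetricForm n) where

    private
      module P = SymmetricForm P
      module Q = SymmetricForm Q

    -- Both forms then descend to the quotient by the null vectors of `P`, where `P` is definite.
    -- Elimination may discard null directions.
    record Admissible : Set where
      field
        psd     : ∀ x → NonNeg P.⟪ x , x ⟫
        radical : ∀ x → NonNeg (- P.⟪ x , x ⟫) → ∀ y → Q.⟪ x , y ⟫ ≈ 0#

    -- Positive definiteness of `Q` modulo the null vectors of `P`, in the uniform shape P ≤ k Q;
    -- the refutation at the threshold works by bounding this `k`.
    Dominates : Set
    Dominates = ∃ λ k → Pos k × ∀ x → NonNeg (k * Q.⟪ x , x ⟫ - P.⟪ x , x ⟫)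

    Escapes : Set
    Escapes = ∃ λ x → Pos P.⟪ x , x ⟫ × NonNeg (- Q.⟪ x , x ⟫)

  orthogonal : ∀ {n} (P : SymmetricForm n) → let open SymmetricForm P in
    (∀ x → NonNeg ⟪ x , x ⟫) → ∀ x → NonNeg (- ⟪ x , x ⟫) → ∀ y → ⟪ x , y ⟫ ≈ 0#
  orthogonal P psd x x≤0 y = null⇒orthogonal _ _ _ x≤0 (λ s t → nn-resp (P.square-comb s x t y) (psd _))
    where module P = SymmetricForm P

  record LinearMap (m n : ℕ) : Set where
    field
      map      : Vector m → Vector n
      map-cong : ∀ {x y} → x ≋ y → map x ≋ map y
      map-lin  : ∀ s x t y → map (comb s x t y) ≋ comb s (map x) t (map y)

  pullback : ∀ {m n} → LinearMap m n → SymmetricForm n → SymmetricForm m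
  pullback L B = record
    { ⟪_,_⟫ = λ x y → ⟪ map x , map y ⟫
    ; respects  = λ p q → respects (map-cong p) (map-cong q)
    ; symm  = λ x y → symm _ _
    ; linˡ  = λ s x t y z → ≈-trans (respects (map-lin s x t y) (λ _ → ≈-refl)) (linˡ s (map x) t (map y) (map z))
    }
    where
    open LinearMap L
    open SymmetricForm B

  e₀ : ∀ {n} → Vector (suc n)
  e₀ zero    = 1#
  e₀ (suc _) = 0#

  0∷_ : ∀ {n} → Vector n → Vector (suc n)
  (0∷ y) zero    = 0#
  (0∷ y) (suc a) = y a

  -- With a = Q(e₀, e₀) and f = Q(e₀, ·) this is the projection to the `Q`-orthogonal complement of
  -- `e₀`, multiplied by `a` so that no division occurs.
  shear : ∀ {n} (a : F) (f : Vector n → F) → (∀ {x y} → x ≋ y → f x ≈ f y) →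
    (∀ s x t y → f (comb s x t y) ≈ s * f x + t * f y) → LinearMap n (suc n)
  shear a f f-cong f-lin = record
    { map = λ y → comb a (0∷ y) (- f y) e₀
    ; map-cong = λ { p zero → +-congˡ (*-congʳ (-‿cong (f-cong p)))
                   ; p (suc b) → +-cong (*-congˡ (p b)) (*-congʳ (-‿cong (f-cong p))) }
    ; map-lin = λ { s x t y zero → ≈-trans (+-congˡ (*-congʳ (-‿cong (f-lin s x t y)))) (at-zero a s t (f x) (f y))
                  ; s x t y (suc b) → ≈-trans (+-congˡ (*-congʳ (-‿cong (f-lin s x t y)))) (at-suc a s t (x b) (y b) (f x) (f y)) }
    }
    where
    at-zero : ∀ a s t u v → a * 0# + - (s * u + t * v) * 1# ≈ s * (a * 0# + - u * 1#) + t * (a * 0# + - v * 1#)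
    at-zero = solve 5 (λ a s t u v →
      a :* :0 :+ :- (s :* u :+ t :* v) :* :1 := s :* (a :* :0 :+ :- u :* :1) :+ t :* (a :* :0 :+ :- v :* :1)) ≈-refl
    at-suc : ∀ a s t x y u v →
      a * (s * x + t * y) + - (s * u + t * v) * 0# ≈ s * (a * x + - u * 0#) + t * (a * y + - v * 0#)
    at-suc = solve 7 (λ a s t x y u v →
      a :* (s :* x :+ t :* y) :+ :- (s :* u :+ t :* v) :* :0 := s :* (a :* x :+ :- u :* :0) :+ t :* (a :* y :+ :- v :* :0)) ≈-refl

  tail : ∀ {n} → Vector (suc n) → Vector n
  tail x = x ∘ suc

  private
    doubled : F → F
    doubled x = x + x

  eliminate : ∀ {n} (P Q : SymmetricForm n) → Admissible P Q → M (Dominates P Q ⊎ Escapes P Q)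
  eliminate {zero} P Q adm = return (inj₁ (1# , pos-1 , λ x → nn-resp (empty _ _ (null x)) (nn-* (pos⇒nn pos-1) (nn-resp (≈-sym (nullQ x)) nn-0))))
    where
    module P = SymmetricForm P
    module Q = SymmetricForm Q
    open Admissible adm
    null : ∀ x → P.⟪ x , x ⟫ ≈ 0#
    null x = ≈-trans (P.respects {y′ = x} (λ ()) (λ _ → ≈-refl)) (≈-trans (P.linˡ 0# x 0# x x) (zeros P.⟪ x , x ⟫))
      where
      zeros : ∀ p → 0# * p + 0# * p ≈ 0#
      zeros = solve 1 (λ p →
        :0 :* p :+ :0 :* p := :0) ≈-refl
    nullQ : ∀ x → Q.⟪ x , x ⟫ ≈ 0#
    nullQ x = radical x (nn-resp (≈-trans (≈-sym -0#≈0#) (-‿cong (≈-sym (null x)))) nn-0) x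
      where open import Algebra.Properties.Ring (CommutativeRing.ring commutativeRing) using (-0#≈0#)
    empty : ∀ p q → p ≈ 0# → 1# * q ≈ 1# * q - p
    empty p q p≈0 = ≈-trans (lemma (1# * q)) (+-congˡ (-‿cong (≈-sym p≈0)))
      where
      lemma : ∀ q → q ≈ q - 0#
      lemma = solve 1 (λ q →
        q := q :- :0) ≈-refl
  eliminate {suc n} P Q adm = bind (sign? P.⟪ e₀ , e₀ ⟫) λ
      { (inj₁ p≤0) → bind (eliminate (pullback drop P) (pullback drop Q) adm-drop) λ
          { (inj₁ (k , k>0 , h)) → return (inj₁ (k , k>0 , λ x →
              nn-resp (+-cong (*-congˡ (drop-form Q (λ y → radical e₀ p≤0 y) x))
                              (-‿cong (drop-form P (orthogonal P psd e₀ p≤0) x))) (h (tail x))))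
          ; (inj₂ (y , p , q)) → return (inj₂ (_ , p , q)) }
      ; (inj₂ p>0) → bind (sign? Q.⟪ e₀ , e₀ ⟫) λ
          { (inj₁ q≤0) → return (inj₂ (e₀ , p>0 , q≤0))
          ; (inj₂ q>0) → bind (eliminate (pullback square P) (pullback square Q) adm-square) λ
              { (inj₁ dom) → return (inj₁ (complete q>0 dom))
              ; (inj₂ (y , p , q)) → return (inj₂ (_ , p , q)) } } }
    where
    module P = SymmetricForm P
    module Q = SymmetricForm Q
    open Admissible adm
    open import Relation.Binary.Reasoning.Setoid setoid

    pullback-adm : ∀ {m} (L : LinearMap m (suc n)) → Admissible (pullback L P) (pullback L Q)
    pullback-adm L = record { psd = λ x → psd _ ; radical = λ x p y → radical _ p _ }

    drop : LinearMap n (suc n)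
    drop = record
      { map = 0∷_
      ; map-cong = λ { p zero → ≈-refl ; p (suc b) → p b }
      ; map-lin = λ { s x t y zero → zeros s t ; s x t y (suc b) → ≈-refl } }
      where
      zeros : ∀ s t → 0# ≈ s * 0# + t * 0#
      zeros = solve 2 (λ s t →
        :0 := s :* :0 :+ t :* :0) ≈-refl

    adm-drop : Admissible (pullback drop P) (pullback drop Q)
    adm-drop = pullback-adm drop

    split : ∀ x → x ≋ comb (x zero) e₀ 1# (0∷ tail x)
    split x zero = lemma (x zero)
      where
      lemma : ∀ a → a ≈ a * 1# + 1# * 0#
      lemma = solve 1 (λ a →
        a := a :* :1 :+ :1 :* :0) ≈-refl
    split x (suc b) = lemma (x zero) (x (suc b))
      where
      lemma : ∀ a c → c ≈ a * 0# + 1# * c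
      lemma = solve 2 (λ a c →
        c := a :* :0 :+ :1 :* c) ≈-refl

    drop-form : (B : SymmetricForm (suc n)) → let open SymmetricForm B in
      (∀ y → ⟪ e₀ , y ⟫ ≈ 0#) → ∀ x → ⟪ 0∷ tail x , 0∷ tail x ⟫ ≈ ⟪ x , x ⟫
    drop-form B e⊥ x = ≈-sym (begin
      ⟪ x , x ⟫                                                 ≈⟨ respects (split x) (split x) ⟩
      ⟪ comb t e₀ 1# y , comb t e₀ 1# y ⟫                       ≈⟨ square-comb t e₀ 1# y ⟩
      t * t * ⟪ e₀ , e₀ ⟫ + (t * 1# + t * 1#) * ⟪ e₀ , y ⟫ + 1# * 1# * ⟪ y , y ⟫
        ≈⟨ +-congʳ (+-cong (*-congˡ (e⊥ e₀)) (*-congˡ (e⊥ y))) ⟩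
      t * t * 0# + (t * 1# + t * 1#) * 0# + 1# * 1# * ⟪ y , y ⟫ ≈⟨ lemma t ⟪ y , y ⟫ ⟩
      ⟪ y , y ⟫ ∎)
      where
      open SymmetricForm B
      t = x zero
      y = 0∷ tail x
      lemma : ∀ t a → t * t * 0# + (t * 1# + t * 1#) * 0# + 1# * 1# * a ≈ a
      lemma = solve 2 (λ t a →
        t :* t :* :0 :+ (t :* :1 :+ t :* :1) :* :0 :+ :1 :* :1 :* a := a) ≈-refl

    a = Q.⟪ e₀ , e₀ ⟫

    functional : Vector n → F
    functional y = Q.⟪ e₀ , 0∷ y ⟫

    square : LinearMap n (suc n)
    square = shear a functional (λ p → Q.respects (λ _ → ≈-refl) (map-cong p))
      (λ s x t y → ≈-trans (Q.respects (λ _ → ≈-refl) (map-lin s x t y)) (Q.linʳ e₀ s (0∷ x) t (0∷ y)))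
      where open LinearMap drop

    adm-square : Admissible (pullback square P) (pullback square Q)
    adm-square = pullback-adm square

    module _ (x : Vector (suc n)) where

      y′ = LinearMap.map square (tail x)
      r  = a * x zero + functional (tail x)

      -- Completing the square, cleared of the denominator `a`: the component `y′` is `Q`-orthogonal
      -- to `e₀`, so the cross term disappears from `Q`, though not from `P`.
      scaled : comb a x 0# x ≋ comb r e₀ 1# y′
      scaled zero = lemma a (x zero) (functional (tail x))
        where
        lemma : ∀ a t f → a * t + 0# * t ≈ (a * t + f) * 1# + 1# * (a * 0# + - f * 1#)
        lemma = solve 3 (λ a t f →
          a :* t :+ :0 :* t := (a :* t :+ f) :* :1 :+ :1 :* (a :* :0 :+ :- f :* :1)) ≈-refl
      scaled (suc b) = lemma a (x (suc b)) (functional (tail x)) r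
        where
        lemma : ∀ a t f r → a * t + 0# * t ≈ r * 0# + 1# * (a * t + - f * 0#)
        lemma = solve 4 (λ a t f r →
          a :* t :+ :0 :* t := r :* :0 :+ :1 :* (a :* t :+ :- f :* :0)) ≈-refl

      scaled-form : (B : SymmetricForm (suc n)) → let open SymmetricForm B in
        a * a * ⟪ x , x ⟫ ≈ r * r * ⟪ e₀ , e₀ ⟫ + (r + r) * ⟪ e₀ , y′ ⟫ + ⟪ y′ , y′ ⟫
      scaled-form B = begin
        a * a * ⟪ x , x ⟫                                       ≈⟨ lemma₁ a ⟪ x , x ⟫ ⟩
        a * a * ⟪ x , x ⟫ + (a * 0# + a * 0#) * ⟪ x , x ⟫ + 0# * 0# * ⟪ x , x ⟫ ≈⟨ square-comb a x 0# x ⟨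
        ⟪ comb a x 0# x , comb a x 0# x ⟫                       ≈⟨ respects scaled scaled ⟩
        ⟪ comb r e₀ 1# y′ , comb r e₀ 1# y′ ⟫                   ≈⟨ square-comb r e₀ 1# y′ ⟩
        r * r * ⟪ e₀ , e₀ ⟫ + (r * 1# + r * 1#) * ⟪ e₀ , y′ ⟫ + 1# * 1# * ⟪ y′ , y′ ⟫
          ≈⟨ lemma₂ r ⟪ e₀ , e₀ ⟫ ⟪ e₀ , y′ ⟫ ⟪ y′ , y′ ⟫ ⟩
        r * r * ⟪ e₀ , e₀ ⟫ + (r + r) * ⟪ e₀ , y′ ⟫ + ⟪ y′ , y′ ⟫ ∎
        where
        open SymmetricForm B
        lemma₁ : ∀ a q → a * a * q ≈ a * a * q + (a * 0# + a * 0#) * q + 0# * 0# * q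
        lemma₁ = solve 2 (λ a q →
          a :* a :* q := a :* a :* q :+ (a :* :0 :+ a :* :0) :* q :+ :0 :* :0 :* q) ≈-refl
        lemma₂ : ∀ r p m q → r * r * p + (r * 1# + r * 1#) * m + 1# * 1# * q ≈ r * r * p + (r + r) * m + q
        lemma₂ = solve 4 (λ r p m q →
          r :* r :* p :+ (r :* :1 :+ r :* :1) :* m :+ :1 :* :1 :* q := r :* r :* p :+ (r :+ r) :* m :+ q) ≈-refl

      Q-split : a * a * Q.⟪ x , x ⟫ ≈ r * r * a + Q.⟪ y′ , y′ ⟫
      Q-split = ≈-trans (scaled-form Q) (+-congʳ (≈-trans (+-congˡ (≈-trans (*-congˡ orth) (zeroʳ (r + r)))) (+-identityʳ (r * r * a))))
        where
        orth : Q.⟪ e₀ , y′ ⟫ ≈ 0#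
        orth = ≈-trans (Q.linʳ e₀ a (0∷ tail x) (- functional (tail x)) e₀) (lemma a (functional (tail x)))
          where
          lemma : ∀ a f → a * f + - f * a ≈ 0#
          lemma = solve 2 (λ a f →
            a :* f :+ :- f :* a := :0) ≈-refl

    complete : Pos a → Dominates (pullback square P) (pullback square Q) → Dominates P Q
    complete q>0 (k , k>0 , h) with arch {a} (doubled P.⟪ e₀ , e₀ ⟫) q>0
    -- Since P(r e₀ - y′) ≥ 0, the form `P` at r e₀ + y′ is at most 2 r² P(e₀, e₀) + 2 P(y′, y′).
    -- The choice l a ≥ 2 P(e₀, e₀) absorbs the first term, and `doubled k` the second.
    ... | l , l>0 , l≥ = l + doubled k , pos-+ l>0 (nn-+ (pos⇒nn k>0) (pos⇒nn k>0)) ,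
        λ x → nn-cancel q>0 (nn-cancel q>0 (nn-resp (main x) (sum x)))
      where
      module _ (x : Vector (suc n)) where
        p = P.⟪ e₀ , e₀ ⟫
        m = P.⟪ e₀ , y′ x ⟫
        P′ = P.⟪ y′ x , y′ x ⟫
        Q′ = Q.⟪ y′ x , y′ x ⟫
        ρ = r x

        Q′≥0 : NonNeg Q′
        Q′≥0 = nn-cancel k>0 (nn-resp (lemma k Q′ P′) (nn-+ (h (tail x)) (psd (y′ x))))
          where
          lemma : ∀ k q p → (k * q - p) + p ≈ k * q
          lemma = solve 3 (λ k q p →
            (k :* q :- p) :+ p := k :* q) ≈-refl

        reflected : NonNeg (ρ * ρ * p - (ρ + ρ) * m + P′)
        reflected = nn-resp (≈-trans (P.square-comb ρ e₀ (- 1#) (y′ x)) (lemma ρ p m P′)) (psd (comb ρ e₀ (- 1#) (y′ x)))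
          where
          lemma : ∀ r p m q → r * r * p + (r * - 1# + r * - 1#) * m + - 1# * - 1# * q ≈ r * r * p - (r + r) * m + q
          lemma = solve 4 (λ r p m q →
            r :* r :* p :+ (r :* :- :1 :+ r :* :- :1) :* m :+ :- :1 :* :- :1 :* q := r :* r :* p :- (r :+ r) :* m :+ q) ≈-refl

        total : F
        total = (ρ * ρ * p - (ρ + ρ) * m + P′) + ρ * ρ * (l * a - (p + p)) + doubled (k * Q′ - P′)
              + l * Q′ + doubled k * (ρ * ρ * a)

        sum : NonNeg total
        sum = nn-+ (nn-+ (nn-+ (nn-+ reflected (nn-* (nn-sq ρ) l≥)) (nn-+ (h (tail x)) (h (tail x))))
                (nn-* (pos⇒nn l>0) Q′≥0)) (nn-* (nn-+ (pos⇒nn k>0) (pos⇒nn k>0)) (nn-* (nn-sq ρ) (pos⇒nn q>0)))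

        main : total ≈ a * (a * ((l + doubled k) * Q.⟪ x , x ⟫ - P.⟪ x , x ⟫))
        main = begin
          total
            ≈⟨ lemma₁ ρ p m P′ Q′ l k a ⟩
          (l + (k + k)) * (ρ * ρ * a + Q′) - (ρ * ρ * p + (ρ + ρ) * m + P′)
            ≈⟨ +-cong (*-congˡ (Q-split x)) (-‿cong (scaled-form x P)) ⟨
          (l + (k + k)) * (a * a * Q.⟪ x , x ⟫) - a * a * P.⟪ x , x ⟫
            ≈⟨ lemma₂ (l + (k + k)) a Q.⟪ x , x ⟫ P.⟪ x , x ⟫ ⟩
          a * (a * ((l + (k + k)) * Q.⟪ x , x ⟫ - P.⟪ x , x ⟫)) ∎
          where
          lemma₁ : ∀ r p m P′ Q′ l k a →
            (r * r * p - (r + r) * m + P′) + r * r * (l * a - (p + p)) + ((k * Q′ - P′) + (k * Q′ - P′))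
              + l * Q′ + (k + k) * (r * r * a) ≈
            (l + (k + k)) * (r * r * a + Q′) - (r * r * p + (r + r) * m + P′)
          lemma₁ = solve 8 (λ r p m P′ Q′ l k a →
            (r :* r :* p :- (r :+ r) :* m :+ P′) :+ r :* r :* (l :* a :- (p :+ p)) :+ ((k :* Q′ :- P′) :+ (k :* Q′ :- P′)) :+ l :* Q′ :+ (k :+ k) :* (r :* r :* a) := (l :+ (k :+ k)) :* (r :* r :* a :+ Q′) :- (r :* r :* p :+ (r :+ r) :* m :+ P′)) ≈-refl
          lemma₂ : ∀ k a q p → k * (a * a * q) - a * a * p ≈ a * (a * (k * q - p))
          lemma₂ = solve 4 (λ k a q p →
            k :* (a :* a :* q) :- a :* a :* p := a :* (a :* (k :* q :- p))) ≈-refl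

-- Rational and real numbers

module Rationals where

  open import Data.Integer.Base using (+_)
  open Rat using (_≤_; _<_; _+_; _*_; _-_; -_; 1/_) renaming (∣_∣ to abs) public
  open CommutativeRingSolver ℚₚ.+-*-commutativeRing public using (solve; _:=_; _:+_; _:*_; _:-_; :-_; :0; :1)

  0≤-⇒≤ : ∀ {p q} → 0ℚ ≤ q - p → p ≤ q
  0≤-⇒≤ {p} {q} h = ℚₚ.≤-trans (ℚₚ.≤-reflexive (sym (ℚₚ.+-identityʳ p)))
    (ℚₚ.≤-trans (ℚₚ.+-monoʳ-≤ p h) (ℚₚ.≤-reflexive (lemma p q)))
    where
    lemma : ∀ p q → p + (q - p) ≡ q
    lemma = solve 2 (λ p q → p :+ (q :- p) := q) refl

  ≤⇒0≤- : ∀ {p q} → p ≤ q → 0ℚ ≤ q - p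
  ≤⇒0≤- {p} {q} h = ℚₚ.≤-trans (ℚₚ.≤-reflexive (sym (ℚₚ.+-inverseʳ p))) (ℚₚ.+-monoˡ-≤ (- p) h)

  difference : ∀ {p q} r → 0ℚ ≤ r → r ≡ q - p → p ≤ q
  difference r h eq = 0≤-⇒≤ (subst (0ℚ ≤_) eq h)

  0≤+ : ∀ {p q} → 0ℚ ≤ p → 0ℚ ≤ q → 0ℚ ≤ p + q
  0≤+ {p} {q} h k = ℚₚ.+-mono-≤ h k

  0≤* : ∀ {p q} → 0ℚ ≤ p → 0ℚ ≤ q → 0ℚ ≤ p * q
  0≤* {p} {q} h k = ℚₚ.nonNegative⁻¹ (p * q) {{ℚₚ.nonNeg*nonNeg⇒nonNeg p {{Rat.nonNegative h}} q {{Rat.nonNegative k}}}}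

  0<* : ∀ {p q} → 0ℚ < p → 0ℚ < q → 0ℚ < p * q
  0<* {p} {q} h k = ℚₚ.positive⁻¹ (p * q) {{ℚₚ.pos*pos⇒pos p {{Rat.positive h}} q {{Rat.positive k}}}}

  0≤sq : ∀ p → 0ℚ ≤ p * p
  0≤sq p with ℚₚ.≤-total 0ℚ p
  ... | inj₁ h = 0≤* h h
  ... | inj₂ h = subst (0ℚ ≤_) (lemma p) (0≤* (≤⇒0≤- h) (≤⇒0≤- h))
    where
    lemma : ∀ p → (0ℚ - p) * (0ℚ - p) ≡ p * p
    lemma = solve 1 (λ p → (:0 :- p) :* (:0 :- p) := p :* p) refl

  0≤*-cancel : ∀ {p q} → 0ℚ < p → 0ℚ ≤ p * q → 0ℚ ≤ q
  0≤*-cancel {p} {q} h k = ℚₚ.*-cancelˡ-≤-pos p {{Rat.positive h}} (subst (_≤ p * q) (sym (ℚₚ.*-zeroʳ p)) k)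

  abs-≤ : ∀ {p q} → 0ℚ ≤ q - p → 0ℚ ≤ q + p → abs p ≤ q
  abs-≤ {p} {q} h k with ℚₚ.∣p∣≡p∨∣p∣≡-p p
  ... | inj₁ e rewrite e = 0≤-⇒≤ h
  ... | inj₂ e rewrite e = difference (q + p) k (lemma p q)
    where
    lemma : ∀ p q → q + p ≡ q - - p
    lemma = solve 2 (λ p q → q :+ p := q :- (:- p)) refl

  abs-upper : ∀ {p q} → abs p ≤ q → 0ℚ ≤ q - p
  abs-upper {p} {q} h with ℚₚ.≤-total 0ℚ p
  ... | inj₁ 0≤p = ≤⇒0≤- (subst (_≤ q) (ℚₚ.0≤p⇒∣p∣≡p 0≤p) h)
  ... | inj₂ p≤0 = ≤⇒0≤- (ℚₚ.≤-trans p≤0 (ℚₚ.≤-trans (ℚₚ.0≤∣p∣ p) h))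

  abs-lower : ∀ {p q} → abs p ≤ q → 0ℚ ≤ q + p
  abs-lower {p} {q} h = subst (0ℚ ≤_) (lemma p q) (abs-upper { - p} (subst (_≤ q) (sym (ℚₚ.∣-p∣≡∣p∣ p)) h))
    where
    lemma : ∀ p q → q - - p ≡ q + p
    lemma = solve 2 (λ p q → q :- (:- p) := q :+ p) refl

  sq-≤⇒abs-≤ : ∀ {p q} → 0ℚ ≤ q → 0ℚ ≤ q * q - p * p → abs p ≤ q
  sq-≤⇒abs-≤ {p} {q} 0≤q h with abs p ℚₚ.≤? q
  ... | yes k = k
  ... | no ¬k = contradiction (0≤-⇒≤ (subst (λ r → 0ℚ ≤ q * q - r) (sym abs-sq) h)) (λ le → ℚₚ.<-irrefl refl (ℚₚ.≤-<-trans le q²<))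
    where
    q< = ℚₚ.≰⇒> ¬k
    abs-sq : abs p * abs p ≡ p * p
    abs-sq with ℚₚ.∣p∣≡p∨∣p∣≡-p p
    ... | inj₁ e rewrite e = refl
    ... | inj₂ e rewrite e = solve 1 (λ p → (:- p) :* (:- p) := p :* p) refl p
    q²< : q * q < abs p * abs p
    q²< = ℚₚ.≤-<-trans (ℚₚ.*-monoˡ-≤-nonNeg q {{Rat.nonNegative 0≤q}} (ℚₚ.<⇒≤ q<))
            (ℚₚ.*-monoˡ-<-pos (abs p) {{Rat.positive (ℚₚ.≤-<-trans 0≤q q<)}} q<)

  nat : ℕ → ℚ
  nat k = + k Rat./ 1

  nat-+ : ∀ a b → nat (a ℕ.+ b) ≡ nat a + nat b
  nat-+ a b = ℚₚ.toℚᵘ-injective (begin-equality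
    Rat.toℚᵘ (nat (a ℕ.+ b))              ≃⟨ ℚₚ.toℚᵘ-fromℚᵘ (ℚᵘ.mkℚᵘ (+ (a ℕ.+ b)) 0) ⟩
    ℚᵘ.mkℚᵘ (+ (a ℕ.+ b)) 0             ≃⟨ ℚᵘ.*≡* (cong (ℤ._* + 1) (cong₂ ℤ._+_ (sym (ℤₚ.*-identityʳ (+ a))) (sym (ℤₚ.*-identityʳ (+ b))))) ⟩
    ℚᵘ.mkℚᵘ (+ a) 0 ℚᵘ.+ ℚᵘ.mkℚᵘ (+ b) 0 ≃⟨ ℚᵘₚ.+-cong (ℚₚ.toℚᵘ-fromℚᵘ (ℚᵘ.mkℚᵘ (+ a) 0)) (ℚₚ.toℚᵘ-fromℚᵘ (ℚᵘ.mkℚᵘ (+ b) 0)) ⟨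
    Rat.toℚᵘ (nat a) ℚᵘ.+ Rat.toℚᵘ (nat b)  ≃⟨ ℚₚ.toℚᵘ-homo-+ (nat a) (nat b) ⟨
    Rat.toℚᵘ (nat a + nat b)              ∎)
    where open ℚᵘₚ.≤-Reasoning

  ratio-* : ∀ a b → ratio a (suc b) * nat (suc b) ≡ nat a
  ratio-* a b = ℚₚ.toℚᵘ-injective (begin-equality
    Rat.toℚᵘ (ratio a (suc b) * nat (suc b))                    ≃⟨ ℚₚ.toℚᵘ-homo-* (ratio a (suc b)) (nat (suc b)) ⟩
    Rat.toℚᵘ (ratio a (suc b)) ℚᵘ.* Rat.toℚᵘ (nat (suc b))        ≃⟨ ℚᵘₚ.*-cong (ℚₚ.toℚᵘ-fromℚᵘ (ℚᵘ.mkℚᵘ (+ a) b)) (ℚₚ.toℚᵘ-fromℚᵘ (ℚᵘ.mkℚᵘ (+ suc b) 0)) ⟩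
    ℚᵘ.mkℚᵘ (+ a) b ℚᵘ.* ℚᵘ.mkℚᵘ (+ suc b) 0                  ≃⟨ ℚᵘ.*≡* (trans (ℤₚ.*-identityʳ _) (cong (+ a ℤ.*_) (sym (cong ℤ.+_ (ℕₚ.*-identityʳ (suc b)))))) ⟩
    ℚᵘ.mkℚᵘ (+ a) 0                                           ≃⟨ ℚₚ.toℚᵘ-fromℚᵘ (ℚᵘ.mkℚᵘ (+ a) 0) ⟨
    Rat.toℚᵘ (nat a)                                            ∎)
    where open ℚᵘₚ.≤-Reasoning

  0≤ratio : ∀ a b → 0ℚ ≤ ratio a b
  0≤ratio a zero    = ℚₚ.≤-refl
  0≤ratio a (suc b) = ℚₚ.nonNegative⁻¹ (ratio a (suc b)) {{ℚₚ.normalize-nonNeg a (suc b)}}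

  0≤nat : ∀ a → 0ℚ ≤ nat a
  0≤nat a = 0≤ratio a 1

  0<nat : ∀ a → 0ℚ < nat (suc a)
  0<nat a = ℚₚ.positive⁻¹ (nat (suc a)) {{ℚₚ.normalize-pos (suc a) 1}}

  0<ratio : ∀ a b → 0ℚ < ratio (suc a) (suc b)
  0<ratio a b = ℚₚ.positive⁻¹ (ratio (suc a) (suc b)) {{ℚₚ.normalize-pos (suc a) (suc b)}}

  -- The denominator d + 1 of ε already gives the index, because a positive numerator makes ε at
  -- least 1/(d + 1).
  archimedean : ∀ {ε} → 0ℚ < ε → ∃ λ n → ∀ m → n ℕ.≤ m → ratio 1 (suc m) ≤ ε
  archimedean {ε@(mkℚ (+ suc a) d _)} _ = d , λ m d≤m → ℚₚ.toℚᵘ-cancel-≤ (begin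
    Rat.toℚᵘ (ratio 1 (suc m))   ≃⟨ ℚₚ.toℚᵘ-fromℚᵘ (ℚᵘ.mkℚᵘ (+ 1) m) ⟩
    ℚᵘ.mkℚᵘ (+ 1) m            ≤⟨ ℚᵘ.*≤* (ℤ.+≤+ (ℕₚ.≤-trans (ℕₚ.≤-reflexive (ℕₚ.*-identityˡ (suc d))) (ℕₚ.≤-trans (ℕ.s≤s d≤m) (ℕₚ.m≤m+n (suc m) (a ℕ.* suc m))))) ⟩
    ℚᵘ.mkℚᵘ (+ suc a) d        ∎)
    where open ℚᵘₚ.≤-Reasoning
  archimedean {mkℚ (+ zero) d _} 0<ε = contradiction (Rat.positive 0<ε) λ ()
  archimedean {mkℚ ℤ.-[1+ a ] d _} 0<ε = contradiction (Rat.positive 0<ε) λ ()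

  0<1/ : ∀ {p} (0<p : 0ℚ < p) → 0ℚ < (1/ p) {{Rat.>-nonZero 0<p}}
  0<1/ {p} 0<p = ℚₚ.positive⁻¹ _ {{ℚₚ.1/pos⇒pos p {{Rat.positive 0<p}}}}

  inverse : ∀ {p} → 0ℚ < p → ∃ λ q → 0ℚ < q × q * p ≡ 1ℚ
  inverse {p} 0<p = (1/ p) {{Rat.>-nonZero 0<p}} , 0<1/ 0<p , ℚₚ.*-inverseˡ p {{Rat.>-nonZero 0<p}}

  orderedRing : OrderedRing
  orderedRing = record
    { M = λ A → A
    ; return = λ a → a
    ; bind = λ a f → f a
    ; commutativeRing = ℚₚ.+-*-commutativeRing
    ; NonNeg = 0ℚ ≤_
    ; Pos = 0ℚ <_
    ; nn-resp = λ eq → subst (0ℚ ≤_) eq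
    ; nn-0 = ℚₚ.≤-refl
    ; nn-+ = 0≤+
    ; nn-* = 0≤*
    ; nn-sq = 0≤sq
    ; nn-cancel = 0≤*-cancel
    ; sq-0 = λ {a} h → ℚₚ.∣p∣≡0⇒p≡0 a (ℚₚ.≤-antisym
        (sq-≤⇒abs-≤ ℚₚ.≤-refl (subst (0ℚ ≤_) (sym (ℚₚ.+-identityˡ (- (a * a)))) h)) (ℚₚ.0≤∣p∣ a))
    ; pos⇒nn = ℚₚ.<⇒≤
    ; pos-1 = ℚₚ.positive⁻¹ 1ℚ
    ; pos-+ = λ {a} {b} h k → ℚₚ.<-≤-trans h (ℚₚ.≤-trans (ℚₚ.≤-reflexive (sym (ℚₚ.+-identityʳ a))) (ℚₚ.+-monoʳ-≤ a k))
    -- The multiplier is (|b| + 1) / a; the summand 1 keeps it positive when `b` is 0.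
    ; arch = λ {a} b 0<a → let q , 0<q , qa≡1 = inverse 0<a
                               0<k = ℚₚ.<-≤-trans (ℚₚ.positive⁻¹ 1ℚ) (ℚₚ.≤-trans (ℚₚ.≤-reflexive (sym (ℚₚ.+-identityˡ 1ℚ))) (ℚₚ.+-monoˡ-≤ 1ℚ (ℚₚ.0≤∣p∣ b))) in
        (abs b + 1ℚ) * q , 0<* 0<k 0<q ,
        subst (0ℚ ≤_) (trans (lemma (abs b) b) (cong (_- b) (sym (trans (ℚₚ.*-assoc (abs b + 1ℚ) q a) (trans (cong ((abs b + 1ℚ) *_) qa≡1) (ℚₚ.*-identityʳ (abs b + 1ℚ)))))))
          (0≤+ (abs-upper {b} ℚₚ.≤-refl) (ℚₚ.<⇒≤ (ℚₚ.positive⁻¹ 1ℚ)))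
    ; sign? = λ a → case a ℚₚ.≤? 0ℚ of λ
        { (yes h) → inj₁ (ℚₚ.neg-antimono-≤ h)
        ; (no ¬h) → inj₂ (ℚₚ.≰⇒> ¬h) }
    }
    where
    lemma : ∀ c b → (c - b) + 1ℚ ≡ (c + 1ℚ) - b
    lemma = solve 2 (λ c b → (c :- b) :+ :1 := (c :+ :1) :- b) refl

module Reals where

  open Rationals
  open ℝ
  open Real using (Eventually)

  always : ∀ {Q : ℕ → Set} → (∀ n → Q n) → Eventually Q
  always h = 0 , λ n _ → h n

  eventually₁ : ∀ {P Q : ℕ → Set} → (∀ n → P n → Q n) → Eventually P → Eventually Q
  eventually₁ f (N , h) = N , λ n p → f n (h n p)

  eventually₂ : ∀ {P Q R : ℕ → Set} → (∀ n → P n → Q n → R n) → Eventually P → Eventually Q → Eventually R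
  eventually₂ f (N , h) (M , k) = N ℕ.⊔ M , λ n p →
    f n (h n (ℕₚ.≤-trans (ℕₚ.m≤m⊔n N M) p)) (k n (ℕₚ.≤-trans (ℕₚ.m≤n⊔m N M) p))

  ½ε : ∀ ε → Positive ε → Positive (½ * ε)
  ½ε ε ε>0 = ℚₚ.pos*pos⇒pos ½ ε {{ε>0}}

  0< : ∀ ε → Positive ε → 0ℚ < ε
  0< ε ε>0 = ℚₚ.positive⁻¹ ε {{ε>0}}

  NonNegative : ℝ → Set
  NonNegative x = ∀ ε → Positive ε → Eventually λ n → 0ℚ ≤ seq x n + ε

  Pos : ℝ → Set
  Pos x = ∃ λ ε → 0ℚ < ε × Eventually λ n → ε ≤ seq x n

  pointwise⇒≃ : ∀ x y → (∀ n → seq x n ≡ seq y n) → x ≃ y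
  pointwise⇒≃ x y h ε ε>0 = always λ n → subst (λ q → abs (seq x n - q) ≤ ε) (h n)
    (subst (λ q → abs q ≤ ε) (sym (ℚₚ.+-inverseʳ (seq x n))) (ℚₚ.<⇒≤ (0< ε ε>0)))

  pointwise⇒nn : ∀ {x} → (∀ n → 0ℚ ≤ seq x n) → NonNegative x
  pointwise⇒nn {x} h ε ε>0 = always λ n → 0≤+ (h n) (ℚₚ.<⇒≤ (0< ε ε>0))

  ≃-refl : ∀ {x} → x ≃ x
  ≃-refl {x} = pointwise⇒≃ x x (λ _ → refl)

  ≃-sym : ∀ {x y} → x ≃ y → y ≃ x
  ≃-sym {x} {y} h ε ε>0 = eventually₁ (λ n k →
    abs-≤ (subst (0ℚ ≤_) (lemma₁ ε (seq x n) (seq y n)) (abs-lower k))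
          (subst (0ℚ ≤_) (lemma₂ ε (seq x n) (seq y n)) (abs-upper k))) (h ε ε>0)
    where
    lemma₁ : ∀ e a b → e + (a - b) ≡ e - (b - a)
    lemma₁ = solve 3 (λ e a b → e :+ (a :- b) := e :- (b :- a)) refl
    lemma₂ : ∀ e a b → e - (a - b) ≡ e + (b - a)
    lemma₂ = solve 3 (λ e a b → e :- (a :- b) := e :+ (b :- a)) refl

  ½+½ : ∀ ε → ½ * ε + ½ * ε ≡ ε
  ½+½ ε = trans (sym (ℚₚ.*-distribʳ-+ ε ½ ½)) (ℚₚ.*-identityˡ ε)

  -- The common form of the ε/2 arguments: a difference that splits termwise into two small ones is
  -- small.
  ≃-by : ∀ {x y} u v u′ v′ → u ≃ u′ → v ≃ v′ →
    (∀ n → seq x n - seq y n ≡ (seq u n - seq u′ n) + (seq v n - seq v′ n)) → x ≃ y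
  ≃-by {x} {y} u v u′ v′ p q eq ε ε>0 = eventually₂ (λ n h k → subst (λ r → abs r ≤ ε) (sym (eq n))
      (ℚₚ.≤-trans (ℚₚ.∣p+q∣≤∣p∣+∣q∣ (seq u n - seq u′ n) _)
        (ℚₚ.≤-trans (ℚₚ.+-mono-≤ h k) (ℚₚ.≤-reflexive (½+½ ε)))))
    (p (½ * ε) (½ε ε ε>0)) (q (½ * ε) (½ε ε ε>0))

  ≃-trans : ∀ {x y z} → x ≃ y → y ≃ z → x ≃ z
  ≃-trans {x} {y} {z} p q = ≃-by {x} {z} x y y z p q (λ n → lemma (seq x n) (seq y n) (seq z n))
    where
    lemma : ∀ a b c → a - c ≡ (a - b) + (b - c)
    lemma = solve 3 (λ a b c → a :- c := (a :- b) :+ (b :- c)) refl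

  +ᴿ-cong : ∀ {x x′ y y′} → x ≃ x′ → y ≃ y′ → x +ᴿ y ≃ x′ +ᴿ y′
  +ᴿ-cong {x} {x′} {y} {y′} p q = ≃-by {x +ᴿ y} {x′ +ᴿ y′} x y x′ y′ p q
    (λ n → lemma (seq x n) (seq x′ n) (seq y n) (seq y′ n))
    where
    lemma : ∀ a a′ b b′ → (a + b) - (a′ + b′) ≡ (a - a′) + (b - b′)
    lemma = solve 4 (λ a a′ b b′ → (a :+ b) :- (a′ :+ b′) := (a :- a′) :+ (b :- b′)) refl

  -ᴿ-cong : ∀ {x y} → x ≃ y → -ᴿ x ≃ -ᴿ y
  -ᴿ-cong {x} {y} p ε ε>0 = eventually₁ (λ n h → subst (λ r → r ≤ ε)
    (trans (sym (ℚₚ.∣-p∣≡∣p∣ (seq x n - seq y n))) (cong abs (lemma (seq x n) (seq y n)))) h) (p ε ε>0)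
    where
    lemma : ∀ a b → - (a - b) ≡ (- a) - (- b)
    lemma = solve 2 (λ a b → :- (a :- b) := (:- a) :- (:- b)) refl

  bounded : ∀ x → ∃ λ K → 0ℚ < K × Eventually λ n → abs (seq x n) ≤ K
  bounded x with cauchy x 1ℚ _
  ... | N , h = abs (seq x N) + 1ℚ ,
      ℚₚ.≤-<-trans (ℚₚ.0≤∣p∣ (seq x N)) (subst (_< abs (seq x N) + 1ℚ) (ℚₚ.+-identityʳ _)
        (ℚₚ.+-monoʳ-< (abs (seq x N)) (ℚₚ.positive⁻¹ 1ℚ))) ,
      N , λ n p → subst (λ r → abs r ≤ abs (seq x N) + 1ℚ) (lemma (seq x N) (seq x n))
        (ℚₚ.≤-trans (ℚₚ.∣p+q∣≤∣p∣+∣q∣ (seq x N) (seq x n - seq x N)) (ℚₚ.+-monoʳ-≤ (abs (seq x N)) (h n N p ℕₚ.≤-refl)))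
    where
    lemma : ∀ a b → a + (b - a) ≡ b
    lemma = solve 2 (λ a b → a :+ (b :- a) := b) refl

  *ᴿ-congˡ : ∀ x {y y′} → y ≃ y′ → x *ᴿ y ≃ x *ᴿ y′
  *ᴿ-congˡ x {y} {y′} p ε ε>0 = eventually₂ (λ n h k → subst (_≤ ε) (eq n) (bound n h k)) x≤ (p η (Rat.positive η>0))
    where
    K = proj₁ (bounded x)
    K>0 = proj₁ (proj₂ (bounded x))
    x≤ = proj₂ (proj₂ (bounded x))
    K⁻¹ = inverse K>0
    η = ε * proj₁ K⁻¹
    η>0 = 0<* (0< ε ε>0) (proj₁ (proj₂ K⁻¹))
    eq : ∀ n → abs (seq x n) * abs (seq y n - seq y′ n) ≡ abs (seq x n * seq y n - seq x n * seq y′ n)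
    eq n = trans (sym (ℚₚ.∣p*q∣≡∣p∣*∣q∣ (seq x n) _)) (cong abs (lemma (seq x n) (seq y n) (seq y′ n)))
      where
      lemma : ∀ a b c → a * (b - c) ≡ a * b - a * c
      lemma = solve 3 (λ a b c → a :* (b :- c) := a :* b :- a :* c) refl
    bound : ∀ n → abs (seq x n) ≤ K → abs (seq y n - seq y′ n) ≤ η → abs (seq x n) * abs (seq y n - seq y′ n) ≤ ε
    bound n h k = ℚₚ.≤-trans (ℚₚ.*-monoʳ-≤-nonNeg (abs (seq y n - seq y′ n)) {{ℚₚ.∣-∣-nonNeg (seq y n - seq y′ n)}} h)
      (ℚₚ.≤-trans (ℚₚ.*-monoˡ-≤-nonNeg K {{Rat.nonNegative (ℚₚ.<⇒≤ K>0)}} k)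
        (ℚₚ.≤-reflexive (trans (lemma K ε (proj₁ K⁻¹)) (trans (cong (ε *_) (proj₂ (proj₂ K⁻¹))) (ℚₚ.*-identityʳ ε)))))
      where
      lemma : ∀ K e q → K * (e * q) ≡ e * (q * K)
      lemma = solve 3 (λ K e q → K :* (e :* q) := e :* (q :* K)) refl

  *ᴿ-cong : ∀ {x x′ y y′} → x ≃ x′ → y ≃ y′ → x *ᴿ y ≃ x′ *ᴿ y′
  *ᴿ-cong {x} {x′} {y} {y′} p q = ≃-trans {x *ᴿ y} {x *ᴿ y′} {x′ *ᴿ y′} (*ᴿ-congˡ x {y} {y′} q)
    (≃-trans {x *ᴿ y′} {y′ *ᴿ x} {x′ *ᴿ y′} (pointwise⇒≃ (x *ᴿ y′) (y′ *ᴿ x) (λ n → ℚₚ.*-comm (seq x n) (seq y′ n)))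
      (≃-trans {y′ *ᴿ x} {y′ *ᴿ x′} {x′ *ᴿ y′} (*ᴿ-congˡ y′ {x} {x′} p)
        (pointwise⇒≃ (y′ *ᴿ x′) (x′ *ᴿ y′) (λ n → ℚₚ.*-comm (seq y′ n) (seq x′ n)))))

  1ᴿ : ℝ
  1ᴿ = fromℚ 1ℚ

  commutativeRing : CommutativeRing 0ℓ 0ℓ
  commutativeRing = record
    { Carrier = ℝ ; _≈_ = _≃_ ; _+_ = _+ᴿ_ ; _*_ = _*ᴿ_ ; -_ = -ᴿ_ ; 0# = 0ᴿ ; 1# = 1ᴿ
    ; isCommutativeRing = record
      { isRing = record
        { +-isAbelianGroup = record
          { isGroup = record
            { isMonoid = record
              { isSemigroup = record
                { isMagma = record
                  { isEquivalence = record
                    { refl = λ {x} → ≃-refl {x} ; sym = λ {x} {y} → ≃-sym {x} {y} ; trans = λ {x} {y} {z} → ≃-trans {x} {y} {z} }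
                  ; ∙-cong = λ {x} {x′} {y} {y′} → +ᴿ-cong {x} {x′} {y} {y′} }
                ; assoc = λ x y z → pointwise⇒≃ ((x +ᴿ y) +ᴿ z) (x +ᴿ (y +ᴿ z)) λ n → ℚₚ.+-assoc (seq x n) (seq y n) (seq z n) }
              ; identity = (λ x → pointwise⇒≃ (0ᴿ +ᴿ x) x λ n → ℚₚ.+-identityˡ (seq x n)) , (λ x → pointwise⇒≃ (x +ᴿ 0ᴿ) x λ n → ℚₚ.+-identityʳ (seq x n)) }
            ; inverse = (λ x → pointwise⇒≃ (-ᴿ x +ᴿ x) 0ᴿ λ n → ℚₚ.+-inverseˡ (seq x n)) , (λ x → pointwise⇒≃ (x +ᴿ -ᴿ x) 0ᴿ λ n → ℚₚ.+-inverseʳ (seq x n))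
            ; ⁻¹-cong = λ {x} {y} → -ᴿ-cong {x} {y} }
          ; comm = λ x y → pointwise⇒≃ (x +ᴿ y) (y +ᴿ x) λ n → ℚₚ.+-comm (seq x n) (seq y n) }
        ; *-cong = λ {x} {x′} {y} {y′} → *ᴿ-cong {x} {x′} {y} {y′}
        ; *-assoc = λ x y z → pointwise⇒≃ ((x *ᴿ y) *ᴿ z) (x *ᴿ (y *ᴿ z)) λ n → ℚₚ.*-assoc (seq x n) (seq y n) (seq z n)
        ; *-identity = (λ x → pointwise⇒≃ (1ᴿ *ᴿ x) x λ n → ℚₚ.*-identityˡ (seq x n)) , (λ x → pointwise⇒≃ (x *ᴿ 1ᴿ) x λ n → ℚₚ.*-identityʳ (seq x n))
        ; distrib = (λ x y z → pointwise⇒≃ (x *ᴿ (y +ᴿ z)) (x *ᴿ y +ᴿ x *ᴿ z) λ n → ℚₚ.*-distribˡ-+ (seq x n) (seq y n) (seq z n))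
                  , (λ x y z → pointwise⇒≃ ((y +ᴿ z) *ᴿ x) (y *ᴿ x +ᴿ z *ᴿ x) λ n → ℚₚ.*-distribʳ-+ (seq x n) (seq y n) (seq z n)) }
      ; *-comm = λ x y → pointwise⇒≃ (x *ᴿ y) (y *ᴿ x) λ n → ℚₚ.*-comm (seq x n) (seq y n) } }

  nn-resp : ∀ {x y} → x ≃ y → NonNegative x → NonNegative y
  nn-resp {x} {y} p h ε ε>0 = eventually₂ (λ n a b →
      subst (0ℚ ≤_) (trans (lemma (seq x n) (seq y n) (½ * ε)) (cong (λ r → seq y n + r) (½+½ ε))) (0≤+ b (abs-upper a)))
    (p (½ * ε) (½ε ε ε>0)) (h (½ * ε) (½ε ε ε>0))
    where
    lemma : ∀ a b e → (a + e) + (e - (a - b)) ≡ b + (e + e)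
    lemma = solve 3 (λ a b e → (a :+ e) :+ (e :- (a :- b)) := b :+ (e :+ e)) refl

  nn-+ : ∀ {x y} → NonNegative x → NonNegative y → NonNegative (x +ᴿ y)
  nn-+ {x} {y} h k ε ε>0 = eventually₂ (λ n a b →
      subst (0ℚ ≤_) (trans (lemma (seq x n) (seq y n) (½ * ε)) (cong (λ r → (seq x n + seq y n) + r) (½+½ ε))) (0≤+ a b))
    (h (½ * ε) (½ε ε ε>0)) (k (½ * ε) (½ε ε ε>0))
    where
    lemma : ∀ a b e → (a + e) + (b + e) ≡ (a + b) + (e + e)
    lemma = solve 3 (λ a b e → (a :+ e) :+ (b :+ e) := (a :+ b) :+ (e :+ e)) refl

  nn-* : ∀ {x y} → NonNegative x → NonNegative y → NonNegative (x *ᴿ y)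
  nn-* {x} {y} h k ε ε>0 = eventually₂ (λ n (a , a′) (b , b′) → main n a a′ b b′)
      (eventually₂ (λ _ → _,_) (proj₂ (proj₂ (bounded x))) (h δ δ>0))
      (eventually₂ (λ _ → _,_) (proj₂ (proj₂ (bounded y))) (k δ δ>0))
    where
    K = proj₁ (bounded x)
    K′ = proj₁ (bounded y)
    K≥0 = ℚₚ.<⇒≤ (proj₁ (proj₂ (bounded x)))
    K′≥0 = ℚₚ.<⇒≤ (proj₁ (proj₂ (bounded y)))
    L = (K + K′) + 1ℚ
    L>0 : 0ℚ < L
    L>0 = OrderedRing.pos-+ orderedRing {1ℚ} {K + K′} (ℚₚ.positive⁻¹ 1ℚ) (0≤+ K≥0 K′≥0) |> subst (0ℚ <_) (ℚₚ.+-comm 1ℚ (K + K′))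
    L⁻¹ = inverse L>0
    -- Expanding (x + δ)(y + δ) ≥ 0 costs at most δ (K + K′ + δ). The cap by 1 gives δ ≤ 1, so that
    -- δ (K + K′ + 1) = ε′ ≤ ε covers this cost.
    ε′ = ε Rat.⊓ 1ℚ
    ε′>0 : 0ℚ < ε′
    ε′>0 = case ℚₚ.⊓-sel ε 1ℚ of λ
      { (inj₁ e) → subst (0ℚ <_) (sym e) (0< ε ε>0)
      ; (inj₂ e) → subst (0ℚ <_) (sym e) (ℚₚ.positive⁻¹ 1ℚ) }
    δ = ε′ * proj₁ L⁻¹
    0<δ : 0ℚ < δ
    0<δ = 0<* ε′>0 (proj₁ (proj₂ L⁻¹))
    δ>0 = Rat.positive 0<δ
    δ≥0 = ℚₚ.<⇒≤ 0<δ
    δL : δ * L ≡ ε′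
    δL = trans (ℚₚ.*-assoc ε′ _ L) (trans (cong (ε′ *_) (proj₂ (proj₂ L⁻¹))) (ℚₚ.*-identityʳ ε′))
    δ≤1 : δ ≤ 1ℚ
    δ≤1 = ℚₚ.≤-trans (difference (δ * (K + K′)) (0≤* δ≥0 (0≤+ K≥0 K′≥0)) (lemma δ (K + K′)))
            (ℚₚ.≤-trans (ℚₚ.≤-reflexive δL) (ℚₚ.p⊓q≤q ε 1ℚ))
      where
      lemma : ∀ d k → d * k ≡ d * (k + 1ℚ) - d
      lemma = solve 2 (λ d k → d :* k := d :* (k :+ :1) :- d) refl
    main : ∀ n → abs (seq x n) ≤ K → 0ℚ ≤ seq x n + δ → abs (seq y n) ≤ K′ → 0ℚ ≤ seq y n + δ → 0ℚ ≤ seq x n * seq y n + ε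
    main n a a′ b b′ = subst (0ℚ ≤_)
      (trans (lemma (seq x n) (seq y n) δ K K′ ε) (solve 3 (λ s t e → s :+ (e :- (t :- t)) := s :+ e) refl (seq x n * seq y n) (δ * L) ε))
      (0≤+ (0≤+ (0≤+ (0≤+ (0≤* a′ b′) (0≤* δ≥0 (abs-upper a))) (0≤* δ≥0 (abs-upper b))) (0≤* δ≥0 (≤⇒0≤- δ≤1)))
        (≤⇒0≤- (ℚₚ.≤-trans (ℚₚ.≤-reflexive δL) (ℚₚ.p⊓q≤p ε 1ℚ))))
      where
      lemma : ∀ a b d K K′ e → (a + d) * (b + d) + d * (K - a) + d * (K′ - b) + d * (1ℚ - d) + (e - d * ((K + K′) + 1ℚ)) ≡
        a * b + (e - (d * ((K + K′) + 1ℚ) - d * ((K + K′) + 1ℚ)))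
      lemma = solve 6 (λ a b d K K′ e → (a :+ d) :* (b :+ d) :+ d :* (K :- a) :+ d :* (K′ :- b) :+ d :* (:1 :- d) :+ (e :- d :* ((K :+ K′) :+ :1)) :=
        a :* b :+ (e :- (d :* ((K :+ K′) :+ :1) :- d :* ((K :+ K′) :+ :1)))) refl

  nn-cancel : ∀ {a x} → Pos a → NonNegative (a *ᴿ x) → NonNegative x
  nn-cancel {a} {x} (c , c>0 , a≥c) h ε ε>0 = eventually₂ main a≥c (h (c * ε) (Rat.positive (0<* c>0 (0< ε ε>0))))
    where
    main : ∀ n → c ≤ seq a n → 0ℚ ≤ seq a n * seq x n + c * ε → 0ℚ ≤ seq x n + ε
    main n c≤a h = 0≤*-cancel (ℚₚ.<-≤-trans c>0 c≤a)
      (subst (0ℚ ≤_) (lemma (seq a n) c (seq x n) ε) (0≤+ h (0≤* (≤⇒0≤- c≤a) (ℚₚ.<⇒≤ (0< ε ε>0)))))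
      where
      lemma : ∀ a c x e → (a * x + c * e) + (a - c) * e ≡ a * (x + e)
      lemma = solve 4 (λ a c x e → (a :* x :+ c :* e) :+ (a :- c) :* e := a :* (x :+ e)) refl

  sq-0 : ∀ {x} → NonNegative (-ᴿ (x *ᴿ x)) → x ≃ 0ᴿ
  sq-0 {x} h ε ε>0 = eventually₁ (λ n k → subst (λ r → abs r ≤ ε) (sym (ℚₚ.+-identityʳ (seq x n)))
      (sq-≤⇒abs-≤ (ℚₚ.<⇒≤ (0< ε ε>0)) (subst (0ℚ ≤_) (ℚₚ.+-comm (- (seq x n * seq x n)) (ε * ε)) k)))
    (h (ε * ε) (Rat.positive (0<* {ε} {ε} (0< ε ε>0) (0< ε ε>0))))

  pos⇒nn : ∀ {x} → Pos x → NonNegative x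
  pos⇒nn (c , c>0 , h) ε ε>0 = eventually₁ (λ n k → 0≤+ (ℚₚ.≤-trans (ℚₚ.<⇒≤ c>0) k) (ℚₚ.<⇒≤ (0< ε ε>0))) h

  pos-+ : ∀ {x y} → Pos x → NonNegative y → Pos (x +ᴿ y)
  pos-+ {x} {y} (c , c>0 , h) k = ½ * c , 0<* (ℚₚ.positive⁻¹ ½) c>0 ,
    eventually₂ (λ n a b → difference _ (0≤+ (≤⇒0≤- a) b)
        (trans (cong (λ r → (seq x n - r) + (seq y n + ½ * c)) (sym (½+½ c))) (lemma (seq x n) (seq y n) (½ * c))))
      h (k (½ * c) (Rat.positive (0<* (ℚₚ.positive⁻¹ ½) c>0)))
    where
    lemma : ∀ a b e → (a - (e + e)) + (b + e) ≡ (a + b) - e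
    lemma = solve 3 (λ a b e → (a :- (e :+ e)) :+ (b :+ e) := (a :+ b) :- e) refl

  arch : ∀ {a} b → Pos a → ∃ λ k → Pos k × NonNegative (k *ᴿ a +ᴿ -ᴿ b)
  arch {a} b (c , c>0 , a≥c) = fromℚ k , (k , k>0 , always (λ _ → ℚₚ.≤-refl)) ,
      λ ε ε>0 → eventually₂ (λ n h h′ → 0≤+ (main n h h′) (ℚₚ.<⇒≤ (0< ε ε>0))) a≥c (proj₂ (proj₂ (bounded b)))
    where
    K = proj₁ (bounded b)
    c⁻¹ = inverse c>0
    k = K * proj₁ c⁻¹
    k>0 = 0<* (proj₁ (proj₂ (bounded b))) (proj₁ (proj₂ c⁻¹))
    main : ∀ n → c ≤ seq a n → abs (seq b n) ≤ K → 0ℚ ≤ k * seq a n - seq b n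
    main n h h′ = subst (0ℚ ≤_) (trans (cong (λ r → k * (seq a n - c) + (r - seq b n)) (sym kc)) (lemma k (seq a n) c (seq b n)))
      (0≤+ (0≤* (ℚₚ.<⇒≤ k>0) (≤⇒0≤- h)) (abs-upper h′))
      where
      kc : k * c ≡ K
      kc = trans (ℚₚ.*-assoc K _ c) (trans (cong (K *_) (proj₂ (proj₂ c⁻¹))) (ℚₚ.*-identityʳ K))
      lemma : ∀ k a c b → k * (a - c) + (k * c - b) ≡ k * a - b
      lemma = solve 4 (λ k a c b → k :* (a :- c) :+ (k :* c :- b) := k :* a :- b) refl

  -- Past some index `N` the sequence stays within ε/4 of its `N`-th term, a rational that can be
  -- compared with ε/2. If that term is at least ε/2, the tail is at least ε/4 and `x` is positive;
  -- otherwise the tail is at most 3ε/4.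
  ¬pos⇒nn : ∀ x → ¬ Pos x → NonNegative (-ᴿ x)
  ¬pos⇒nn x ¬pos ε ε>0 with cauchy x (½ * (½ * ε)) (½ε (½ * ε) (½ε ε ε>0))
  ... | N , h with ½ * ε ℚₚ.≤? seq x N
  ...   | yes large = contradiction (η , 0< η η>0 , N , λ n p → difference _ (0≤+ (abs-lower (h n N p ℕₚ.≤-refl)) (≤⇒0≤- large))
            (trans (cong (λ r → (η + (seq x n - seq x N)) + (seq x N - r)) (sym (½+½ (½ * ε)))) (lemma η (seq x n) (seq x N)))) ¬pos
    where
    η = ½ * (½ * ε)
    η>0 = ½ε (½ * ε) (½ε ε ε>0)
    lemma : ∀ e a b → (e + (a - b)) + (b - (e + e)) ≡ a - e
    lemma = solve 3 (λ e a b → (e :+ (a :- b)) :+ (b :- (e :+ e)) := a :- e) refl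
  ...   | no small = N , λ n p → subst (0ℚ ≤_) (trans (lemma η (seq x n) (seq x N)) (cong (λ r → - seq x n + r) (trans (cong₂ _+_ (½+½ (½ * ε)) (½+½ (½ * ε))) (½+½ ε))))
            (0≤+ (0≤+ (abs-upper (h n N p ℕₚ.≤-refl)) (≤⇒0≤- (ℚₚ.≤-trans (ℚₚ.<⇒≤ (ℚₚ.≰⇒> small)) (ℚₚ.≤-reflexive (sym (½+½ (½ * ε))))))) (ℚₚ.<⇒≤ (0< η η>0)))
    where
    η = ½ * (½ * ε)
    η>0 = ½ε (½ * ε) (½ε ε ε>0)
    lemma : ∀ e a b → (e - (a - b)) + ((e + e) - b) + e ≡ - a + ((e + e) + (e + e))
    lemma = solve 3 (λ e a b → (e :- (a :- b)) :+ ((e :+ e) :- b) :+ e := :- a :+ ((e :+ e) :+ (e :+ e))) refl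

  orderedRingᴿ : OrderedRing
  orderedRingᴿ = record
    { M = λ A → ¬ ¬ A
    ; return = λ a k → k a
    ; bind = λ m f k → m λ a → f a k
    ; commutativeRing = commutativeRing
    ; NonNeg = NonNegative
    ; Pos = Pos
    ; nn-resp = λ {x} {y} → nn-resp {x} {y}
    ; nn-0 = pointwise⇒nn {0ᴿ} (λ _ → ℚₚ.≤-refl)
    ; nn-+ = λ {x} {y} → nn-+ {x} {y}
    ; nn-* = λ {x} {y} → nn-* {x} {y}
    ; nn-sq = λ x → pointwise⇒nn {x *ᴿ x} (λ n → 0≤sq (seq x n))
    ; nn-cancel = λ {a} {x} → nn-cancel {a} {x}
    ; sq-0 = λ {x} → sq-0 {x}
    ; pos⇒nn = λ {x} → pos⇒nn {x}
    ; pos-1 = 1ℚ , ℚₚ.positive⁻¹ 1ℚ , always (λ _ → ℚₚ.≤-refl)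
    ; pos-+ = λ {x} {y} → pos-+ {x} {y}
    ; arch = λ {a} → arch {a}
    ; sign? = λ a k → k (inj₁ (¬pos⇒nn a (λ p → k (inj₂ p))))
    }

  nn⇒≤ᴿ : ∀ {x y} → NonNegative (y +ᴿ -ᴿ x) → x ≤ᴿ y
  nn⇒≤ᴿ {x} {y} h ε ε>0 = eventually₁ (λ n k → difference _ k (lemma (seq x n) (seq y n) ε)) (h ε ε>0)
    where
    lemma : ∀ a b e → (b - a) + e ≡ (b + e) - a
    lemma = solve 3 (λ a b e → (b :- a) :+ e := (b :+ e) :- a) refl

  ≤ᴿ⇒nn : ∀ {x y} → x ≤ᴿ y → NonNegative (y +ᴿ -ᴿ x)
  ≤ᴿ⇒nn {x} {y} h ε ε>0 = eventually₁ (λ n k → subst (0ℚ ≤_) (lemma (seq x n) (seq y n) ε) (≤⇒0≤- k)) (h ε ε>0)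
    where
    lemma : ∀ a b e → (b + e) - a ≡ (b - a) + e
    lemma = solve 3 (λ a b e → (b :+ e) :- a := (b :- a) :+ e) refl

  ≤ᴿ-trans : ∀ {x y z} → x ≤ᴿ y → y ≤ᴿ z → x ≤ᴿ z
  ≤ᴿ-trans {x} {y} {z} h k = nn⇒≤ᴿ {x} {z} (nn-resp {(z +ᴿ -ᴿ y) +ᴿ (y +ᴿ -ᴿ x)} {z +ᴿ -ᴿ x}
    (pointwise⇒≃ ((z +ᴿ -ᴿ y) +ᴿ (y +ᴿ -ᴿ x)) (z +ᴿ -ᴿ x) (λ n → lemma (seq x n) (seq y n) (seq z n)))
    (nn-+ {z +ᴿ -ᴿ y} {y +ᴿ -ᴿ x} (≤ᴿ⇒nn {y} {z} k) (≤ᴿ⇒nn {x} {y} h)))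
    where
    lemma : ∀ a b c → (c - b) + (b - a) ≡ c - a
    lemma = solve 3 (λ a b c → (c :- b) :+ (b :- a) := c :- a) refl

  -- `x ≤ᴿ y` amounts to `x - y` not being positive, which is a negation, and negations are stable.
  ≤ᴿ-stable : ∀ {x y} → ¬ ¬ (x ≤ᴿ y) → x ≤ᴿ y
  ≤ᴿ-stable {x} {y} ¬¬h = nn⇒≤ᴿ {x} {y} (nn-resp { -ᴿ (x +ᴿ -ᴿ y)} {y +ᴿ -ᴿ x}
    (pointwise⇒≃ (-ᴿ (x +ᴿ -ᴿ y)) (y +ᴿ -ᴿ x) (λ n → lemma (seq x n) (seq y n)))
    (¬pos⇒nn (x +ᴿ -ᴿ y) λ (c , c>0 , h) → ¬¬h λ x≤y → absurd c c>0 h (x≤y (½ * c) (Rat.positive (0<* (ℚₚ.positive⁻¹ ½) c>0)))))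
    where
    lemma : ∀ a b → - (a - b) ≡ b - a
    lemma = solve 2 (λ a b → :- (a :- b) := b :- a) refl
    gap : ∀ c n → c ≤ seq x n - seq y n → seq x n ≤ seq y n + ½ * c → ½ * c ≤ 0ℚ
    gap c n h k = difference _ (0≤+ (≤⇒0≤- h) (≤⇒0≤- k))
      (trans (cong (λ r → ((seq x n - seq y n) - r) + ((seq y n + ½ * c) - seq x n)) (sym (½+½ c))) (lemma′ (seq x n) (seq y n) (½ * c)))
      where
      lemma′ : ∀ a b e → ((a - b) - (e + e)) + ((b + e) - a) ≡ 0ℚ - e
      lemma′ = solve 3 (λ a b e → ((a :- b) :- (e :+ e)) :+ ((b :+ e) :- a) := :0 :- e) refl
    absurd : ∀ c → 0ℚ < c → Eventually (λ n → c ≤ seq x n - seq y n) → ¬ Eventually (λ n → seq x n ≤ seq y n + ½ * c)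
    absurd c c>0 p q = ℚₚ.<-irrefl refl (ℚₚ.<-≤-trans (0<* (ℚₚ.positive⁻¹ ½) c>0) (proj₂ both (proj₁ both) ℕₚ.≤-refl))
      where
      both : Eventually (λ _ → ½ * c ≤ 0ℚ)
      both = eventually₂ (gap c) p q

-- Finite sums and sums over subsets

module Sums where

  open Rationals

  private
    variable
      A B : Set

  Σ[_] : List A → (A → ℚ) → ℚ
  Σ[ xs ] f = List.foldr (λ a r → f a + r) 0ℚ xs

  Σ-cong : ∀ (xs : List A) {f g} → (∀ a → f a ≡ g a) → Σ[ xs ] f ≡ Σ[ xs ] g
  Σ-cong []       h = refl
  Σ-cong (x ∷ xs) h = cong₂ _+_ (h x) (Σ-cong xs h)

  Σ-0 : ∀ (xs : List A) {f} → (∀ a → f a ≡ 0ℚ) → Σ[ xs ] f ≡ 0ℚ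
  Σ-0 []       h = refl
  Σ-0 (x ∷ xs) h = trans (cong₂ _+_ (h x) (Σ-0 xs h)) (ℚₚ.+-identityˡ 0ℚ)

  Σ-+ : ∀ (xs : List A) f g → Σ[ xs ] (λ a → f a + g a) ≡ Σ[ xs ] f + Σ[ xs ] g
  Σ-+ []       f g = sym (ℚₚ.+-identityˡ 0ℚ)
  Σ-+ (x ∷ xs) f g = trans (cong ((f x + g x) +_) (Σ-+ xs f g)) (lemma (f x) (g x) (Σ[ xs ] f) (Σ[ xs ] g))
    where
    lemma : ∀ a b c d → (a + b) + (c + d) ≡ (a + c) + (b + d)
    lemma = solve 4 (λ a b c d → (a :+ b) :+ (c :+ d) := (a :+ c) :+ (b :+ d)) refl

  Σ-*ˡ : ∀ (xs : List A) c f → c * Σ[ xs ] f ≡ Σ[ xs ] (λ a → c * f a)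
  Σ-*ˡ []       c f = ℚₚ.*-zeroʳ c
  Σ-*ˡ (x ∷ xs) c f = trans (ℚₚ.*-distribˡ-+ c (f x) (Σ[ xs ] f)) (cong (c * f x +_) (Σ-*ˡ xs c f))

  Σ-*ʳ : ∀ (xs : List A) c f → Σ[ xs ] f * c ≡ Σ[ xs ] (λ a → f a * c)
  Σ-*ʳ xs c f = trans (ℚₚ.*-comm _ c) (trans (Σ-*ˡ xs c f) (Σ-cong xs (λ a → ℚₚ.*-comm c (f a))))

  Σ-swap : ∀ (xs : List A) (ys : List B) (f : A → B → ℚ) →
    Σ[ xs ] (λ a → Σ[ ys ] (f a)) ≡ Σ[ ys ] (λ b → Σ[ xs ] (λ a → f a b))
  Σ-swap []       ys f = sym (Σ-0 ys (λ _ → refl))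
  Σ-swap (x ∷ xs) ys f = trans (cong (Σ[ ys ] (f x) +_) (Σ-swap xs ys f)) (sym (Σ-+ ys (f x) _))

  Σ-++ : ∀ (xs ys : List A) f → Σ[ xs ++ ys ] f ≡ Σ[ xs ] f + Σ[ ys ] f
  Σ-++ []       ys f = sym (ℚₚ.+-identityˡ _)
  Σ-++ (x ∷ xs) ys f = trans (cong (f x +_) (Σ-++ xs ys f)) (sym (ℚₚ.+-assoc (f x) (Σ[ xs ] f) (Σ[ ys ] f)))

  Σ-map : ∀ (g : A → B) xs f → Σ[ List.map g xs ] f ≡ Σ[ xs ] (f ∘ g)
  Σ-map g []       f = refl
  Σ-map g (x ∷ xs) f = cong (f (g x) +_) (Σ-map g xs f)

  Σ-nonneg : ∀ (xs : List A) {f} → (∀ a → 0ℚ ≤ f a) → 0ℚ ≤ Σ[ xs ] f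
  Σ-nonneg []       h = ℚₚ.≤-refl
  Σ-nonneg (x ∷ xs) h = 0≤+ (h x) (Σ-nonneg xs h)

  Σ-≥ : ∀ {xs : List A} {f} → (∀ a → 0ℚ ≤ f a) → ∀ {a} → a ∈ᴸ xs → f a ≤ Σ[ xs ] f
  Σ-≥ {f = f} h {a} (here {xs = xs} refl) = ℚₚ.≤-trans (ℚₚ.≤-reflexive (sym (ℚₚ.+-identityʳ (f a)))) (ℚₚ.+-monoʳ-≤ (f a) (Σ-nonneg xs h))
  Σ-≥ {f = f} h (there {x} p) = ℚₚ.≤-trans (Σ-≥ h p) (ℚₚ.≤-trans (ℚₚ.≤-reflexive (sym (ℚₚ.+-identityˡ _))) (ℚₚ.+-monoˡ-≤ _ (h x)))

  χ : Bool → ℚ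
  χ b = if b then 1ℚ else 0ℚ

  0≤χ : ∀ b → 0ℚ ≤ χ b
  0≤χ true  = ℚₚ.<⇒≤ (ℚₚ.positive⁻¹ 1ℚ)
  0≤χ false = ℚₚ.≤-refl

  [_] : ∀ {p} {P : Set p} → Dec P → ℚ
  [ d ] = χ (does d)

  [yes] : ∀ {p} {P : Set p} (d : Dec P) → P → [ d ] ≡ 1ℚ
  [yes] (yes _) p = refl
  [yes] (no ¬p) p = contradiction p ¬p

  [no] : ∀ {p} {P : Set p} (d : Dec P) → ¬ P → [ d ] ≡ 0ℚ
  [no] (yes p) ¬p = contradiction p ¬p
  [no] (no _)  ¬p = refl

  []-cong : ∀ {p q} {P : Set p} {Q : Set q} (d : Dec P) (e : Dec Q) → (P → Q) → (Q → P) → [ d ] ≡ [ e ]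
  []-cong (yes p) e f g = sym ([yes] e (f p))
  []-cong (no ¬p) e f g = sym ([no] e (¬p ∘ g))

  Σ-filter : ∀ {p} {P : A → Set p} (P? : Decidable P) xs f → Σ[ filter P? xs ] f ≡ Σ[ xs ] (λ a → [ P? a ] * f a)
  Σ-filter P? []       f = refl
  Σ-filter P? (x ∷ xs) f with P? x
  ... | yes _ = cong₂ _+_ (sym (ℚₚ.*-identityˡ (f x))) (Σ-filter P? xs f)
  ... | no  _ = trans (Σ-filter P? xs f) (sym (trans (cong (_+ Σ[ xs ] (λ a → [ P? a ] * f a)) (ℚₚ.*-zeroˡ (f x))) (ℚₚ.+-identityˡ (Σ[ xs ] (λ a → [ P? a ] * f a)))))

  Σ-1 : ∀ (xs : List A) → nat (List.length xs) ≡ Σ[ xs ] (λ _ → 1ℚ)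
  Σ-1 []       = refl
  Σ-1 (x ∷ xs) = trans (nat-+ 1 (List.length xs)) (cong (1ℚ +_) (Σ-1 xs))

  [yes]* : ∀ {p} {P : Set p} (d : Dec P) x → P → [ d ] * x ≡ x
  [yes]* d x p = trans (cong (λ r → r * x) ([yes] d p)) (ℚₚ.*-identityˡ x)

  [no]* : ∀ {p} {P : Set p} (d : Dec P) x → ¬ P → [ d ] * x ≡ 0ℚ
  [no]* d x ¬p = trans (cong (λ r → r * x) ([no] d ¬p)) (ℚₚ.*-zeroˡ x)

  Σ-δ : ∀ {xs : List A} (_≟_ : (a b : A) → Dec (a ≡ b)) → Unique xs → ∀ {b} → b ∈ᴸ xs → (f : A → ℚ) →
    Σ[ xs ] (λ a → [ a ≟ b ] * f a) ≡ f b
  Σ-δ {A} {x ∷ xs} _≟_ (x∉ ∷ u) {b} (here refl) f =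
    trans (cong₂ _+_ ([yes]* (b ≟ b) (f b) refl) (absent xs x∉)) (ℚₚ.+-identityʳ (f b))
    where
    absent : ∀ ys → All (b ≢_) ys → Σ[ ys ] (λ a → [ a ≟ b ] * f a) ≡ 0ℚ
    absent []       []         = refl
    absent (y ∷ ys) (b≢y ∷ ps) = trans (cong₂ _+_ ([no]* (y ≟ b) (f y) (b≢y ∘ sym)) (absent ys ps)) (ℚₚ.+-identityˡ 0ℚ)
  Σ-δ {A} {x ∷ xs} _≟_ (x∉ ∷ u) {b} (there p) f =
    trans (cong₂ _+_ ([no]* (x ≟ b) (f x) (All.lookup x∉ p)) (Σ-δ _≟_ u p f)) (ℚₚ.+-identityˡ (f b))

  Σ-allFin-suc : ∀ {n} (f : Fin (suc n) → ℚ) → Σ[ allFin (suc n) ] f ≡ f zero + Σ[ allFin n ] (f ∘ suc)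
  Σ-allFin-suc {n} f = cong (f zero +_) (trans (cong (λ xs → Σ[ xs ] f) (sym (Listₚ.map-tabulate (λ i → i) suc))) (Σ-map suc (allFin n) f))

module SubsetSums where

  open Rationals
  open Sums

  ins del : ∀ {n} → Fin n → Subset n → Subset n
  ins v σ = σ [ v ]≔ inside
  del v σ = σ [ v ]≔ outside

  on off : ∀ {n} → Fin n → Subset n → ℚ
  on  v σ = χ (lookup σ v)
  off v σ = χ (not (lookup σ v))

  Σ-subsets-suc : ∀ {n} (f : Subset (suc n) → ℚ) →
    Σ[ subsets (suc n) ] f ≡ Σ[ subsets n ] (f ∘ (outside ∷_)) + Σ[ subsets n ] (f ∘ (inside ∷_))
  Σ-subsets-suc {n} f = trans (Σ-++ (List.map (outside ∷_) (subsets n)) _ f)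
    (cong₂ _+_ (Σ-map (outside ∷_) (subsets n) f) (Σ-map (inside ∷_) (subsets n) f))

  -- Reindexes along the bijection σ ↦ σ ∪ {v} from the subsets without v to those with v.
  Σ-toggle : ∀ {n} (v : Fin n) (H : Subset n → Subset n → ℚ) →
    Σ[ subsets n ] (λ τ → on v τ * H (del v τ) τ) ≡ Σ[ subsets n ] (λ σ → off v σ * H σ (ins v σ))
  Σ-toggle {suc n} zero H = begin
    Σ[ subsets (suc n) ] (λ τ → on zero τ * H (del zero τ) τ)
      ≡⟨ Σ-subsets-suc (λ τ → on zero τ * H (del zero τ) τ) ⟩
    Σ[ subsets n ] (λ τ → 0ℚ * H (outside ∷ τ) (outside ∷ τ)) + Σ[ subsets n ] (λ τ → 1ℚ * H (outside ∷ τ) (inside ∷ τ))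
      ≡⟨ cong (_+ Σ[ subsets n ] (λ τ → 1ℚ * H (outside ∷ τ) (inside ∷ τ))) (Σ-0 (subsets n) (λ τ → ℚₚ.*-zeroˡ (H (outside ∷ τ) (outside ∷ τ)))) ⟩
    0ℚ + Σ[ subsets n ] (λ τ → 1ℚ * H (outside ∷ τ) (inside ∷ τ))
      ≡⟨ ℚₚ.+-comm 0ℚ (Σ[ subsets n ] (λ τ → 1ℚ * H (outside ∷ τ) (inside ∷ τ))) ⟩
    Σ[ subsets n ] (λ τ → 1ℚ * H (outside ∷ τ) (inside ∷ τ)) + 0ℚ
      ≡⟨ cong (Σ[ subsets n ] (λ τ → 1ℚ * H (outside ∷ τ) (inside ∷ τ)) +_) (sym (Σ-0 (subsets n) (λ τ → ℚₚ.*-zeroˡ (H (inside ∷ τ) (inside ∷ τ))))) ⟩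
    Σ[ subsets n ] (λ τ → 1ℚ * H (outside ∷ τ) (inside ∷ τ)) + Σ[ subsets n ] (λ τ → 0ℚ * H (inside ∷ τ) (inside ∷ τ))
      ≡⟨ Σ-subsets-suc (λ σ → off zero σ * H σ (ins zero σ)) ⟨
    Σ[ subsets (suc n) ] (λ σ → off zero σ * H σ (ins zero σ)) ∎
    where open ≡-Reasoning
  Σ-toggle {suc n} (suc v) H = trans (Σ-subsets-suc (λ τ → on (suc v) τ * H (del (suc v) τ) τ))
    (trans (cong₂ _+_ (Σ-toggle v (λ σ τ → H (outside ∷ σ) (outside ∷ τ))) (Σ-toggle v (λ σ τ → H (inside ∷ σ) (inside ∷ τ))))
      (sym (Σ-subsets-suc (λ σ → off (suc v) σ * H σ (ins (suc v) σ)))))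

  ∣ins∣ : ∀ {n} (v : Fin n) σ → lookup σ v ≡ outside → ∣ ins v σ ∣ ≡ suc ∣ σ ∣
  ∣ins∣ zero    (outside ∷ σ) refl = refl
  ∣ins∣ (suc v) (outside ∷ σ) h    = ∣ins∣ v σ h
  ∣ins∣ (suc v) (inside  ∷ σ) h    = cong suc (∣ins∣ v σ h)

  ∈subsets : ∀ {n} (σ : Subset n) → σ ∈ᴸ subsets n
  ∈subsets []          = here refl
  ∈subsets (false ∷ σ) = ∈-++⁺ˡ (∈-map⁺ (outside ∷_) (∈subsets σ))
  ∈subsets {suc n} (true ∷ σ) = ∈-++⁺ʳ (List.map (outside ∷_) (subsets n)) (∈-map⁺ (inside ∷_) (∈subsets σ))

  subsets-unique : ∀ n → Unique (subsets n)
  subsets-unique zero    = [] ∷ []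
  subsets-unique (suc n) = Uniqueₚ.++⁺ (Uniqueₚ.map⁺ Vecₚ.∷-injectiveʳ (subsets-unique n)) (Uniqueₚ.map⁺ Vecₚ.∷-injectiveʳ (subsets-unique n)) disjoint
    where
    disjoint : ∀ {σ} → ¬ (σ ∈ᴸ List.map (outside ∷_) (subsets n) × σ ∈ᴸ List.map (inside ∷_) (subsets n))
    disjoint (p , q) with ∈-map⁻ (outside ∷_) p | ∈-map⁻ (inside ∷_) q
    ... | _ , _ , refl | _ , _ , ()

  comprehension : ∀ {p n} {P : Fin n → Set p} → (∀ v → Dec (P v)) → Subset n
  comprehension P? = tabulate (does ∘ P?)

  module _ {p n} {P : Fin n → Set p} (P? : ∀ v → Dec (P v)) where

    ∈-comprehension⁺ : ∀ {v} → P v → v ∈ˢ comprehension P?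
    ∈-comprehension⁺ {v} p = Vecₚ.lookup⇒[]= v _ (trans (Vecₚ.lookup∘tabulate (does ∘ P?) v) (dec-true (P? v) p))

    ∈-comprehension⁻ : ∀ {v} → v ∈ˢ comprehension P? → P v
    ∈-comprehension⁻ {v} v∈ with P? v | trans (sym (Vecₚ.lookup∘tabulate (does ∘ P?) v)) (Vecₚ.[]=⇒lookup v∈)
    ... | yes p | _ = p
    ... | no  _ | ()

  lookup-injective : ∀ {A : Set} {xs : List A} → Unique xs → ∀ {i j} → List.lookup xs i ≡ List.lookup xs j → i ≡ j
  lookup-injective (_  ∷ _)  {zero}  {zero}  _  = refl
  lookup-injective (x∉ ∷ _)  {zero}  {suc j} eq = contradiction eq (All.lookup x∉ (∈-lookup j))
  lookup-injective (x∉ ∷ _)  {suc i} {zero}  eq = contradiction (sym eq) (All.lookup x∉ (∈-lookup i))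
  lookup-injective (_  ∷ xs) {suc i} {suc j} eq = cong suc (lookup-injective xs eq)

  lookup⇒∈ : ∀ {n v} {σ : Subset n} → lookup σ v ≡ inside → v ∈ˢ σ
  lookup⇒∈ {v = v} {σ} = Vecₚ.lookup⇒[]= v σ

  ∈⇒lookup : ∀ {n v} {σ : Subset n} → v ∈ˢ σ → lookup σ v ≡ inside
  ∈⇒lookup = Vecₚ.[]=⇒lookup

  ∉⇒lookup : ∀ {n v} {σ : Subset n} → ¬ v ∈ˢ σ → lookup σ v ≡ outside
  ∉⇒lookup {v = v} {σ} v∉ = by (lookup σ v) refl
    where
    by : ∀ b → lookup σ v ≡ b → b ≡ outside
    by true  eq = contradiction (lookup⇒∈ eq) v∉
    by false _  = refl

  v∈ins : ∀ {n} (v : Fin n) σ → v ∈ˢ ins v σ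
  v∈ins v σ = lookup⇒∈ (Vecₚ.lookup∘updateAt v σ)

  ∈ins⁺ : ∀ {n} {u} (v : Fin n) σ → u ∈ˢ σ → u ∈ˢ ins v σ
  ∈ins⁺ {u = u} v σ u∈ with u Finₚ.≟ v
  ... | yes refl = v∈ins v σ
  ... | no u≢v   = lookup⇒∈ (trans (Vecₚ.lookup∘updateAt′ u v u≢v σ) (∈⇒lookup u∈))

  ∈ins⁻ : ∀ {n} {u} (v : Fin n) σ → u ≢ v → u ∈ˢ ins v σ → u ∈ˢ σ
  ∈ins⁻ {u = u} v σ u≢v u∈ = lookup⇒∈ (trans (sym (Vecₚ.lookup∘updateAt′ u v u≢v σ)) (∈⇒lookup u∈))

  ∈del⁺ : ∀ {n} {u} (v : Fin n) σ → u ≢ v → u ∈ˢ σ → u ∈ˢ del v σ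
  ∈del⁺ {u = u} v σ u≢v u∈ = lookup⇒∈ (trans (Vecₚ.lookup∘updateAt′ u v u≢v σ) (∈⇒lookup u∈))

  v∉del : ∀ {n} (v : Fin n) σ → ¬ v ∈ˢ del v σ
  v∉del v σ v∈ = contradiction (trans (sym (∈⇒lookup v∈)) (Vecₚ.lookup∘updateAt v σ)) λ ()

  ∈del⁻ : ∀ {n} {u} (v : Fin n) σ → u ∈ˢ del v σ → u ≢ v × u ∈ˢ σ
  ∈del⁻ {u = u} v σ u∈ with u Finₚ.≟ v
  ... | yes refl = contradiction u∈ (v∉del v σ)
  ... | no u≢v   = u≢v , lookup⇒∈ (trans (sym (Vecₚ.lookup∘updateAt′ u v u≢v σ)) (∈⇒lookup u∈))

  ins-del : ∀ {n} (v : Fin n) σ → v ∈ˢ σ → ins v (del v σ) ≡ σ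
  ins-del v σ v∈ = trans (Vecₚ.[]≔-idempotent σ v) (trans (cong (σ [ v ]≔_) (sym (∈⇒lookup v∈))) (Vecₚ.[]≔-lookup σ v))

  del-ins : ∀ {n} (v : Fin n) σ → ¬ v ∈ˢ σ → del v (ins v σ) ≡ σ
  del-ins v σ v∉ = trans (Vecₚ.[]≔-idempotent σ v) (trans (cong (σ [ v ]≔_) (sym (∉⇒lookup v∉))) (Vecₚ.[]≔-lookup σ v))

  off-∉ : ∀ {n} (v : Fin n) σ → ¬ v ∈ˢ σ → off v σ ≡ 1ℚ
  off-∉ v σ v∉ = cong (χ ∘ not) (∉⇒lookup v∉)

  off-∈ : ∀ {n} (v : Fin n) σ → v ∈ˢ σ → off v σ ≡ 0ℚ
  off-∈ v σ v∈ = cong (χ ∘ not) (∈⇒lookup v∈)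

  on-∈ : ∀ {n} (v : Fin n) σ → v ∈ˢ σ → on v σ ≡ 1ℚ
  on-∈ v σ v∈ = cong χ (∈⇒lookup v∈)

  on-∉ : ∀ {n} (v : Fin n) σ → ¬ v ∈ˢ σ → on v σ ≡ 0ℚ
  on-∉ v σ v∉ = cong χ (∉⇒lookup v∉)

-- Spectra of weighted complexes

module Coordinates where

  bit : Bool → Fin 2
  bit false = zero
  bit true  = suc zero

  unbit : Fin 2 → Bool
  unbit zero    = false
  unbit (suc _) = true

  -- Elimination works on vectors indexed by `Fin`, so subsets are numbered by reading membership as
  -- binary digits.
  index : ∀ {n} → Subset n → Fin (2 ℕ.^ n)
  index []      = zero
  index (b ∷ σ) = combine (bit b) (index σ)

  unindex : ∀ {n} → Fin (2 ℕ.^ n) → Subset n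
  unindex {zero}  _ = []
  unindex {suc n} i = unbit (proj₁ (split i)) ∷ unindex (proj₂ (split i))
    where
    split : Fin (2 ℕ.^ suc n) → Fin 2 × Fin (2 ℕ.^ n)
    split = remQuot {2} (2 ℕ.^ n)

  unindex-index : ∀ {n} (σ : Subset n) → unindex (index σ) ≡ σ
  unindex-index []          = refl
  unindex-index {suc n} (b ∷ σ) = trans
    (cong (λ p → unbit (proj₁ p) ∷ unindex (proj₂ p)) (Finₚ.remQuot-combine {2} (bit b) (index σ)))
    (cong₂ _∷_ (unbit-bit b) (unindex-index σ))
    where
    unbit-bit : ∀ b → unbit (bit b) ≡ b
    unbit-bit false = refl
    unbit-bit true  = refl

module Operators {n : ℕ} where

  open Rationals
  open Sums
  open Reals
  open ℝ
  open Forms orderedRing using (null⇒orthogonal)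

  Kernel : Set
  Kernel = Fin n → Subset n → ℚ

  at : ∀ {A : Set} → ℕ → (A → ℝ) → A → ℚ
  at k f a = seq (f a) k

  seq-sum : ∀ {A : Set} (xs : List A) (f : A → ℝ) k → seq (sumᴿ f xs) k ≡ Σ[ xs ] (at k f)
  seq-sum []       f k = refl
  seq-sum (x ∷ xs) f k = cong (seq (f x) k +_) (seq-sum xs f k)

  sumᴿ-cong : ∀ {A : Set} (xs : List A) {f g : A → ℝ} → (∀ a → f a ≃ g a) → sumᴿ f xs ≃ sumᴿ g xs
  sumᴿ-cong []       h = ≃-refl {0ᴿ}
  sumᴿ-cong (x ∷ xs) {f} {g} h = +ᴿ-cong {f x} {g x} {sumᴿ f xs} {sumᴿ g xs} (h x) (sumᴿ-cong xs h)

  op : Kernel → (Fin n → Subset n → Subset n) → (Subset n → ℚ) → Subset n → ℚ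
  op c m h σ = Σ[ allFin n ] (λ v → c v σ * h (m v σ))

  opᴿ : Kernel → (Fin n → Subset n → Subset n) → (Subset n → ℝ) → Subset n → ℝ
  opᴿ c m h σ = sumᴿ (λ v → fromℚ (c v σ) *ᴿ h (m v σ)) (allFin n)

  -- The kernels are rational, so the operators act on Cauchy sequences term by term. Identities
  -- over ℝ thereby follow from rational ones at each index.
  opᴿ-at : ∀ c m h σ k → seq (opᴿ c m h σ) k ≡ op c m (at k h) σ
  opᴿ-at c m h σ k = seq-sum (allFin n) (λ v → fromℚ (c v σ) *ᴿ h (m v σ)) k

  op-cong : ∀ c m {h h′} → (∀ σ → h σ ≡ h′ σ) → ∀ σ → op c m h σ ≡ op c m h′ σ
  op-cong c m p σ = Σ-cong (allFin n) (λ v → cong (c v σ *_) (p (m v σ)))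

  opᴿ-cong : ∀ c m {h h′} → (∀ σ → h σ ≃ h′ σ) → ∀ σ → opᴿ c m h σ ≃ opᴿ c m h′ σ
  opᴿ-cong c m {h} {h′} p σ = sumᴿ-cong (allFin n) (λ v → *ᴿ-congˡ (fromℚ (c v σ)) {h (m v σ)} {h′ (m v σ)} (p (m v σ)))

  op-lin : ∀ c m s t f g σ → op c m (λ a → s * f a + t * g a) σ ≡ s * op c m f σ + t * op c m g σ
  op-lin c m s t f g σ = begin
    Σ[ allFin n ] (λ v → c v σ * (s * f (m v σ) + t * g (m v σ)))
      ≡⟨ Σ-cong (allFin n) (λ v → lemma (c v σ) s t (f (m v σ)) (g (m v σ))) ⟩
    Σ[ allFin n ] (λ v → s * (c v σ * f (m v σ)) + t * (c v σ * g (m v σ)))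
      ≡⟨ Σ-+ (allFin n) (λ v → s * (c v σ * f (m v σ))) (λ v → t * (c v σ * g (m v σ))) ⟩
    Σ[ allFin n ] (λ v → s * (c v σ * f (m v σ))) + Σ[ allFin n ] (λ v → t * (c v σ * g (m v σ)))
      ≡⟨ cong₂ _+_ (Σ-*ˡ (allFin n) s (λ v → c v σ * f (m v σ))) (Σ-*ˡ (allFin n) t (λ v → c v σ * g (m v σ))) ⟨
    s * op c m f σ + t * op c m g σ ∎
    where
    open ≡-Reasoning
    lemma : ∀ c s t a b → c * (s * a + t * b) ≡ s * (c * a) + t * (c * b)
    lemma = solve 5 (λ c s t a b → c :* (s :* a :+ t :* b) := s :* (c :* a) :+ t :* (c :* b)) refl

  module Inner (W : Subset n → ℚ) (0≤W : ∀ σ → 0ℚ ≤ W σ) where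

    ip : (Subset n → ℚ) → (Subset n → ℚ) → ℚ
    ip u v = Σ[ subsets n ] (λ σ → W σ * (u σ * v σ))

    ipᴿ : (Subset n → ℝ) → (Subset n → ℝ) → ℝ
    ipᴿ u v = sumᴿ (λ σ → fromℚ (W σ) *ᴿ (u σ *ᴿ v σ)) (subsets n)

    ipᴿ-at : ∀ u v k → seq (ipᴿ u v) k ≡ ip (at k u) (at k v)
    ipᴿ-at u v k = seq-sum (subsets n) (λ σ → fromℚ (W σ) *ᴿ (u σ *ᴿ v σ)) k

    ip-cong : ∀ {u u′ v v′} → (∀ σ → u σ ≡ u′ σ) → (∀ σ → v σ ≡ v′ σ) → ip u v ≡ ip u′ v′
    ip-cong p q = Σ-cong (subsets n) (λ σ → cong₂ (λ a b → W σ * (a * b)) (p σ) (q σ))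

    ipᴿ-cong : ∀ {u u′ v v′} → (∀ σ → u σ ≃ u′ σ) → (∀ σ → v σ ≃ v′ σ) → ipᴿ u v ≃ ipᴿ u′ v′
    ipᴿ-cong {u} {u′} {v} {v′} p q = sumᴿ-cong (subsets n) (λ σ →
      *ᴿ-congˡ (fromℚ (W σ)) {u σ *ᴿ v σ} {u′ σ *ᴿ v′ σ} (*ᴿ-cong {u σ} {u′ σ} {v σ} {v′ σ} (p σ) (q σ)))

    ip-sym : ∀ u v → ip u v ≡ ip v u
    ip-sym u v = Σ-cong (subsets n) (λ σ → cong (W σ *_) (ℚₚ.*-comm (u σ) (v σ)))

    ip-lin : ∀ s t u v z → ip (λ σ → s * u σ + t * v σ) z ≡ s * ip u z + t * ip v z
    ip-lin s t u v z = begin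
      Σ[ subsets n ] (λ σ → W σ * ((s * u σ + t * v σ) * z σ))
        ≡⟨ Σ-cong (subsets n) (λ σ → lemma (W σ) s t (u σ) (v σ) (z σ)) ⟩
      Σ[ subsets n ] (λ σ → s * (W σ * (u σ * z σ)) + t * (W σ * (v σ * z σ)))
        ≡⟨ Σ-+ (subsets n) (λ σ → s * (W σ * (u σ * z σ))) (λ σ → t * (W σ * (v σ * z σ))) ⟩
      Σ[ subsets n ] (λ σ → s * (W σ * (u σ * z σ))) + Σ[ subsets n ] (λ σ → t * (W σ * (v σ * z σ)))
        ≡⟨ cong₂ _+_ (Σ-*ˡ (subsets n) s (λ σ → W σ * (u σ * z σ))) (Σ-*ˡ (subsets n) t (λ σ → W σ * (v σ * z σ))) ⟨
      s * ip u z + t * ip v z ∎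
      where
      open ≡-Reasoning
      lemma : ∀ w s t u v z → w * ((s * u + t * v) * z) ≡ s * (w * (u * z)) + t * (w * (v * z))
      lemma = solve 6 (λ w s t u v z → w :* ((s :* u :+ t :* v) :* z) := s :* (w :* (u :* z)) :+ t :* (w :* (v :* z))) refl

    ip-nonneg : ∀ u → 0ℚ ≤ ip u u
    ip-nonneg u = Σ-nonneg (subsets n) (λ σ → 0≤* (0≤W σ) (0≤sq (u σ)))

    ip-term : ∀ u {σ} → σ ∈ᴸ subsets n → W σ * (u σ * u σ) ≤ ip u u
    ip-term u p = Σ-≥ (λ σ → 0≤* (0≤W σ) (0≤sq (u σ))) p

    ip-psd : ∀ u v s t → 0ℚ ≤ s * s * ip u u + (s * t + s * t) * ip u v + t * t * ip v v
    ip-psd u v s t = subst (0ℚ ≤_) expand (ip-nonneg w)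
      where
      w = λ σ → s * u σ + t * v σ
      expand : ip w w ≡ s * s * ip u u + (s * t + s * t) * ip u v + t * t * ip v v
      expand = begin
        ip w w                                            ≡⟨ ip-lin s t u v w ⟩
        s * ip u w + t * ip v w                           ≡⟨ cong₂ (λ a b → s * a + t * b) (ip-sym u w) (ip-sym v w) ⟩
        s * ip w u + t * ip w v                           ≡⟨ cong₂ (λ a b → s * a + t * b) (ip-lin s t u v u) (ip-lin s t u v v) ⟩
        s * (s * ip u u + t * ip v u) + t * (s * ip u v + t * ip v v)
          ≡⟨ cong (λ a → s * (s * ip u u + t * a) + t * (s * ip u v + t * ip v v)) (ip-sym v u) ⟩
        s * (s * ip u u + t * ip u v) + t * (s * ip u v + t * ip v v)
          ≡⟨ lemma s t (ip u u) (ip u v) (ip v v) ⟩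
        s * s * ip u u + (s * t + s * t) * ip u v + t * t * ip v v ∎
        where
        open ≡-Reasoning
        lemma : ∀ s t a b c → s * (s * a + t * b) + t * (s * b + t * c) ≡ s * s * a + (s * t + s * t) * b + t * t * c
        lemma = solve 5 (λ s t a b c → s :* (s :* a :+ t :* b) :+ t :* (s :* b :+ t :* c) := s :* s :* a :+ (s :* t :+ s :* t) :* b :+ t :* t :* c) refl

    ip-null : ∀ u v → 0ℚ ≤ - ip u u → ip u v ≡ 0ℚ
    ip-null u v h = null⇒orthogonal (ip u u) (ip u v) (ip v v) h (ip-psd u v)

    ipᴿ-null : ∀ u v → NonNegative (-ᴿ ipᴿ u u) → ipᴿ u v ≃ 0ᴿ
    ipᴿ-null u v h = Forms.null⇒orthogonal orderedRingᴿ (ipᴿ u u) (ipᴿ u v) (ipᴿ v v) h λ s t →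
      pointwise⇒nn {s *ᴿ s *ᴿ ipᴿ u u +ᴿ (s *ᴿ t +ᴿ s *ᴿ t) *ᴿ ipᴿ u v +ᴿ t *ᴿ t *ᴿ ipᴿ v v} λ k →
        subst (0ℚ ≤_) (sym (lift (seq s k) (seq t k) k)) (ip-psd (at k u) (at k v) (seq s k) (seq t k))
      where
      lift : ∀ s t k → s * s * seq (ipᴿ u u) k + (s * t + s * t) * seq (ipᴿ u v) k + t * t * seq (ipᴿ v v) k ≡
        s * s * ip (at k u) (at k u) + (s * t + s * t) * ip (at k u) (at k v) + t * t * ip (at k v) (at k v)
      lift s t k rewrite ipᴿ-at u u k | ipᴿ-at u v k | ipᴿ-at v v k = refl

-- Cochains of an abstract weighted complex, as functions on unoriented subsets: η v σ is the sign
-- relating the orientation of σ ∪ {v} to that of σ preceded by v.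
module Spectral {n : ℕ} (w : Subset n → ℕ) (w-mono : ∀ v σ → w σ ≡ 0 → w (SubsetSums.ins v σ) ≡ 0)
  (η : Fin n → Subset n → ℚ) where

  open Rationals
  open Sums
  open SubsetSums
  open Reals
  open ℝ
  open Operators {n} public

  δ-kernel D-kernel : Kernel
  δ-kernel v σ = off v σ * (ratio (w (ins v σ)) (w σ) * η v σ)
  D-kernel v τ = on v τ * η v (del v τ)

  δ D : (Subset n → ℚ) → Subset n → ℚ
  δ = op δ-kernel ins
  D = op D-kernel del

  δᴿ Dᴿ : (Subset n → ℝ) → Subset n → ℝ
  δᴿ = opᴿ δ-kernel ins
  Dᴿ = opᴿ D-kernel del

  -- Cochains of one degree have no type of their own: functions on all subsets are used, and the
  -- inner product sees only the subsets with `k` elements, that is, dimension k - 1.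
  weight : ℕ → Subset n → ℚ
  weight k σ = [ ∣ σ ∣ ℕₚ.≟ k ] * nat (w σ)

  0≤weight : ∀ k σ → 0ℚ ≤ weight k σ
  0≤weight k σ = 0≤* (0≤χ (does (∣ σ ∣ ℕₚ.≟ k))) (0≤nat (w σ))

  -- The denominator of the ratio cancels. Where w(σ) = 0 the ratio takes its default value 0, and
  -- `w-mono` makes w(σ ∪ v) vanish as well.
  weight-ins : ∀ k v σ → off v σ * weight (suc k) (ins v σ) ≡ off v σ * (weight k σ * ratio (w (ins v σ)) (w σ))
  weight-ins k v σ = by (lookup σ v) refl
    where
    ratio-weight : nat (w (ins v σ)) ≡ nat (w σ) * ratio (w (ins v σ)) (w σ)
    ratio-weight with w σ in eq
    ... | zero  rewrite w-mono v σ eq = refl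
    ... | suc b = trans (sym (ratio-* (w (ins v σ)) b)) (ℚₚ.*-comm (ratio (w (ins v σ)) (suc b)) (nat (suc b)))
    by : ∀ b → lookup σ v ≡ b → χ (not b) * weight (suc k) (ins v σ) ≡ χ (not b) * (weight k σ * ratio (w (ins v σ)) (w σ))
    by true  _  = trans (ℚₚ.*-zeroˡ (weight (suc k) (ins v σ))) (sym (ℚₚ.*-zeroˡ (weight k σ * ratio (w (ins v σ)) (w σ))))
    by false eq = cong (1ℚ *_) (trans
      (cong₂ _*_ ([]-cong (∣ ins v σ ∣ ℕₚ.≟ suc k) (∣ σ ∣ ℕₚ.≟ k)
        (λ p → ℕₚ.suc-injective (trans (sym (∣ins∣ v σ eq)) p)) (λ p → trans (∣ins∣ v σ eq) (cong suc p))) ratio-weight)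
      (sym (ℚₚ.*-assoc [ ∣ σ ∣ ℕₚ.≟ k ] (nat (w σ)) (ratio (w (ins v σ)) (w σ)))))

  module Degree (K : ℕ) where

    module I₁ = Inner (weight K) (0≤weight K)
    module I₂ = Inner (weight (suc K)) (0≤weight (suc K))

    -- Both sides run over the incident pairs σ ⊂ σ ∪ {v}: `Σ-toggle` passes from the larger set
    -- with a chosen element to the smaller set with a missing one, and `weight-ins` matches the
    -- weights.
    adjoint : ∀ h k → I₂.ip (D h) k ≡ I₁.ip h (δ k)
    adjoint h k = begin
      Σ[ subsets n ] (λ τ → W₂ τ * (D h τ * k τ))
        ≡⟨ Σ-cong (subsets n) (λ τ → trans (cong (W₂ τ *_) (Σ-*ʳ (allFin n) (k τ) (λ v → D-kernel v τ * h (del v τ))))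
             (trans (Σ-*ˡ (allFin n) (W₂ τ) (λ v → (on v τ * η v (del v τ)) * h (del v τ) * k τ))
               (Σ-cong (allFin n) (λ v → lemma₁ (W₂ τ) (on v τ) (η v (del v τ)) (h (del v τ)) (k τ))))) ⟩
      Σ[ subsets n ] (λ τ → Σ[ allFin n ] (λ v → on v τ * T v (del v τ) τ))
        ≡⟨ Σ-swap (subsets n) (allFin n) (λ τ v → on v τ * T v (del v τ) τ) ⟩
      Σ[ allFin n ] (λ v → Σ[ subsets n ] (λ τ → on v τ * T v (del v τ) τ))
        ≡⟨ Σ-cong (allFin n) (λ v → Σ-toggle v (T v)) ⟩
      Σ[ allFin n ] (λ v → Σ[ subsets n ] (λ σ → off v σ * T v σ (ins v σ)))
        ≡⟨ Σ-swap (allFin n) (subsets n) (λ v σ → off v σ * T v σ (ins v σ)) ⟩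
      Σ[ subsets n ] (λ σ → Σ[ allFin n ] (λ v → off v σ * T v σ (ins v σ)))
        ≡⟨ Σ-cong (subsets n) (λ σ → trans
             (Σ-cong (allFin n) (λ v → lemma₂ (off v σ) (W₂ (ins v σ)) (W₁ σ) (ratio (w (ins v σ)) (w σ)) (η v σ) (h σ) (k (ins v σ)) (weight-ins K v σ)))
             (trans (sym (Σ-*ˡ (allFin n) (W₁ σ) (λ v → h σ * (δ-kernel v σ * k (ins v σ)))))
               (cong (W₁ σ *_) (sym (Σ-*ˡ (allFin n) (h σ) (λ v → δ-kernel v σ * k (ins v σ))))))) ⟩
      Σ[ subsets n ] (λ σ → W₁ σ * (h σ * δ k σ)) ∎
      where
      open ≡-Reasoning
      W₁ = weight K
      W₂ = weight (suc K)
      T : Fin n → Subset n → Subset n → ℚ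
      T v σ τ = W₂ τ * (η v σ * (h σ * k τ))
      lemma₁ : ∀ W o e h k → W * ((o * e) * h * k) ≡ o * (W * (e * (h * k)))
      lemma₁ = solve 5 (λ W o e h k → W :* ((o :* e) :* h :* k) := o :* (W :* (e :* (h :* k)))) refl
      lemma₂ : ∀ o W₂ W₁ r e h k → o * W₂ ≡ o * (W₁ * r) → o * (W₂ * (e * (h * k))) ≡ W₁ * (h * ((o * (r * e)) * k))
      lemma₂ o W₂ W₁ r e h k eq = trans (sym (ℚₚ.*-assoc o W₂ (e * (h * k)))) (trans (cong (_* (e * (h * k))) eq)
        (solve 6 (λ o W₁ r e h k → (o :* (W₁ :* r)) :* (e :* (h :* k)) := W₁ :* (h :* ((o :* (r :* e)) :* k))) refl o W₁ r e h k))

    adjointᴿ : ∀ h k → I₂.ipᴿ (Dᴿ h) k ≃ I₁.ipᴿ h (δᴿ k)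
    adjointᴿ h k = pointwise⇒≃ (I₂.ipᴿ (Dᴿ h) k) (I₁.ipᴿ h (δᴿ k)) λ m → begin
      seq (I₂.ipᴿ (Dᴿ h) k) m            ≡⟨ I₂.ipᴿ-at (Dᴿ h) k m ⟩
      I₂.ip (at m (Dᴿ h)) (at m k)       ≡⟨ I₂.ip-cong (λ σ → opᴿ-at D-kernel del h σ m) (λ _ → refl) ⟩
      I₂.ip (D (at m h)) (at m k)        ≡⟨ adjoint (at m h) (at m k) ⟩
      I₁.ip (at m h) (δ (at m k))        ≡⟨ I₁.ip-cong {at m h} (λ _ → refl) (λ σ → opᴿ-at δ-kernel ins k σ m) ⟨
      I₁.ip (at m h) (at m (δᴿ k))       ≡⟨ I₁.ipᴿ-at h (δᴿ k) m ⟨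
      seq (I₁.ipᴿ h (δᴿ k)) m            ∎
      where open ≡-Reasoning

    open Coordinates

    module Qf = Forms orderedRing
    module Rf = Forms orderedRingᴿ

    dim : ℕ
    dim = 2 ℕ.^ n

    δ̂ D̂ : (Fin dim → ℚ) → Subset n → ℚ
    δ̂ x = δ (x ∘ index)
    D̂ x = D (δ̂ x)

    δ̂ᴿ D̂ᴿ : (Fin dim → ℝ) → Subset n → ℝ
    δ̂ᴿ x = δᴿ (x ∘ index)
    D̂ᴿ x = Dᴿ (δ̂ᴿ x)

    δ̂-cong : ∀ {x x′} → (∀ a → x a ≡ x′ a) → ∀ σ → δ̂ x σ ≡ δ̂ x′ σ
    δ̂-cong p = op-cong δ-kernel ins (p ∘ index)

    D̂-cong : ∀ {x x′} → (∀ a → x a ≡ x′ a) → ∀ σ → D̂ x σ ≡ D̂ x′ σ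
    D̂-cong p = op-cong D-kernel del (δ̂-cong p)

    δ̂ᴿ-cong : ∀ {x x′} → (∀ a → x a ≃ x′ a) → ∀ σ → δ̂ᴿ x σ ≃ δ̂ᴿ x′ σ
    δ̂ᴿ-cong {x} {x′} p = opᴿ-cong δ-kernel ins {x ∘ index} {x′ ∘ index} (p ∘ index)

    D̂ᴿ-cong : ∀ {x x′} → (∀ a → x a ≃ x′ a) → ∀ σ → D̂ᴿ x σ ≃ D̂ᴿ x′ σ
    D̂ᴿ-cong {x} {x′} p = opᴿ-cong D-kernel del {δ̂ᴿ x} {δ̂ᴿ x′} (δ̂ᴿ-cong {x} {x′} p)

    δ̂-at : ∀ m x σ → at m (δ̂ᴿ x) σ ≡ δ̂ (at m x) σ
    δ̂-at m x σ = opᴿ-at δ-kernel ins (x ∘ index) σ m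

    D̂-at : ∀ m x σ → at m (D̂ᴿ x) σ ≡ D̂ (at m x) σ
    D̂-at m x σ = trans (opᴿ-at D-kernel del (δ̂ᴿ x) σ m) (op-cong D-kernel del (δ̂-at m x) σ)

    δ̂-lin : ∀ s x t y σ → δ̂ (Qf.comb s x t y) σ ≡ s * δ̂ x σ + t * δ̂ y σ
    δ̂-lin s x t y = op-lin δ-kernel ins s t (x ∘ index) (y ∘ index)

    D̂-lin : ∀ s x t y σ → D̂ (Qf.comb s x t y) σ ≡ s * D̂ x σ + t * D̂ y σ
    D̂-lin s x t y σ = trans (op-cong D-kernel del (δ̂-lin s x t y) σ) (op-lin D-kernel del s t (δ̂ x) (δ̂ y) σ)

    P R : (Fin dim → ℚ) → (Fin dim → ℚ) → ℚ
    P x y = I₁.ip (δ̂ x) (δ̂ y)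
    R x y = I₂.ip (D̂ x) (D̂ y)

    Pᴿ Rᴿ : (Fin dim → ℝ) → (Fin dim → ℝ) → ℝ
    Pᴿ x y = I₁.ipᴿ (δ̂ᴿ x) (δ̂ᴿ y)
    Rᴿ x y = I₂.ipᴿ (D̂ᴿ x) (D̂ᴿ y)

    P-at : ∀ m x y → seq (Pᴿ x y) m ≡ P (at m x) (at m y)
    P-at m x y = trans (I₁.ipᴿ-at (δ̂ᴿ x) (δ̂ᴿ y) m) (I₁.ip-cong (δ̂-at m x) (δ̂-at m y))

    R-at : ∀ m x y → seq (Rᴿ x y) m ≡ R (at m x) (at m y)
    R-at m x y = trans (I₂.ipᴿ-at (D̂ᴿ x) (D̂ᴿ y) m) (I₂.ip-cong (D̂-at m x) (D̂-at m y))

    P-form : Qf.SymmetricForm dim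
    P-form = record
      { ⟪_,_⟫ = P
      ; respects = λ p q → I₁.ip-cong (δ̂-cong p) (δ̂-cong q)
      ; symm = λ x y → I₁.ip-sym (δ̂ x) (δ̂ y)
      ; linˡ = λ s x t y z → trans (I₁.ip-cong (δ̂-lin s x t y) (λ _ → refl)) (I₁.ip-lin s t (δ̂ x) (δ̂ y) (δ̂ z)) }

    pencil : ℚ → (Fin dim → ℚ) → (Fin dim → ℚ) → ℚ
    pencil c x y = R x y - c * P x y

    Q-form : ℚ → Qf.SymmetricForm dim
    Q-form c = record
      { ⟪_,_⟫ = pencil c
      ; respects = λ p q → cong₂ (λ a b → a - c * b) (I₂.ip-cong (D̂-cong p) (D̂-cong q)) (I₁.ip-cong (δ̂-cong p) (δ̂-cong q))
      ; symm = λ x y → cong₂ (λ a b → a - c * b) (I₂.ip-sym (D̂ x) (D̂ y)) (I₁.ip-sym (δ̂ x) (δ̂ y))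
      ; linˡ = λ s x t y z → trans
          (cong₂ (λ a b → a - c * b) (trans (I₂.ip-cong (D̂-lin s x t y) (λ _ → refl)) (I₂.ip-lin s t (D̂ x) (D̂ y) (D̂ z)))
            (trans (I₁.ip-cong (δ̂-lin s x t y) (λ _ → refl)) (I₁.ip-lin s t (δ̂ x) (δ̂ y) (δ̂ z))))
          (lemma s t c (R x z) (R y z) (P x z) (P y z)) }
      where
      lemma : ∀ s t c a b p q → (s * a + t * b) - c * (s * p + t * q) ≡ s * (a - c * p) + t * (b - c * q)
      lemma = solve 7 (λ s t c a b p q → (s :* a :+ t :* b) :- c :* (s :* p :+ t :* q) := s :* (a :- c :* p) :+ t :* (b :- c :* q)) refl

    -- Moving one coboundary across makes `x` enter through `δ̂ x` alone, so Cauchy-Schwarz for `P`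
    -- controls `R` too. This is what makes the pencil admissible.
    R-polar : ∀ x y → R x y ≡ I₁.ip (δ̂ x) (δ (D̂ y))
    R-polar x y = adjoint (δ̂ x) (D̂ y)

    admissible : ∀ c → Qf.Admissible P-form (Q-form c)
    admissible c = record
      { psd = λ x → I₁.ip-nonneg (δ̂ x)
      ; radical = λ x h y → trans (cong₂ (λ a b → a - c * b) (trans (R-polar x y) (I₁.ip-null (δ̂ x) (δ (D̂ y)) h)) (I₁.ip-null (δ̂ x) (δ̂ y) h))
          (lemma c) }
      where
      lemma : ∀ c → 0ℚ - c * 0ℚ ≡ 0ℚ
      lemma = solve 1 (λ c → :0 :- c :* :0 := :0) refl

    -- Rational lower and upper bounds for the minimum of R / P. At the minimum itself both hold, so
    -- they are not complementary, and `decide` returns one that is true.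
    Good Bad : ℚ → Set
    Good c = ∀ x → 0ℚ ≤ pencil c x x
    Bad c = Qf.Escapes P-form (Q-form c)

    decide : ∀ c → Good c ⊎ Bad c
    decide c with Qf.eliminate P-form (Q-form c) (admissible c)
    ... | inj₂ bad            = inj₂ bad
    ... | inj₁ (k , k>0 , h) = inj₁ λ x → 0≤*-cancel k>0 (subst (0ℚ ≤_) (lemma (k * pencil c x x) (P x x)) (0≤+ (h x) (I₁.ip-nonneg (δ̂ x))))
      where
      lemma : ∀ a b → (a - b) + b ≡ a
      lemma = solve 2 (λ a b → (a :- b) :+ b := a) refl

    good-0 : Good 0ℚ
    good-0 x = subst (0ℚ ≤_) (lemma (R x x) (P x x)) (I₂.ip-nonneg (D̂ x))
      where
      lemma : ∀ r p → r ≡ r - 0ℚ * p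
      lemma = solve 2 (λ r p → r := r :- :0 :* p) refl

    good≤bad : ∀ {a b} → Good a → Bad b → a ≤ b
    good≤bad {a} {b} good (x , p>0 , h) = 0≤-⇒≤ (0≤*-cancel p>0 (subst (0ℚ ≤_) (lemma (R x x) (P x x) a b) (0≤+ (good x) h)))
      where
      lemma : ∀ r p a b → (r - a * p) + - (r - b * p) ≡ p * (b - a)
      lemma = solve 4 (λ r p a b → (r :- a :* p) :+ :- (r :- b :* p) := p :* (b :- a)) refl

    bad-mono : ∀ {a b} → Bad a → a ≤ b → Bad b
    bad-mono {a} {b} (x , p>0 , h) a≤b = x , p>0 , subst (0ℚ ≤_) (lemma (R x x) (P x x) a b) (0≤+ h (0≤* (≤⇒0≤- a≤b) (ℚₚ.<⇒≤ p>0)))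
      where
      lemma : ∀ r p a b → - (r - a * p) + (b - a) * p ≡ - (r - b * p)
      lemma = solve 4 (λ r p a b → :- (r :- a :* p) :+ (b :- a) :* p := :- (r :- b :* p)) refl

    -- Walking up from a good value, the first bad value met closes an interval of length `q`. The
    -- bad value at the far end bounds the number of steps.
    search : ∀ q → 0ℚ ≤ q → ∀ steps c → Good c → Bad (c + nat steps * q) → ∃ λ l → Good l × Bad (l + q)
    search q 0≤q zero c good bad = c , good , bad-mono {c + nat 0 * q} {c + q} bad (difference q 0≤q (lemma c q))
      where
      lemma : ∀ c q → q ≡ (c + q) - (c + 0ℚ * q)
      lemma = solve 2 (λ c q → q := (c :+ q) :- (c :+ :0 :* q)) refl
    search q 0≤q (suc steps) c good bad with decide (c + q)
    ... | inj₂ b = c , good , b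
    ... | inj₁ g = search q 0≤q steps (c + q) g (subst Bad (trans (cong (λ r → c + r * q) (nat-+ 1 steps)) (lemma c q (nat steps))) bad)
      where
      lemma : ∀ c q s → c + (1ℚ + s) * q ≡ (c + q) + s * q
      lemma = solve 3 (λ c q s → c :+ (:1 :+ s) :* q := (c :+ q) :+ s :* q) refl

    module Threshold (c : ℕ) (bad-c : Bad (nat c)) where

      mesh : ℕ → ℚ
      mesh k = ratio 1 (suc k)

      0≤mesh : ∀ k → 0ℚ ≤ mesh k
      0≤mesh k = 0≤ratio 1 (suc k)

      nat-* : ∀ a b → nat (a ℕ.* b) ≡ nat a * nat b
      nat-* zero    b = sym (ℚₚ.*-zeroˡ (nat b))
      nat-* (suc a) b = trans (nat-+ b (a ℕ.* b)) (trans (cong (nat b +_) (nat-* a b))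
        (trans (lemma (nat a) (nat b)) (cong (_* nat b) (sym (nat-+ 1 a)))))
        where
        lemma : ∀ a b → b + a * b ≡ (1ℚ + a) * b
        lemma = solve 2 (λ a b → b :+ a :* b := (:1 :+ a) :* b) refl

      approximation : ∀ k → ∃ λ l → Good l × Bad (l + mesh k)
      -- `c * suc k` steps of length 1/(k + 1) lead from 0, which is good because `R` is
      -- semidefinite, to the bad value `c`.
      approximation k = search (mesh k) (0≤mesh k) (c ℕ.* suc k) 0ℚ good-0 (subst Bad (sym total) bad-c)
        where
        total : 0ℚ + nat (c ℕ.* suc k) * mesh k ≡ nat c
        total = trans (ℚₚ.+-identityˡ _) (trans (cong (_* mesh k) (nat-* c (suc k))) (trans (ℚₚ.*-assoc (nat c) (nat (suc k)) (mesh k))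
          (trans (cong (nat c *_) (trans (ℚₚ.*-comm (nat (suc k)) (mesh k)) (ratio-* 1 k))) (ℚₚ.*-identityʳ (nat c)))))

      approx : ℕ → ℚ
      approx k = proj₁ (approximation k)

      good : ∀ k → Good (approx k)
      good k = proj₁ (proj₂ (approximation k))

      bad : ∀ k → Bad (approx k + mesh k)
      bad k = proj₂ (proj₂ (approximation k))

      -- A good value never exceeds a bad one. Used with both orders of the indices, this bounds the
      -- distance of two approximations by their meshes without comparing the searches that produced
      -- them.
      approx-≤ : ∀ j k → approx j ≤ approx k + mesh k
      approx-≤ j k = good≤bad (good j) (bad k)

      abstract
        approx-cauchy : Real.Cauchy approx
        approx-cauchy ε ε>0 = N , λ j k p q → abs-≤
            (subst (0ℚ ≤_) (lemma₁ (approx j) (approx k) (mesh k) ε) (0≤+ (≤⇒0≤- (approx-≤ j k)) (≤⇒0≤- (mesh≤ k q))))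
            (subst (0ℚ ≤_) (lemma₂ (approx j) (approx k) (mesh j) ε) (0≤+ (≤⇒0≤- (approx-≤ k j)) (≤⇒0≤- (mesh≤ j p))))
          where
          N : ℕ
          N = proj₁ (archimedean (0< ε ε>0))
          mesh≤ : ∀ m → N ℕ.≤ m → mesh m ≤ ε
          mesh≤ = proj₂ (archimedean (0< ε ε>0))
          lemma₁ : ∀ a b m e → ((b + m) - a) + (e - m) ≡ e - (a - b)
          lemma₁ = solve 4 (λ a b m e → ((b :+ m) :- a) :+ (e :- m) := e :- (a :- b)) refl
          lemma₂ : ∀ a b m e → ((a + m) - b) + (e - m) ≡ e + (a - b)
          lemma₂ = solve 4 (λ a b m e → ((a :+ m) :- b) :+ (e :- m) := e :+ (a :- b)) refl

      μ : ℝ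
      μ = Real.mkℝ approx approx-cauchy

      μ≤c : μ ≤ᴿ fromℕ c
      μ≤c ε ε>0 = always λ k → ℚₚ.≤-trans (good≤bad (good k) bad-c)
        (difference ε (ℚₚ.<⇒≤ (0< ε ε>0)) (solve 2 (λ c e → e := (c :+ e) :- c) refl (nat c) ε))

      Q-at : ∀ m x y → seq (Rᴿ x y +ᴿ -ᴿ (μ *ᴿ Pᴿ x y)) m ≡ pencil (approx m) (at m x) (at m y)
      Q-at m x y = cong₂ (λ a b → a - approx m * b) (R-at m x y) (P-at m x y)

      -- The rational form may vary with the index: the pencil at `μ` is represented at index `m` by
      -- the pencil at `approx m`. Symmetry and linearity hold at each index, whereas compatibility
      -- with `≃` has to be given separately.
      form : (B : ℕ → Qf.SymmetricForm dim) (Bᴿ : (Fin dim → ℝ) → (Fin dim → ℝ) → ℝ) →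
        (∀ m x y → seq (Bᴿ x y) m ≡ Qf.SymmetricForm.⟪_,_⟫ (B m) (at m x) (at m y)) →
        (∀ {x x′ y y′} → (∀ a → x a ≃ x′ a) → (∀ a → y a ≃ y′ a) → Bᴿ x y ≃ Bᴿ x′ y′) → Rf.SymmetricForm dim
      form B Bᴿ B-at B-cong = record
        { ⟪_,_⟫ = Bᴿ
        ; respects = λ {x} {x′} {y} {y′} → B-cong {x} {x′} {y} {y′}
        ; symm = λ x y → pointwise⇒≃ (Bᴿ x y) (Bᴿ y x) λ m →
            trans (B-at m x y) (trans (Qf.SymmetricForm.symm (B m) (at m x) (at m y)) (sym (B-at m y x)))
        ; linˡ = λ s x t y z → pointwise⇒≃ (Bᴿ (Rf.comb s x t y) z) (s *ᴿ Bᴿ x z +ᴿ t *ᴿ Bᴿ y z) λ m →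
            trans (B-at m (Rf.comb s x t y) z) (trans (Qf.SymmetricForm.linˡ (B m) (seq s m) (at m x) (seq t m) (at m y) (at m z))
              (sym (cong₂ (λ a b → seq s m * a + seq t m * b) (B-at m x z) (B-at m y z)))) }

      P-formᴿ Q-formᴿ : Rf.SymmetricForm dim
      P-formᴿ = form (λ _ → P-form) Pᴿ P-at (λ {x} {x′} {y} {y′} p q →
        I₁.ipᴿ-cong {δ̂ᴿ x} {δ̂ᴿ x′} {δ̂ᴿ y} {δ̂ᴿ y′} (δ̂ᴿ-cong {x} {x′} p) (δ̂ᴿ-cong {y} {y′} q))
      Q-formᴿ = form (λ m → Q-form (approx m)) (λ x y → Rᴿ x y +ᴿ -ᴿ (μ *ᴿ Pᴿ x y)) Q-at (λ {x} {x′} {y} {y′} p q →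
        +ᴿ-cong {Rᴿ x y} {Rᴿ x′ y′} { -ᴿ (μ *ᴿ Pᴿ x y)} { -ᴿ (μ *ᴿ Pᴿ x′ y′)}
          (I₂.ipᴿ-cong {D̂ᴿ x} {D̂ᴿ x′} {D̂ᴿ y} {D̂ᴿ y′} (D̂ᴿ-cong {x} {x′} p) (D̂ᴿ-cong {y} {y′} q))
          (-ᴿ-cong {μ *ᴿ Pᴿ x y} {μ *ᴿ Pᴿ x′ y′} (*ᴿ-congˡ μ {Pᴿ x y} {Pᴿ x′ y′}
            (Rf.SymmetricForm.respects P-formᴿ {x} {x′} {y} {y′} p q))))

      module Pᶠ = Rf.SymmetricForm P-formᴿ
      module Qᶠ = Rf.SymmetricForm Q-formᴿ

      -- Every `approx m` is good, so positivity holds at each index and no limit argument is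
      -- involved.
      Q-psd : ∀ x → NonNegative Qᶠ.⟪ x , x ⟫
      Q-psd x = pointwise⇒nn {Qᶠ.⟪ x , x ⟫} λ m → subst (0ℚ ≤_) (sym (Q-at m x x)) (good m (at m x))

      admissibleᴿ : Rf.Admissible P-formᴿ Q-formᴿ
      admissibleᴿ = record
        { psd = λ x → pointwise⇒nn {Pᴿ x x} λ m → subst (0ℚ ≤_) (sym (P-at m x x)) (I₁.ip-nonneg (δ̂ (at m x)))
        ; radical = λ x h y → ≃-trans {Qᶠ.⟪ x , y ⟫} {I₁.ipᴿ (δ̂ᴿ x) (v y)} {0ᴿ}
            (pointwise⇒≃ Qᶠ.⟪ x , y ⟫ (I₁.ipᴿ (δ̂ᴿ x) (v y)) (λ m → polar m x y)) (I₁.ipᴿ-null (δ̂ᴿ x) (v y) h) }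
        where
        v : (Fin dim → ℝ) → Subset n → ℝ
        v y σ = δᴿ (D̂ᴿ y) σ +ᴿ -ᴿ (μ *ᴿ δ̂ᴿ y σ)
        v-at : ∀ m y σ → at m (v y) σ ≡ 1ℚ * δ (D̂ (at m y)) σ + - approx m * δ̂ (at m y) σ
        v-at m y σ = trans (cong₂ (λ a b → a - approx m * b) (trans (opᴿ-at δ-kernel ins (D̂ᴿ y) σ m) (op-cong δ-kernel ins (D̂-at m y) σ)) (δ̂-at m y σ))
          (solve 3 (λ a b c → a :- c :* b := :1 :* a :+ :- c :* b) refl (δ (D̂ (at m y)) σ) (δ̂ (at m y) σ) (approx m))
        polar : ∀ m x y → seq Qᶠ.⟪ x , y ⟫ m ≡ seq (I₁.ipᴿ (δ̂ᴿ x) (v y)) m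
        polar m x y = trans (Q-at m x y) (sym (begin
          seq (I₁.ipᴿ (δ̂ᴿ x) (v y)) m                        ≡⟨ I₁.ipᴿ-at (δ̂ᴿ x) (v y) m ⟩
          I₁.ip (at m (δ̂ᴿ x)) (at m (v y))                   ≡⟨ I₁.ip-cong (δ̂-at m x) (v-at m y) ⟩
          I₁.ip X (λ σ → 1ℚ * δ (D̂ Y) σ + - c′ * δ̂ Y σ)      ≡⟨ I₁.ip-sym X (λ σ → 1ℚ * δ (D̂ Y) σ + - c′ * δ̂ Y σ) ⟩
          I₁.ip (λ σ → 1ℚ * δ (D̂ Y) σ + - c′ * δ̂ Y σ) X      ≡⟨ I₁.ip-lin 1ℚ (- c′) (δ (D̂ Y)) (δ̂ Y) X ⟩
          1ℚ * I₁.ip (δ (D̂ Y)) X + - c′ * I₁.ip (δ̂ Y) X      ≡⟨ cong₂ (λ a b → 1ℚ * a + - c′ * b)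
            (trans (I₁.ip-sym (δ (D̂ Y)) X) (sym (R-polar (at m x) Y))) (I₁.ip-sym (δ̂ Y) X) ⟩
          1ℚ * R (at m x) Y + - c′ * P (at m x) Y            ≡⟨ solve 3 (λ a b c → :1 :* a :+ :- c :* b := a :- c :* b) refl (R (at m x) Y) (P (at m x) Y) c′ ⟩
          pencil c′ (at m x) Y ∎))
          where
          open ≡-Reasoning
          X = δ̂ (at m x)
          Y = at m y
          c′ = approx m

      -- Bad values come arbitrarily close to `μ`. On their witnesses the pencil at `μ` is small
      -- compared with `P`, and no constant `k` can make up for that.
      ¬dominates : ¬ Rf.Dominates P-formᴿ Q-formᴿ
      ¬dominates (k , k>0 , dom) = ℚₚ.<-irrefl refl (ℚₚ.<-≤-trans (0<* (ℚₚ.positive⁻¹ ½) (0<* (ℚₚ.positive⁻¹ ½) p>0)) contra)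
        where
        κ = proj₁ (bounded k)
        κ>0 = proj₁ (proj₂ (bounded k))
        κ⁻¹ = inverse κ>0
        -- θ = 1/(4κ), where κ bounds `k`. From index `N` on the meshes are at most θ, so the pencil
        -- at `approx m` takes at most the value 2θ p on the witness `x`.
        θ = ½ * ½ * proj₁ κ⁻¹
        θ>0 : 0ℚ < θ
        θ>0 = 0<* (0<* (ℚₚ.positive⁻¹ ½) (ℚₚ.positive⁻¹ ½)) (proj₁ (proj₂ κ⁻¹))
        κθ : κ * θ ≡ ½ * ½
        κθ = trans (lemma κ (proj₁ κ⁻¹) (½ * ½)) (trans (cong (½ * ½ *_) (proj₂ (proj₂ κ⁻¹))) (ℚₚ.*-identityʳ (½ * ½)))
          where
          lemma : ∀ k q h → k * (h * q) ≡ h * (q * k)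
          lemma = solve 3 (λ k q h → k :* (h :* q) := h :* (q :* k)) refl
        N = proj₁ (archimedean θ>0)
        mesh≤θ : ∀ m → N ℕ.≤ m → mesh m ≤ θ
        mesh≤θ = proj₂ (archimedean θ>0)
        x = proj₁ (bad N)
        p = P x x
        r = R x x
        p>0 : 0ℚ < p
        p>0 = proj₁ (proj₂ (bad N))
        xᴿ : Fin dim → ℝ
        xᴿ a = fromℚ (x a)
        ε = ½ * (½ * p)
        ε>0 : 0ℚ < ε
        ε>0 = 0<* (ℚₚ.positive⁻¹ ½) (0<* (ℚₚ.positive⁻¹ ½) p>0)

        -- p ≤ k (r - μ p) + ε ≤ κ (2 θ p) + ε = 3 p / 4.
        bound : ∀ m → N ℕ.≤ m → abs (seq k m) ≤ κ → 0ℚ ≤ seq (k *ᴿ Qᶠ.⟪ xᴿ , xᴿ ⟫ +ᴿ -ᴿ Pᴿ xᴿ xᴿ) m + ε → ε ≤ 0ℚ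
        bound m N≤m k≤ h = difference _
          (0≤+ (0≤+ (0≤+ h′ (0≤* (abs-upper k≤) (good m x))) (0≤* (ℚₚ.<⇒≤ κ>0) (proj₂ (proj₂ (bad N)))))
            (0≤* (0≤* (ℚₚ.<⇒≤ κ>0) (ℚₚ.<⇒≤ p>0))
              (0≤+ (0≤+ (≤⇒0≤- (approx-≤ N m)) (≤⇒0≤- (mesh≤θ m N≤m))) (≤⇒0≤- (mesh≤θ N ℕₚ.≤-refl)))))
          (trans (lemma₁ (seq k m) κ r p (approx m) (approx N) (mesh m) (mesh N) θ ε)
            (trans (cong (λ z → (z + z) * p - p + ε) κθ) (lemma₂ p)))
          where
          h′ : 0ℚ ≤ (seq k m * pencil (approx m) x x - p) + ε
          h′ = subst (0ℚ ≤_) (cong₂ (λ a b → (seq k m * a - b) + ε) (Q-at m xᴿ xᴿ) (P-at m xᴿ xᴿ)) h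
          lemma₁ : ∀ k κ r p a b s t θ ε → ((k * (r - a * p) - p) + ε) + (κ - k) * (r - a * p) + κ * - (r - (b + t) * p)
              + (κ * p) * (((a + s) - b) + (θ - s) + (θ - t)) ≡ (κ * θ + κ * θ) * p - p + ε
          lemma₁ = solve 10 (λ k κ r p a b s t θ ε → ((k :* (r :- a :* p) :- p) :+ ε) :+ (κ :- k) :* (r :- a :* p) :+ κ :* :- (r :- (b :+ t) :* p)
              :+ (κ :* p) :* (((a :+ s) :- b) :+ (θ :- s) :+ (θ :- t)) := (κ :* θ :+ κ :* θ) :* p :- p :+ ε) refl
          lemma₂ : ∀ p → (½ * ½ + ½ * ½) * p - p + ½ * (½ * p) ≡ 0ℚ - ½ * (½ * p)
          lemma₂ p = trans (cong (λ h → (½ * ½ + ½ * ½) * p - h + ½ * (½ * p)) quarters) (ring ½ p)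
            where
            quarters : p ≡ ((½ * ½ + ½ * ½) + (½ * ½ + ½ * ½)) * p
            quarters = sym (ℚₚ.*-identityˡ p)
            ring : ∀ h p → (h * h + h * h) * p - ((h * h + h * h) + (h * h + h * h)) * p + h * (h * p) ≡ 0ℚ - h * (h * p)
            ring = solve 2 (λ h p → (h :* h :+ h :* h) :* p :- ((h :* h :+ h :* h) :+ (h :* h :+ h :* h)) :* p :+ h :* (h :* p) := :0 :- h :* (h :* p)) refl

        contra : ε ≤ 0ℚ
        contra = proj₂ both (proj₁ both) ℕₚ.≤-refl
          where
          both : Real.Eventually (λ _ → ε ≤ 0ℚ)
          both = eventually₂ (λ m (N≤m , k≤) h → bound m N≤m k≤ h)
            (eventually₂ (λ _ → _,_) (N , λ _ q → q) (proj₂ (proj₂ (bounded k)))) (dom xᴿ ε (Rat.positive ε>0))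

-- Eigenvectors at the threshold

module Eigenvectors {n : ℕ} (w : Subset n → ℕ) (w-mono : ∀ v σ → w σ ≡ 0 → w (SubsetSums.ins v σ) ≡ 0)
  (η : Fin n → Subset n → ℚ) (K c : ℕ) (bad-c : Spectral.Degree.Bad w w-mono η K (Rationals.nat c)) where

  open Rationals
  open Sums
  open SubsetSums
  open Reals
  open ℝ
  open Coordinates
  open Spectral w w-mono η
  open Degree K
  open Threshold c bad-c

  -- A non-zero weight stands for being a simplex: in the building the weight counts the chambers
  -- around a set, and every simplex lies in one.
  IsSimplexOfDegree : Subset n → Set
  IsSimplexOfDegree σ = ∣ σ ∣ ≡ K × w σ ≢ 0

  Eigenvector : (Subset n → ℝ) → Set
  Eigenvector u = (∀ σ → IsSimplexOfDegree σ → δᴿ (Dᴿ u) σ ≃ μ *ᴿ u σ)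
                × ¬ (∀ σ → IsSimplexOfDegree σ → u σ ≃ 0ᴿ)

  ¬pos-0 : ∀ {x} → x ≃ 0ᴿ → ¬ Pos x
  ¬pos-0 {x} x≃0 (c , c>0 , h) = ℚₚ.<-irrefl refl (ℚₚ.<-≤-trans (0<* (ℚₚ.positive⁻¹ ½) c>0) (proj₂ both (proj₁ both) ℕₚ.≤-refl))
    where
    step-≤ : ∀ m → c ≤ seq x m → abs (seq x m - 0ℚ) ≤ ½ * c → ½ * c ≤ 0ℚ
    step-≤ m p q = difference _ (0≤+ (≤⇒0≤- p) (abs-upper q))
      (trans (cong (λ r → (seq x m - r) + (½ * c - (seq x m - 0ℚ))) (sym (½+½ c))) (lemma (seq x m) (½ * c)))
      where
      lemma : ∀ a e → (a - (e + e)) + (e - (a - 0ℚ)) ≡ 0ℚ - e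
      lemma = solve 2 (λ a e → (a :- (e :+ e)) :+ (e :- (a :- :0)) := :0 :- e) refl
    both : Real.Eventually (λ _ → ½ * c ≤ 0ℚ)
    both = eventually₂ step-≤ h (x≃0 (½ * c) (Rat.positive (0<* (ℚₚ.positive⁻¹ ½) c>0)))

  module FromEscape (x : Fin dim → ℝ) (p>0 : Pos (Pᴿ x x)) (q≤0 : NonNegative (-ᴿ Qᶠ.⟪ x , x ⟫)) where

    u : Subset n → ℝ
    u = δ̂ᴿ x

    residual : Subset n → ℝ
    residual σ = δᴿ (Dᴿ u) σ +ᴿ -ᴿ (μ *ᴿ u σ)

    -- Semidefiniteness makes the null vector `x` orthogonal to everything. Testing against this
    -- particular vector turns orthogonality into the vanishing of the norm of the residual.
    y : Fin dim → ℝ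
    y a = Dᴿ u (unindex {n} a) +ᴿ -ᴿ (μ *ᴿ x (index (unindex {n} a)))

    -- Q x y = ⟨residual, δ ŷ⟩ and δ ŷ = residual.
    Q-residual : Qᶠ.⟪ x , y ⟫ ≃ I₁.ipᴿ residual residual
    Q-residual = pointwise⇒≃ Qᶠ.⟪ x , y ⟫ (I₁.ipᴿ residual residual) λ m → trans (Q-at m x y) (sym (trans (I₁.ipᴿ-at residual residual m) (sym (rational m))))
      where
      module _ (m : ℕ) where
        c′ = approx m
        X = at m x
        v : Subset n → ℚ
        v σ = 1ℚ * δ (D (δ̂ X)) σ + - c′ * δ̂ X σ
        residual-at : ∀ σ → at m residual σ ≡ v σ
        residual-at σ = trans (cong₂ (λ a b → a - c′ * b) (trans (opᴿ-at δ-kernel ins (Dᴿ u) σ m) (op-cong δ-kernel ins (D̂-at m x) σ)) (δ̂-at m x σ))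
          (solve 3 (λ a b c → a :- c :* b := :1 :* a :+ :- c :* b) refl (δ (D (δ̂ X)) σ) (δ̂ X σ) c′)
        y-at : ∀ σ → at m y (index σ) ≡ 1ℚ * D̂ X σ + - c′ * X (index σ)
        y-at σ = trans (cong (λ τ → seq (Dᴿ u τ) m - c′ * X (index τ)) (unindex-index σ))
          (trans (cong (_- c′ * X (index σ)) (D̂-at m x σ)) (solve 3 (λ a b c → a :- c :* b := :1 :* a :+ :- c :* b) refl (D̂ X σ) (X (index σ)) c′))
        δy : ∀ σ → δ̂ (at m y) σ ≡ v σ
        δy σ = trans (op-cong δ-kernel ins y-at σ) (op-lin δ-kernel ins 1ℚ (- c′) (D̂ X) (X ∘ index) σ)
        open ≡-Reasoning
        rational : pencil c′ X (at m y) ≡ I₁.ip (at m residual) (at m residual)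
        rational = begin
          R X (at m y) - c′ * P X (at m y)
            ≡⟨ cong₂ (λ a b → a - c′ * b)
                 (trans (I₂.ip-sym (D̂ X) (D̂ (at m y))) (trans (adjoint (δ̂ (at m y)) (D̂ X)) (I₁.ip-sym (δ̂ (at m y)) (δ (D̂ X))))) refl ⟩
          I₁.ip (δ (D̂ X)) (δ̂ (at m y)) - c′ * I₁.ip (δ̂ X) (δ̂ (at m y))
            ≡⟨ solve 3 (λ a b c → a :- c :* b := :1 :* a :+ :- c :* b) refl (I₁.ip (δ (D̂ X)) (δ̂ (at m y))) (I₁.ip (δ̂ X) (δ̂ (at m y))) c′ ⟩
          1ℚ * I₁.ip (δ (D̂ X)) (δ̂ (at m y)) + - c′ * I₁.ip (δ̂ X) (δ̂ (at m y))
            ≡⟨ I₁.ip-lin 1ℚ (- c′) (δ (D̂ X)) (δ̂ X) (δ̂ (at m y)) ⟨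
          I₁.ip v (δ̂ (at m y))
            ≡⟨ I₁.ip-cong (λ σ → sym (residual-at σ)) (λ σ → trans (δy σ) (sym (residual-at σ))) ⟩
          I₁.ip (at m residual) (at m residual) ∎

    residual-null : I₁.ipᴿ residual residual ≃ 0ᴿ
    residual-null = ≃-trans {I₁.ipᴿ residual residual} {Qᶠ.⟪ x , y ⟫} {0ᴿ}
      (≃-sym {Qᶠ.⟪ x , y ⟫} {I₁.ipᴿ residual residual} Q-residual) (Rf.orthogonal Q-formᴿ Q-psd x q≤0 y)

    -- Each summand of the norm is bounded by the whole norm, which is null, and the weight of a
    -- simplex is positive and can be cancelled.
    residual-0 : ∀ σ → IsSimplexOfDegree σ → residual σ ≃ 0ᴿ
    residual-0 σ (∣σ∣≡K , w≢0) = sq-0 {residual σ} (nn-cancel {fromℚ W} { -ᴿ (residual σ *ᴿ residual σ)}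
        (W , W>0 , always (λ _ → ℚₚ.≤-refl))
        (nn-resp {difference′ +ᴿ -ᴿ I₁.ipᴿ residual residual} {fromℚ W *ᴿ -ᴿ (residual σ *ᴿ residual σ)}
          (pointwise⇒≃ (difference′ +ᴿ -ᴿ I₁.ipᴿ residual residual) (fromℚ W *ᴿ -ᴿ (residual σ *ᴿ residual σ)) λ m → lemma (seq (I₁.ipᴿ residual residual) m) W (seq (residual σ) m))
          (nn-+ {difference′} { -ᴿ I₁.ipᴿ residual residual}
            (pointwise⇒nn {difference′} λ m → subst (λ r → 0ℚ ≤ r - W * (seq (residual σ) m * seq (residual σ) m)) (sym (I₁.ipᴿ-at residual residual m))
              (≤⇒0≤- (I₁.ip-term (at m residual) (∈subsets σ))))
            (nn-resp {0ᴿ} { -ᴿ I₁.ipᴿ residual residual} (≃-trans {0ᴿ} { -ᴿ 0ᴿ} { -ᴿ I₁.ipᴿ residual residual}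
                (pointwise⇒≃ 0ᴿ (-ᴿ 0ᴿ) (λ _ → refl))
                (-ᴿ-cong {0ᴿ} {I₁.ipᴿ residual residual} (≃-sym {I₁.ipᴿ residual residual} {0ᴿ} residual-null)))
              (pointwise⇒nn {0ᴿ} (λ _ → ℚₚ.≤-refl))))))
      where
      W = weight K σ
      W>0 : 0ℚ < W
      W>0 = subst (0ℚ <_) (sym ([yes]* (∣ σ ∣ ℕₚ.≟ K) (nat (w σ)) ∣σ∣≡K)) (positive-w (w σ) w≢0)
        where
        positive-w : ∀ a → a ≢ 0 → 0ℚ < nat a
        positive-w zero    h = contradiction refl h
        positive-w (suc a) _ = 0<nat a
      difference′ = I₁.ipᴿ residual residual +ᴿ -ᴿ (fromℚ W *ᴿ (residual σ *ᴿ residual σ))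
      lemma : ∀ i w r → (i - w * (r * r)) - i ≡ w * - (r * r)
      lemma = solve 3 (λ i w r → (i :- w :* (r :* r)) :- i := w :* :- (r :* r)) refl

    eigenvector : Eigenvector u
    eigenvector = (λ σ s → equation σ (residual-0 σ s)) , λ vanishes → ¬pos-0 {Pᴿ x x} (null vanishes) p>0
      where
      equation : ∀ σ → residual σ ≃ 0ᴿ → δᴿ (Dᴿ u) σ ≃ μ *ᴿ u σ
      equation σ h = ≃-by {δᴿ (Dᴿ u) σ} {μ *ᴿ u σ} (residual σ) 0ᴿ 0ᴿ 0ᴿ h (≃-refl {0ᴿ})
        λ m → solve 2 (λ a b → a :- b := ((a :- b) :- :0) :+ (:0 :- :0)) refl (seq (δᴿ (Dᴿ u) σ) m) (approx m * seq (u σ) m)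
      null : (∀ σ → IsSimplexOfDegree σ → u σ ≃ 0ᴿ) → Pᴿ x x ≃ 0ᴿ
      null vanishes = ≃-trans {Pᴿ x x} {sumᴿ (λ _ → 0ᴿ) (subsets n)} {0ᴿ}
        (sumᴿ-cong (subsets n) {λ σ → fromℚ (weight K σ) *ᴿ (u σ *ᴿ u σ)} {λ _ → 0ᴿ} term)
        (pointwise⇒≃ (sumᴿ (λ _ → 0ᴿ) (subsets n)) 0ᴿ (λ m → trans (seq-sum (subsets n) (λ _ → 0ᴿ) m) (Σ-0 (subsets n) (λ _ → refl))))
        where
        weighted : ∀ c σ → u σ ≃ 0ᴿ → fromℚ c *ᴿ (u σ *ᴿ u σ) ≃ 0ᴿ
        weighted c σ h = ≃-trans {fromℚ c *ᴿ (u σ *ᴿ u σ)} {fromℚ c *ᴿ (0ᴿ *ᴿ 0ᴿ)} {0ᴿ}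
          (*ᴿ-congˡ (fromℚ c) {u σ *ᴿ u σ} {0ᴿ *ᴿ 0ᴿ} (*ᴿ-cong {u σ} {0ᴿ} {u σ} {0ᴿ} h h))
          (pointwise⇒≃ (fromℚ c *ᴿ (0ᴿ *ᴿ 0ᴿ)) 0ᴿ λ m → ℚₚ.*-zeroʳ c)
        zero-weight : ∀ c σ → c ≡ 0ℚ → fromℚ c *ᴿ (u σ *ᴿ u σ) ≃ 0ᴿ
        zero-weight c σ c≡0 = pointwise⇒≃ (fromℚ c *ᴿ (u σ *ᴿ u σ)) 0ᴿ λ m →
          trans (cong (_* (seq (u σ) m * seq (u σ) m)) c≡0) (ℚₚ.*-zeroˡ (seq (u σ) m * seq (u σ) m))
        by-cases : ∀ σ → Dec (∣ σ ∣ ≡ K) → Dec (w σ ≡ 0) → fromℚ (weight K σ) *ᴿ (u σ *ᴿ u σ) ≃ 0ᴿ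
        by-cases σ (no size)  _         = zero-weight (weight K σ) σ ([no]* (∣ σ ∣ ℕₚ.≟ K) (nat (w σ)) size)
        by-cases σ (yes _)    (yes w≡0) = zero-weight (weight K σ) σ
          (trans (cong (λ a → [ ∣ σ ∣ ℕₚ.≟ K ] * nat a) w≡0) (ℚₚ.*-zeroʳ [ ∣ σ ∣ ℕₚ.≟ K ]))
        by-cases σ (yes size) (no w≢0)  = weighted (weight K σ) σ (vanishes σ (size , w≢0))
        term : ∀ σ → fromℚ (weight K σ) *ᴿ (u σ *ᴿ u σ) ≃ 0ᴿ
        term σ = by-cases σ (∣ σ ∣ ℕₚ.≟ K) (w σ ℕₚ.≟ 0)

    -- If μ vanished then D u would be null, hence orthogonal to x, while ⟨D u, x⟩ = P x x.
    μ-nonzero : ¬ (μ ≃ 0ᴿ)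
    μ-nonzero μ≃0 = ¬pos-0 {Pᴿ x x} (≃-trans {Pᴿ x x} {I₂.ipᴿ (Dᴿ u) (x ∘ index)} {0ᴿ}
        (≃-trans {Pᴿ x x} {I₁.ipᴿ u (δᴿ (x ∘ index))} {I₂.ipᴿ (Dᴿ u) (x ∘ index)} (≃-refl {Pᴿ x x})
          (≃-sym {I₂.ipᴿ (Dᴿ u) (x ∘ index)} {I₁.ipᴿ u (δᴿ (x ∘ index))} (adjointᴿ u (x ∘ index))))
        (I₂.ipᴿ-null (Dᴿ u) (x ∘ index) R≤0)) p>0
      where
      R≤0 : NonNegative (-ᴿ Rᴿ x x)
      R≤0 = nn-resp { -ᴿ Qᶠ.⟪ x , x ⟫ } { -ᴿ Rᴿ x x}
        (≃-by { -ᴿ Qᶠ.⟪ x , x ⟫ } { -ᴿ Rᴿ x x} (μ *ᴿ Pᴿ x x) 0ᴿ (0ᴿ *ᴿ Pᴿ x x) 0ᴿ (*ᴿ-cong {μ} {0ᴿ} {Pᴿ x x} {Pᴿ x x} μ≃0 (≃-refl {Pᴿ x x})) (≃-refl {0ᴿ})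
          λ m → solve 3 (λ r a p → :- (r :- a :* p) :- :- r := (a :* p :- :0 :* p) :+ (:0 :- :0)) refl (seq (Rᴿ x x) m) (approx m) (seq (Pᴿ x x) m))
        q≤0

  threshold : ¬ ¬ (¬ (μ ≃ 0ᴿ) × ∃ Eigenvector)
  threshold k = Rf.eliminate P-formᴿ Q-formᴿ admissibleᴿ λ
    { (inj₁ dom) → ¬dominates dom
    ; (inj₂ (x , p>0 , q≤0)) → let open FromEscape x p>0 q≤0 in k (μ-nonzero , u , eigenvector) }

-- Tits systems

module GroupSolver {c ℓ} (G : Group c ℓ) where

  open Group G renaming (refl to ≈-refl; sym to ≈-sym; trans to ≈-trans)
  open import Algebra.Properties.Group G using (ε⁻¹≈ε; ⁻¹-anti-homo-∙; ⁻¹-involutive)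
  open import Relation.Binary.Reasoning.Setoid setoid

  infixl 7 _:∙_
  infix 8 :inv_

  data Expr (n : ℕ) : Set where
    var   : Fin n → Expr n
    :ε    : Expr n
    _:∙_  : Expr n → Expr n → Expr n
    :inv_ : Expr n → Expr n

  ⟦_⟧ : ∀ {n} → Expr n → Vec Carrier n → Carrier
  ⟦ var i ⟧ ρ    = lookup ρ i
  ⟦ :ε ⟧ ρ       = ε
  ⟦ e :∙ f ⟧ ρ   = ⟦ e ⟧ ρ ∙ ⟦ f ⟧ ρ
  ⟦ :inv e ⟧ ρ   = (⟦ e ⟧ ρ) ⁻¹

  private
    Word : ℕ → Set
    Word n = List (Bool × Fin n)

    letter : ∀ {n} → Bool → Fin n → Vec Carrier n → Carrier
    letter true  i ρ = lookup ρ i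
    letter false i ρ = (lookup ρ i) ⁻¹

    value : ∀ {n} → Word n → Vec Carrier n → Carrier
    value []            ρ = ε
    value ((b , i) ∷ w) ρ = letter b i ρ ∙ value w ρ

    push : ∀ {n} → Bool → Fin n → Word n → Word n
    push b     i [] = (b , i) ∷ []
    push true  i ((true , j) ∷ w)  = (true , i) ∷ (true , j) ∷ w
    push false i ((false , j) ∷ w) = (false , i) ∷ (false , j) ∷ w
    push true  i ((false , j) ∷ w) with i Finₚ.≟ j
    ... | yes _ = w
    ... | no  _ = (true , i) ∷ (false , j) ∷ w
    push false i ((true , j) ∷ w) with i Finₚ.≟ j
    ... | yes _ = w
    ... | no  _ = (false , i) ∷ (true , j) ∷ w

    push-correct : ∀ {n} b (i : Fin n) w ρ → value (push b i w) ρ ≈ letter b i ρ ∙ value w ρ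
    push-correct b     i [] ρ = ≈-refl
    push-correct true  i ((true , j) ∷ w)  ρ = ≈-refl
    push-correct false i ((false , j) ∷ w) ρ = ≈-refl
    push-correct true  i ((false , j) ∷ w) ρ with i Finₚ.≟ j
    ... | no  _      = ≈-refl
    ... | yes refl = ≈-sym (≈-trans (≈-sym (assoc _ _ _)) (≈-trans (∙-congʳ (inverseʳ _)) (identityˡ _)))
    push-correct false i ((true , j) ∷ w) ρ with i Finₚ.≟ j
    ... | no  _      = ≈-refl
    ... | yes refl = ≈-sym (≈-trans (≈-sym (assoc _ _ _)) (≈-trans (∙-congʳ (inverseˡ _)) (identityˡ _)))

    -- The Boolean records whether the expression or its inverse is being read, so inverses reach
    -- the letters in one pass and products under them are reversed.
    expand : ∀ {n} → Bool → Expr n → Word n → Word n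
    expand b     (var i)   w = push b i w
    expand b     :ε        w = w
    expand true  (e :∙ f)  w = expand true e (expand true f w)
    expand false (e :∙ f)  w = expand false f (expand false e w)
    expand true  (:inv e)  w = expand false e w
    expand false (:inv e)  w = expand true e w

    signed : ∀ {n} → Bool → Expr n → Vec Carrier n → Carrier
    signed true  e ρ = ⟦ e ⟧ ρ
    signed false e ρ = (⟦ e ⟧ ρ) ⁻¹

    expand-correct : ∀ {n} b (e : Expr n) w ρ → value (expand b e w) ρ ≈ signed b e ρ ∙ value w ρ
    expand-correct true  (var i)  w ρ = push-correct true i w ρ
    expand-correct false (var i)  w ρ = push-correct false i w ρ
    expand-correct true  :ε       w ρ = ≈-sym (identityˡ _)
    expand-correct false :ε       w ρ = ≈-sym (≈-trans (∙-congʳ ε⁻¹≈ε) (identityˡ _))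
    expand-correct true  (e :∙ f) w ρ = ≈-trans (expand-correct true e _ ρ) (≈-trans (∙-congˡ (expand-correct true f w ρ)) (≈-sym (assoc _ _ _)))
    expand-correct false (e :∙ f) w ρ = ≈-trans (expand-correct false f _ ρ) (≈-trans (∙-congˡ (expand-correct false e w ρ))
      (≈-trans (≈-sym (assoc _ _ _)) (∙-congʳ (≈-sym (⁻¹-anti-homo-∙ _ _)))))
    expand-correct true  (:inv e) w ρ = expand-correct false e w ρ
    expand-correct false (:inv e) w ρ = ≈-trans (expand-correct true e w ρ) (∙-congʳ (≈-sym (⁻¹-involutive _)))

  ⟦_⇓⟧ : ∀ {n} → Expr n → Vec Carrier n → Carrier
  ⟦ e ⇓⟧ ρ = value (expand true e []) ρ

  private
    correct : ∀ {n} (e : Expr n) ρ → ⟦ e ⇓⟧ ρ ≈ ⟦ e ⟧ ρ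
    correct e ρ = ≈-trans (expand-correct true e [] ρ) (identityʳ _)

  open Relation.Binary.Reflection setoid var ⟦_⟧ ⟦_⇓⟧ correct public using (solve) renaming (_⊜_ to _:=_)

module Bruhat {c e} {G : FiniteGroup c e} {r : ℕ} (𝒯 : TitsSystem G r) where

  open FiniteGroup G renaming (refl to ≈-refl; sym to ≈-sym; trans to ≈-trans)
  open TitsSystem 𝒯
  open import Data.Nat.Base using (_≤_)
  open import Data.List.Base using ([_])
  open GroupSolver group using (solve; _:=_; _:∙_; :inv_; :ε)

  private
    module B = IsSubgroup B-subgroup
    module N = IsSubgroup N-subgroup

  C-resp : ∀ {x y g h} → x ≈ y → g ≈ h → BwB x g → BwB y h
  C-resp x≈y g≈h (b , b′ , b∈ , b′∈ , eq) = b , b′ , b∈ , b′∈ , ≈-trans (≈-sym g≈h) (≈-trans eq (∙-congʳ (∙-congˡ x≈y)))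

  C-refl : ∀ x → BwB x x
  C-refl x = ε , ε , B.ε-closed , B.ε-closed , solve 1 (λ x → x := :ε :∙ x :∙ :ε) ≈-refl x

  C-sym : ∀ {x g} → BwB x g → BwB g x
  C-sym {x} {g} (b , b′ , b∈ , b′∈ , eq) = inv b , inv b′ , B.inv-closed b b∈ , B.inv-closed b′ b′∈ ,
    ≈-trans (solve 3 (λ x b b′ → x := :inv b :∙ (b :∙ x :∙ b′) :∙ :inv b′) ≈-refl x b b′) (∙-congʳ (∙-congˡ (≈-sym eq)))

  C-trans : ∀ {x g h} → BwB x g → BwB g h → BwB x h
  C-trans {x} (b , b′ , b∈ , b′∈ , eq) (a , a′ , a∈ , a′∈ , eq′) =
    a ∙ b , b′ ∙ a′ , B.∙-closed a b a∈ b∈ , B.∙-closed b′ a′ b′∈ a′∈ ,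
    ≈-trans eq′ (≈-trans (∙-congʳ (∙-congˡ eq))
      (solve 5 (λ x b b′ a a′ → a :∙ (b :∙ x :∙ b′) :∙ a′ := (a :∙ b) :∙ x :∙ (b′ :∙ a′)) ≈-refl x b b′ a a′))

  C-inv : ∀ {x g} → BwB x g → BwB (inv x) (inv g)
  C-inv {x} (b , b′ , b∈ , b′∈ , eq) = inv b′ , inv b , B.inv-closed b′ b′∈ , B.inv-closed b b∈ ,
    ≈-trans (⁻¹-cong eq) (solve 3 (λ x b b′ → :inv (b :∙ x :∙ b′) := :inv b′ :∙ :inv x :∙ :inv b) ≈-refl x b b′)

  C-translate : ∀ {x g} b b′ → b ∈ B → b′ ∈ B → BwB x g → BwB x (b ∙ g ∙ b′)
  C-translate b b′ b∈ b′∈ x∼g = C-trans x∼g (b , b′ , b∈ , b′∈ , ≈-refl)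

  T-resp : ∀ {g h} → g ≈ h → InT g → InT h
  T-resp g≈h (p , q) = ∈-resp g≈h p , ∈-resp g≈h q

  T-ε : InT ε
  T-ε = B.ε-closed , N.ε-closed

  T-∙ : ∀ {g h} → InT g → InT h → InT (g ∙ h)
  T-∙ {g} {h} (p , q) (p′ , q′) = B.∙-closed g h p p′ , N.∙-closed g h q q′

  T-inv : ∀ {g} → InT g → InT (inv g)
  T-inv {g} (p , q) = B.inv-closed g p , N.inv-closed g q

  T? : ∀ g → Dec (InT g)
  T? g = (to g ∈? B) ×-dec (to g ∈? N)
    where open Inverse enumeration using (to)

  infix 4 _~_
  _~_ : Carrier → Carrier → Set
  x ~ y = InT (inv x ∙ y)

  ≈⇒~ : ∀ {x y} → x ≈ y → x ~ y
  ≈⇒~ {x} {y} x≈y = T-resp (≈-trans (≈-sym (inverseˡ x)) (∙-congˡ x≈y)) T-ε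

  ~-refl : ∀ {x} → x ~ x
  ~-refl = ≈⇒~ ≈-refl

  ~-sym : ∀ {x y} → x ~ y → y ~ x
  ~-sym {x} {y} p = T-resp (solve 2 (λ x y → :inv (:inv x :∙ y) := :inv y :∙ x) ≈-refl x y) (T-inv p)

  ~-trans : ∀ {x y z} → x ~ y → y ~ z → x ~ z
  ~-trans {x} {y} {z} p q = T-resp (solve 3 (λ x y z → (:inv x :∙ y) :∙ (:inv y :∙ z) := :inv x :∙ z) ≈-refl x y z) (T-∙ p q)

  ~-congˡ : ∀ z {x y} → x ~ y → z ∙ x ~ z ∙ y
  ~-congˡ z {x} {y} = T-resp (solve 3 (λ x y z → :inv x :∙ y := :inv (z :∙ x) :∙ (z :∙ y)) ≈-refl x y z)

  ~-congʳ : ∀ {n} → n ∈ N → ∀ {x y} → x ~ y → x ∙ n ~ y ∙ n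
  ~-congʳ {n} n∈ {x} {y} p = T-resp
    (solve 3 (λ x y n → :inv n :∙ (:inv x :∙ y) :∙ :inv (:inv n) := :inv (x :∙ n) :∙ (y :∙ n)) ≈-refl x y n)
    (T-normal (inv n) _ (N.inv-closed n n∈) p)

  ~⇒C : ∀ {x y} → x ~ y → BwB x y
  ~⇒C {x} {y} p = ε , inv x ∙ y , B.ε-closed , proj₁ p , solve 2 (λ x y → y := :ε :∙ x :∙ (:inv x :∙ y)) ≈-refl x y

  s⁻² : ∀ j → InT (inv (s j) ∙ inv (s j))
  s⁻² j = T-resp (solve 1 (λ s → :inv (s :∙ s) := :inv s :∙ :inv s) ≈-refl (s j)) (T-inv (s-invol j))

  ss~ : ∀ j x → x ∙ s j ∙ s j ~ x
  ss~ j x = T-resp (solve 2 (λ s x → :inv (s :∙ s) := :inv (x :∙ s :∙ s) :∙ x) ≈-refl (s j) x) (T-inv (s-invol j))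

  s-s~ : ∀ j {x} → x ∈ N → s j ∙ (s j ∙ x) ~ x
  s-s~ j {x} x∈ = T-resp (solve 2 (λ s x → :inv x :∙ :inv (s :∙ s) :∙ :inv (:inv x) := :inv (s :∙ (s :∙ x)) :∙ x) ≈-refl (s j) x)
    (T-normal (inv x) _ (N.inv-closed x x∈) (T-inv (s-invol j)))

  -- The axiom `sBw⊆` is applied to w⁻¹ and s⁻² b⁻¹ and then inverted; s⁻² lies in `T` and absorbs
  -- the difference between s and s⁻¹.
  wBs⊆ : ∀ j w b → w ∈ N → b ∈ B → BwB w (w ∙ b ∙ s j) ⊎ BwB (w ∙ s j) (w ∙ b ∙ s j)
  wBs⊆ j w b w∈ b∈ with sBw⊆ j (inv w) ((inv (s j) ∙ inv (s j)) ∙ inv b) (N.inv-closed w w∈) (B.∙-closed _ _ (proj₁ (s⁻² j)) (B.inv-closed b b∈))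
  ... | inj₁ p = inj₁ (C-resp (solve 1 (λ w → :inv (:inv w) := w) ≈-refl w)
          (solve 3 (λ w b s → :inv (s :∙ (:inv s :∙ :inv s :∙ :inv b) :∙ :inv w) := w :∙ b :∙ s) ≈-refl w b (s j)) (C-inv p))
  ... | inj₂ p = inj₂ (C-trans (~⇒C (T-resp (solve 2 (λ w s → :inv s :∙ :inv s := :inv (w :∙ s) :∙ (w :∙ :inv s)) ≈-refl w (s j)) (s⁻² j)))
          (C-resp (solve 2 (λ w s → :inv (s :∙ :inv w) := w :∙ :inv s) ≈-refl w (s j))
          (solve 3 (λ w b s → :inv (s :∙ (:inv s :∙ :inv s :∙ :inv b) :∙ :inv w) := w :∙ b :∙ s) ≈-refl w b (s j)) (C-inv p)))

  Word : Set
  Word = List (Fin r)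

  -- The letters are multiplied from right to left, so that the axiom wBs⊆ applies to the head.
  eval : Word → Carrier
  eval []      = ε
  eval (j ∷ u) = eval u ∙ s j

  eval∈N : ∀ u → eval u ∈ N
  eval∈N []      = N.ε-closed
  eval∈N (j ∷ u) = N.∙-closed _ _ (eval∈N u) (s∈N j)

  eval-++ : ∀ u v → eval (u ++ v) ≈ eval v ∙ eval u
  eval-++ []      v = ≈-sym (identityʳ _)
  eval-++ (j ∷ u) v = ≈-trans (∙-congʳ (eval-++ u v)) (assoc _ _ _)

  eval-snoc : ∀ u j → eval (u ++ [ j ]) ≈ s j ∙ eval u
  eval-snoc u j = ≈-trans (eval-++ u [ j ]) (∙-congʳ (identityˡ (s j)))

  eval-inv : ∀ u → inv (eval u) ~ eval (reverse u)
  eval-inv []      = ≈⇒~ (solve 0 (:inv :ε := :ε) ≈-refl)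
  eval-inv (j ∷ u) = ~-trans (≈⇒~ (solve 2 (λ u s → :inv (u :∙ s) := :inv s :∙ :inv u) ≈-refl (eval u) (s j)))
    (~-trans (~-congʳ (N.inv-closed _ (eval∈N u)) (~-sym (T-resp ≈-refl (s⁻² j))))
      (~-trans (~-congˡ (s j) (eval-inv u))
        (≈⇒~ (≈-trans (≈-sym (eval-snoc (reverse u) j)) (reflexive (cong eval (sym (Listₚ.unfold-reverse j u))))))))

  word : ∀ n → n ∈ N → ∃ λ u → n ~ eval u
  word n n∈ = proj₂ (go (W-generated n n∈))
    where
    go : ∀ {n} → ⟨ (λ x → InT x ⊎ ∃ λ j → x ≈ s j) ⟩ n → n ∈ N × ∃ λ u → n ~ eval u
    go (gen (inj₁ t))         = proj₂ t , [] , T-resp (≈-sym (identityʳ _)) (T-inv t)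
    go (gen (inj₂ (j , x≈s))) = ∈-resp (≈-sym x≈s) (s∈N j) , [ j ] , ≈⇒~ (≈-trans x≈s (≈-sym (identityˡ _)))
    go unit                   = N.ε-closed , [] , ~-refl
    go (mul {g} {h} p q)      = let g∈ , u , g~ = go p ; h∈ , v , h~ = go q in
      N.∙-closed g h g∈ h∈ , v ++ u ,
      ~-trans (~-congʳ h∈ g~) (~-trans (~-congˡ (eval u) h~) (≈⇒~ (≈-sym (eval-++ v u))))
    go (neg {g} p)            = let g∈ , u , g~ = go p in
      N.inv-closed g g∈ , reverse u ,
      ~-trans (inverse-cong g∈ (eval∈N u) g~) (eval-inv u)
      where
      inverse-cong : ∀ {x y} → x ∈ N → y ∈ N → x ~ y → inv x ~ inv y
      inverse-cong {x} {y} x∈ y∈ p = T-resp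
        (solve 2 (λ x y → y :∙ :inv (:inv x :∙ y) :∙ :inv y := :inv (:inv x) :∙ :inv y) ≈-refl x y) (T-normal y _ y∈ (T-inv p))
    go (resp g≈h p)           = let g∈ , u , g~ = go p in ∈-resp g≈h g∈ , u , ~-trans (≈⇒~ (≈-sym g≈h)) g~

  -- Lengths are not computed, since that would require a search over words; a lower bound for all
  -- words over `I`, paired with a word attaining it, takes their place. The alphabet is explicit
  -- because lengths in W_I are used without knowing that they agree with those in W.
  Short : Pred (Fin r) 0ℓ → Carrier → ℕ → Set
  Short I x k = ∀ v → All I v → x ~ eval v → k ≤ length v

  Any : Pred (Fin r) 0ℓ
  Any _ = ⊤

  any : ∀ u → All Any u
  any u = All.universal (λ _ → tt) u

  record Reduced (I : Pred (Fin r) 0ℓ) (x : Carrier) : Set where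
    constructor reduced
    field
      letters : Word
      letters∈ : All I letters
      represents : x ~ eval letters
      short : Short I x (length letters)

  -- A word that is not shortest has a shorter rival over the same letters, and lengths cannot
  -- decrease for ever. The rival is not found effectively, hence the double negation.
  reduce : ∀ I x u → All I u → x ~ eval u → ¬ ¬ Reduced I x
  reduce I x u = go (length u) u ℕₚ.≤-refl
    where
    go : ∀ k u → length u ≤ k → All I u → x ~ eval u → ¬ ¬ Reduced I x
    go zero    [] _ u∈ x~ not = not (reduced [] u∈ x~ λ _ _ _ → z≤n)
    go (suc k) u u≤ u∈ x~ not = not (reduced u u∈ x~ short)
      where
      short : Short I x (length u)
      short v v∈ x~v with length u ℕₚ.≤? length v
      ... | yes h = h
      ... | no ¬h = contradiction not (go k v (ℕₚ.≤-pred (ℕₚ.≤-trans (ℕₚ.≰⇒> ¬h) u≤)) v∈ x~v)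

  reduce-N : ∀ {x} → x ∈ N → ¬ ¬ Reduced Any x
  reduce-N {x} x∈ = let u , x~ = word x x∈ in reduce Any x u (any u) x~

  short-resp : ∀ {I x y k} → x ~ y → Short I x k → Short I y k
  short-resp x~y h v v∈ y~v = h v v∈ (~-trans x~y y~v)

  short-∙ : ∀ {I x j k} → I j → Short I x (suc k) → Short I (x ∙ s j) k
  short-∙ {j = j} j∈ h v v∈ xs~v = ℕₚ.≤-pred (h (j ∷ v) (j∈ ∷ v∈) (~-trans (~-sym (ss~ j _)) (~-congʳ (s∈N j) xs~v)))

  -- `g` is recovered from `g ∙ s j` by multiplying with s⁻¹, which agrees with s up to `T`, so
  -- `wBs⊆` applies.
  C-divide : ∀ j {x g} → x ∈ N → BwB x (g ∙ s j) → BwB x g ⊎ BwB (x ∙ s j) g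
  C-divide j {x} {g} x∈ (b , b′ , b∈ , b′∈ , eq) =
    Sum.map transfer transfer (wBs⊆ j x (b′ ∙ (inv (s j) ∙ inv (s j))) x∈ (B.∙-closed _ _ b′∈ (proj₁ (s⁻² j))))
    where
    transfer : ∀ {y} → BwB y (x ∙ (b′ ∙ (inv (s j) ∙ inv (s j))) ∙ s j) → BwB y g
    transfer q = C-resp ≈-refl
      (≈-trans (solve 4 (λ x b b′ s → b :∙ (x :∙ (b′ :∙ (:inv s :∙ :inv s)) :∙ s) :∙ :ε := (b :∙ x :∙ b′) :∙ :inv s) ≈-refl x b b′ (s j))
      (≈-trans (∙-congʳ (≈-sym eq)) (solve 2 (λ g s → (g :∙ s) :∙ :inv s := g) ≈-refl g (s j))))
      (C-translate b ε b∈ B.ε-closed q)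

  -- Dividing off the rightmost factor s puts the rest `u` in the double coset of x or of x s. The
  -- first case would give `x` the word `u`, which is too short; in the second the induction
  -- hypothesis applies.
  separate-short : ∀ u x → x ∈ N → Short Any x (length u) → BwB (eval u) x → eval u ~ x
  separate-short [] x x∈ _ (b , b′ , b∈ , b′∈ , eq) = T-resp (solve 1 (λ x → x := :inv :ε :∙ x) ≈-refl x)
    (∈-resp (≈-sym (≈-trans eq (solve 2 (λ b b′ → b :∙ :ε :∙ b′ := b :∙ b′) ≈-refl b b′))) (B.∙-closed b b′ b∈ b′∈) , x∈)
  separate-short (j ∷ u) x x∈ short ux with C-divide j x∈ (C-sym ux)
  ... | inj₁ p = contradiction
          (short u (any u) (~-sym (separate-short u x x∈ (λ v v∈ q → ℕₚ.≤-trans (ℕₚ.n≤1+n _) (short v v∈ q)) (C-sym p))))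
          (ℕₚ.<⇒≱ (ℕₚ.n<1+n _))
  ... | inj₂ p = ~-trans
          (~-congʳ (s∈N j) (separate-short u (x ∙ s j) (N.∙-closed _ _ x∈ (s∈N j)) (short-∙ tt short) (C-sym p))) (ss~ j x)

  ~-stable : ∀ {x y} → ¬ ¬ (x ~ y) → x ~ y
  ~-stable = decidable-stable (T? _)

  separate : ∀ {x y} → x ∈ N → y ∈ N → BwB x y → x ~ y
  separate {x} {y} x∈ y∈ xy = ~-stable λ not → reduce-N x∈ λ ρ → reduce-N y∈ λ σ → not (compare ρ σ)
    where
    compare : Reduced Any x → Reduced Any y → x ~ y
    compare (reduced u _ x~u short-x) (reduced v _ y~v short-y) with ℕₚ.≤-total (length u) (length v)
    ... | inj₁ u≤v = ~-trans x~u (separate-short u y y∈ (λ z z∈ q → ℕₚ.≤-trans u≤v (short-y z z∈ q)) (C-trans (~⇒C (~-sym x~u)) xy))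
    ... | inj₂ v≤u = ~-sym (~-trans y~v (separate-short v x x∈ (λ z z∈ q → ℕₚ.≤-trans v≤u (short-x z z∈ q)) (C-trans (~⇒C (~-sym y~v)) (C-sym xy))))

  -- Induction on the word. If s j b x s k lay in the double coset of x s k, then dividing by s k
  -- would identify s j x with x s k or with x. The first gives s j x s k the word of x, which is
  -- too short; the second makes s j trivial.
  product : ∀ I j u → I j → All I u → Short I (eval u) (length u) → Short I (s j ∙ eval u) (length u) →
    ∀ b → b ∈ B → BwB (s j ∙ eval u) (s j ∙ b ∙ eval u)
  product I j [] _ _ _ _ b b∈ = ε , b , B.ε-closed , b∈ ,
    solve 2 (λ s b → s :∙ b :∙ :ε := :ε :∙ (s :∙ :ε) :∙ b) ≈-refl (s j) b
  product I j (k ∷ u) j∈ (k∈ ∷ u∈) short short′ b b∈ with sBw⊆ j (eval (k ∷ u)) b (eval∈N (k ∷ u)) b∈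
  ... | inj₂ p = p
  ... | inj₁ p = ⊥-elim (Sum.[ first , second ] (C-divide k (eval∈N (k ∷ u)) (C-resp ≈-refl (≈-sym (assoc _ _ _)) p)))
    where
    x = eval u
    ih : BwB (s j ∙ x) (s j ∙ b ∙ x)
    ih = product I j u j∈ u∈ (short-resp (ss~ k x) (short-∙ k∈ short))
      (short-resp (~-trans (≈⇒~ (∙-congʳ (≈-sym (assoc _ _ _)))) (ss~ k (s j ∙ x))) (short-∙ k∈ short′)) b b∈
    sx∈ : s j ∙ x ∈ N
    sx∈ = N.∙-closed _ _ (s∈N j) (eval∈N u)
    first : ¬ BwB (x ∙ s k) (s j ∙ b ∙ x)
    first q = contradiction (short′ u u∈ (~-trans (~-congˡ (s j) (separate (eval∈N (k ∷ u)) sx∈ (C-trans q (C-sym ih)))) (s-s~ j (eval∈N u))))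
      (ℕₚ.<⇒≱ (ℕₚ.n<1+n _))
    second : ¬ BwB (x ∙ s k ∙ s k) (s j ∙ b ∙ x)
    second q = s-nontriv j (T-resp (solve 2 (λ s x → x :∙ (:inv x :∙ (s :∙ x)) :∙ :inv x := s) ≈-refl (s j) x)
      (T-normal x _ (eval∈N u) (separate (eval∈N u) sx∈ (C-trans (C-trans (~⇒C (~-sym (ss~ k x))) q) (C-sym ih)))))

  -- Conjugation by s does not keep `B` inside itself, so some `b` has s b s outside `B`, the double
  -- coset of s². The axiom then leaves only the double coset of s.
  thick : ∀ j → ∃ λ b → b ∈ B × BwB (s j) (s j ∙ b ∙ s j)
  thick j with ∃? (λ { {g} {h} g≈h (p , q) → ∈-resp g≈h p , λ h∈ → q (∈-resp (∙-congʳ (∙-congˡ (≈-sym g≈h))) h∈) })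
                  (λ b → (to b ∈? B) ×-dec ¬? (to (s j ∙ b ∙ inv (s j)) ∈? B))
    where
    open Inverse enumeration using (to)
  ... | no none = contradiction (λ b b∈ → decidable-stable (_ ∈? B) (λ ∉ → none (b , b∈ , ∉))) (sBs≢B j)
  ... | yes (b , b∈ , sbs∉) with sBw⊆ j (s j) b (s∈N j) b∈
  ...   | inj₁ p = b , b∈ , p
  ...   | inj₂ (a , a′ , a∈ , a′∈ , eq) = contradiction
            (∈-resp (solve 2 (λ g s → g :∙ (:inv s :∙ :inv s) := g :∙ :inv s :∙ :inv s) ≈-refl (s j ∙ b ∙ s j) (s j) |> λ e →
              ≈-trans e (solve 2 (λ s b → (s :∙ b :∙ s) :∙ :inv s :∙ :inv s := s :∙ b :∙ :inv s) ≈-refl (s j) b))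
              (B.∙-closed _ _ (∈-resp (≈-sym eq) (B.∙-closed _ _ (B.∙-closed _ _ a∈ (proj₁ (s-invol j))) a′∈)) (proj₁ (s⁻² j)))) sbs∉

  short-eval : ∀ {I j x} v → I j → s j ∙ x ~ eval v → x ∈ N → Short I x (suc (length v)) → Short I (eval v) (length v)
  short-eval {I} {j} {x} v j∈ sx~v x∈ short z z∈ v~z = ℕₚ.≤-pred (ℕₚ.≤-trans
    (short (z ++ [ j ]) (Allₚ.++⁺ z∈ (j∈ ∷ [])) (~-trans (~-sym (s-s~ j x∈)) (~-trans (~-congˡ (s j) (~-trans sx~v v~z)) (≈⇒~ (≈-sym (eval-snoc z j))))))
    (ℕₚ.≤-reflexive (trans (Listₚ.length-++ z) (ℕₚ.+-comm (length z) 1))))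

  -- Write x = s y with y shorter. By `thick` some s b s has the form a s a′, so s b x is a s a′ y
  -- up to `T`, and `product` places this in the double coset of s y.
  descent : ∀ {I j x} v → I j → All I v → x ∈ N → s j ∙ x ~ eval v → Short I x (suc (length v)) →
    ∃ λ b → b ∈ B × BwB x (s j ∙ b ∙ x)
  descent {I} {j} {x} v j∈ v∈ x∈ sx~v short with thick j
  ... | b , b∈ , (a , a′ , a∈ , a′∈ , eq) = b , b∈ , C-resp ≈-refl final
      (C-translate a (inv (s j ∙ y) ∙ x) a∈ (proj₁ sy~x) (C-trans (~⇒C (~-sym sy~x)) step′))
    where
    y = eval v
    sy~x : s j ∙ y ~ x
    sy~x = ~-trans (~-congˡ (s j) (~-sym sx~v)) (s-s~ j x∈)
    step′ : BwB (s j ∙ y) (s j ∙ a′ ∙ y)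
    step′ = product I j v j∈ v∈ (short-eval v j∈ sx~v x∈ short)
      (short-resp (~-sym sy~x) (λ z z∈ q → ℕₚ.≤-trans (ℕₚ.n≤1+n _) (short z z∈ q))) a′ a′∈
    final : a ∙ (s j ∙ a′ ∙ y) ∙ (inv (s j ∙ y) ∙ x) ≈ s j ∙ b ∙ x
    final = ≈-trans (solve 5 (λ a s a′ y x → a :∙ (s :∙ a′ :∙ y) :∙ (:inv (s :∙ y) :∙ x) := (a :∙ s :∙ a′) :∙ :inv s :∙ x) ≈-refl a (s j) a′ y x)
      (≈-trans (∙-congʳ (∙-congʳ (≈-sym eq))) (solve 3 (λ s b x → (s :∙ b :∙ s) :∙ :inv s :∙ x := s :∙ b :∙ x) ≈-refl (s j) b x))

  s≁ : ∀ j {x} → x ∈ N → ¬ (x ~ s j ∙ x)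
  s≁ j {x} x∈ p = s-nontriv j (T-resp (solve 2 (λ s x → x :∙ (:inv x :∙ (s :∙ x)) :∙ :inv x := s) ≈-refl (s j) x) (T-normal x _ x∈ p))

  record HasLength (x : Carrier) (k : ℕ) : Set where
    constructor mkLength
    field
      letters : Word
      length≡ : length letters ≡ k
      represents : x ~ eval letters
      short : Short Any x k

  length-unique : ∀ {x k k′} → HasLength x k → HasLength x k′ → k ≡ k′
  length-unique (mkLength u refl x~u short) (mkLength v refl x~v short′) = ℕₚ.≤-antisym (short v (any v) x~v) (short′ u (any u) x~u)

  has-length : ∀ {x} → x ∈ N → ¬ ¬ ∃ (HasLength x)
  has-length x∈ none = reduce-N x∈ λ (reduced u _ x~u short) → none (_ , mkLength u refl x~u short)

  length-resp : ∀ {x y k} → x ~ y → HasLength x k → HasLength y k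
  length-resp x~y (mkLength u eq x~u short) = mkLength u eq (~-trans (~-sym x~y) x~u) (short-resp x~y short)

  -- If x and s x had the same length, then C(s) C(x) = C(s x) and C(s) C(s x) = C(x);
  -- as C(s) C(s) contains C(s), the double cosets of x and s x would coincide.
  length-s≢ : ∀ j {x k} → x ∈ N → HasLength x k → ¬ HasLength (s j ∙ x) k
  length-s≢ j {x} x∈ (mkLength u refl x~u short) (mkLength v eq sx~v short′) with thick j
  ... | b , b∈ , (a , a′ , a∈ , a′∈ , sbs≈) = s≁ j (eval∈N u) (separate (eval∈N u) sy∈ (C-trans y∼ (C-sym sy∼)))
    where
    y = eval u
    y′ = eval v
    sy∈ : s j ∙ y ∈ N
    sy∈ = N.∙-closed _ _ (s∈N j) (eval∈N u)
    y′~sy : y′ ~ s j ∙ y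
    y′~sy = ~-trans (~-sym sx~v) (~-congˡ (s j) x~u)
    sy′~y : s j ∙ y′ ~ y
    sy′~y = ~-trans (~-congˡ (s j) y′~sy) (s-s~ j (eval∈N u))
    sy∼ : BwB (s j ∙ y) (s j ∙ b ∙ (s j ∙ y))
    sy∼ = C-resp ≈-refl (≈-trans (solve 4 (λ a s a′ y → a :∙ (s :∙ a′ :∙ y) :∙ :ε := (a :∙ s :∙ a′) :∙ y) ≈-refl a (s j) a′ y)
        (≈-trans (∙-congʳ (≈-sym sbs≈)) (assoc _ _ _)))
      (C-translate a ε a∈ B.ε-closed (product Any j u tt (any u) (short-resp x~u short) (short-resp (~-congˡ (s j) x~u) short-sx) a′ a′∈))
      where
      short-sx : Short Any (s j ∙ x) (length u)
      short-sx = short′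
    y∼ : BwB y (s j ∙ b ∙ (s j ∙ y))
    y∼ = C-trans (~⇒C (~-sym sy′~y)) (C-resp ≈-refl (solve 4 (λ s b y′ y → :ε :∙ (s :∙ b :∙ y′) :∙ (:inv y′ :∙ (s :∙ y)) := s :∙ b :∙ (s :∙ y)) ≈-refl (s j) b y′ y)
      (C-translate ε (inv y′ ∙ (s j ∙ y)) B.ε-closed (proj₁ y′~sy)
        (product Any j v tt (any v) (subst (Short Any y′) (sym eq) (short-resp sx~v short′))
          (subst (Short Any (s j ∙ y′)) (sym eq) (short-resp (~-trans x~u (~-sym sy′~y)) short)) b b∈)))

  length-s≤ : ∀ j {x k k′} → HasLength x k → HasLength (s j ∙ x) k′ → k′ ≤ suc k
  length-s≤ j (mkLength u refl x~u _) (mkLength _ _ _ short) = ℕₚ.≤-trans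
    (short (u ++ [ j ]) (any _) (~-trans (~-congˡ (s j) x~u) (≈⇒~ (≈-sym (eval-snoc u j)))))
    (ℕₚ.≤-reflexive (trans (Listₚ.length-++ u) (ℕₚ.+-comm (length u) 1)))

  even : ℕ → Bool
  even zero    = true
  even (suc n) = not (even n)

  even-+ : ∀ m {n n′} → even n ≡ even n′ → even (m ℕ.+ n) ≡ even (m ℕ.+ n′)
  even-+ zero    p = p
  even-+ (suc m) p = cong not (even-+ m p)

  length-s-parity : ∀ j {x k k′} → x ∈ N → HasLength x k → HasLength (s j ∙ x) k′ → even k′ ≡ not (even k)
  length-s-parity j {x} {k} {k′} x∈ h h′ with ℕₚ.<-cmp k k′
  ... | tri< k<k′ _ _ = cong even (ℕₚ.≤-antisym (length-s≤ j h h′) k<k′)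
  ... | tri≈ _ refl _ = contradiction h′ (length-s≢ j x∈ h)
  ... | tri> _ _ k′<k = trans (sym (Boolₚ.not-involutive (even k′)))
        (cong (not ∘ even) (ℕₚ.≤-antisym k′<k (length-s≤ j h′ (length-resp (~-sym (s-s~ j x∈)) h))))

  eval-parity : ∀ u {y k k′} → y ∈ N → HasLength y k → HasLength (eval u ∙ y) k′ → even k′ ≡ even (length u ℕ.+ k)
  eval-parity []      y∈ h h′ = cong even (length-unique (length-resp (≈⇒~ (identityˡ _)) h′) h)
  eval-parity (j ∷ u) {y} {k} {k′} y∈ h h′ = decidable-stable (even k′ Boolₚ.≟ _) λ ≢ → has-length sy∈ λ (k″ , h″) →
    ≢ (trans (eval-parity u sy∈ h″ (length-resp (≈⇒~ (assoc _ _ _)) h′))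
      (trans (even-+ (length u) {k″} {suc k} (length-s-parity j y∈ h h″)) (cong even (ℕₚ.+-suc (length u) k))))
    where
    sy∈ : s j ∙ y ∈ N
    sy∈ = N.∙-closed _ _ (s∈N j) y∈

  -- Left multiplication by a generator changes the length by exactly one, so a word has the parity
  -- of the length of its element. The sign character of W thus comes directly from the axioms,
  -- without a Coxeter presentation.
  word-parity : ∀ u v → eval u ~ eval v → even (length u) ≡ even (length v)
  word-parity u v u~v = decidable-stable (_ Boolₚ.≟ _) λ ≢ → has-length (eval∈N u) λ (k , h) →
    ≢ (trans (sym (parity u h)) (parity v (length-resp u~v h)))
    where
    parity : ∀ u {k} → HasLength (eval u) k → even k ≡ even (length u)
    parity u h = trans (eval-parity u N.ε-closed (mkLength [] refl ~-refl λ _ _ _ → z≤n) (length-resp (≈⇒~ (≈-sym (identityʳ _))) h))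
      (cong even (ℕₚ.+-identityʳ (length u)))

  length-snoc : ∀ (u : Word) j → length (u ++ [ j ]) ≡ suc (length u)
  length-snoc u j = trans (Listₚ.length-++ u) (ℕₚ.+-comm (length u) 1)

  module Overgroup {Q : Subset order} (Q-subgroup : IsSubgroup Q) (B⊆Q : ∀ b → b ∈ B → b ∈ Q) where

    private
      module Q = IsSubgroup Q-subgroup

    double-coset∈ : ∀ {x g} → BwB x g → x ∈ Q → g ∈ Q
    double-coset∈ (b , b′ , b∈ , b′∈ , eq) x∈ = ∈-resp (≈-sym eq) (Q.∙-closed _ _ (Q.∙-closed _ _ (B⊆Q b b∈) x∈) (B⊆Q b′ b′∈))

    eval∈ : ∀ u → All (λ j → s j ∈ Q) u → eval u ∈ Q
    eval∈ []      []       = Q.ε-closed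
    eval∈ (j ∷ u) (p ∷ ps) = Q.∙-closed _ _ (eval∈ u ps) p

    NormalisesB : Carrier → Set c
    NormalisesB x = ∀ b → b ∈ B → x ∙ b ∙ inv x ∈ Q

    -- From s b x = a x a′ one reads off s = a (x a′ x⁻¹) b⁻¹, a product of elements of `Q`.
    descent∈ : ∀ {x} j → NormalisesB x → (∃ λ b → b ∈ B × BwB x (s j ∙ b ∙ x)) → s j ∈ Q
    descent∈ {x} j conj (b , b∈ , (a , a′ , a∈ , a′∈ , eq)) = ∈-resp equation
        (Q.∙-closed _ _ (Q.∙-closed _ _ (B⊆Q a a∈) (conj a′ a′∈)) (Q.inv-closed _ (B⊆Q b b∈)))
      where
      equation : a ∙ (x ∙ a′ ∙ inv x) ∙ inv b ≈ s j
      equation = ≈-trans (solve 4 (λ a x a′ b → a :∙ (x :∙ a′ :∙ :inv x) :∙ :inv b := (a :∙ x :∙ a′) :∙ :inv x :∙ :inv b) ≈-refl a x a′ b)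
        (≈-trans (∙-congʳ (∙-congʳ (≈-sym eq))) (solve 3 (λ s b x → (s :∙ b :∙ x) :∙ :inv x :∙ :inv b := s) ≈-refl (s j) b x))

    normalises-cancel : ∀ {x y} j → x ≈ s j ∙ y → s j ∈ Q → NormalisesB x → NormalisesB y
    normalises-cancel {x} {y} j x≈ s∈ conj b b∈ = ∈-resp equation
        (Q.∙-closed _ _ (Q.∙-closed _ _ (Q.inv-closed _ s∈) (conj b b∈)) s∈)
      where
      equation : inv (s j) ∙ (x ∙ b ∙ inv x) ∙ s j ≈ y ∙ b ∙ inv y
      equation = ≈-trans (∙-congʳ (∙-congˡ (∙-cong (∙-congʳ x≈) (⁻¹-cong x≈))))
        (solve 3 (λ s y b → :inv s :∙ ((s :∙ y) :∙ b :∙ :inv (s :∙ y)) :∙ s := y :∙ b :∙ :inv y) ≈-refl (s j) y b)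

    -- The last entry of the list is the leftmost factor. `descent∈` puts it in `Q`, and cancelling
    -- it leaves a shorter word that still conjugates `B` into `Q`. The bound `k` carries the
    -- induction.
    letters∈ : ∀ k u → List.InitLast u → length u ≤ k → Short Any (eval u) (length u) → NormalisesB (eval u) → All (λ j → s j ∈ Q) u
    letters∈ k       .[]           []       u≤ short conj = []
    letters∈ zero    .(v ++ [ j ]) (v ∷ʳ′ j) u≤ short conj =
      contradiction (trans (sym (length-snoc v j)) (ℕₚ.n≤0⇒n≡0 u≤)) λ ()
    letters∈ (suc k) .(v ++ [ j ]) (v ∷ʳ′ j) u≤ short conj = Allₚ.++⁺
        (letters∈ k v (initLast v) (ℕₚ.≤-pred (ℕₚ.≤-trans (ℕₚ.≤-reflexive (sym (length-snoc v j))) u≤))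
          (short-eval v tt sx~v x∈ short′) (normalises-cancel j x≈ s∈ conj))
        (s∈ ∷ [])
      where
      x = eval (v ++ [ j ])
      x∈ : x ∈ N
      x∈ = eval∈N (v ++ [ j ])
      x≈ : x ≈ s j ∙ eval v
      x≈ = eval-snoc v j
      short′ : Short Any x (suc (length v))
      short′ = subst (Short Any x) (length-snoc v j) short
      sx~v : s j ∙ x ~ eval v
      sx~v = ~-trans (~-congˡ (s j) (≈⇒~ x≈)) (s-s~ j (eval∈N v))
      s∈ : s j ∈ Q
      s∈ = descent∈ j conj (descent v tt (any v) x∈ sx~v short′)

    letters-conj : ∀ {x} (ρ : Reduced Any x) → (∀ b → b ∈ B → x ∙ b ∙ inv x ∈ Q) → All (λ j → s j ∈ Q) (Reduced.letters ρ)
    letters-conj {x} (reduced u _ x~u short) conj = letters∈ (length u) u (initLast u) ℕₚ.≤-refl (short-resp x~u short) λ b b∈ →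
      ∈-resp (solve 3 (λ x u b → x :∙ ((:inv x :∙ u) :∙ b :∙ :inv (:inv x :∙ u)) :∙ :inv x := u :∙ b :∙ :inv u) ≈-refl x (eval u) b)
        (conj _ (B.∙-closed _ _ (B.∙-closed _ _ (proj₁ x~u) b∈) (B.inv-closed _ (proj₁ x~u))))

    letters-reduced : ∀ {x} (ρ : Reduced Any x) → x ∈ Q → All (λ j → s j ∈ Q) (Reduced.letters ρ)
    letters-reduced ρ x∈ = letters-conj ρ λ b b∈ → Q.∙-closed _ _ (Q.∙-closed _ _ x∈ (B⊆Q b b∈)) (Q.inv-closed _ x∈)

  -- B W_I B, where W_I is generated by the s j with j in I.
  D : Pred (Fin r) 0ℓ → Carrier → Set (c ⊔ e)
  D I g = ∃ λ u → All I u × BwB (eval u) g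

  D-resp : ∀ {I g h} → g ≈ h → D I g → D I h
  D-resp g≈h (u , u∈ , p) = u , u∈ , C-resp ≈-refl g≈h p

  D-B : ∀ {I} b → b ∈ B → D I b
  D-B b b∈ = [] , [] , b , ε , b∈ , B.ε-closed , solve 1 (λ b → b := b :∙ :ε :∙ :ε) ≈-refl b

  D-eval : ∀ {I} u → All I u → D I (eval u)
  D-eval u u∈ = u , u∈ , C-refl _

  D-translate : ∀ {I} b b′ {g} → b ∈ B → b′ ∈ B → D I g → D I (b ∙ g ∙ b′)
  D-translate b b′ b∈ b′∈ (u , u∈ , p) = u , u∈ , C-translate b b′ b∈ b′∈ p

  D-s∙ : ∀ {I} j {g} → I j → D I g → D I (s j ∙ g)
  D-s∙ {I} j {g} j∈ (u , u∈ , (b , b′ , b∈ , b′∈ , eq)) = D-resp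
      (≈-trans (solve 4 (λ s b u b′ → :ε :∙ (s :∙ b :∙ u) :∙ b′ := s :∙ (b :∙ u :∙ b′)) ≈-refl (s j) b (eval u) b′) (∙-congˡ (≈-sym eq)))
      (D-translate ε b′ B.ε-closed b′∈ moved)
    where
    moved : D I (s j ∙ b ∙ eval u)
    moved with sBw⊆ j (eval u) b (eval∈N u) b∈
    ... | inj₁ p = u , u∈ , p
    ... | inj₂ p = u ++ [ j ] , Allₚ.++⁺ u∈ (j∈ ∷ []) , C-resp (≈-sym (eval-snoc u j)) ≈-refl p

  D-eval∙ : ∀ {I} u {g} → All I u → D I g → D I (eval u ∙ g)
  D-eval∙ []      []         p = D-resp (≈-sym (identityˡ _)) p
  D-eval∙ (j ∷ u) (j∈ ∷ u∈) p = D-resp (≈-sym (assoc _ _ _)) (D-eval∙ u u∈ (D-s∙ j j∈ p))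

  D-eval⁻¹∙ : ∀ {I} u {g} → All I u → D I g → D I (inv (eval u) ∙ g)
  D-eval⁻¹∙ []      {g} []         p = D-resp (solve 1 (λ g → g := :inv :ε :∙ g) ≈-refl g) p
  D-eval⁻¹∙ (j ∷ u) {g} (j∈ ∷ u∈) p = D-resp
    (solve 3 (λ s u g → s :∙ ((:inv s :∙ :inv s) :∙ (:inv u :∙ g) :∙ :ε) := :inv (u :∙ s) :∙ g) ≈-refl (s j) (eval u) g)
    (D-s∙ j j∈ (D-translate _ ε (proj₁ (s⁻² j)) B.ε-closed (D-eval⁻¹∙ u u∈ p)))

  D-∙ : ∀ {I} g h → D I g → D I h → D I (g ∙ h)
  D-∙ g h (u , u∈ , (b , b′ , b∈ , b′∈ , eq)) q = D-resp
    (≈-trans (solve 4 (λ b u b′ h → b :∙ (u :∙ (b′ :∙ h :∙ :ε)) :∙ :ε := (b :∙ u :∙ b′) :∙ h) ≈-refl b (eval u) b′ h) (∙-congʳ (≈-sym eq)))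
    (D-translate b ε b∈ B.ε-closed (D-eval∙ u u∈ (D-translate b′ ε b′∈ B.ε-closed q)))

  D-inv : ∀ {I} g → D I g → D I (inv g)
  D-inv g (u , u∈ , (b , b′ , b∈ , b′∈ , eq)) = D-resp
    (≈-trans (solve 3 (λ b u b′ → :inv b′ :∙ (:inv u :∙ :inv b) :∙ :ε := :inv (b :∙ u :∙ b′)) ≈-refl b (eval u) b′) (⁻¹-cong (≈-sym eq)))
    (D-translate (inv b′) ε (B.inv-closed b′ b′∈) B.ε-closed (D-eval⁻¹∙ u u∈ (D-B (inv b) (B.inv-closed b b∈))))

  -- Bruhat decomposition: B W_I B is closed under products and inverses, and over the full alphabet
  -- it contains both generating subgroups.
  decompose : ∀ g → D Any g
  decompose g = go (G-generated g)
    where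
    go : ∀ {g} → ⟨ (λ x → x ∈ B ⊎ x ∈ N) ⟩ g → D Any g
    go (gen (inj₁ g∈)) = D-B _ g∈
    go {g} (gen (inj₂ g∈)) = let u , g~u = word g g∈ in u , any u , ~⇒C (~-sym g~u)
    go unit       = D-B ε B.ε-closed
    go (mul p q)  = D-∙ _ _ (go p) (go q)
    go (neg p)    = D-inv _ (go p)
    go (resp e p) = D-resp e (go p)

  s≁ε : ∀ j → ¬ (s j ~ ε)
  s≁ε j p = s-nontriv j (T-resp (solve 1 (λ s → :inv (:inv s :∙ :ε) := s) ≈-refl (s j)) (T-inv p))

  ss~ε⇒≡ : ∀ i j → s i ∙ s j ~ ε → i ≡ j
  ss~ε⇒≡ i j p = s-distinct i j (T-resp
    (solve 2 (λ s t → (:inv s :∙ :inv s) :∙ :inv (:inv (s :∙ t) :∙ :ε) := :inv s :∙ t) ≈-refl (s i) (s j)) (T-∙ (s⁻² i) (T-inv p)))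

  short-1 : ∀ {x} → ¬ (x ~ ε) → Short Any x 1
  short-1 x≁ε []      _ p = contradiction p x≁ε
  short-1 x≁ε (_ ∷ _) _ _ = s≤s z≤n

  letters-separate : ∀ i j b → i ≢ j → b ∈ B → ¬ BwB (s j) (s i ∙ b ∙ s j)
  letters-separate i j b i≢j b∈ p = s≁ i (s∈N j) (separate (s∈N j) (N.∙-closed _ _ (s∈N i) (s∈N j)) (C-trans p (C-sym sisj)))
    where
    ε∙s : ε ∙ s j ≈ s j
    ε∙s = identityˡ (s j)
    short : Short Any (eval [ j ]) 1
    short = short-1 λ q → s≁ε j (~-trans (≈⇒~ (≈-sym ε∙s)) q)
    short′ : Short Any (s i ∙ eval [ j ]) 1
    short′ = short-1 λ q → i≢j (ss~ε⇒≡ i j (~-trans (≈⇒~ (∙-congˡ (≈-sym ε∙s))) q))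
    sisj : BwB (s i ∙ s j) (s i ∙ b ∙ s j)
    sisj = C-resp (∙-congˡ ε∙s) (∙-congˡ ε∙s) (product Any i [ j ] tt (tt ∷ []) short short′ b b∈)

  -- A shortest word over `I` for s j has a leftmost factor s i with i in `I`, and `descent` puts
  -- some s i b s j in the double coset of s j; as i ≠ j, it belongs to that of s i s j. The length
  -- must be taken over `I`, for such a word could a priori be longer than one letter.
  s∉D : ∀ {I} j → ¬ I j → ¬ D I (s j)
  s∉D {I} j j∉ (u , u∈ , p) = reduce I (s j) u u∈ (~-sym (separate (eval∈N u) (s∈N j) p))
      λ (reduced v v∈ s~v short) → absurd v (initLast v) v∈ s~v short
    where
    absurd : ∀ v → List.InitLast v → All I v → s j ~ eval v → Short I (s j) (length v) → ⊥
    absurd .[]           []       v∈ s~v short = s≁ε j s~v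
    absurd .(v ++ [ i ]) (v ∷ʳ′ i) v∈ s~v short =
      let b , b∈ , q = descent v i∈ (Allₚ.++⁻ˡ v v∈) (s∈N j) ss~v (subst (Short I (s j)) (length-snoc v i) short)
      in letters-separate i j b (λ i≡j → j∉ (subst I i≡j i∈)) b∈ q
      where
      i∈ : I i
      i∈ = All.head (Allₚ.++⁻ʳ v v∈)
      ss~v : s i ∙ s j ~ eval v
      ss~v = ~-trans (~-congˡ (s i) (~-trans s~v (≈⇒~ (eval-snoc v i)))) (s-s~ i (eval∈N v))

  module _ {Q : Subset order} (Q-subgroup : IsSubgroup Q) (B⊆Q : ∀ b → b ∈ B → b ∈ Q) where

    open Overgroup Q-subgroup B⊆Q

    -- The Bruhat representative of `g` also conjugates `B` into `Q`, so the letters of its reduced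
    -- word lie in `Q`. In particular subgroups above `B` are their own normalisers.
    conj⊆⇒∈ : ∀ g → (∀ b → b ∈ B → g ∙ b ∙ inv g ∈ Q) → g ∈ Q
    conj⊆⇒∈ g conj with decompose g
    ... | u , _ , (b , b′ , b∈ , b′∈ , eq) = decidable-stable (_ ∈? Q) λ ∉ → reduce-N (eval∈N u) λ ρ →
        ∉ (double-coset∈ (b , b′ , b∈ , b′∈ , eq) (double-coset∈ (~⇒C (~-sym (Reduced.represents ρ))) (eval∈ _ (letters-conj ρ conj-u))))
      where
      conj-u : ∀ a → a ∈ B → eval u ∙ a ∙ inv (eval u) ∈ Q
      conj-u a a∈ = ∈-resp
        (≈-trans (∙-congʳ (∙-congˡ (∙-cong (∙-congʳ eq) (⁻¹-cong eq))))
          (solve 4 (λ b u b′ a → :inv b :∙ ((b :∙ u :∙ b′) :∙ (:inv b′ :∙ a :∙ b′) :∙ :inv (b :∙ u :∙ b′)) :∙ b := u :∙ a :∙ :inv u) ≈-refl b (eval u) b′ a))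
        (Q.∙-closed _ _ (Q.∙-closed _ _ (B⊆Q _ (B.inv-closed b b∈)) (conj _ (B.∙-closed _ _ (B.∙-closed _ _ (B.inv-closed _ b′∈) a∈) b′∈))) (B⊆Q b b∈))
        where module Q = IsSubgroup Q-subgroup

    overgroup⊆D : ∀ g → g ∈ Q → ¬ ¬ D (λ j → s j ∈ Q) g
    overgroup⊆D g g∈ none with decompose g
    ... | u , _ , p = reduce-N (eval∈N u) λ ρ → none (_ , letters-reduced ρ (double-coset∈ (C-sym p) g∈) , C-trans (~⇒C (~-sym (Reduced.represents ρ))) p)

-- The building and its colouring

-- Membership in the maximal standard parabolic subgroups is decidable, but to avoid a search
-- over words this is a parameter, discharged later under a double negation.
module Chambers {c e} {G : FiniteGroup c e} {ℓ : ℕ} (𝒯 : TitsSystem G (suc ℓ))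
  (M? : ∀ j g → Dec (Bruhat.D 𝒯 (_≢ j) g)) where

  open FiniteGroup G renaming (refl to ≈-refl; sym to ≈-sym; trans to ≈-trans)
  open TitsSystem 𝒯
  open Bruhat 𝒯
  open GroupSolver group using (solve; _:=_; _:∙_; :inv_; :ε)
  open Inverse enumeration using (to; from; strictlyInverseʳ; strictlyInverseˡ)
  open SubsetSums

  private
    module B = IsSubgroup B-subgroup

  Color : Set
  Color = Fin (suc ℓ)

  module _ {p} {P : Pred Carrier p} (P? : ∀ g → Dec (P g)) (resp : ∀ {g h} → g ≈ h → P g → P h) where

    collect : Subset order
    collect = comprehension (P? ∘ from)

    ∈-collect⁺ : ∀ {g} → P g → g ∈ collect
    ∈-collect⁺ {g} p = ∈-comprehension⁺ (P? ∘ from) (resp (≈-sym (strictlyInverseʳ g)) p)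

    ∈-collect⁻ : ∀ {g} → g ∈ collect → P g
    ∈-collect⁻ {g} g∈ = resp (strictlyInverseʳ g) (∈-comprehension⁻ (P? ∘ from) g∈)

  from-⊆ : ∀ {P Q : Subset order} → (∀ g → g ∈ P → g ∈ Q) → P ⊆ˢ Q
  from-⊆ {P} {Q} h {i} i∈ = subst (_∈ˢ Q) (strictlyInverseˡ i) (h (from i) (subst (_∈ˢ P) (sym (strictlyInverseˡ i)) i∈))

  -- The maximal standard parabolic subgroup B W_I B, where I omits a single generator. The omitted
  -- generator serves as the colour.
  M : Color → Subset order
  M j = collect (M? j) D-resp

  ∈M⁺ : ∀ j {g} → D (_≢ j) g → g ∈ M j
  ∈M⁺ j = ∈-collect⁺ (M? j) D-resp

  ∈M⁻ : ∀ j {g} → g ∈ M j → D (_≢ j) g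
  ∈M⁻ j = ∈-collect⁻ (M? j) D-resp

  M-subgroup : ∀ j → IsSubgroup (M j)
  M-subgroup j = record
    { ε-closed   = ∈M⁺ j (D-B ε B.ε-closed)
    ; ∙-closed   = λ g h p q → ∈M⁺ j (D-∙ g h (∈M⁻ j p) (∈M⁻ j q))
    ; inv-closed = λ g p → ∈M⁺ j (D-inv g (∈M⁻ j p)) }

  B⊆M : ∀ j b → b ∈ B → b ∈ M j
  B⊆M j b b∈ = ∈M⁺ j (D-B b b∈)

  s∈M : ∀ j k → k ≢ j → s k ∈ M j
  s∈M j k k≢j = ∈M⁺ j (D-resp (identityˡ (s k)) (D-eval (k ∷ []) (k≢j ∷ [])))

  s∉M : ∀ j → s j ∉ M j
  s∉M j p = s∉D j (λ j≢j → j≢j refl) (∈M⁻ j p)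

  conjugate : Carrier → Subset order → Subset order
  conjugate g Q = collect (λ h → to (inv g ∙ h ∙ g) ∈? Q) (λ h≈h′ → ∈-resp (∙-congʳ (∙-congˡ h≈h′)))

  ∈conj⁺ : ∀ g Q {h} → inv g ∙ h ∙ g ∈ Q → h ∈ conjugate g Q
  ∈conj⁺ g Q = ∈-collect⁺ (λ h → to (inv g ∙ h ∙ g) ∈? Q) (λ h≈h′ → ∈-resp (∙-congʳ (∙-congˡ h≈h′)))

  ∈conj⁻ : ∀ g Q {h} → h ∈ conjugate g Q → inv g ∙ h ∙ g ∈ Q
  ∈conj⁻ g Q = ∈-collect⁻ (λ h → to (inv g ∙ h ∙ g) ∈? Q) (λ h≈h′ → ∈-resp (∙-congʳ (∙-congˡ h≈h′)))

  ∈conj-∙ : ∀ g Q {h} → h ∈ Q → g ∙ h ∙ inv g ∈ conjugate g Q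
  ∈conj-∙ g Q {h} h∈ = ∈conj⁺ g Q (∈-resp (solve 2 (λ g h → h := :inv g :∙ (g :∙ h :∙ :inv g) :∙ g) ≈-refl g h) h∈)

  conjugate-subgroup : ∀ g {Q} → IsSubgroup Q → IsSubgroup (conjugate g Q)
  conjugate-subgroup g {Q} Q-sub = record
    { ε-closed = ∈conj⁺ g Q (∈-resp (solve 1 (λ g → :ε := :inv g :∙ :ε :∙ g) ≈-refl g) Q.ε-closed)
    ; ∙-closed = λ h k p q → ∈conj⁺ g Q (∈-resp (solve 3 (λ g h k → (:inv g :∙ h :∙ g) :∙ (:inv g :∙ k :∙ g) := :inv g :∙ (h :∙ k) :∙ g) ≈-refl g h k)
        (Q.∙-closed _ _ (∈conj⁻ g Q p) (∈conj⁻ g Q q)))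
    ; inv-closed = λ h p → ∈conj⁺ g Q (∈-resp (solve 2 (λ g h → :inv (:inv g :∙ h :∙ g) := :inv g :∙ :inv h :∙ g) ≈-refl g h) (Q.inv-closed _ (∈conj⁻ g Q p))) }
    where module Q = IsSubgroup Q-sub

  module _ {Q : Subset order} (Q-sub : IsSubgroup Q) (Q≢⊤ : Q ≢ full) (B⊆Q : ∀ b → b ∈ B → b ∈ Q) where

    open Overgroup Q-sub B⊆Q using (eval∈; double-coset∈)

    missing-generator : ∃ λ j → s j ∉ Q
    missing-generator with Finₚ.any? (λ j → ¬? (to (s j) ∈? Q))
    ... | yes found = found
    ... | no  none  = contradiction (⊆-antisym ⊆⊤ (from-⊆ λ g _ → everything g)) Q≢⊤
      where
      everything : ∀ g → g ∈ Q
      everything g with decompose g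
      ... | u , _ , p = double-coset∈ p (eval∈ u (All.universal (λ j → decidable-stable (_ ∈? Q) (λ ∉ → none (j , ∉))) u))

    ⊆M : ∀ j → s j ∉ Q → ∀ g → g ∈ Q → g ∈ M j
    ⊆M j s∉ g g∈ = decidable-stable (_ ∈? M j) λ ∉ → overgroup⊆D Q-sub B⊆Q g g∈ λ (u , u∈ , p) →
      ∉ (∈M⁺ j (u , All.map (λ {k} sk∈ k≡j → s∉ (subst (λ i → s i ∈ Q) k≡j sk∈)) u∈ , p))

  -- Conjugated back by `g`, the subgroup contains `B`; being proper it misses some generator, and
  -- subgroups above `B` are determined by the generators they contain.
  ⊆conjugate : ∀ {Q} → IsSubgroup Q → Q ≢ full → ∀ g → (∀ b → b ∈ B → g ∙ b ∙ inv g ∈ Q) →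
    ∃ λ j → g ∙ s j ∙ inv g ∉ Q × Q ⊆ˢ conjugate g (M j)
  ⊆conjugate {Q} Q-sub Q≢⊤ g gB⊆ = j , (λ p → s∉ (back p)) , from-⊆ λ h h∈ → ∈conj⁺ g (M j) (⊆M sub ≢⊤ B⊆ j s∉ _
      (∈conj⁺ (inv g) Q (∈-resp (solve 2 (λ g h → h := :inv (:inv g) :∙ (:inv g :∙ h :∙ g) :∙ :inv g) ≈-refl g h) h∈)))
    where
    Q′ = conjugate (inv g) Q
    sub = conjugate-subgroup (inv g) Q-sub
    back : ∀ {h} → g ∙ h ∙ inv g ∈ Q → h ∈ Q′
    back {h} p = ∈conj⁺ (inv g) Q (∈-resp (solve 2 (λ g h → g :∙ h :∙ :inv g := :inv (:inv g) :∙ h :∙ :inv g) ≈-refl g h) p)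
    B⊆ : ∀ b → b ∈ B → b ∈ Q′
    B⊆ b b∈ = back (gB⊆ b b∈)
    ≢⊤ : Q′ ≢ full
    ≢⊤ eq = Q≢⊤ (⊆-antisym ⊆⊤ (from-⊆ λ h _ → ∈-resp
      (solve 2 (λ g h → :inv (:inv g) :∙ (:inv g :∙ h :∙ g) :∙ :inv g := h) ≈-refl g h)
      (∈conj⁻ (inv g) Q (subst (to (inv g ∙ h ∙ g) ∈ˢ_) (sym eq) ∈⊤))))
    j = proj₁ (missing-generator sub ≢⊤ B⊆)
    s∉ : s j ∉ Q′
    s∉ = proj₂ (missing-generator sub ≢⊤ B⊆)

  gM : Carrier → Color → Subset order
  gM g j = conjugate g (M j)

  gB⊆gM : ∀ g j b → b ∈ B → g ∙ b ∙ inv g ∈ gM g j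
  gB⊆gM g j b b∈ = ∈conj-∙ g (M j) (B⊆M j b b∈)

  gs∈gM : ∀ g j k → k ≢ j → g ∙ s k ∙ inv g ∈ gM g j
  gs∈gM g j k k≢j = ∈conj-∙ g (M j) (s∈M j k k≢j)

  gs∉gM : ∀ g j → g ∙ s j ∙ inv g ∉ gM g j
  gs∉gM g j p = s∉M j (∈-resp (solve 2 (λ g h → :inv g :∙ (g :∙ h :∙ :inv g) :∙ g := h) ≈-refl g (s j)) (∈conj⁻ g (M j) p))

  gM-proper : ∀ g j → ProperParabolic 𝒯 (gM g j)
  gM-proper g j = conjugate-subgroup g (M-subgroup j) ,
    (λ eq → gs∉gM g j (subst (to (g ∙ s j ∙ inv g) ∈ˢ_) (sym eq) ∈⊤)) , g , gB⊆gM g j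

  -- A proper subgroup above it lies in the conjugate for some colour `k` and misses the conjugate
  -- of `s k`. As the conjugates of all generators except `s j` are present, `k` must be `j`.
  gM-maximal : ∀ g j → MaximalParabolic 𝒯 (gM g j)
  gM-maximal g j = gM-proper g j , λ { (Q , (Q-sub , Q≢⊤ , _) , gM⊆Q , gM≢Q) →
    let k , s∉ , Q⊆ = ⊆conjugate Q-sub Q≢⊤ g (λ b b∈ → gM⊆Q (gB⊆gM g j b b∈))
        k≡j = decidable-stable (k Finₚ.≟ j) (λ k≢j → s∉ (gM⊆Q (gs∈gM g j k k≢j)))
    in gM≢Q (⊆-antisym gM⊆Q (subst (λ i → Q ⊆ˢ gM g i) k≡j Q⊆)) }

  maximal-form : ∀ {V} → MaximalParabolic 𝒯 V → ∀ g → (∀ b → b ∈ B → g ∙ b ∙ inv g ∈ V) → ∃ λ j → V ≡ gM g j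
  maximal-form {V} ((V-sub , V≢⊤ , _) , maximal) g gB⊆ =
    let j , _ , V⊆ = ⊆conjugate V-sub V≢⊤ g gB⊆
    in j , decidable-stable (V ≟ˢ gM g j) λ ≢ → maximal (gM g j , gM-proper g j , V⊆ , ≢)

  -- Vertices of colour `j` are thus the cosets of `M j`, and colours are well defined. The element
  -- g⁻¹h conjugates `B` into `M j` and so lies there; if `k` differed from `j`, then `s k` would
  -- lie in `M j`, and its conjugate by `h` in a subgroup that omits it.
  gM-injective : ∀ g h j k → gM g j ≡ gM h k → j ≡ k × inv g ∙ h ∈ M j
  gM-injective g h j k eq = decidable-stable (j Finₚ.≟ k) (λ j≢k → gs∉gM h k (subst (to (h ∙ s k ∙ inv h) ∈ˢ_) eq
      (∈conj⁺ g (M j) (∈-resp (rearrange (s k)) (M.∙-closed _ _ (M.∙-closed _ _ x∈ (s∈M j k (j≢k ∘ sym))) (M.inv-closed _ x∈)))))) , x∈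
    where
    module M = IsSubgroup (M-subgroup j)
    rearrange : ∀ b → (inv g ∙ h) ∙ b ∙ inv (inv g ∙ h) ≈ inv g ∙ (h ∙ b ∙ inv h) ∙ g
    rearrange b = solve 3 (λ g h b → (:inv g :∙ h) :∙ b :∙ :inv (:inv g :∙ h) := :inv g :∙ (h :∙ b :∙ :inv h) :∙ g) ≈-refl g h b
    x∈ : inv g ∙ h ∈ M j
    x∈ = conj⊆⇒∈ (M-subgroup j) (B⊆M j) (inv g ∙ h) λ b b∈ → ∈-resp (≈-sym (rearrange b))
      (∈conj⁻ g (M j) (subst (to (h ∙ b ∙ inv h) ∈ˢ_) (sym eq) (gB⊆gM h k b b∈)))

  gM-cong : ∀ g h j → inv g ∙ h ∈ M j → gM g j ≡ gM h j
  gM-cong g h j x∈ = ⊆-antisym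
    (from-⊆ λ y y∈ → ∈conj⁺ h (M j) (∈-resp
      (solve 3 (λ g h y → :inv (:inv g :∙ h) :∙ (:inv g :∙ y :∙ g) :∙ (:inv g :∙ h) := :inv h :∙ y :∙ h) ≈-refl g h y)
      (M.∙-closed _ _ (M.∙-closed _ _ (M.inv-closed _ x∈) (∈conj⁻ g (M j) y∈)) x∈)))
    (from-⊆ λ y y∈ → ∈conj⁺ g (M j) (∈-resp
      (solve 3 (λ g h y → (:inv g :∙ h) :∙ (:inv h :∙ y :∙ h) :∙ :inv (:inv g :∙ h) := :inv g :∙ y :∙ g) ≈-refl g h y)
      (M.∙-closed _ _ (M.∙-closed _ _ x∈ (∈conj⁻ h (M j) y∈)) (M.inv-closed _ x∈))))
    where module M = IsSubgroup (M-subgroup j)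

  maximals = maximalParabolics 𝒯

  Vertex : Set
  Vertex = Fin (length maximals)

  subgroup : Vertex → Subset order
  subgroup = List.lookup maximals

  subgroup-maximal : ∀ v → MaximalParabolic 𝒯 (subgroup v)
  subgroup-maximal v = proj₂ (∈-filter⁻ (maximalParabolic? 𝒯) {xs = subsets order} (∈-lookup v))

  subgroup-injective : ∀ {u v} → subgroup u ≡ subgroup v → u ≡ v
  subgroup-injective = lookup-injective (Uniqueₚ.filter⁺ (maximalParabolic? 𝒯) (subsets-unique order))

  abstract
    vertex : Carrier → Color → Vertex
    vertex g j = Any.index (∈-filter⁺ (maximalParabolic? 𝒯) (∈subsets (gM g j)) (gM-maximal g j))

    subgroup-vertex : ∀ g j → subgroup (vertex g j) ≡ gM g j
    subgroup-vertex g j = sym (lookup-index (∈-filter⁺ (maximalParabolic? 𝒯) (∈subsets (gM g j)) (gM-maximal g j)))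

  vertex-unique : ∀ v g j → subgroup v ≡ gM g j → v ≡ vertex g j
  vertex-unique v g j eq = subgroup-injective {v} {vertex g j} (trans eq (sym (subgroup-vertex g j)))

  vertex-form : ∀ v g → (∀ b → b ∈ B → g ∙ b ∙ inv g ∈ subgroup v) → ∃ λ j → v ≡ vertex g j
  vertex-form v g gB⊆ = Product.map₂ (vertex-unique v g _) (maximal-form (subgroup-maximal v) g gB⊆)

  abstract
    representative : ∀ v → ∃₂ λ g j → v ≡ vertex g j
    representative v = let (_ , _ , g , gB⊆) , _ = subgroup-maximal v in g , vertex-form v g gB⊆

  color : Vertex → Color
  color v = proj₁ (proj₂ (representative v))

  vertex-injective : ∀ g h j k → vertex g j ≡ vertex h k → j ≡ k × inv g ∙ h ∈ M j
  vertex-injective g h j k eq = gM-injective g h j k (trans (sym (subgroup-vertex g j)) (trans (cong subgroup eq) (subgroup-vertex h k)))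

  vertex-cong : ∀ g h j → inv g ∙ h ∈ M j → vertex g j ≡ vertex h j
  vertex-cong g h j x∈ = subgroup-injective (trans (subgroup-vertex g j) (trans (gM-cong g h j x∈) (sym (subgroup-vertex h j))))

  vertex-resp : ∀ {g h} j → g ≈ h → vertex g j ≡ vertex h j
  vertex-resp {g} {h} j g≈h = vertex-cong g h j (∈-resp (≈-trans (≈-sym (inverseˡ g)) (∙-congˡ g≈h)) (IsSubgroup.ε-closed (M-subgroup j)))

  -- Adjacent chambers differ only in the vertex of the crossed colour; the cancellation in the test
  -- cochain rests on this.
  vertex-s : ∀ g j k → k ≢ j → vertex g j ≡ vertex (g ∙ s k) j
  vertex-s g j k k≢j = vertex-cong g (g ∙ s k) j (∈-resp (solve 2 (λ g s → s := :inv g :∙ (g :∙ s)) ≈-refl g (s k)) (s∈M j k k≢j))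

  color-unique : ∀ g j v → v ≡ vertex g j → color v ≡ j
  color-unique g j v eq = sym (proj₁ (vertex-injective g (proj₁ (representative v)) j (color v)
    (trans (sym eq) (proj₂ (proj₂ (representative v))))))

  color-vertex : ∀ g j → color (vertex g j) ≡ j
  color-vertex g j = color-unique g j (vertex g j) refl

  -- v is a vertex of the chamber g B g⁻¹.
  InChamber : Carrier → Vertex → Set
  InChamber g v = v ≡ vertex g (color v)

  inChamber-vertex : ∀ g j → InChamber g (vertex g j)
  inChamber-vertex g j = cong (vertex g) (sym (color-vertex g j))

  inChamber-unique : ∀ v g → (∃ λ j → v ≡ vertex g j) → InChamber g v
  inChamber-unique v g (j , eq) = trans eq (cong (vertex g) (sym (color-unique g j v eq)))

  ⊇gB⇒inChamber : ∀ v g → (∀ b → b ∈ B → g ∙ b ∙ inv g ∈ subgroup v) → InChamber g v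
  ⊇gB⇒inChamber v g gB⊆ = inChamber-unique v g (vertex-form v g gB⊆)

  inChamber⇒⊇gB : ∀ v g → InChamber g v → ∀ b → b ∈ B → g ∙ b ∙ inv g ∈ subgroup v
  inChamber⇒⊇gB v g eq b b∈ = subst (to (g ∙ b ∙ inv g) ∈ˢ_)
    (sym (trans (cong subgroup eq) (subgroup-vertex g (color v)))) (gB⊆gM g (color v) b b∈)

  open Complex (building 𝒯) using (Simplex)

  simplex⇒chamber : ∀ {σ} → Simplex σ → ∃ λ g → (∀ v → v ∈ˢ σ → InChamber g v) × ∃ λ j → vertex g j ∈ˢ σ
  simplex⇒chamber {σ} (P , (P-sub , P≢⊤ , g , gB⊆) , refl) = g ,
    (λ v v∈ → ⊇gB⇒inChamber v g λ b b∈ → ∈-comprehension⁻ (λ v → P ⊆? subgroup v) v∈ (gB⊆ b b∈)) ,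
    let j , _ , P⊆ = ⊆conjugate P-sub P≢⊤ g gB⊆
    in j , ∈-comprehension⁺ (λ v → P ⊆? subgroup v) (λ i∈ → subst (_ ∈ˢ_) (sym (subgroup-vertex g j)) (P⊆ i∈))

  -- `P` is the intersection of the subgroups in `σ`, proper because of `v₀`. A vertex of the
  -- chamber outside `σ` cannot contain `P`: the conjugate of its own generator lies in every member
  -- of `σ` but not in that vertex.
  chamber⇒simplex : ∀ {σ} g → (∀ v → v ∈ˢ σ → InChamber g v) → ∀ v → v ∈ˢ σ → Simplex σ
  chamber⇒simplex {σ} g inChamber v₀ v₀∈ = P , (P-subgroup , P≢⊤ , g , gB⊆P) , ⊆-antisym σ⊆ ⊆σ
    where
    InAll : Pred Carrier 0ℓ
    InAll h = ∀ v → v ∈ˢ σ → h ∈ subgroup v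
    inAll? : ∀ h → Dec (InAll h)
    inAll? h = Finₚ.all? (λ v → (v ∈? σ) →-dec (to h ∈? subgroup v))
    inAll-resp : ∀ {h k} → h ≈ k → InAll h → InAll k
    inAll-resp h≈k p v v∈ = ∈-resp h≈k (p v v∈)
    P = collect inAll? inAll-resp
    P⁺ : ∀ {h} → InAll h → h ∈ P
    P⁺ = ∈-collect⁺ inAll? inAll-resp
    P⁻ : ∀ {h} → h ∈ P → InAll h
    P⁻ = ∈-collect⁻ inAll? inAll-resp
    module V v = IsSubgroup (proj₁ (proj₁ (subgroup-maximal v)))
    P-subgroup : IsSubgroup P
    P-subgroup = record
      { ε-closed = P⁺ λ v _ → V.ε-closed v
      ; ∙-closed = λ h k p q → P⁺ λ v v∈ → V.∙-closed v h k (P⁻ p v v∈) (P⁻ q v v∈)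
      ; inv-closed = λ h p → P⁺ λ v v∈ → V.inv-closed v h (P⁻ p v v∈) }
    P⊆ : ∀ v → v ∈ˢ σ → P ⊆ˢ subgroup v
    P⊆ v v∈ = from-⊆ λ h h∈ → P⁻ h∈ v v∈
    P≢⊤ : P ≢ full
    P≢⊤ eq = proj₁ (proj₂ (proj₁ (subgroup-maximal v₀))) (⊆-antisym ⊆⊤ (subst (_⊆ˢ subgroup v₀) eq (P⊆ v₀ v₀∈)))
    gB⊆P : ∀ b → b ∈ B → g ∙ b ∙ inv g ∈ P
    gB⊆P b b∈ = P⁺ λ v v∈ → inChamber⇒⊇gB v g (inChamber v v∈) b b∈
    σ⊆ : σ ⊆ˢ verticesOf 𝒯 P
    σ⊆ {v} v∈ = ∈-comprehension⁺ (λ v → P ⊆? subgroup v) (P⊆ v v∈)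
    ⊆σ : verticesOf 𝒯 P ⊆ˢ σ
    ⊆σ {v} v∈ = decidable-stable (v ∈? σ) λ v∉ → gs∉gM g (color v) (subst (to gs ∈ˢ_)
        (trans (cong subgroup v≡) (subgroup-vertex g (color v)))
        (P⊆v (P⁺ λ u u∈ → subst (to gs ∈ˢ_) (sym (trans (cong subgroup (inChamber u u∈)) (subgroup-vertex g (color u))))
          (gs∈gM g (color u) (color v) λ colors≡ → v∉ (subst (_∈ˢ σ) (trans (inChamber u u∈) (trans (cong (vertex g) (sym colors≡)) (sym v≡))) u∈)))))
      where
      gs = g ∙ s (color v) ∙ inv g
      P⊆v : P ⊆ˢ subgroup v
      P⊆v = ∈-comprehension⁻ (λ v → P ⊆? subgroup v) v∈
      v≡ : InChamber g v
      v≡ = ⊇gB⇒inChamber v g λ b b∈ → P⊆v (gB⊆P b b∈)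

  -- The letters of a reduced word must lie in every `M j`, which fails for the letter `j` itself;
  -- the word is therefore empty.
  ⋂M∩N⊆T : ∀ {x} → x ∈ N → (∀ j → x ∈ M j) → x ~ ε
  ⋂M∩N⊆T {x} x∈N x∈ = ~-stable λ not → reduce-N x∈N λ (ρ@(reduced u _ x~u _)) →
    not (no-letters u x~u λ j → Overgroup.letters-reduced (M-subgroup j) (B⊆M j) ρ (x∈ j))
    where
    no-letters : ∀ u → x ~ eval u → (∀ j → All (λ k → s k ∈ M j) u) → x ~ ε
    no-letters []      x~u _  = x~u
    no-letters (j ∷ u) x~u h = contradiction (All.head (h j)) (s∉M j)

-- Weights: counting the chambers around a face

module Weights {p} (X : Complex p) where

  open Complex X
  open Rationals
  open Sums
  open SubsetSums

  private
    n = #vertices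

  top⊇? : ∀ σ → Decidable (λ ρ → Simplex ρ × ∣ ρ ∣ ≡ suc dim × σ ⊆ˢ ρ)
  top⊇? σ ρ = simplex? ρ ×-dec (∣ ρ ∣ ℕₚ.≟ suc dim) ×-dec (σ ⊆? ρ)

  weight : Subset n → ℕ
  weight σ = length (filter (top⊇? σ) (subsets n))

  nat-weight : ∀ σ → nat (weight σ) ≡ Σ[ subsets n ] (λ ρ → [ top⊇? σ ρ ])
  nat-weight σ = trans (Σ-1 (filter (top⊇? σ) (subsets n))) (trans (Σ-filter (top⊇? σ) (subsets n) (λ _ → 1ℚ))
    (Σ-cong (subsets n) (λ ρ → ℚₚ.*-identityʳ [ top⊇? σ ρ ])))

  witness : ∀ {A : Set} {q} {Q : Pred A q} (Q? : Decidable Q) xs → length (filter Q? xs) ≢ 0 → ∃ Q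
  witness Q? []       h = contradiction refl h
  witness Q? (x ∷ xs) h with Q? x
  ... | yes q = x , q
  ... | no  _ = witness Q? xs h

  ins-⊆ : ∀ {v} {σ ρ : Subset n} → σ ⊆ˢ ρ → v ∈ˢ ρ → ins v σ ⊆ˢ ρ
  ins-⊆ {v} {σ} {ρ} σ⊆ v∈ {u} u∈ with u Finₚ.≟ v
  ... | yes refl = v∈
  ... | no u≢v   = σ⊆ (∈ins⁻ v σ u≢v u∈)

  weight-≢0⇒top : ∀ σ → weight σ ≢ 0 → ∃ λ ρ → Simplex ρ × ∣ ρ ∣ ≡ suc dim × σ ⊆ˢ ρ
  weight-≢0⇒top σ = witness (top⊇? σ) (subsets n)

  top⇒weight-≢0 : ∀ {σ ρ} → Simplex ρ → ∣ ρ ∣ ≡ suc dim → σ ⊆ˢ ρ → weight σ ≢ 0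
  top⇒weight-≢0 {σ} {ρ} simplex size σ⊆ eq = contradiction
    (subst (1ℚ ≤_) (trans (sym (nat-weight σ)) (cong nat eq))
      (subst (_≤ Σ[ subsets n ] (λ ρ → [ top⊇? σ ρ ])) ([yes] (top⊇? σ ρ) (simplex , size , σ⊆)) (Σ-≥ (λ ρ → 0≤χ (does (top⊇? σ ρ))) (∈subsets ρ))))
    λ 1≤0 → ℚₚ.<-irrefl refl (ℚₚ.<-≤-trans (ℚₚ.positive⁻¹ 1ℚ) 1≤0)

  weight-mono : ∀ v σ → weight σ ≡ 0 → weight (ins v σ) ≡ 0
  weight-mono v σ eq with weight (ins v σ) ℕₚ.≟ 0
  ... | yes ≡0 = ≡0
  ... | no  ≢0 = let ρ , simplex , size , ⊆ρ = weight-≢0⇒top (ins v σ) ≢0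
                 in contradiction eq (top⇒weight-≢0 simplex size (λ u∈ → ⊆ρ (∈ins⁺ v σ u∈)))

  Σ-on : ∀ {m} (σ : Subset m) → Σ[ allFin m ] (λ v → on v σ) ≡ nat ∣ σ ∣
  Σ-on []          = refl
  Σ-on (true ∷ σ)  = trans (Σ-allFin-suc (λ v → on v (true ∷ σ))) (trans (cong (1ℚ +_) (Σ-on σ)) (sym (nat-+ 1 ∣ σ ∣)))
  Σ-on (false ∷ σ) = trans (Σ-allFin-suc (λ v → on v (false ∷ σ))) (trans (cong (0ℚ +_) (Σ-on σ)) (ℚₚ.+-identityˡ (nat ∣ σ ∣)))

  Σ-off-on : ∀ (σ ρ : Subset n) → σ ⊆ˢ ρ → Σ[ allFin n ] (λ v → off v σ * on v ρ) + nat ∣ σ ∣ ≡ nat ∣ ρ ∣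
  Σ-off-on σ ρ σ⊆ = trans (cong (Σ[ allFin n ] (λ v → off v σ * on v ρ) +_) (sym (Σ-on σ)))
    (trans (sym (Σ-+ (allFin n) (λ v → off v σ * on v ρ) (λ v → on v σ))) (trans (Σ-cong (allFin n) pointwise) (Σ-on ρ)))
    where
    by-cases : ∀ a b → (a ≡ true → b ≡ true) → χ (not a) * χ b + χ a ≡ χ b
    by-cases true  b h rewrite h refl = refl
    by-cases false true  h = refl
    by-cases false false h = refl
    pointwise : ∀ v → off v σ * on v ρ + on v σ ≡ on v ρ
    pointwise v = by-cases (lookup σ v) (lookup ρ v) (λ v∈ → ∈⇒lookup (σ⊆ (lookup⇒∈ v∈)))

  -- Count the pairs of a chamber containing `σ` and a vertex of it outside `σ` in two ways; each
  -- chamber has `d` such vertices. The constant of the theorem originates here.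
  neighbours : ∀ σ d → ∣ σ ∣ ℕ.+ d ≡ suc dim → Σ[ allFin n ] (λ v → off v σ * nat (weight (ins v σ))) ≡ nat d * nat (weight σ)
  neighbours σ d size = begin
    Σ[ allFin n ] (λ v → off v σ * nat (weight (ins v σ)))
      ≡⟨ Σ-cong (allFin n) (λ v → trans (cong (off v σ *_) (nat-weight (ins v σ))) (Σ-*ˡ (subsets n) (off v σ) (λ ρ → [ top⊇? (ins v σ) ρ ]))) ⟩
    Σ[ allFin n ] (λ v → Σ[ subsets n ] (λ ρ → off v σ * [ top⊇? (ins v σ) ρ ]))
      ≡⟨ Σ-swap (allFin n) (subsets n) (λ v ρ → off v σ * [ top⊇? (ins v σ) ρ ]) ⟩
    Σ[ subsets n ] (λ ρ → Σ[ allFin n ] (λ v → off v σ * [ top⊇? (ins v σ) ρ ]))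
      ≡⟨ Σ-cong (subsets n) (λ ρ → inner ρ (top⊇? σ ρ)) ⟩
    Σ[ subsets n ] (λ ρ → nat d * [ top⊇? σ ρ ])
      ≡⟨ Σ-*ˡ (subsets n) (nat d) (λ ρ → [ top⊇? σ ρ ]) ⟨
    nat d * Σ[ subsets n ] (λ ρ → [ top⊇? σ ρ ])
      ≡⟨ cong (nat d *_) (nat-weight σ) ⟨
    nat d * nat (weight σ) ∎
    where
    open ≡-Reasoning
    cancel : ∀ a b c → a + b ≡ b + c → a ≡ c
    cancel a b c eq = trans (solve 2 (λ a b → a := (a :+ b) :- b) refl a b) (trans (cong (_- b) eq) (solve 2 (λ b c → (b :+ c) :- b := c) refl b c))
    count : ∀ ρ → ∣ ρ ∣ ≡ suc dim → σ ⊆ˢ ρ → Σ[ allFin n ] (λ v → off v σ * on v ρ) ≡ nat d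
    count ρ size′ σ⊆ = cancel _ (nat ∣ σ ∣) (nat d) (trans (Σ-off-on σ ρ σ⊆) (trans (cong nat (trans size′ (sym size))) (nat-+ ∣ σ ∣ d)))
    on-top : ∀ v ρ → Simplex ρ → ∣ ρ ∣ ≡ suc dim → σ ⊆ˢ ρ → [ top⊇? (ins v σ) ρ ] ≡ on v ρ
    on-top v ρ simplex size′ σ⊆ = by (lookup ρ v) refl
      where
      by : ∀ b → lookup ρ v ≡ b → [ top⊇? (ins v σ) ρ ] ≡ χ b
      by true  eq = [yes] (top⊇? (ins v σ) ρ) (simplex , size′ , ins-⊆ σ⊆ (lookup⇒∈ eq))
      by false eq = [no] (top⊇? (ins v σ) ρ) λ (_ , _ , ⊆ρ) → contradiction (trans (sym eq) (∈⇒lookup (⊆ρ (v∈ins v σ)))) λ ()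
    inner : ∀ ρ (t : Dec (Simplex ρ × ∣ ρ ∣ ≡ suc dim × σ ⊆ˢ ρ)) → Σ[ allFin n ] (λ v → off v σ * [ top⊇? (ins v σ) ρ ]) ≡ nat d * [ t ]
    inner ρ (yes (simplex , size′ , σ⊆)) = trans (Σ-cong (allFin n) (λ v → cong (off v σ *_) (on-top v ρ simplex size′ σ⊆)))
      (trans (count ρ size′ σ⊆) (sym (ℚₚ.*-identityʳ (nat d))))
    inner ρ (no none) = trans (Σ-0 (allFin n) (λ v → trans (cong (off v σ *_) ([no] (top⊇? (ins v σ) ρ)
        (λ (simplex , size′ , ⊆ρ) → none (simplex , size′ , λ u∈ → ⊆ρ (∈ins⁺ v σ u∈))))) (ℚₚ.*-zeroʳ (off v σ)))) (sym (ℚₚ.*-zeroʳ (nat d)))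

module Signs {r : ℕ} where

  open Rationals

  sg : Fin r → Fin r → ℚ
  sg a b = if does (a Finₚ.<? b) then - 1ℚ else 1ℚ

  sg-sq : ∀ a b → sg a b * sg a b ≡ 1ℚ
  sg-sq a b with does (a Finₚ.<? b)
  ... | true  = refl
  ... | false = refl

  Π : ∀ {A : Set} → List A → (A → ℚ) → ℚ
  Π xs f = List.foldr (λ a r → f a * r) 1ℚ xs

  Π-cong : ∀ {A : Set} (xs : List A) {f g : A → ℚ} → (∀ a → f a ≡ g a) → Π xs f ≡ Π xs g
  Π-cong []       h = refl
  Π-cong (x ∷ xs) h = cong₂ _*_ (h x) (Π-cong xs h)

  Π-* : ∀ {A : Set} (xs : List A) (f g : A → ℚ) → Π xs (λ a → f a * g a) ≡ Π xs f * Π xs g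
  Π-* []       f g = refl
  Π-* (x ∷ xs) f g = trans (cong ((f x * g x) *_) (Π-* xs f g))
    (solve 4 (λ a b c d → (a :* b) :* (c :* d) := (a :* c) :* (b :* d)) refl (f x) (g x) (Π xs f) (Π xs g))

  Π-1 : ∀ {A : Set} (xs : List A) {f : A → ℚ} → (∀ a → f a ≡ 1ℚ) → Π xs f ≡ 1ℚ
  Π-1 []       h = refl
  Π-1 (x ∷ xs) h = cong₂ _*_ (h x) (Π-1 xs h)

  factor : Fin r → Subset r → Fin r → ℚ
  factor a S b = if lookup S b then sg b a else 1ℚ

  -- The sign of moving a to its place in S, past the elements below it.
  ηˢ : Fin r → Subset r → ℚ
  ηˢ a S = Π (allFin r) (factor a S)

  ηˢ-sq : ∀ a S → ηˢ a S * ηˢ a S ≡ 1ℚ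
  ηˢ-sq a S = trans (sym (Π-* (allFin r) (factor a S) (factor a S))) (Π-1 (allFin r) (λ b → by b (lookup S b)))
    where
    by : ∀ b c → (if c then sg b a else 1ℚ) * (if c then sg b a else 1ℚ) ≡ 1ℚ
    by b true  = sg-sq b a
    by b false = refl

module Faces {c e} {G : FiniteGroup c e} {ℓ : ℕ} (𝒯 : TitsSystem G (suc ℓ))
  (M? : ∀ j g → Dec (Bruhat.D 𝒯 (_≢ j) g)) where

  open FiniteGroup G using (Carrier)
  open Chambers 𝒯 M? public
  open Weights (building 𝒯) public
  open Signs {suc ℓ} public
  open Rationals
  open Sums
  open SubsetSums
  open Complex (building 𝒯) using (Simplex)

  n : ℕ
  n = length maximals

  HasColor : Subset n → Color → Set
  HasColor σ c = ∃ λ v → v ∈ˢ σ × color v ≡ c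

  hasColor? : ∀ σ c → Dec (HasColor σ c)
  hasColor? σ c = Finₚ.any? (λ v → (v ∈? σ) ×-dec (color v Finₚ.≟ c))

  colors : Subset n → Subset (suc ℓ)
  colors σ = comprehension (hasColor? σ)

  ∈colors⁺ : ∀ {σ} v → v ∈ˢ σ → color v ∈ˢ colors σ
  ∈colors⁺ {σ} v v∈ = ∈-comprehension⁺ (hasColor? σ) (v , v∈ , refl)

  ∈colors⁻ : ∀ {σ c} → c ∈ˢ colors σ → HasColor σ c
  ∈colors⁻ {σ} = ∈-comprehension⁻ (hasColor? σ)

  -- Each simplex is oriented by increasing colour. This one choice serves the whole building, and
  -- incidence signs depend on colours only.
  η : Vertex → Subset n → ℚ
  η v σ = ηˢ (color v) (colors σ)

  InFace : Carrier → Subset (suc ℓ) → Vertex → Set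
  InFace x L v = color v ∈ˢ L × InChamber x v

  inFace? : ∀ x L v → Dec (InFace x L v)
  inFace? x L v = (color v ∈? L) ×-dec (v Finₚ.≟ vertex x (color v))

  face : Carrier → Subset (suc ℓ) → Subset n
  face x L = comprehension (inFace? x L)

  ∈face⁻ : ∀ x L {v} → v ∈ˢ face x L → InFace x L v
  ∈face⁻ x L = ∈-comprehension⁻ (inFace? x L)

  ∈face⁺ : ∀ x L {v} → InFace x L v → v ∈ˢ face x L
  ∈face⁺ x L = ∈-comprehension⁺ (inFace? x L)

  vertex∈face : ∀ x L c → c ∈ˢ L → vertex x c ∈ˢ face x L
  vertex∈face x L c c∈ = ∈face⁺ x L (subst (_∈ˢ L) (sym (color-vertex x c)) c∈ , inChamber-vertex x c)

  vertex∈face⁻ : ∀ x L c → vertex x c ∈ˢ face x L → c ∈ˢ L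
  vertex∈face⁻ x L c v∈ = subst (_∈ˢ L) (color-vertex x c) (proj₁ (∈face⁻ x L v∈))

  colors-face : ∀ x L → colors (face x L) ≡ L
  colors-face x L = ⊆-antisym
    (λ c∈ → let v , v∈ , eq = ∈colors⁻ {face x L} c∈ in subst (_∈ˢ L) eq (proj₁ (∈face⁻ x L v∈)))
    (λ {c} c∈ → subst (_∈ˢ colors (face x L)) (color-vertex x c) (∈colors⁺ {face x L} (vertex x c) (vertex∈face x L c c∈)))

  face-cong : ∀ x y L → (∀ c → c ∈ˢ L → vertex x c ≡ vertex y c) → face x L ≡ face y L
  face-cong x y L h = ⊆-antisym
    (λ v∈ → let c∈ , v≡ = ∈face⁻ x L v∈ in ∈face⁺ y L (c∈ , trans v≡ (h _ c∈)))
    (λ v∈ → let c∈ , v≡ = ∈face⁻ y L v∈ in ∈face⁺ x L (c∈ , trans v≡ (sym (h _ c∈))))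

  face-del : ∀ x c L → del (vertex x c) (face x L) ≡ face x (del c L)
  face-del x c L = ⊆-antisym
    (λ {v} v∈ → let v≢ , v∈face = ∈del⁻ (vertex x c) (face x L) v∈
                    c∈ , v≡ = ∈face⁻ x L v∈face
                in ∈face⁺ x (del c L) (∈del⁺ c L (λ eq → v≢ (trans v≡ (cong (vertex x) eq))) c∈ , v≡))
    (λ {v} v∈ → let c∈ , v≡ = ∈face⁻ x (del c L) v∈
                    ≢c , c∈L = ∈del⁻ c L c∈
                in ∈del⁺ (vertex x c) (face x L) (λ eq → ≢c (trans (cong color eq) (color-vertex x c))) (∈face⁺ x L (c∈L , v≡)))

  Σ-chamber : ∀ x (F : Vertex → ℚ) → (∀ v → ¬ InChamber x v → F v ≡ 0ℚ) →
    Σ[ allFin n ] F ≡ Σ[ allFin (suc ℓ) ] (F ∘ vertex x)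
  Σ-chamber x F vanishes = begin
    Σ[ allFin n ] F
      ≡⟨ Σ-cong (allFin n) split ⟩
    Σ[ allFin n ] (λ v → Σ[ allFin (suc ℓ) ] (λ c → [ v Finₚ.≟ vertex x c ] * F v))
      ≡⟨ Σ-swap (allFin n) (allFin (suc ℓ)) (λ v c → [ v Finₚ.≟ vertex x c ] * F v) ⟩
    Σ[ allFin (suc ℓ) ] (λ c → Σ[ allFin n ] (λ v → [ v Finₚ.≟ vertex x c ] * F v))
      ≡⟨ Σ-cong (allFin (suc ℓ)) (λ c → Σ-δ Finₚ._≟_ (Uniqueₚ.allFin⁺ n) (∈-allFin (vertex x c)) F) ⟩
    Σ[ allFin (suc ℓ) ] (F ∘ vertex x) ∎
    where
    open ≡-Reasoning
    split : ∀ v → F v ≡ Σ[ allFin (suc ℓ) ] (λ c → [ v Finₚ.≟ vertex x c ] * F v)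
    split v = by (v Finₚ.≟ vertex x (color v))
      where
      by : Dec (InChamber x v) → F v ≡ Σ[ allFin (suc ℓ) ] (λ c → [ v Finₚ.≟ vertex x c ] * F v)
      by (no out) = trans (vanishes v out) (sym (Σ-0 (allFin (suc ℓ)) (λ c → trans (cong ([ v Finₚ.≟ vertex x c ] *_) (vanishes v out)) (ℚₚ.*-zeroʳ [ v Finₚ.≟ vertex x c ]))))
      by (yes v≡) = sym (trans
        (Σ-cong (allFin (suc ℓ)) (λ c → cong (_* F v) ([]-cong (v Finₚ.≟ vertex x c) (c Finₚ.≟ color v)
          (λ eq → sym (color-unique x c v eq)) (λ eq → trans v≡ (cong (vertex x) (sym eq))))))
        (Σ-δ Finₚ._≟_ (Uniqueₚ.allFin⁺ (suc ℓ)) (∈-allFin (color v)) (λ _ → F v)))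

  nat-injective : ∀ a b → nat a ≡ nat b → a ≡ b
  nat-injective zero    zero    _  = refl
  nat-injective zero    (suc b) eq = contradiction (subst (0ℚ <_) (sym eq) (0<nat b)) (ℚₚ.<-irrefl refl)
  nat-injective (suc a) zero    eq = contradiction (subst (0ℚ <_) eq (0<nat a)) (ℚₚ.<-irrefl refl)
  nat-injective (suc a) (suc b) eq = cong suc (nat-injective a b (trans (predecessor a) (trans (cong (_- 1ℚ) eq) (sym (predecessor b)))))
    where
    predecessor : ∀ a → nat a ≡ nat (suc a) - 1ℚ
    predecessor a = trans (solve 1 (λ a → a := (:1 :+ a) :- :1) refl (nat a)) (cong (_- 1ℚ) (sym (nat-+ 1 a)))

  -- Cardinalities are compared as rational sums, so that `Σ-chamber` can pass from vertices to
  -- colours.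
  ∣face∣ : ∀ x L → ∣ face x L ∣ ≡ ∣ L ∣
  ∣face∣ x L = nat-injective ∣ face x L ∣ ∣ L ∣ (trans (sym (Σ-on (face x L)))
    (trans (Σ-chamber x (λ v → on v (face x L)) (λ v out → on-∉ v (face x L) (λ v∈ → out (proj₂ (∈face⁻ x L v∈)))))
      (trans (Σ-cong (allFin (suc ℓ)) pointwise) (Σ-on L))))
    where
    pointwise : ∀ c → on (vertex x c) (face x L) ≡ on c L
    pointwise c with c ∈? L
    ... | yes c∈ = trans (on-∈ (vertex x c) (face x L) (vertex∈face x L c c∈)) (sym (on-∈ c L c∈))
    ... | no  c∉ = trans (on-∉ (vertex x c) (face x L) (c∉ ∘ vertex∈face⁻ x L c)) (sym (on-∉ c L c∉))

  chamber : Carrier → Subset n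
  chamber x = face x full

  chamber-simplex : ∀ x → Simplex (chamber x)
  chamber-simplex x = chamber⇒simplex x (λ v v∈ → proj₂ (∈face⁻ x full v∈)) (vertex x zero) (vertex∈face x full zero ∈⊤)

  ∣chamber∣ : ∀ x → ∣ chamber x ∣ ≡ suc ℓ
  ∣chamber∣ x = trans (∣face∣ x full) (∣⊤∣≡n (suc ℓ))

  ⊆chamber⇒weight≢0 : ∀ {σ} x → (∀ v → v ∈ˢ σ → InChamber x v) → weight σ ≢ 0
  ⊆chamber⇒weight≢0 x h = top⇒weight-≢0 (chamber-simplex x) (∣chamber∣ x) (λ {v} v∈ → ∈face⁺ x full (∈⊤ , h v v∈))

  weight≢0⇒⊆chamber : ∀ {σ} → weight σ ≢ 0 → ∃ λ x → ∀ v → v ∈ˢ σ → InChamber x v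
  weight≢0⇒⊆chamber {σ} ≢0 = let ρ , simplex , _ , σ⊆ = weight-≢0⇒top σ ≢0
                                 x , h , _ = simplex⇒chamber simplex
                             in x , λ v v∈ → h v (σ⊆ v∈)

  face-weight≢0 : ∀ x L → weight (face x L) ≢ 0
  face-weight≢0 x L = ⊆chamber⇒weight≢0 x (λ v v∈ → proj₂ (∈face⁻ x L v∈))

  color-injective-on : ∀ {τ u v} → weight τ ≢ 0 → u ∈ˢ τ → v ∈ˢ τ → color u ≡ color v → u ≡ v
  color-injective-on ≢0 u∈ v∈ eq = let x , h = weight≢0⇒⊆chamber ≢0
    in trans (h _ u∈) (trans (cong (vertex x) eq) (sym (h _ v∈)))

  vertex∉face-del : ∀ x c L → ¬ vertex x c ∈ˢ face x (del c L)
  vertex∉face-del x c L v∈ = v∉del c L (vertex∈face⁻ x (del c L) c v∈)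

  -- The right side is the boundary of one face, with one term for each colour removed. On the left
  -- only vertices of the chamber `x` contribute, and these are indexed by colours.
  boundary-face : ∀ x L σ →
    Σ[ allFin n ] (λ v → off v σ * (η v σ * [ face x L ≟ˢ ins v σ ])) ≡
    Σ[ allFin (suc ℓ) ] (λ c → on c L * (ηˢ c (del c L) * [ face x (del c L) ≟ˢ σ ]))
  boundary-face x L σ = trans (Σ-chamber x F outside-0) (Σ-cong (allFin (suc ℓ)) (λ c → by c (face x (del c L) ≟ˢ σ) (c ∈? L)))
    where
    F : Vertex → ℚ
    F v = off v σ * (η v σ * [ face x L ≟ˢ ins v σ ])
    G′ : Color → ℚ
    G′ c = on c L * (ηˢ c (del c L) * [ face x (del c L) ≟ˢ σ ])
    F-0 : ∀ v → face x L ≢ ins v σ → F v ≡ 0ℚ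
    F-0 v ≢ = trans (cong (λ t → off v σ * (η v σ * t)) ([no] (face x L ≟ˢ ins v σ) ≢))
      (solve 2 (λ a b → a :* (b :* :0) := :0) refl (off v σ) (η v σ))
    outside-0 : ∀ v → ¬ InChamber x v → F v ≡ 0ℚ
    outside-0 v out = F-0 v λ eq → out (proj₂ (∈face⁻ x L (subst (v ∈ˢ_) (sym eq) (v∈ins v σ))))
    v∈⇒0 : ∀ v → v ∈ˢ σ → F v ≡ 0ℚ
    v∈⇒0 v v∈ = trans (cong (_* (η v σ * [ face x L ≟ˢ ins v σ ])) (off-∈ v σ v∈)) (ℚₚ.*-zeroˡ (η v σ * [ face x L ≟ˢ ins v σ ]))
    by : ∀ c → Dec (face x (del c L) ≡ σ) → Dec (c ∈ˢ L) → F (vertex x c) ≡ G′ c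
    by c (yes refl) (yes c∈) = cong₂ _*_
      (trans (off-∉ (vertex x c) (face x (del c L)) (vertex∉face-del x c L)) (sym (on-∈ c L c∈)))
      (cong₂ _*_ (cong₂ ηˢ (color-vertex x c) (colors-face x (del c L)))
        (trans ([yes] (face x L ≟ˢ ins (vertex x c) (face x (del c L)))
            (trans (sym (ins-del (vertex x c) (face x L) (vertex∈face x L c c∈))) (cong (ins (vertex x c)) (face-del x c L))))
          (sym ([yes] (face x (del c L) ≟ˢ face x (del c L)) refl))))
    by c _ (no c∉) = trans (F-0 (vertex x c) (λ eq → c∉ (vertex∈face⁻ x L c (subst (vertex x c ∈ˢ_) (sym eq) (v∈ins (vertex x c) σ)))))
      (sym (trans (cong (_* (ηˢ c (del c L) * [ face x (del c L) ≟ˢ σ ])) (on-∉ c L c∉)) (ℚₚ.*-zeroˡ (ηˢ c (del c L) * [ face x (del c L) ≟ˢ σ ]))))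
    by c (no ≢σ) (yes c∈) = trans (zero′ (vertex x c ∈? σ))
      (sym (trans (cong (λ t → on c L * (ηˢ c (del c L) * t)) ([no] (face x (del c L) ≟ˢ σ) ≢σ))
        (solve 2 (λ a b → a :* (b :* :0) := :0) refl (on c L) (ηˢ c (del c L)))))
      where
      zero′ : Dec (vertex x c ∈ˢ σ) → F (vertex x c) ≡ 0ℚ
      zero′ (yes v∈) = v∈⇒0 (vertex x c) v∈
      zero′ (no v∉)  = F-0 (vertex x c) λ eq → ≢σ (trans (sym (face-del x c L)) (trans (cong (del (vertex x c)) eq) (del-ins (vertex x c) σ v∉)))

-- The test cochain

module TestCochain {c e} {G : FiniteGroup c e} {ℓ : ℕ} (𝒯 : TitsSystem G (suc ℓ))
  (M? : ∀ j g → Dec (Bruhat.D 𝒯 (_≢ j) g)) (i : ℕ) (i<ℓ : i ℕ.< ℓ) where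

  open FiniteGroup G using (Carrier; _≈_; _∙_; ε; inv; order; enumeration; ∈-resp; IsSubgroup; group)
    renaming (refl to ≈-refl; sym to ≈-sym; trans to ≈-trans; _∈_ to _∈ᴳ_)
  open TitsSystem 𝒯
  open Bruhat 𝒯 using (eval; even; _~_; word-parity; ~-sym; ~-trans; ~-congʳ; ≈⇒~; ~-refl)
  open Faces 𝒯 M?
  open Rationals
  open Sums
  open SubsetSums
  open Inverse enumeration using (to; from; strictlyInverseʳ; strictlyInverseˡ; to-cong)
  open GroupSolver group using () renaming (solve to solveᴳ; _:=_ to _:≈_; _:∙_ to _:∙_; :inv_ to :inv_; :ε to :ε)

  private
    module N = IsSubgroup N-subgroup

  -- One even word is asked for; `word-parity` makes the choice of word immaterial.
  Even : Carrier → Set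
  Even x = ∃ λ u → even (length u) ≡ true × x ~ eval u

  below : ℕ → Subset (suc ℓ)
  below k = comprehension (λ c → toℕ c ℕₚ.<? k)

  ∈below⁺ : ∀ k {c} → toℕ c ℕ.< k → c ∈ˢ below k
  ∈below⁺ k = ∈-comprehension⁺ (λ c → toℕ c ℕₚ.<? k)

  ∈below⁻ : ∀ k {c} → c ∈ˢ below k → toℕ c ℕ.< k
  ∈below⁻ k = ∈-comprehension⁻ (λ c → toℕ c ℕₚ.<? k)

  ∣below∣ : ∀ r k → k ℕ.≤ r → ∣ comprehension {n = r} (λ c → toℕ c ℕₚ.<? k) ∣ ≡ k
  ∣below∣ zero    zero    _           = refl
  ∣below∣ (suc r) zero    _           = ∣below∣ r zero ℕ.z≤n
  ∣below∣ (suc r) (suc k) (ℕ.s≤s k≤r) = cong suc (∣below∣ r k k≤r)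

  J K′ : Subset (suc ℓ)
  J  = below (suc i)
  K′ = below (suc (suc i))

  k : Color
  -- The colour i + 1, the only one of `K′` outside `J`. Colours end at ℓ, so `i<ℓ` is what makes
  -- room for it.
  k = fromℕ< (ℕ.s≤s i<ℓ)

  toℕ-k : toℕ k ≡ suc i
  toℕ-k = Finₚ.toℕ-fromℕ< (ℕ.s≤s i<ℓ)

  k∈K′ : k ∈ˢ K′
  k∈K′ = ∈below⁺ (suc (suc i)) (ℕₚ.≤-reflexive (cong suc toℕ-k))

  del-k : del k K′ ≡ J
  del-k = ⊆-antisym
    (λ c∈ → let c≢k , c∈K′ = ∈del⁻ k K′ c∈ in ∈below⁺ (suc i)
      (ℕₚ.≤∧≢⇒< (ℕₚ.≤-pred (∈below⁻ (suc (suc i)) c∈K′)) (λ eq → c≢k (Finₚ.toℕ-injective (trans eq (sym toℕ-k))))))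
    (λ c∈ → ∈del⁺ k K′ (λ { refl → ℕₚ.<-irrefl toℕ-k (∈below⁻ (suc i) c∈) }) (∈below⁺ (suc (suc i)) (ℕₚ.m<n⇒m<1+n (∈below⁻ (suc i) c∈))))

  -- The preimage in N of W_J, the subgroup generated by the s c with c in J.
  InNJ : Carrier → Set
  InNJ x = x ∈ᴳ N × ∀ c → ¬ c ∈ˢ J → x ∈ᴳ M c

  inNJ? : ∀ x → Dec (InNJ x)
  inNJ? x = (to x ∈? N) ×-dec Finₚ.all? (λ c → ¬? (c ∈? J) →-dec (to x ∈? M c))

  InNJ-resp : ∀ {x y} → x ≈ y → InNJ x → InNJ y
  InNJ-resp x≈y (p , q) = ∈-resp x≈y p , λ c c∉ → ∈-resp x≈y (q c c∉)

  InNJ-s : ∀ c → c ∈ˢ J → ∀ {x} → InNJ x → InNJ (x ∙ s c)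
  InNJ-s c c∈ (p , q) = N.∙-closed _ _ p (s∈N c) , λ b b∉ → IsSubgroup.∙-closed (M-subgroup b) _ _ (q b b∉) (s∈M b c λ { refl → b∉ c∈ })

  InNJ-s⁻ : ∀ c → c ∈ˢ J → ∀ {x} → InNJ (x ∙ s c) → InNJ x
  InNJ-s⁻ c c∈ {x} (p , q) = ∈-resp cancel (N.∙-closed _ _ p (N.inv-closed _ (s∈N c))) , λ b b∉ →
      ∈-resp cancel (IsSubgroup.∙-closed (M-subgroup b) _ _ (q b b∉) (IsSubgroup.inv-closed (M-subgroup b) _ (s∈M b c λ { refl → b∉ c∈ })))
    where
    cancel : (x ∙ s c) ∙ inv (s c) ≈ x
    cancel = solveᴳ 2 (λ x s → (x :∙ s) :∙ :inv s :≈ x) ≈-refl x (s c)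

  module Signed (even? : ∀ x → Dec (Even x)) where

    sgn : Carrier → ℚ
    sgn x = if does (even? x) then 1ℚ else - 1ℚ

    Even-resp : ∀ {x y} → x ~ y → Even x → Even y
    Even-resp x~y (u , p , x~u) = u , p , ~-trans (~-sym x~y) x~u

    sgn-even : ∀ x → Even x → sgn x ≡ 1ℚ
    sgn-even x p with even? x
    ... | yes _ = refl
    ... | no ¬p = contradiction p ¬p

    sgn-odd : ∀ x → ¬ Even x → sgn x ≡ - 1ℚ
    sgn-odd x ¬p with even? x
    ... | yes p = contradiction p ¬p
    ... | no _  = refl

    sgn-resp : ∀ {x y} → x ~ y → sgn x ≡ sgn y
    sgn-resp {x} {y} x~y = by (even? x)
      where
      by : Dec (Even x) → sgn x ≡ sgn y
      by (yes p) = trans (sgn-even x p) (sym (sgn-even y (Even-resp x~y p)))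
      by (no ¬p) = trans (sgn-odd x ¬p) (sym (sgn-odd y (¬p ∘ Even-resp (~-sym x~y))))

    even-not : ∀ u c x → x ~ eval u → even (length u) ≡ true → ¬ Even (x ∙ s c)
    even-not u c x x~u p (v , q , xs~v) = contradiction (trans (sym (cong not p)) (trans (word-parity (c ∷ u) v (~-trans (~-sym (~-congʳ (s∈N c) x~u)) xs~v)) q)) λ ()

    odd-even : ∀ x c → x ∈ᴳ N → ¬ Even x → Even (x ∙ s c)
    odd-even x c x∈ ¬p = let u , x~u = Bruhat.word 𝒯 x x∈ in by u x~u (even (length u)) refl
      where
      by : ∀ u → x ~ eval u → ∀ b → even (length u) ≡ b → Even (x ∙ s c)
      by u x~u true  eq = contradiction (u , eq , x~u) ¬p
      by u x~u false eq = c ∷ u , cong not eq , ~-congʳ (s∈N c) x~u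

    sgn-s : ∀ x c → x ∈ᴳ N → sgn (x ∙ s c) ≡ - sgn x
    sgn-s x c x∈ = by (even? x)
      where
      by : Dec (Even x) → sgn (x ∙ s c) ≡ - sgn x
      by (yes p@(u , q , x~u)) = trans (sgn-odd (x ∙ s c) (even-not u c x x~u q)) (cong -_ (sym (sgn-even x p)))
      by (no ¬p) = trans (sgn-even (x ∙ s c) (odd-even x c x∈ ¬p)) (cong -_ (sym (sgn-odd x ¬p)))

    mult : Carrier → ℚ
    mult x = [ inNJ? x ] * sgn x

    term : Subset (suc ℓ) → Subset n → Carrier → ℚ
    term L σ x = mult x * [ face x L ≟ˢ σ ]

    -- The sum runs over the preimage of W_J in `N`, so each term occurs once for every element of
    -- `T`. This positive factor is harmless, and no representatives have to be chosen.
    A : Subset (suc ℓ) → Subset n → ℚ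
    A L σ = Σ[ allFin order ] (term L σ ∘ from)

    mult-resp : ∀ {x y} → x ≈ y → mult x ≡ mult y
    mult-resp {x} {y} x≈y = cong₂ _*_ ([]-cong (inNJ? x) (inNJ? y) (InNJ-resp x≈y) (InNJ-resp (≈-sym x≈y))) (sgn-resp (≈⇒~ x≈y))

    term-resp : ∀ L σ {x y} → x ≈ y → term L σ x ≡ term L σ y
    term-resp L σ {x} {y} x≈y = cong₂ _*_ (mult-resp x≈y) (cong (λ ρ → [ ρ ≟ˢ σ ]) (face-cong x y L (λ c _ → vertex-resp c x≈y)))

    mult-s : ∀ x c → c ∈ˢ J → mult (x ∙ s c) ≡ - mult x
    mult-s x c c∈ = by (inNJ? x)
      where
      by : Dec (InNJ x) → mult (x ∙ s c) ≡ - mult x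
      by (yes p) = trans ([yes]* (inNJ? (x ∙ s c)) (sgn (x ∙ s c)) (InNJ-s c c∈ p))
        (trans (sgn-s x c (proj₁ p)) (cong -_ (sym ([yes]* (inNJ? x) (sgn x) p))))
      by (no ¬p) = trans ([no]* (inNJ? (x ∙ s c)) (sgn (x ∙ s c)) (¬p ∘ InNJ-s⁻ c c∈))
        (cong -_ (sym ([no]* (inNJ? x) (sgn x) ¬p)))

    term-s : ∀ L σ x c → c ∈ˢ J → ¬ c ∈ˢ L → term L σ (x ∙ s c) ≡ - term L σ x
    term-s L σ x c c∈ c∉ = trans (cong₂ _*_ (mult-s x c c∈)
        (cong (λ ρ → [ ρ ≟ˢ σ ]) (face-cong (x ∙ s c) x L (λ b b∈ → sym (vertex-s x b c (λ { refl → c∉ b∈ }))))))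
      (solve 2 (λ a b → (:- a) :* b := :- (a :* b)) refl (mult x) [ face x L ≟ˢ σ ])

    Σ-translate : ∀ y (f : Carrier → ℚ) → (∀ {g h} → g ≈ h → f g ≡ f h) →
      Σ[ allFin order ] (λ a → f (from a ∙ y)) ≡ Σ[ allFin order ] (f ∘ from)
    Σ-translate y f resp = begin
      Σ[ allFin order ] (λ a → f (from a ∙ y))
        ≡⟨ Σ-cong (allFin order) (λ a → trans (resp (≈-sym (strictlyInverseʳ (from a ∙ y)))) (sym (Σ-δ Finₚ._≟_ (Uniqueₚ.allFin⁺ order) (∈-allFin (to (from a ∙ y))) (f ∘ from)))) ⟩
      Σ[ allFin order ] (λ a → Σ[ allFin order ] (λ b → [ b Finₚ.≟ to (from a ∙ y) ] * f (from b)))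
        ≡⟨ Σ-swap (allFin order) (allFin order) (λ a b → [ b Finₚ.≟ to (from a ∙ y) ] * f (from b)) ⟩
      Σ[ allFin order ] (λ b → Σ[ allFin order ] (λ a → [ b Finₚ.≟ to (from a ∙ y) ] * f (from b)))
        ≡⟨ Σ-cong (allFin order) (λ b → trans
             (Σ-cong (allFin order) (λ a → cong (_* f (from b)) ([]-cong (b Finₚ.≟ to (from a ∙ y)) (a Finₚ.≟ to (from b ∙ inv y)) (forth a b) (back a b))))
             (Σ-δ Finₚ._≟_ (Uniqueₚ.allFin⁺ order) (∈-allFin (to (from b ∙ inv y))) (λ _ → f (from b)))) ⟩
      Σ[ allFin order ] (f ∘ from) ∎
      where
      open ≡-Reasoning
      forth : ∀ a b → b ≡ to (from a ∙ y) → a ≡ to (from b ∙ inv y)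
      forth a b refl = trans (sym (strictlyInverseˡ a)) (to-cong (≈-trans
        (solveᴳ 2 (λ a y → a :≈ (a :∙ y) :∙ :inv y) ≈-refl (from a) y) (FiniteGroup.∙-congʳ G (≈-sym (strictlyInverseʳ (from a ∙ y))))))
      back : ∀ a b → a ≡ to (from b ∙ inv y) → b ≡ to (from a ∙ y)
      back a b refl = trans (sym (strictlyInverseˡ b)) (to-cong (≈-trans
        (solveᴳ 2 (λ b y → b :≈ (b :∙ :inv y) :∙ y) ≈-refl (from b) y) (FiniteGroup.∙-congʳ G (≈-sym (strictlyInverseʳ (from b ∙ inv y))))))

    -- Rather than pairing terms, translate the whole sum by `s c`: faces of type `L` stay fixed,
    -- signs flip, and the sum equals its own negative.
    A-vanish : ∀ L σ c → c ∈ˢ J → ¬ c ∈ˢ L → A L σ ≡ 0ℚ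
    A-vanish L σ c c∈ c∉ = self-negative (A L σ) (trans (sym (Σ-translate (s c) (term L σ) (term-resp L σ)))
        (trans (Σ-cong (allFin order) (λ a → trans (term-s L σ (from a) c c∈ c∉) (solve 1 (λ t → :- t := (:- :1) :* t) refl (term L σ (from a)))))
          (trans (sym (Σ-*ˡ (allFin order) (- 1ℚ) (term L σ ∘ from))) (solve 1 (λ t → (:- :1) :* t := :- t) refl (A L σ)))))
      where
      self-negative : ∀ a → a ≡ - a → a ≡ 0ℚ
      self-negative a eq = OrderedRing.sq-0 orderedRing {a} (subst (0ℚ ≤_) (trans (cong (a *_) eq) (solve 1 (λ a → a :* :- a := :- (a :* a)) refl a)) (0≤sq a))

    A-weight : ∀ L σ → weight σ ≡ 0 → A L σ ≡ 0ℚ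
    A-weight L σ ≡0 = Σ-0 (allFin order) λ a → trans (cong (mult (from a) *_)
      ([no] (face (from a) L ≟ˢ σ) (λ eq → face-weight≢0 (from a) L (trans (cong weight eq) ≡0)))) (ℚₚ.*-zeroʳ (mult (from a)))

    A-colors : ∀ L σ → colors σ ≢ L → A L σ ≡ 0ℚ
    A-colors L σ ≢L = Σ-0 (allFin order) λ a → trans (cong (mult (from a) *_)
      ([no] (face (from a) L ≟ˢ σ) (λ eq → ≢L (trans (cong colors (sym eq)) (colors-face (from a) L))))) (ℚₚ.*-zeroʳ (mult (from a)))

    θ : ℚ
    θ = ηˢ k J

    boundary-A : ∀ σ → Σ[ allFin n ] (λ v → off v σ * (η v σ * A K′ (ins v σ))) ≡ θ * A J σ
    boundary-A σ = begin
      Σ[ allFin n ] (λ v → off v σ * (η v σ * A K′ (ins v σ)))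
        ≡⟨ Σ-cong (allFin n) (λ v → trans (cong (off v σ *_) (Σ-*ˡ (allFin order) (η v σ) (term K′ (ins v σ) ∘ from)))
             (trans (Σ-*ˡ (allFin order) (off v σ) (λ a → η v σ * term K′ (ins v σ) (from a)))
               (Σ-cong (allFin order) (λ a → solve 4 (λ o e m t → o :* (e :* (m :* t)) := m :* (o :* (e :* t))) refl
                 (off v σ) (η v σ) (mult (from a)) [ face (from a) K′ ≟ˢ ins v σ ])))) ⟩
      Σ[ allFin n ] (λ v → Σ[ allFin order ] (λ a → mult (from a) * (off v σ * (η v σ * [ face (from a) K′ ≟ˢ ins v σ ]))))
        ≡⟨ Σ-swap (allFin n) (allFin order) (λ v a → mult (from a) * (off v σ * (η v σ * [ face (from a) K′ ≟ˢ ins v σ ]))) ⟩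
      Σ[ allFin order ] (λ a → Σ[ allFin n ] (λ v → mult (from a) * (off v σ * (η v σ * [ face (from a) K′ ≟ˢ ins v σ ]))))
        ≡⟨ Σ-cong (allFin order) (λ a → trans (sym (Σ-*ˡ (allFin n) (mult (from a)) (λ v → off v σ * (η v σ * [ face (from a) K′ ≟ˢ ins v σ ]))))
             (trans (cong (mult (from a) *_) (boundary-face (from a) K′ σ))
               (trans (Σ-*ˡ (allFin (suc ℓ)) (mult (from a)) (λ c → on c K′ * (ηˢ c (del c K′) * [ face (from a) (del c K′) ≟ˢ σ ])))
                 (Σ-cong (allFin (suc ℓ)) (λ c → solve 4 (λ m o e t → m :* (o :* (e :* t)) := (o :* e) :* (m :* t)) refl
                   (mult (from a)) (on c K′) (ηˢ c (del c K′)) [ face (from a) (del c K′) ≟ˢ σ ]))))) ⟩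
      Σ[ allFin order ] (λ a → Σ[ allFin (suc ℓ) ] (λ c → (on c K′ * ηˢ c (del c K′)) * term (del c K′) σ (from a)))
        ≡⟨ Σ-swap (allFin order) (allFin (suc ℓ)) (λ a c → (on c K′ * ηˢ c (del c K′)) * term (del c K′) σ (from a)) ⟩
      Σ[ allFin (suc ℓ) ] (λ c → Σ[ allFin order ] (λ a → (on c K′ * ηˢ c (del c K′)) * term (del c K′) σ (from a)))
        ≡⟨ Σ-cong (allFin (suc ℓ)) (λ c → trans (sym (Σ-*ˡ (allFin order) (on c K′ * ηˢ c (del c K′)) (term (del c K′) σ ∘ from))) (only-k c (c Finₚ.≟ k) (c ∈? K′))) ⟩
      Σ[ allFin (suc ℓ) ] (λ c → [ c Finₚ.≟ k ] * (θ * A J σ))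
        ≡⟨ Σ-δ Finₚ._≟_ (Uniqueₚ.allFin⁺ (suc ℓ)) (∈-allFin k) (λ _ → θ * A J σ) ⟩
      θ * A J σ ∎
      where
      open ≡-Reasoning
      only-k : ∀ c (d : Dec (c ≡ k)) → Dec (c ∈ˢ K′) → (on c K′ * ηˢ c (del c K′)) * A (del c K′) σ ≡ [ d ] * (θ * A J σ)
      only-k c (yes refl) _ = trans (cong₂ (λ o L → (o * ηˢ k L) * A L σ) (on-∈ k K′ k∈K′) del-k)
        (solve 2 (λ t a → (:1 :* t) :* a := :1 :* (t :* a)) refl θ (A J σ))
      only-k c (no c≢k) (yes c∈) = trans (cong ((on c K′ * ηˢ c (del c K′)) *_) (A-vanish (del c K′) σ c (subst (c ∈ˢ_) del-k (∈del⁺ k K′ c≢k c∈)) (v∉del c K′)))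
        (solve 3 (λ o e a → (o :* e) :* :0 := :0 :* a) refl (on c K′) (ηˢ c (del c K′)) (θ * A J σ))
      only-k c (no c≢k) (no c∉) = trans (cong (λ o → (o * ηˢ c (del c K′)) * A (del c K′) σ) (on-∉ c K′ c∉))
        (solve 3 (λ e a b → (:0 :* e) :* a := :0 :* b) refl (ηˢ c (del c K′)) (A (del c K′) σ) (θ * A J σ))

    σ₀ : Subset n
    σ₀ = face ε J

    -- Only elements of T, which have sign 1, stabilise the face of type J of the fundamental chamber.
    1≤A : 1ℚ ≤ A J σ₀
    1≤A = subst (_≤ A J σ₀) term-ε (Σ-≥ {f = term J σ₀ ∘ from} (λ a → nonneg (from a)) (∈-allFin (to ε)))
      where
      NJ-ε : InNJ ε
      NJ-ε = N.ε-closed , λ c _ → IsSubgroup.ε-closed (M-subgroup c)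
      even-ε : ∀ {x} → x ~ ε → Even x
      even-ε x~ε = [] , refl , x~ε
      stabiliser : ∀ x → InNJ x → face x J ≡ σ₀ → x ~ ε
      stabiliser x (x∈N , x∈M) eq = ⋂M∩N⊆T x∈N λ c → by c (c ∈? J)
        where
        by : ∀ c → Dec (c ∈ˢ J) → x ∈ᴳ M c
        by c (no c∉)  = x∈M c c∉
        by c (yes c∈) = ∈-resp (solveᴳ 1 (λ x → :inv :ε :∙ x :≈ x) ≈-refl x)
          (proj₂ (vertex-injective ε x c c (sym (trans (proj₂ (∈face⁻ ε J (subst (vertex x c ∈ˢ_) eq (vertex∈face x J c c∈)))) (cong (vertex ε) (color-vertex x c))))))
      nonneg : ∀ x → 0ℚ ≤ term J σ₀ x
      nonneg x = by (inNJ? x) (face x J ≟ˢ σ₀)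
        where
        by : (d : Dec (InNJ x)) (d′ : Dec (face x J ≡ σ₀)) → 0ℚ ≤ ([ d ] * sgn x) * [ d′ ]
        by (yes p) (yes q) = subst (λ t → 0ℚ ≤ (1ℚ * t) * 1ℚ) (sym (sgn-even x (even-ε (stabiliser x p q)))) (ℚₚ.<⇒≤ (ℚₚ.positive⁻¹ 1ℚ))
        by (no _)  d′      = ℚₚ.≤-reflexive (solve 2 (λ a b → :0 := (:0 :* a) :* b) refl (sgn x) [ d′ ])
        by (yes _) (no _)  = ℚₚ.≤-reflexive (solve 1 (λ a → :0 := (:1 :* a) :* :0) refl (sgn x))
      term-ε : term J σ₀ (from (to ε)) ≡ 1ℚ
      term-ε = trans (term-resp J σ₀ (strictlyInverseʳ ε)) (cong₂ _*_ (trans ([yes]* (inNJ? ε) (sgn ε) NJ-ε) (sgn-even ε (even-ε ~-refl))) ([yes] (σ₀ ≟ˢ σ₀) refl))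

module TestVector {c e} {G : FiniteGroup c e} {ℓ : ℕ} (𝒯 : TitsSystem G (suc ℓ))
  (M? : ∀ j g → Dec (Bruhat.D 𝒯 (_≢ j) g)) (i : ℕ) (i<ℓ : i ℕ.< ℓ)
  (even? : ∀ x → Dec (TestCochain.Even 𝒯 M? i i<ℓ x)) where

  open Faces 𝒯 M?
  open TestCochain 𝒯 M? i i<ℓ
  open Signed even?
  open Rationals
  open Sums
  open SubsetSums
  open Coordinates
  open Spectral weight weight-mono η renaming (weight to degreeWeight)
  open Degree (suc i)

  φ : Subset n → ℚ
  φ σ = ratio 1 (weight σ) * (θ * A J σ)

  h : Subset n → ℚ
  h τ = ratio 1 (weight τ) * A K′ τ

  φ-colors : ∀ σ → colors σ ≢ J → φ σ ≡ 0ℚ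
  φ-colors σ ≢J = trans (cong (λ a → ratio 1 (weight σ) * (θ * a)) (A-colors J σ ≢J))
    (solve 2 (λ r t → r :* (t :* :0) := :0) refl (ratio 1 (weight σ)) θ)

  ratio-cancel : ∀ a b → ratio (suc a) b * ratio 1 (suc a) ≡ ratio 1 b
  ratio-cancel a zero    = ℚₚ.*-zeroˡ (ratio 1 (suc a))
  ratio-cancel a (suc b) = cancel (nat (suc b)) (0<nat b) (trans
    (solve 3 (λ x y z → (x :* y) :* z := y :* (x :* z)) refl (ratio (suc a) (suc b)) (ratio 1 (suc a)) (nat (suc b)))
    (trans (cong (ratio 1 (suc a) *_) (ratio-* (suc a) b)) (trans (ratio-* 1 a) (sym (ratio-* 1 b)))))
    where
    cancel : ∀ {p q} z → 0ℚ < z → p * z ≡ q * z → p ≡ q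
    cancel {p} {q} z z>0 eq = let y , _ , yz≡1 = inverse z>0 in
      trans (unit p z y yz≡1) (trans (cong (_* y) eq) (sym (unit q z y yz≡1)))
      where
      unit : ∀ p z y → y * z ≡ 1ℚ → p ≡ p * z * y
      unit p z y yz≡1 = trans (sym (ℚₚ.*-identityʳ p)) (trans (cong (p *_) (sym yz≡1)) (solve 3 (λ p z y → p :* (y :* z) := p :* z :* y) refl p z y))

  -- Dividing by the weight cancels the numerator of the ratio in δ and leaves the unweighted
  -- boundary over w(σ). The cancellation in `boundary-A` can then proceed without comparing
  -- weights.
  δh : ∀ σ → δ h σ ≡ φ σ
  δh σ = begin
    Σ[ allFin n ] (λ v → (off v σ * (ratio (weight (ins v σ)) (weight σ) * η v σ)) * (ratio 1 (weight (ins v σ)) * A K′ (ins v σ)))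
      ≡⟨ Σ-cong (allFin n) (λ v → trans
           (solve 5 (λ o r e q a → (o :* (r :* e)) :* (q :* a) := (o :* e) :* ((r :* q) :* a)) refl
             (off v σ) (ratio (weight (ins v σ)) (weight σ)) (η v σ) (ratio 1 (weight (ins v σ))) (A K′ (ins v σ)))
           (trans (cong ((off v σ * η v σ) *_) (simplify (weight (ins v σ)) (A K′ (ins v σ)) (A-weight K′ (ins v σ))))
             (solve 4 (λ o e q a → (o :* e) :* (q :* a) := q :* (o :* (e :* a))) refl (off v σ) (η v σ) (ratio 1 (weight σ)) (A K′ (ins v σ))))) ⟩
    Σ[ allFin n ] (λ v → ratio 1 (weight σ) * (off v σ * (η v σ * A K′ (ins v σ))))
      ≡⟨ Σ-*ˡ (allFin n) (ratio 1 (weight σ)) (λ v → off v σ * (η v σ * A K′ (ins v σ))) ⟨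
    ratio 1 (weight σ) * Σ[ allFin n ] (λ v → off v σ * (η v σ * A K′ (ins v σ)))
      ≡⟨ cong (ratio 1 (weight σ) *_) (boundary-A σ) ⟩
    φ σ ∎
    where
    open ≡-Reasoning
    simplify : ∀ w a → (w ≡ 0 → a ≡ 0ℚ) → (ratio w (weight σ) * ratio 1 w) * a ≡ ratio 1 (weight σ) * a
    -- Here the default ratio does not cancel, but `A` vanishes because faces of chambers have
    -- non-zero weight.
    simplify zero    a p = trans (cong ((ratio 0 (weight σ) * ratio 1 0) *_) (p refl)) (trans (ℚₚ.*-zeroʳ (ratio 0 (weight σ) * ratio 1 0))
      (sym (trans (cong (ratio 1 (weight σ) *_) (p refl)) (ℚₚ.*-zeroʳ (ratio 1 (weight σ))))))
    simplify (suc w) a _ = cong (_* a) (ratio-cancel w (weight σ))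

  summand : Subset n → Vertex → ℚ
  summand τ v = (on v τ * η v (del v τ)) * φ (del v τ)

  -- A simplex has at most one face with colour set J.
  summands-disjoint : ∀ τ → weight τ ≢ 0 → ∀ u v → u ≢ v → summand τ u * summand τ v ≡ 0ℚ
  summands-disjoint τ ≢0 u v u≢v = by (u ∈? τ) (v ∈? τ) (colors (del u τ) ≟ˢ J) (colors (del v τ) ≟ˢ J)
    where
    left : summand τ u ≡ 0ℚ → summand τ u * summand τ v ≡ 0ℚ
    left eq = trans (cong (_* summand τ v) eq) (ℚₚ.*-zeroˡ (summand τ v))
    right : summand τ v ≡ 0ℚ → summand τ u * summand τ v ≡ 0ℚ
    right eq = trans (cong (summand τ u *_) eq) (ℚₚ.*-zeroʳ (summand τ u))
    outside-0 : ∀ v → ¬ v ∈ˢ τ → summand τ v ≡ 0ℚ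
    outside-0 v v∉ = trans (cong (λ o → (o * η v (del v τ)) * φ (del v τ)) (on-∉ v τ v∉)) (solve 2 (λ e f → (:0 :* e) :* f := :0) refl (η v (del v τ)) (φ (del v τ)))
    colors-0 : ∀ v → colors (del v τ) ≢ J → summand τ v ≡ 0ℚ
    colors-0 v ≢J = trans (cong ((on v τ * η v (del v τ)) *_) (φ-colors (del v τ) ≢J)) (ℚₚ.*-zeroʳ (on v τ * η v (del v τ)))
    by : Dec (u ∈ˢ τ) → Dec (v ∈ˢ τ) → Dec (colors (del u τ) ≡ J) → Dec (colors (del v τ) ≡ J) → summand τ u * summand τ v ≡ 0ℚ
    by (no u∉) _ _ _ = left (outside-0 u u∉)
    by _ (no v∉) _ _ = right (outside-0 v v∉)
    by _ _ (no ≢J) _ = left (colors-0 u ≢J)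
    by _ _ _ (no ≢J) = right (colors-0 v ≢J)
    by (yes u∈) (yes v∈) (yes ≡J) (yes ≡J′) =
      let t , t∈ , eq = ∈colors⁻ {del u τ} (subst (color u ∈ˢ_) (trans ≡J′ (sym ≡J)) (∈colors⁺ {del v τ} u (∈del⁺ v τ u≢v u∈)))
          t≢u , t∈τ = ∈del⁻ u τ t∈
      in contradiction (color-injective-on ≢0 t∈τ u∈ eq) t≢u

  square-disjoint : ∀ (f : Vertex → ℚ) → (∀ u v → u ≢ v → f u * f v ≡ 0ℚ) → Σ[ allFin n ] f * Σ[ allFin n ] f ≡ Σ[ allFin n ] (λ v → f v * f v)
  square-disjoint f disjoint = trans (Σ-*ʳ (allFin n) (Σ[ allFin n ] f) f) (Σ-cong (allFin n) (λ u → trans (Σ-*ˡ (allFin n) (f u) f)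
    (trans (Σ-cong (allFin n) (λ v → by u v (v Finₚ.≟ u))) (Σ-δ Finₚ._≟_ (Uniqueₚ.allFin⁺ n) (∈-allFin u) (λ v → f u * f v)))))
    where
    by : ∀ u v (d : Dec (v ≡ u)) → f u * f v ≡ [ d ] * (f u * f v)
    by u v (yes _)  = sym (ℚₚ.*-identityˡ (f u * f v))
    by u v (no v≢u) = trans (disjoint u v (v≢u ∘ sym)) (sym (ℚₚ.*-zeroˡ (f u * f v)))

  summand-sq : ∀ τ v → summand τ v * summand τ v ≡ on v τ * (φ (del v τ) * φ (del v τ))
  summand-sq τ v = trans (solve 3 (λ o e f → ((o :* e) :* f) :* ((o :* e) :* f) := ((o :* o) :* (e :* e)) :* (f :* f)) refl (on v τ) (η v (del v τ)) (φ (del v τ)))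
    (cong (_* (φ (del v τ) * φ (del v τ))) (trans (cong₂ _*_ (idempotent (lookup τ v)) (ηˢ-sq (color v) (colors (del v τ)))) (ℚₚ.*-identityʳ (on v τ))))
    where
    idempotent : ∀ b → χ b * χ b ≡ χ b
    idempotent true  = refl
    idempotent false = refl

  -- A sum with at most one non-zero term squares termwise, and the signs square to 1. Exchanging
  -- faces and cofaces then leaves the weights of all σ ∪ {v}, which `neighbours` adds up.
  norm-D : I₂.ip (D φ) (D φ) ≡ nat (ℓ ℕ.∸ i) * I₁.ip φ φ
  norm-D = begin
    Σ[ subsets n ] (λ τ → W₂ τ * (D φ τ * D φ τ))
      ≡⟨ Σ-cong (subsets n) (λ τ → trans (squares τ (weight τ ℕₚ.≟ 0)) (trans (Σ-*ˡ (allFin n) (W₂ τ) (λ v → on v τ * (φ (del v τ) * φ (del v τ))))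
           (Σ-cong (allFin n) (λ v → solve 3 (λ w o f → w :* (o :* f) := o :* (w :* f)) refl (W₂ τ) (on v τ) (φ (del v τ) * φ (del v τ)))))) ⟩
    Σ[ subsets n ] (λ τ → Σ[ allFin n ] (λ v → on v τ * (W₂ τ * (φ (del v τ) * φ (del v τ)))))
      ≡⟨ Σ-swap (subsets n) (allFin n) (λ τ v → on v τ * (W₂ τ * (φ (del v τ) * φ (del v τ)))) ⟩
    Σ[ allFin n ] (λ v → Σ[ subsets n ] (λ τ → on v τ * (W₂ τ * (φ (del v τ) * φ (del v τ)))))
      ≡⟨ Σ-cong (allFin n) (λ v → Σ-toggle v (λ σ τ → W₂ τ * (φ σ * φ σ))) ⟩
    Σ[ allFin n ] (λ v → Σ[ subsets n ] (λ σ → off v σ * (W₂ (ins v σ) * (φ σ * φ σ))))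
      ≡⟨ Σ-swap (allFin n) (subsets n) (λ v σ → off v σ * (W₂ (ins v σ) * (φ σ * φ σ))) ⟩
    Σ[ subsets n ] (λ σ → Σ[ allFin n ] (λ v → off v σ * (W₂ (ins v σ) * (φ σ * φ σ))))
      ≡⟨ Σ-cong (subsets n) (λ σ → trans (Σ-cong (allFin n) (λ v → sym (ℚₚ.*-assoc (off v σ) (W₂ (ins v σ)) (φ σ * φ σ))))
           (trans (sym (Σ-*ʳ (allFin n) (φ σ * φ σ) (λ v → off v σ * W₂ (ins v σ))))
             (trans (cong (_* (φ σ * φ σ)) (extensions σ (∣ σ ∣ ℕₚ.≟ suc i))) (ℚₚ.*-assoc (nat d) (W₁ σ) (φ σ * φ σ))))) ⟩
    Σ[ subsets n ] (λ σ → nat d * (W₁ σ * (φ σ * φ σ)))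
      ≡⟨ Σ-*ˡ (subsets n) (nat d) (λ σ → W₁ σ * (φ σ * φ σ)) ⟨
    nat d * I₁.ip φ φ ∎
    where
    open ≡-Reasoning
    d = ℓ ℕ.∸ i
    W₁ W₂ : Subset n → ℚ
    W₁ = degreeWeight (suc i)
    W₂ = degreeWeight (suc (suc i))
    squares : ∀ τ → Dec (weight τ ≡ 0) → W₂ τ * (D φ τ * D φ τ) ≡ W₂ τ * Σ[ allFin n ] (λ v → on v τ * (φ (del v τ) * φ (del v τ)))
    squares τ (yes ≡0) = trans (zero-weight (D φ τ * D φ τ)) (sym (zero-weight (Σ[ allFin n ] (λ v → on v τ * (φ (del v τ) * φ (del v τ))))))
      where
      zero-weight : ∀ a → W₂ τ * a ≡ 0ℚ
      zero-weight a = trans (cong (λ w → ([ ∣ τ ∣ ℕₚ.≟ suc (suc i) ] * nat w) * a) ≡0) (solve 2 (λ b a → (b :* :0) :* a := :0) refl [ ∣ τ ∣ ℕₚ.≟ suc (suc i) ] a)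
    squares τ (no ≢0) = cong (W₂ τ *_) (trans (square-disjoint (summand τ) (summands-disjoint τ ≢0)) (Σ-cong (allFin n) (summand-sq τ)))
    W₂-ins : ∀ v σ (t : Dec (∣ σ ∣ ≡ suc i)) → off v σ * W₂ (ins v σ) ≡ [ t ] * (off v σ * nat (weight (ins v σ)))
    W₂-ins v σ t = by (v ∈? σ)
      where
      by : Dec (v ∈ˢ σ) → off v σ * W₂ (ins v σ) ≡ [ t ] * (off v σ * nat (weight (ins v σ)))
      by (yes v∈) = trans (cong (_* W₂ (ins v σ)) (off-∈ v σ v∈)) (trans (solve 3 (λ a b w → :0 :* a := b :* (:0 :* w)) refl (W₂ (ins v σ)) [ t ] (nat (weight (ins v σ))))
        (cong (λ o → [ t ] * (o * nat (weight (ins v σ)))) (sym (off-∈ v σ v∈))))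
      by (no v∉)  = trans (cong (λ b → off v σ * (b * nat (weight (ins v σ)))) ([]-cong (∣ ins v σ ∣ ℕₚ.≟ suc (suc i)) t
          (λ p → ℕₚ.suc-injective (trans (sym (∣ins∣ v σ (∉⇒lookup v∉))) p)) (λ p → trans (∣ins∣ v σ (∉⇒lookup v∉)) (cong suc p))))
        (solve 3 (λ o b w → o :* (b :* w) := b :* (o :* w)) refl (off v σ) [ t ] (nat (weight (ins v σ))))
    extensions : ∀ σ (t : Dec (∣ σ ∣ ≡ suc i)) → Σ[ allFin n ] (λ v → off v σ * W₂ (ins v σ)) ≡ nat d * ([ t ] * nat (weight σ))
    extensions σ t = trans (Σ-cong (allFin n) (λ v → W₂-ins v σ t)) (trans (sym (Σ-*ˡ (allFin n) [ t ] (λ v → off v σ * nat (weight (ins v σ))))) (by t))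
      where
      by : (t : Dec (∣ σ ∣ ≡ suc i)) → [ t ] * Σ[ allFin n ] (λ v → off v σ * nat (weight (ins v σ))) ≡ nat d * ([ t ] * nat (weight σ))
      -- An `i`-simplex has i + 1 vertices and a chamber has ℓ + 1, which leaves ℓ - i.
      by (yes size) = trans (cong (1ℚ *_) (neighbours σ d (trans (cong (ℕ._+ d) size) (cong suc (ℕₚ.m+[n∸m]≡n (ℕₚ.<⇒≤ i<ℓ))))))
        (solve 2 (λ d w → :1 :* (d :* w) := d :* (:1 :* w)) refl (nat d) (nat (weight σ)))
      by (no _) = solve 3 (λ s d w → :0 :* s := d :* (:0 :* w)) refl (Σ[ allFin n ] (λ v → off v σ * nat (weight (ins v σ)))) (nat d) (nat (weight σ))

  norm-φ>0 : 0ℚ < I₁.ip φ φ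
  norm-φ>0 = ℚₚ.<-≤-trans (0<* W>0 (subst (0ℚ <_) (sym φ-sq) (0<* (0<* r>0 r>0) (0<* A>0 A>0)))) (I₁.ip-term φ (∈subsets σ₀))
    where
    size : ∣ σ₀ ∣ ≡ suc i
    size = trans (∣face∣ _ J) (∣below∣ (suc ℓ) (suc i) (ℕₚ.m<n⇒m<1+n i<ℓ))
    positive-nat : ∀ w → w ≢ 0 → 0ℚ < nat w
    positive-nat zero    ≢0 = contradiction refl ≢0
    positive-nat (suc w) _  = 0<nat w
    positive-ratio : ∀ w → w ≢ 0 → 0ℚ < ratio 1 w
    positive-ratio zero    ≢0 = contradiction refl ≢0
    positive-ratio (suc w) _  = 0<ratio 0 w
    W>0 : 0ℚ < degreeWeight (suc i) σ₀
    W>0 = subst (0ℚ <_) (sym ([yes]* (∣ σ₀ ∣ ℕₚ.≟ suc i) (nat (weight σ₀)) size)) (positive-nat (weight σ₀) (face-weight≢0 _ J))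
    r>0 = positive-ratio (weight σ₀) (face-weight≢0 _ J)
    A>0 : 0ℚ < A J σ₀
    A>0 = ℚₚ.<-≤-trans (ℚₚ.positive⁻¹ 1ℚ) 1≤A
    φ-sq : φ σ₀ * φ σ₀ ≡ (ratio 1 (weight σ₀) * ratio 1 (weight σ₀)) * (A J σ₀ * A J σ₀)
    φ-sq = trans (solve 3 (λ r t a → (r :* (t :* a)) :* (r :* (t :* a)) := (t :* t) :* ((r :* r) :* (a :* a))) refl (ratio 1 (weight σ₀)) θ (A J σ₀))
      (trans (cong (_* ((ratio 1 (weight σ₀) * ratio 1 (weight σ₀)) * (A J σ₀ * A J σ₀))) (ηˢ-sq k J)) (ℚₚ.*-identityˡ _))

  test : Fin dim → ℚ
  test a = h (unindex {n} a)

  δ-test : ∀ σ → δ̂ test σ ≡ φ σ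
  δ-test σ = trans (op-cong δ-kernel ins (λ τ → cong h (unindex-index τ)) σ) (δh σ)

  bad : Bad (nat (ℓ ℕ.∸ i))
  bad = test , subst (0ℚ <_) (sym P-test) norm-φ>0 , ℚₚ.≤-reflexive (sym equality)
    where
    d = ℓ ℕ.∸ i
    P-test : P test test ≡ I₁.ip φ φ
    P-test = I₁.ip-cong δ-test δ-test
    R-test : R test test ≡ nat d * I₁.ip φ φ
    R-test = trans (I₂.ip-cong (op-cong D-kernel del δ-test) (op-cong D-kernel del δ-test)) norm-D
    equality : - pencil (nat d) test test ≡ 0ℚ
    equality = trans (cong₂ (λ a b → - (a - nat d * b)) R-test P-test) (solve 2 (λ d p → :- (d :* p :- d :* p) := :0) refl (nat d) (I₁.ip φ φ))

-- Orientations and the Laplace operator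

module Exchanges {A : Set} where

  vec-ext : ∀ {k} {xs ys : Vec A k} → (∀ p → lookup xs p ≡ lookup ys p) → xs ≡ ys
  vec-ext {xs = xs} {ys} h = trans (sym (Vecₚ.tabulate∘lookup xs)) (trans (Vecₚ.tabulate-cong h) (Vecₚ.tabulate∘lookup ys))

  transpose-suc : ∀ {k} (a b p : Fin k) → transpose (suc a) (suc b) (suc p) ≡ suc (transpose a b p)
  transpose-suc a b p with does (p Finₚ.≟ a)
  ... | true  = refl
  ... | false with does (p Finₚ.≟ b)
  ...   | true  = refl
  ...   | false = refl

  transpose-left : ∀ {k} (a b : Fin k) {p} → p ≡ a → transpose a b p ≡ b
  transpose-left a b {p} p≡a rewrite dec-true (p Finₚ.≟ a) p≡a = refl

  transpose-right : ∀ {k} (a b : Fin k) {p} → p ≢ a → p ≡ b → transpose a b p ≡ a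
  transpose-right a b {p} p≢a p≡b rewrite dec-false (p Finₚ.≟ a) p≢a | dec-true (p Finₚ.≟ b) p≡b = refl

  transpose-other : ∀ {k} (a b : Fin k) {p} → p ≢ a → p ≢ b → transpose a b p ≡ p
  transpose-other a b {p} p≢a p≢b rewrite dec-false (p Finₚ.≟ a) p≢a | dec-false (p Finₚ.≟ b) p≢b = refl

  transpose-comm : ∀ {k} (a b p : Fin k) → transpose a b p ≡ transpose b a p
  transpose-comm a b p = by (p Finₚ.≟ a) (p Finₚ.≟ b)
    where
    by : Dec (p ≡ a) → Dec (p ≡ b) → transpose a b p ≡ transpose b a p
    by (yes refl) (yes refl) = refl
    by (yes p≡a)  (no p≢b)   = trans (transpose-left a b p≡a) (sym (transpose-right b a p≢b p≡a))
    by (no p≢a)   (yes p≡b)  = trans (transpose-right a b p≢a p≡b) (sym (transpose-left b a p≡b))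
    by (no p≢a)   (no p≢b)   = trans (transpose-other a b p≢a p≢b) (sym (transpose-other b a p≢b p≢a))

  lookup-exchange : ∀ {k} (a b : Fin k) (xs : Vec A k) p → lookup (exchange a b xs) p ≡ lookup xs (transpose a b p)
  lookup-exchange a b xs = Vecₚ.lookup∘tabulate (lookup xs ∘ transpose a b)

  exchange-comm : ∀ {k} (a b : Fin k) (xs : Vec A k) → exchange a b xs ≡ exchange b a xs
  exchange-comm a b xs = Vecₚ.tabulate-cong (λ p → cong (lookup xs) (transpose-comm a b p))

  exchange-suc : ∀ {k} (a b : Fin k) x (xs : Vec A k) → exchange (suc a) (suc b) (x ∷ xs) ≡ x ∷ exchange a b xs
  exchange-suc a b x xs = cong (x ∷_) (Vecₚ.tabulate-cong (λ p → cong (lookup (x ∷ xs)) (transpose-suc a b p)))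

  exchange-zero : ∀ {k} (b : Fin k) x (xs : Vec A k) → exchange zero (suc b) (x ∷ xs) ≡ lookup xs b ∷ (xs [ b ]≔ x)
  exchange-zero b x xs = cong (lookup xs b ∷_) (trans (Vecₚ.tabulate-cong pointwise) (Vecₚ.tabulate∘lookup (xs [ b ]≔ x)))
    where
    pointwise : ∀ p → lookup (x ∷ xs) (transpose zero (suc b) (suc p)) ≡ lookup (xs [ b ]≔ x) p
    pointwise p with p Finₚ.≟ b
    ... | yes refl = sym (Vecₚ.lookup∘updateAt p xs)
    ... | no p≢b   = sym (Vecₚ.lookup∘updateAt′ p b p≢b xs)

  exchange-unique : ∀ {k} (a b : Fin k) (xs : Vec A k) → Uniqueᵛ xs → Uniqueᵛ (exchange a b xs)
  exchange-unique a b xs u = Uniqueᵛₚ.tabulate⁺ λ {p} {q} eq → trans (sym (transpose-inverse b a))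
    (trans (cong (transpose b a) (Uniqueᵛₚ.lookup-injective u (transpose a b p) (transpose a b q) eq)) (transpose-inverse b a))

exchange-map : ∀ {A B : Set} (f : A → B) {k} (a b : Fin k) xs → Vec.map f (exchange a b xs) ≡ exchange a b (Vec.map f xs)
exchange-map f a b xs = Exchanges.vec-ext λ p → trans (Vecₚ.lookup-map p f (exchange a b xs)) (trans (cong f (Exchanges.lookup-exchange a b xs p))
  (sym (trans (Exchanges.lookup-exchange a b (Vec.map f xs) p) (Vecₚ.lookup-map (transpose a b p) f xs))))

removeAt-map : ∀ {A B : Set} (f : A → B) {k} (xs : Vec A (suc k)) j → Vec.map f (removeAt xs j) ≡ removeAt (Vec.map f xs) j
removeAt-map f (x ∷ xs)     zero    = refl
removeAt-map f (x ∷ y ∷ xs) (suc j) = cong (f x ∷_) (removeAt-map f (y ∷ xs) j)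

module Supports where

  open SubsetSums
  open Rationals
  open Sums

  lookup∈support : ∀ {n k} (s : Vec (Fin n) k) p → lookup s p ∈ˢ support s
  lookup∈support (v ∷ s) zero    = x∈p∪q⁺ (inj₁ (x∈⁅x⁆ v))
  lookup∈support (v ∷ s) (suc p) = x∈p∪q⁺ {p = ⁅ v ⁆} (inj₂ (lookup∈support s p))

  ∈support⁻ : ∀ {n k} (s : Vec (Fin n) k) {u} → u ∈ˢ support s → ∃ λ p → lookup s p ≡ u
  ∈support⁻ []      u∈ = contradiction u∈ ∉⊥
  ∈support⁻ (v ∷ s) u∈ with x∈p∪q⁻ ⁅ v ⁆ (support s) u∈
  ... | inj₁ h = zero , sym (x∈⁅y⁆⇒x≡y v h)
  ... | inj₂ h = let p , eq = ∈support⁻ s h in suc p , eq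

  support-⊆ : ∀ {n k l} (s : Vec (Fin n) k) (t : Vec (Fin n) l) → (∀ p → ∃ λ q → lookup t q ≡ lookup s p) → ∀ {u} → u ∈ˢ support s → u ∈ˢ support t
  support-⊆ s t h u∈ = let p , eq = ∈support⁻ s u∈ ; q , eq′ = h p in subst (_∈ˢ support t) (trans eq′ eq) (lookup∈support t q)

  support-exchange : ∀ {n k} (a b : Fin k) (s : Vec (Fin n) k) → support (exchange a b s) ≡ support s
  support-exchange a b s = ⊆-antisym
    (support-⊆ (exchange a b s) s (λ p → transpose a b p , sym (Exchanges.lookup-exchange a b s p)))
    (support-⊆ s (exchange a b s) (λ p → transpose b a p , trans (Exchanges.lookup-exchange a b s (transpose b a p)) (cong (lookup s) (transpose-inverse a b))))

  support-∷ : ∀ {n k} v (s : Vec (Fin n) k) → support (v ∷ s) ≡ ins v (support s)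
  support-∷ v s = ⊆-antisym forth back
    where
    forth : ∀ {u} → u ∈ˢ support (v ∷ s) → u ∈ˢ ins v (support s)
    forth u∈ with x∈p∪q⁻ ⁅ v ⁆ (support s) u∈
    ... | inj₁ h = subst (_∈ˢ ins v (support s)) (sym (x∈⁅y⁆⇒x≡y v h)) (v∈ins v (support s))
    ... | inj₂ h = ∈ins⁺ v (support s) h
    back : ∀ {u} → u ∈ˢ ins v (support s) → u ∈ˢ support (v ∷ s)
    back {u} u∈ with u Finₚ.≟ v
    ... | yes refl = x∈p∪q⁺ (inj₁ (x∈⁅x⁆ u))
    ... | no u≢v   = x∈p∪q⁺ {p = ⁅ v ⁆} (inj₂ (∈ins⁻ v (support s) u≢v u∈))

  fresh : ∀ {n k v} {s : Vec (Fin n) k} → Allᵛ (v ≢_) s → ¬ v ∈ˢ support s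
  fresh {s = s} v# v∈ = let p , eq = ∈support⁻ s v∈ in Allᵛₚ.lookup⁺ v# p (sym eq)

  fresh⁻ : ∀ {n k v} (s : Vec (Fin n) k) → ¬ v ∈ˢ support s → Allᵛ (v ≢_) s
  fresh⁻ []      v∉ = []
  fresh⁻ (u ∷ s) v∉ = (λ { refl → v∉ (x∈p∪q⁺ (inj₁ (x∈⁅x⁆ u))) }) ∷ fresh⁻ s (v∉ ∘ x∈p∪q⁺ {p = ⁅ u ⁆} ∘ inj₂)

  ∣support∣ : ∀ {n k} (s : Vec (Fin n) k) → Uniqueᵛ s → ∣ support s ∣ ≡ k
  ∣support∣ {n} []      []       = ∣⊥∣≡0 n
  ∣support∣ (v ∷ s) (v# ∷ u) = trans (cong ∣_∣ (support-∷ v s)) (trans (∣ins∣ v (support s) (∉⇒lookup (fresh v#))) (cong suc (∣support∣ s u)))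

  support-removeAt : ∀ {n k} (s : Vec (Fin n) (suc k)) → Uniqueᵛ s → ∀ j → support (removeAt s j) ≡ del (lookup s j) (support s)
  support-removeAt (v ∷ s) (v# ∷ u) zero = sym (trans (cong (del v) (support-∷ v s)) (del-ins v (support s) (fresh v#)))
  support-removeAt (v ∷ x ∷ s) (v# ∷ u) (suc j) = ⊆-antisym forth back
    where
    y = lookup (x ∷ s) j
    v≢y : v ≢ y
    v≢y = Allᵛₚ.lookup⁺ v# j
    rest : support (removeAt (x ∷ s) j) ≡ del y (support (x ∷ s))
    rest = support-removeAt (x ∷ s) u j
    forth : ∀ {z} → z ∈ˢ support (v ∷ removeAt (x ∷ s) j) → z ∈ˢ del y (support (v ∷ x ∷ s))
    forth z∈ with x∈p∪q⁻ ⁅ v ⁆ (support (removeAt (x ∷ s) j)) z∈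
    ... | inj₁ h = subst (_∈ˢ del y (support (v ∷ x ∷ s))) (sym (x∈⁅y⁆⇒x≡y v h)) (∈del⁺ y (support (v ∷ x ∷ s)) v≢y (lookup∈support (v ∷ x ∷ s) zero))
    ... | inj₂ h = let z≢y , z∈′ = ∈del⁻ y (support (x ∷ s)) (subst (_ ∈ˢ_) rest h) in ∈del⁺ y (support (v ∷ x ∷ s)) z≢y (x∈p∪q⁺ {p = ⁅ v ⁆} (inj₂ z∈′))
    back : ∀ {z} → z ∈ˢ del y (support (v ∷ x ∷ s)) → z ∈ˢ support (v ∷ removeAt (x ∷ s) j)
    back z∈ with ∈del⁻ y (support (v ∷ x ∷ s)) z∈
    ... | z≢y , z∈′ with x∈p∪q⁻ ⁅ v ⁆ (support (x ∷ s)) z∈′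
    ...   | inj₁ h = x∈p∪q⁺ (inj₁ h)
    ...   | inj₂ h = x∈p∪q⁺ {p = ⁅ v ⁆} (inj₂ (subst (_ ∈ˢ_) (sym rest) (∈del⁺ y (support (x ∷ s)) z≢y h)))

  Σ-support : ∀ {n k} (s : Vec (Fin n) k) → Uniqueᵛ s → (F : Fin n → ℚ) →
    Σ[ allFin k ] (F ∘ lookup s) ≡ Σ[ allFin n ] (λ v → on v (support s) * F v)
  Σ-support {n} [] [] F = sym (Σ-0 (allFin n) (λ v → trans (cong (_* F v) (on-∉ v (support []) (∉⊥ {x = v}))) (ℚₚ.*-zeroˡ (F v))))
  Σ-support {n} {suc k} (x ∷ s) (x# ∷ u) F = begin
    Σ[ allFin (suc k) ] (F ∘ lookup (x ∷ s))
      ≡⟨ Σ-allFin-suc (F ∘ lookup (x ∷ s)) ⟩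
    F x + Σ[ allFin k ] (F ∘ lookup s)
      ≡⟨ cong₂ _+_ (sym (Σ-δ Finₚ._≟_ (Uniqueₚ.allFin⁺ n) (∈-allFin x) F)) (Σ-support s u F) ⟩
    Σ[ allFin n ] (λ v → [ v Finₚ.≟ x ] * F v) + Σ[ allFin n ] (λ v → on v (support s) * F v)
      ≡⟨ Σ-+ (allFin n) (λ v → [ v Finₚ.≟ x ] * F v) (λ v → on v (support s) * F v) ⟨
    Σ[ allFin n ] (λ v → [ v Finₚ.≟ x ] * F v + on v (support s) * F v)
      ≡⟨ Σ-cong (allFin n) (λ v → trans (sym (ℚₚ.*-distribʳ-+ (F v) [ v Finₚ.≟ x ] (on v (support s)))) (cong (_* F v) (by v (v Finₚ.≟ x)))) ⟩
    Σ[ allFin n ] (λ v → on v (support (x ∷ s)) * F v) ∎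
    where
    open ≡-Reasoning
    by : ∀ v (d : Dec (v ≡ x)) → [ d ] + on v (support s) ≡ on v (support (x ∷ s))
    by v (yes refl) = trans (cong (1ℚ +_) (on-∉ v (support s) (fresh x#))) (sym (on-∈ v (support (v ∷ s)) (lookup∈support (v ∷ s) zero)))
    by v (no v≢x)   = trans (ℚₚ.+-identityˡ (on v (support s))) (cong χ (sym (trans (cong (λ σ → lookup σ v) (support-∷ x s)) (Vecₚ.lookup∘updateAt′ v x v≢x (support s)))))

  support-suc : ∀ {n k} (s : Vec (Fin n) k) → support (Vec.map suc s) ≡ outside ∷ support s
  support-suc []      = refl
  support-suc (v ∷ s) = cong (⁅ suc v ⁆ ∪_) (support-suc s)

  zero-fresh : ∀ {n k} (s : Vec (Fin n) k) → Allᵛ (Fin.zero {n} ≢_) (Vec.map suc s)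
  zero-fresh []      = []
  zero-fresh (_ ∷ s) = (λ ()) ∷ zero-fresh s

  enumerate : ∀ {n} (σ : Subset n) → ∃ λ (s : Vec (Fin n) ∣ σ ∣) → Uniqueᵛ s × support s ≡ σ
  enumerate []          = [] , [] , refl
  enumerate (true ∷ σ)  = let s , u , eq = enumerate σ in
    zero ∷ Vec.map suc s , zero-fresh s ∷ Uniqueᵛₚ.map⁺ Finₚ.suc-injective u ,
    trans (support-∷ zero (Vec.map suc s)) (cong (ins zero) (trans (support-suc s) (cong (outside ∷_) eq)))
  enumerate (false ∷ σ) = let s , u , eq = enumerate σ in
    Vec.map suc s , Uniqueᵛₚ.map⁺ Finₚ.suc-injective u , trans (support-suc s) (cong (outside ∷_) eq)

module Orientation {r : ℕ} where

  open Rationals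
  open SubsetSums
  open Supports
  open Exchanges
  open Signs {r}

  sg-antisym : ∀ {a b} → a ≢ b → sg a b ≡ - sg b a
  sg-antisym {a} {b} a≢b with Finₚ.<-cmp a b
  ... | tri< a<b _ ¬b<a = trans (cong (if_then - 1ℚ else 1ℚ) (dec-true (a Finₚ.<? b) a<b)) (cong -_ (sym (cong (if_then - 1ℚ else 1ℚ) (dec-false (b Finₚ.<? a) ¬b<a))))
  ... | tri≈ _ a≡b _    = contradiction a≡b a≢b
  ... | tri> ¬a<b _ b<a = trans (cong (if_then - 1ℚ else 1ℚ) (dec-false (a Finₚ.<? b) ¬a<b)) (cong -_ (sym (cong (if_then - 1ℚ else 1ℚ) (dec-true (b Finₚ.<? a) b<a))))

  ηᵛ : ∀ {k} → Fin r → Vec (Fin r) k → ℚ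
  ηᵛ a []       = 1ℚ
  ηᵛ a (b ∷ cs) = sg b a * ηᵛ a cs

  -- The sign of the permutation sorting cs.
  ε : ∀ {k} → Vec (Fin r) k → ℚ
  ε []       = 1ℚ
  ε (a ∷ cs) = ηᵛ a cs * ε cs

  ηᵛ-sq : ∀ {k} a (cs : Vec (Fin r) k) → ηᵛ a cs * ηᵛ a cs ≡ 1ℚ
  ηᵛ-sq a []       = refl
  ηᵛ-sq a (b ∷ cs) = trans (solve 2 (λ s e → (s :* e) :* (s :* e) := (s :* s) :* (e :* e)) refl (sg b a) (ηᵛ a cs)) (cong₂ _*_ (sg-sq b a) (ηᵛ-sq a cs))

  ε-sq : ∀ {k} (cs : Vec (Fin r) k) → ε cs * ε cs ≡ 1ℚ
  ε-sq []       = refl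
  ε-sq (a ∷ cs) = trans (solve 2 (λ s e → (s :* e) :* (s :* e) := (s :* s) :* (e :* e)) refl (ηᵛ a cs) (ε cs)) (cong₂ _*_ (ηᵛ-sq a cs) (ε-sq cs))

  -- Replacing an entry trades its factor for that of the new entry; the product form avoids
  -- dividing by a sign.
  ηᵛ-update : ∀ {k} a x (cs : Vec (Fin r) k) b → sg (lookup cs b) a * ηᵛ a (cs [ b ]≔ x) ≡ sg x a * ηᵛ a cs
  ηᵛ-update a x (y ∷ cs) zero    = solve 3 (λ s t e → s :* (t :* e) := t :* (s :* e)) refl (sg y a) (sg x a) (ηᵛ a cs)
  ηᵛ-update a x (y ∷ cs) (suc b) = trans (solve 3 (λ s t e → s :* (t :* e) := t :* (s :* e)) refl (sg (lookup cs b) a) (sg y a) (ηᵛ a (cs [ b ]≔ x)))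
    (trans (cong (sg y a *_) (ηᵛ-update a x cs b)) (solve 3 (λ s t e → s :* (t :* e) := t :* (s :* e)) refl (sg y a) (sg x a) (ηᵛ a cs)))

  ηᵛ-exchange : ∀ {k} x (cs : Vec (Fin r) k) a b → a ≢ b → ηᵛ x (exchange a b cs) ≡ ηᵛ x cs
  ηᵛ-exchange x (y ∷ cs) zero    zero    a≢b = contradiction refl a≢b
  ηᵛ-exchange x (y ∷ cs) zero    (suc b) _   = trans (cong (ηᵛ x) (exchange-zero b y cs)) (ηᵛ-update x y cs b)
  ηᵛ-exchange x (y ∷ cs) (suc a) zero    _   = trans (cong (ηᵛ x) (trans (exchange-comm (suc a) zero (y ∷ cs)) (exchange-zero a y cs))) (ηᵛ-update x y cs a)
  ηᵛ-exchange x (y ∷ cs) (suc a) (suc b) a≢b = trans (cong (ηᵛ x) (exchange-suc a b y cs)) (cong (sg y x *_) (ηᵛ-exchange x cs a b (a≢b ∘ cong suc)))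

  -- When the head trades places with a later entry, both change sides relative to each entry in
  -- between, which gives two flips that cancel. Only the comparison of the two exchanged entries
  -- with each other changes the sign.
  ε-update : ∀ {k} x (cs : Vec (Fin r) k) b → Uniqueᵛ (x ∷ cs) →
    ηᵛ (lookup cs b) (cs [ b ]≔ x) * ε (cs [ b ]≔ x) ≡ - (ηᵛ x cs * ε cs)
  ε-update x (y ∷ cs) zero ((x≢y ∷ _) ∷ _) = trans (cong (λ t → (t * ηᵛ y cs) * (ηᵛ x cs * ε cs)) (sg-antisym x≢y))
    (solve 4 (λ s p q e → ((:- s) :* p) :* (q :* e) := :- ((s :* q) :* (p :* e))) refl (sg y x) (ηᵛ y cs) (ηᵛ x cs) (ε cs))
  ε-update x (y ∷ cs) (suc b) ((x≢y ∷ x#) ∷ (y# ∷ u)) = begin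
    (sg y z * ηᵛ z cs′) * (ηᵛ y cs′ * ε cs′)
      ≡⟨ solve 4 (λ s a b c → (s :* a) :* (b :* c) := s :* (b :* (a :* c))) refl (sg y z) (ηᵛ z cs′) (ηᵛ y cs′) (ε cs′) ⟩
    sg y z * (ηᵛ y cs′ * (ηᵛ z cs′ * ε cs′))
      ≡⟨ cong₂ (λ s t → s * (ηᵛ y cs′ * t)) (sg-antisym (Allᵛₚ.lookup⁺ y# b)) (ε-update x cs b (x# ∷ u)) ⟩
    - sg z y * (ηᵛ y cs′ * - (ηᵛ x cs * ε cs))
      ≡⟨ solve 4 (λ s a b c → (:- s) :* (a :* :- (b :* c)) := (s :* a) :* (b :* c)) refl (sg z y) (ηᵛ y cs′) (ηᵛ x cs) (ε cs) ⟩
    (sg z y * ηᵛ y cs′) * (ηᵛ x cs * ε cs)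
      ≡⟨ cong (_* (ηᵛ x cs * ε cs)) (trans (ηᵛ-update y x cs b) (cong (_* ηᵛ y cs) (sg-antisym x≢y))) ⟩
    (- sg y x * ηᵛ y cs) * (ηᵛ x cs * ε cs)
      ≡⟨ solve 4 (λ s p q e → ((:- s) :* p) :* (q :* e) := :- ((s :* q) :* (p :* e))) refl (sg y x) (ηᵛ y cs) (ηᵛ x cs) (ε cs) ⟩
    - ((sg y x * ηᵛ x cs) * (ηᵛ y cs * ε cs)) ∎
    where
    open ≡-Reasoning
    z = lookup cs b
    cs′ = cs [ b ]≔ x

  ε-exchange : ∀ {k} (cs : Vec (Fin r) k) a b → a ≢ b → Uniqueᵛ cs → ε (exchange a b cs) ≡ - ε cs
  ε-exchange (y ∷ cs) zero    zero    a≢b _ = contradiction refl a≢b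
  ε-exchange (y ∷ cs) zero    (suc b) _   u = trans (cong ε (exchange-zero b y cs)) (ε-update y cs b u)
  ε-exchange (y ∷ cs) (suc a) zero    _   u = trans (cong ε (trans (exchange-comm (suc a) zero (y ∷ cs)) (exchange-zero a y cs))) (ε-update y cs a u)
  ε-exchange (y ∷ cs) (suc a) (suc b) a≢b (_ ∷ u) = trans (cong ε (exchange-suc a b y cs))
    (trans (cong₂ _*_ (ηᵛ-exchange y cs a b (a≢b ∘ cong suc)) (ε-exchange cs a b (a≢b ∘ cong suc) u))
      (solve 2 (λ p q → p :* :- q := :- (p :* q)) refl (ηᵛ y cs) (ε cs)))

  power : ℕ → ℚ
  power zero    = 1ℚ
  power (suc j) = - power j

  ηᵛ-removeAt : ∀ {k} a (cs : Vec (Fin r) (suc k)) j → ηᵛ a cs ≡ sg (lookup cs j) a * ηᵛ a (removeAt cs j)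
  ηᵛ-removeAt a (y ∷ cs)     zero    = refl
  ηᵛ-removeAt a (y ∷ z ∷ cs) (suc j) = trans (cong (sg y a *_) (ηᵛ-removeAt a (z ∷ cs) j))
    (solve 3 (λ s t e → s :* (t :* e) := t :* (s :* e)) refl (sg y a) (sg (lookup (z ∷ cs) j) a) (ηᵛ a (removeAt (z ∷ cs) j)))

  -- Bringing an entry to the front passes all entries before it. This converts the alternating sign
  -- in the coboundary into the colour sign η.
  ε-removeAt : ∀ {k} (cs : Vec (Fin r) (suc k)) → Uniqueᵛ cs → ∀ j → ε cs ≡ power (toℕ j) * (ηᵛ (lookup cs j) (removeAt cs j) * ε (removeAt cs j))
  ε-removeAt (y ∷ cs)     _        zero    = sym (ℚₚ.*-identityˡ (ηᵛ y cs * ε cs))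
  ε-removeAt (y ∷ z ∷ cs) (y# ∷ u) (suc j) = begin
    ηᵛ y (z ∷ cs) * ε (z ∷ cs)
      ≡⟨ cong₂ _*_ (ηᵛ-removeAt y (z ∷ cs) j) (ε-removeAt (z ∷ cs) u j) ⟩
    (sg x y * ηᵛ y rest) * (power (toℕ j) * (ηᵛ x rest * ε rest))
      ≡⟨ cong (λ s → (s * ηᵛ y rest) * (power (toℕ j) * (ηᵛ x rest * ε rest))) (sg-antisym (Allᵛₚ.lookup⁺ y# j ∘ sym)) ⟩
    (- sg y x * ηᵛ y rest) * (power (toℕ j) * (ηᵛ x rest * ε rest))
      ≡⟨ solve 5 (λ s a p b e → ((:- s) :* a) :* (p :* (b :* e)) := (:- p) :* ((s :* b) :* (a :* e))) refl (sg y x) (ηᵛ y rest) (power (toℕ j)) (ηᵛ x rest) (ε rest) ⟩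
    - power (toℕ j) * ((sg y x * ηᵛ x rest) * (ηᵛ y rest * ε rest)) ∎
    where
    open ≡-Reasoning
    x = lookup (z ∷ cs) j
    rest = removeAt (z ∷ cs) j

  Π-single : ∀ b (f : Fin r → ℚ) {xs} → Unique xs → b ∈ᴸ xs → Π xs (λ x → if does (x Finₚ.≟ b) then f x else 1ℚ) ≡ f b
  Π-single b f {x ∷ xs} (b# ∷ u) (here refl) = trans (cong₂ _*_ (cong (if_then f b else 1ℚ) (dec-true (b Finₚ.≟ b) refl)) (absent xs b#)) (ℚₚ.*-identityʳ (f b))
    where
    absent : ∀ ys → All (b ≢_) ys → Π ys (λ x → if does (x Finₚ.≟ b) then f x else 1ℚ) ≡ 1ℚ
    absent []       []          = refl
    absent (y ∷ ys) (b≢y ∷ ys#) = trans (cong₂ _*_ (cong (if_then f y else 1ℚ) (dec-false (y Finₚ.≟ b) (b≢y ∘ sym))) (absent ys ys#)) (ℚₚ.*-identityˡ 1ℚ)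
  Π-single b f {x ∷ xs} (x# ∷ u) (there p) = trans (cong₂ _*_ (cong (if_then f x else 1ℚ) (dec-false (x Finₚ.≟ b) (All.lookup x# p))) (Π-single b f u p)) (ℚₚ.*-identityˡ (f b))

  ηᵛ-support : ∀ {k} a (cs : Vec (Fin r) k) → Uniqueᵛ cs → ηᵛ a cs ≡ ηˢ a (support cs)
  ηᵛ-support a []       []       = sym (Π-1 (allFin r) (λ b → cong (if_then sg b a else 1ℚ) (∉⇒lookup (∉⊥ {x = b}))))
  ηᵛ-support a (b ∷ cs) (b# ∷ u) = sym (begin
    Π (allFin r) (factor a (support (b ∷ cs)))
      ≡⟨ Π-cong (allFin r) (λ x → by x (x Finₚ.≟ b)) ⟩
    Π (allFin r) (λ x → (if does (x Finₚ.≟ b) then sg x a else 1ℚ) * factor a (support cs) x)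
      ≡⟨ Π-* (allFin r) (λ x → if does (x Finₚ.≟ b) then sg x a else 1ℚ) (factor a (support cs)) ⟩
    Π (allFin r) (λ x → if does (x Finₚ.≟ b) then sg x a else 1ℚ) * ηˢ a (support cs)
      ≡⟨ cong₂ _*_ (Π-single b (λ x → sg x a) (Uniqueₚ.allFin⁺ r) (∈-allFin b)) (sym (ηᵛ-support a cs u)) ⟩
    sg b a * ηᵛ a cs ∎)
    where
    open ≡-Reasoning
    by : ∀ x (d : Dec (x ≡ b)) → factor a (support (b ∷ cs)) x ≡ (if does d then sg x a else 1ℚ) * factor a (support cs) x
    by x (yes refl) = trans (cong (if_then sg x a else 1ℚ) (∈⇒lookup (lookup∈support (x ∷ cs) zero)))
      (sym (trans (cong (λ t → sg x a * (if t then sg x a else 1ℚ)) (∉⇒lookup (fresh b#))) (ℚₚ.*-identityʳ (sg x a))))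
    by x (no x≢b)   = trans (cong (if_then sg x a else 1ℚ) (trans (cong (λ σ → lookup σ x) (support-∷ b cs)) (Vecₚ.lookup∘updateAt′ x b x≢b (support cs))))
      (sym (ℚₚ.*-identityˡ (factor a (support cs) x)))

module Link {c e} {G : FiniteGroup c e} {ℓ : ℕ} (𝒯 : TitsSystem G (suc ℓ))
  (M? : ∀ j g → Dec (Bruhat.D 𝒯 (_≢ j) g)) where

  open import Data.Parity.Base using (_⁻¹)
  open Faces 𝒯 M? hiding (Vertex)
  open Orientation {suc ℓ}
  open Supports
  open Rationals
  open Sums
  open SubsetSums
  open Reals
  open ℝ
  open Spectral weight weight-mono η using (δᴿ; Dᴿ; δ-kernel; D-kernel; opᴿ-at; seq-sum)
  open Complex (building 𝒯) using (Simplex; Vertex)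
  open Laplacian (building 𝒯) using (IsOrderedSimplex; isOrderedSimplex?; w; Values; IsCochain; alternate; d; Δ)
    renaming (δ to δᴸ)

  sign : ∀ {k} → Vec Vertex k → ℚ
  sign s = ε (Vec.map color s)

  -- The ordering enters only through the sign of the permutation sorting the colours; on simplices
  -- of the building this passes from functions on vertex sets to alternating cochains.
  oriented : ∀ {k} → (Subset n → ℝ) → Vec Vertex k → ℝ
  oriented u s = fromℚ (sign s) *ᴿ u (support s)

  Rainbow : ∀ {k} → Vec Vertex k → Set
  Rainbow s = Uniqueᵛ (Vec.map color s)

  unique-from-lookup : ∀ {A : Set} {k} (xs : Vec A k) → (∀ p q → lookup xs p ≡ lookup xs q → p ≡ q) → Uniqueᵛ xs
  unique-from-lookup xs h = subst Uniqueᵛ (Vecₚ.tabulate∘lookup xs) (Uniqueᵛₚ.tabulate⁺ (λ {p} {q} → h p q))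

  rainbow : ∀ {k} {s : Vec Vertex k} → Uniqueᵛ s → weight (support s) ≢ 0 → Rainbow s
  rainbow {s = s} u ≢0 = unique-from-lookup (Vec.map color s) λ p q eq → Uniqueᵛₚ.lookup-injective u p q
    (color-injective-on ≢0 (lookup∈support s p) (lookup∈support s q)
      (trans (sym (Vecₚ.lookup-map p color s)) (trans eq (Vecₚ.lookup-map q color s))))

  simplex-weight : ∀ {σ} → Simplex σ → weight σ ≢ 0
  simplex-weight simplex = let x , h , _ = simplex⇒chamber simplex in ⊆chamber⇒weight≢0 x h

  ordered-rainbow : ∀ {k} {s : Vec Vertex (suc k)} → IsOrderedSimplex s → Rainbow s
  ordered-rainbow (u , simplex) = rainbow u (simplex-weight simplex)

  support-colors : ∀ {k} (s : Vec Vertex k) → support (Vec.map color s) ≡ colors (support s)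
  support-colors s = ⊆-antisym
    (λ c∈ → let p , eq = ∈support⁻ (Vec.map color s) c∈ in
      subst (_∈ˢ colors (support s)) (trans (sym (Vecₚ.lookup-map p color s)) eq) (∈colors⁺ {support s} (lookup s p) (lookup∈support s p)))
    (λ c∈ → let v , v∈ , eq = ∈colors⁻ {support s} c∈ ; p , eq′ = ∈support⁻ s v∈ in
      subst (_∈ˢ support (Vec.map color s)) (trans (Vecₚ.lookup-map p color s) (trans (cong color eq′) eq)) (lookup∈support (Vec.map color s) p))

  η-link : ∀ {k} v (s : Vec Vertex k) → Rainbow s → ηᵛ (color v) (Vec.map color s) ≡ η v (support s)
  η-link v s r = trans (ηᵛ-support (color v) (Vec.map color s) r) (cong (ηˢ (color v)) (support-colors s))

  parity-sign : Parity → ℚ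
  parity-sign 0ℙ = 1ℚ
  parity-sign 1ℙ = - 1ℚ

  reordering-sign : ∀ {k π} {s t : Vec Vertex k} → Reordering π s t → Rainbow s →
    Rainbow t × support t ≡ support s × sign t ≡ parity-sign π * sign s
  reordering-sign {s = s} done r = r , refl , sym (ℚₚ.*-identityˡ (sign s))
  reordering-sign {s = s} (step {π} {t = t} {a} {b} a≢b ρ) r =
    let rt , supp , eq = reordering-sign ρ r in
    subst Uniqueᵛ (sym (exchange-map color a b t)) (Exchanges.exchange-unique a b (Vec.map color t) rt) ,
    trans (support-exchange a b t) supp ,
    trans (cong ε (exchange-map color a b t)) (trans (ε-exchange (Vec.map color t) a b a≢b rt) (trans (cong -_ eq) (flip π)))
    where
    flip : ∀ π → - (parity-sign π * sign s) ≡ parity-sign (π ⁻¹) * sign s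
    flip 0ℙ = solve 1 (λ x → :- (:1 :* x) := (:- :1) :* x) refl (sign s)
    flip 1ℙ = solve 1 (λ x → :- ((:- :1) :* x) := :1 :* x) refl (sign s)

  oriented-cochain : ∀ {i} u → IsCochain {i} (oriented u)
  oriented-cochain u {s} {t} ord =
      (λ ρ → let _ , supp , eq = reordering-sign ρ (ordered-rainbow ord) in
        pointwise⇒≃ (oriented u t) (oriented u s) λ m → cong₂ (λ q σ → q * seq (u σ) m) (trans eq (ℚₚ.*-identityˡ (sign s))) supp)
    , (λ ρ → let _ , supp , eq = reordering-sign ρ (ordered-rainbow ord) in
        pointwise⇒≃ (oriented u t) (-ᴿ oriented u s) λ m → trans (cong₂ (λ q σ → q * seq (u σ) m) eq supp)
          (solve 2 (λ a b → ((:- :1) :* a) :* b := :- (a :* b)) refl (sign s) (seq (u (support s)) m)))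

  alternate-at : ∀ j x m → seq (alternate j x) m ≡ power j * seq x m
  alternate-at zero    x m = sym (ℚₚ.*-identityˡ (seq x m))
  alternate-at (suc j) x m = trans (cong -_ (alternate-at j x m)) (solve 2 (λ a b → :- (a :* b) := (:- a) :* b) refl (power j) (seq x m))

  d-link : ∀ {i} u (t : Vec Vertex (suc (suc i))) → Uniqueᵛ t → Rainbow t → ∀ m →
    seq (d (oriented u) t) m ≡ sign t * seq (Dᴿ u (support t)) m
  d-link {i} u t uniq r m = begin
    seq (d (oriented u) t) m
      ≡⟨ seq-sum (allFin (suc (suc i))) (λ j → alternate (toℕ j) (oriented u (removeAt t j))) m ⟩
    Σ[ allFin (suc (suc i)) ] (λ j → seq (alternate (toℕ j) (oriented u (removeAt t j))) m)
      ≡⟨ Σ-cong (allFin (suc (suc i))) (λ j → trans (alternate-at (toℕ j) (oriented u (removeAt t j)) m) (face-term j)) ⟩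
    Σ[ allFin (suc (suc i)) ] (λ j → sign t * F (lookup t j))
      ≡⟨ Σ-*ˡ (allFin (suc (suc i))) (sign t) (F ∘ lookup t) ⟨
    sign t * Σ[ allFin (suc (suc i)) ] (F ∘ lookup t)
      ≡⟨ cong (sign t *_) (trans (Σ-support t uniq F) (trans
           (Σ-cong (allFin n) (λ v → sym (ℚₚ.*-assoc (on v τ) (η v (del v τ)) (seq (u (del v τ)) m))))
           (sym (opᴿ-at D-kernel del u τ m)))) ⟩
    sign t * seq (Dᴿ u τ) m ∎
    where
    open ≡-Reasoning
    τ = support t
    F : Vertex → ℚ
    F v = η v (del v τ) * seq (u (del v τ)) m
    face-term : ∀ j → power (toℕ j) * (sign (removeAt t j) * seq (u (support (removeAt t j))) m) ≡ sign t * F (lookup t j)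
    face-term j = begin
      power (toℕ j) * (sign rest * seq (u (support rest)) m)
        ≡⟨ cong₂ (λ q σ → power (toℕ j) * (q * seq (u σ) m)) (cong ε (removeAt-map color t j)) (support-removeAt t uniq j) ⟩
      power (toℕ j) * (ε crest * U)
        ≡⟨ solve 3 (λ p e x → p :* (e :* x) := :1 :* (p :* (e :* x))) refl (power (toℕ j)) (ε crest) U ⟩
      1ℚ * (power (toℕ j) * (ε crest * U))
        -- The square of a sign is inserted: one factor completes `ε-removeAt`, the other is the
        -- sign in the kernel of `Dᴿ`.
        ≡⟨ cong (_* (power (toℕ j) * (ε crest * U))) (sym (ηᵛ-sq c₀ crest)) ⟩
      (ηᵛ c₀ crest * ηᵛ c₀ crest) * (power (toℕ j) * (ε crest * U))
        ≡⟨ solve 4 (λ h p e x → (h :* h) :* (p :* (e :* x)) := (p :* (h :* e)) :* (h :* x)) refl (ηᵛ c₀ crest) (power (toℕ j)) (ε crest) U ⟩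
      (power (toℕ j) * (ηᵛ c₀ crest * ε crest)) * (ηᵛ c₀ crest * U)
        ≡⟨ cong₂ _*_ (sym (ε-removeAt (Vec.map color t) r j)) (cong (_* U) η-face) ⟩
      sign t * F (lookup t j) ∎
      where
      rest = removeAt t j
      crest = removeAt (Vec.map color t) j
      c₀ = lookup (Vec.map color t) j
      U = seq (u (del (lookup t j) τ)) m
      rest-rainbow : Rainbow rest
      rest-rainbow = subst Uniqueᵛ (sym (removeAt-map color t j)) (unique-removeAt (Vec.map color t) r j)
        where
        all-removeAt : ∀ {A : Set} {P : A → Set} {k} (xs : Vec A (suc k)) → Allᵛ P xs → ∀ j → Allᵛ P (removeAt xs j)
        all-removeAt (x ∷ xs)     (p ∷ ps) zero    = ps
        all-removeAt (x ∷ y ∷ xs) (p ∷ ps) (suc j) = p ∷ all-removeAt (y ∷ xs) ps j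
        unique-removeAt : ∀ {A : Set} {k} (xs : Vec A (suc k)) → Uniqueᵛ xs → ∀ j → Uniqueᵛ (removeAt xs j)
        unique-removeAt (x ∷ xs)     (p ∷ ps) zero    = ps
        unique-removeAt (x ∷ y ∷ xs) (p ∷ ps) (suc j) = all-removeAt (y ∷ xs) p j ∷ unique-removeAt (y ∷ xs) ps j
      η-face : ηᵛ c₀ crest ≡ η (lookup t j) (del (lookup t j) τ)
      η-face = trans (cong₂ ηᵛ (Vecₚ.lookup-map j color t) (sym (removeAt-map color t j)))
        (trans (η-link (lookup t j) rest rest-rainbow) (cong (η (lookup t j)) (support-removeAt t uniq j)))

  ratio-0 : ∀ b → ratio 0 b ≡ 0ℚ
  ratio-0 zero    = refl
  ratio-0 (suc b) = ℚₚ.0/n≡0 (suc b)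

  -- The sum in `δᴸ` is restricted to vertices that extend `s` to a simplex. For any other `v`
  -- outside `s` the enlarged set lies in no chamber, so its weight vanishes and with it the ratio.
  δ-link : ∀ {i} (g : Values (suc i)) (g′ : Subset n → ℝ) (s : Vec Vertex (suc i)) → IsOrderedSimplex s → ∀ m →
    (∀ v → IsOrderedSimplex (v ∷ s) → seq (g (v ∷ s)) m ≡ sign (v ∷ s) * seq (g′ (support (v ∷ s))) m) →
    seq (δᴸ g s) m ≡ sign s * seq (δᴿ g′ (support s)) m
  δ-link {i} g g′ s ord m h = begin
    seq (δᴸ g s) m
      ≡⟨ seq-sum (filter ordered? (allFin n)) (λ v → fromℚ (ratio (w (v ∷ s)) (w s)) *ᴿ g (v ∷ s)) m ⟩
    Σ[ filter ordered? (allFin n) ] (λ v → ratio (w (v ∷ s)) (w s) * seq (g (v ∷ s)) m)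
      ≡⟨ Σ-filter ordered? (allFin n) (λ v → ratio (w (v ∷ s)) (w s) * seq (g (v ∷ s)) m) ⟩
    Σ[ allFin n ] (λ v → [ ordered? v ] * (ratio (w (v ∷ s)) (w s) * seq (g (v ∷ s)) m))
      ≡⟨ Σ-cong (allFin n) (λ v → by v (ordered? v) (v ∈? σ)) ⟩
    Σ[ allFin n ] (λ v → sign s * (δ-kernel v σ * seq (g′ (ins v σ)) m))
      ≡⟨ Σ-*ˡ (allFin n) (sign s) (λ v → δ-kernel v σ * seq (g′ (ins v σ)) m) ⟨
    sign s * Σ[ allFin n ] (λ v → δ-kernel v σ * seq (g′ (ins v σ)) m)
      ≡⟨ cong (sign s *_) (opᴿ-at δ-kernel ins g′ σ m) ⟨
    sign s * seq (δᴿ g′ σ) m ∎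
    where
    open ≡-Reasoning
    σ = support s
    ordered? : ∀ v → Dec (IsOrderedSimplex (v ∷ s))
    ordered? v = isOrderedSimplex? (v ∷ s)
    by : ∀ v (o : Dec (IsOrderedSimplex (v ∷ s))) → Dec (v ∈ˢ σ) →
      [ o ] * (ratio (w (v ∷ s)) (w s) * seq (g (v ∷ s)) m) ≡ sign s * (δ-kernel v σ * seq (g′ (ins v σ)) m)
    by v (yes o@((v# ∷ _) , _)) _ = trans (ℚₚ.*-identityˡ (ratio (w (v ∷ s)) (w s) * seq (g (v ∷ s)) m)) (trans
      (cong₂ _*_ (cong (λ τ → ratio (weight τ) (weight σ)) (support-∷ v s))
        (trans (h v o) (cong₂ (λ q τ → (q * sign s) * seq (g′ τ) m) (η-link v s (ordered-rainbow ord)) (support-∷ v s))))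
      (trans (solve 4 (λ r e q x → r :* ((e :* q) :* x) := q :* ((:1 :* (r :* e)) :* x)) refl
          (ratio (weight (ins v σ)) (weight σ)) (η v σ) (sign s) (seq (g′ (ins v σ)) m))
        (cong (λ b → sign s * ((b * (ratio (weight (ins v σ)) (weight σ) * η v σ)) * seq (g′ (ins v σ)) m)) (sym (off-∉ v σ (fresh v#))))))
    by v (no _) (yes v∈) = trans (ℚₚ.*-zeroˡ (ratio (w (v ∷ s)) (w s) * seq (g (v ∷ s)) m)) (sym (trans
      (cong (λ b → sign s * ((b * (ratio (weight (ins v σ)) (weight σ) * η v σ)) * seq (g′ (ins v σ)) m)) (off-∈ v σ v∈))
      (solve 3 (λ q r x → q :* ((:0 :* r) :* x) := :0) refl (sign s) (ratio (weight (ins v σ)) (weight σ) * η v σ) (seq (g′ (ins v σ)) m))))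
    by v (no ¬o) (no v∉) = trans (ℚₚ.*-zeroˡ (ratio (w (v ∷ s)) (w s) * seq (g (v ∷ s)) m)) (sym (trans
      (cong (λ r → sign s * ((off v σ * (r * η v σ)) * seq (g′ (ins v σ)) m)) (trans (cong (λ a → ratio a (weight σ)) no-weight) (ratio-0 (weight σ))))
      (solve 4 (λ q o e x → q :* ((o :* (:0 :* e)) :* x) := :0) refl (sign s) (off v σ) (η v σ) (seq (g′ (ins v σ)) m))))
      where
      no-weight : weight (ins v σ) ≡ 0
      no-weight = decidable-stable (weight (ins v σ) ℕₚ.≟ 0) λ ≢0 →
        let x , inside-x = weight≢0⇒⊆chamber ≢0
        in ¬o ((fresh⁻ s v∉ ∷ proj₁ ord) , subst Simplex (sym (support-∷ v s)) (chamber⇒simplex x inside-x v (v∈ins v σ)))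

  Δ-link : ∀ {i} u (s : Vec Vertex (suc i)) → IsOrderedSimplex s → Δ (oriented u) s ≃ fromℚ (sign s) *ᴿ δᴿ (Dᴿ u) (support s)
  Δ-link u s ord = pointwise⇒≃ (Δ (oriented u) s) (fromℚ (sign s) *ᴿ δᴿ (Dᴿ u) (support s)) λ m →
    δ-link (d (oriented u)) (Dᴿ u) s ord m λ v o → d-link u (v ∷ s) (proj₁ o) (ordered-rainbow o) m

-- Classical decisions and the conclusion

¬¬-finite : ∀ {a n} {A : Fin n → Set a} → (∀ j → ¬ ¬ A j) → ¬ ¬ (∀ j → A j)
¬¬-finite {n = zero}  h k = k λ ()
¬¬-finite {n = suc n} h k = h zero λ a₀ → ¬¬-finite (h ∘ suc) λ as → k λ { zero → a₀ ; (suc j) → as j }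

module Decisions {c e} (G : FiniteGroup c e) where

  open FiniteGroup G using (Carrier; _≈_; order; enumeration) renaming (sym to ≈-sym)
  open Inverse enumeration using (to; from; strictlyInverseʳ)

  -- The group is finite, so the double negation passes through the quantifier one element at a
  -- time.
  ¬¬-decide : ∀ {p} {P : Carrier → Set p} → (∀ {g h} → g ≈ h → P g → P h) → ¬ ¬ (∀ g → Dec (P g))
  ¬¬-decide {P = P} resp k = ¬¬-finite {n = order} {A = λ a → Dec (P (from a))} (λ a → ¬¬-excluded-middle) λ P? → k λ g →
    map′ (resp (strictlyInverseʳ g)) (resp (≈-sym (strictlyInverseʳ g))) (P? (to g))

module Eigenvalue {c e} {G : FiniteGroup c e} {ℓ : ℕ} (𝒯 : TitsSystem G (suc ℓ))
  (M? : ∀ j g → Dec (Bruhat.D 𝒯 (_≢ j) g)) (i : ℕ) (i<ℓ : i ℕ.< ℓ)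
  (even? : ∀ x → Dec (TestCochain.Even 𝒯 M? i i<ℓ x)) where

  open Faces 𝒯 M? hiding (Vertex)
  open Link 𝒯 M?
  open Supports
  open Rationals
  open SubsetSums
  open Reals
  open ℝ
  open Complex (building 𝒯) using (Vertex)
  open Laplacian (building 𝒯) using (IsOrderedSimplex; IsEigenvalue; Δ)
  open Orientation {suc ℓ} using (ε-sq)
  open Spectral weight weight-mono η using (module Degree; δᴿ; Dᴿ)
  open Degree (suc i) using (module Threshold)
  open Threshold (ℓ ∸ i) (TestVector.bad 𝒯 M? i i<ℓ even?) public using (μ; μ≤c)
  open Eigenvectors weight weight-mono η (suc i) (ℓ ∸ i) (TestVector.bad 𝒯 M? i i<ℓ even?) using (IsSimplexOfDegree; Eigenvector; threshold)

  ordered-degree : ∀ s → IsOrderedSimplex {i} s → IsSimplexOfDegree (support s)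
  ordered-degree s (u , simplex) = ∣support∣ s u , simplex-weight simplex

  module _ (u : Subset n → ℝ) where

    equation : ((σ : Subset n) → IsSimplexOfDegree σ → δᴿ (Dᴿ u) σ ≃ μ *ᴿ u σ) →
      ∀ s → IsOrderedSimplex {i} s → Δ (oriented u) s ≃ μ *ᴿ oriented u s
    equation eq s ord = ≃-trans {Δ (oriented u) s} {fromℚ (sign s) *ᴿ δᴿ (Dᴿ u) (support s)} {μ *ᴿ oriented u s} (Δ-link u s ord)
      (≃-trans {fromℚ (sign s) *ᴿ δᴿ (Dᴿ u) (support s)} {fromℚ (sign s) *ᴿ (μ *ᴿ u (support s))} {μ *ᴿ oriented u s}
        (*ᴿ-congˡ (fromℚ (sign s)) {δᴿ (Dᴿ u) (support s)} {μ *ᴿ u (support s)} (eq (support s) (ordered-degree s ord)))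
        (pointwise⇒≃ (fromℚ (sign s) *ᴿ (μ *ᴿ u (support s))) (μ *ᴿ oriented u s) λ m →
          solve 3 (λ e l x → e :* (l :* x) := l :* (e :* x)) refl (sign s) (seq μ m) (seq (u (support s)) m)))

    vanishes : (∀ s → IsOrderedSimplex {i} s → oriented u s ≃ 0ᴿ) → ∀ σ → IsSimplexOfDegree σ → u σ ≃ 0ᴿ
    -- `go` takes a variable length in place of `∣ σ ∣`, so that `size` can be matched with `refl`.
    vanishes h σ (size , ≢0) = let s , uniq , eq = enumerate σ in go s size uniq eq
      where
      go : ∀ {k} (s : Vec Vertex k) → k ≡ suc i → Uniqueᵛ s → support s ≡ σ → u σ ≃ 0ᴿ
      go s refl uniq refl = ≃-trans {u σ} {fromℚ (sign s) *ᴿ oriented u s} {0ᴿ}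
        (pointwise⇒≃ (u σ) (fromℚ (sign s) *ᴿ oriented u s) λ m → trans (sym (ℚₚ.*-identityˡ (seq (u σ) m)))
          (trans (cong (_* seq (u σ) m) (sym (ε-sq (Vec.map color s)))) (ℚₚ.*-assoc (sign s) (sign s) (seq (u σ) m))))
        (≃-trans {fromℚ (sign s) *ᴿ oriented u s} {fromℚ (sign s) *ᴿ 0ᴿ} {0ᴿ} (*ᴿ-congˡ (fromℚ (sign s)) {oriented u s} {0ᴿ} (h s (uniq , simplex)))
          (pointwise⇒≃ (fromℚ (sign s) *ᴿ 0ᴿ) 0ᴿ λ m → ℚₚ.*-zeroʳ (sign s)))
        where
        simplex = let x , inside-x = weight≢0⇒⊆chamber ≢0 in chamber⇒simplex x inside-x (lookup s zero) (lookup∈support s zero)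

    isEigenvalue : Eigenvector u → IsEigenvalue i μ
    isEigenvalue (eq , nonzero) = oriented u , oriented-cochain u , (λ h → nonzero (vanishes h)) , equation eq

  ¬¬eigenvalue : ¬ ¬ (¬ (μ ≃ 0ᴿ) × IsEigenvalue i μ)
  ¬¬eigenvalue k = threshold λ (μ≄0 , u , e) → k (μ≄0 , isEigenvalue u e)

theorem2p22 : ∀ {c e} (G : FiniteGroup c e) (ℓ : ℕ) (𝒯 : TitsSystem G (suc ℓ)) (i : ℕ) → i ℕ.< ℓ →
    ∀ (m : ℝ) → IsMinimalNonzeroEigenvalue (building 𝒯) i m → m ≤ᴿ fromℕ (ℓ ∸ i)
theorem2p22 G ℓ 𝒯 i i<ℓ m minimal = ≤ᴿ-stable {m} {fromℕ (ℓ ∸ i)} λ not →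
    ¬¬-finite (λ j → ¬¬-decide (D-resp {_≢ j})) λ M? →
    ¬¬-decide {P = TestCochain.Even 𝒯 M? i i<ℓ} (λ x≈y (u , p , x~u) → u , p , ~-trans (≈⇒~ (FiniteGroup.sym G x≈y)) x~u) λ even? →
    let open Eigenvalue 𝒯 M? i i<ℓ even? in
    ¬¬eigenvalue λ (μ≄0 , isEigenvalue) → not (≤ᴿ-trans {m} {μ} {fromℕ (ℓ ∸ i)} (IsMinimalNonzeroEigenvalue.minimal minimal μ isEigenvalue μ≄0) μ≤c)
  where
  open Reals using (≤ᴿ-stable; ≤ᴿ-trans)
  open Decisions G using (¬¬-decide)
  open Bruhat 𝒯 using (D-resp; ~-trans; ≈⇒~)
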